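{- Let $\varepsilon>0$ be a constant and let $k=k_n$ be a sequence of integers such that eventually $\varepsilon\log n\le k\le n^{1/3-\varepsilon}$. Then there exists a sequence $m=m_n$ such that asymptotically almost surely $$\gamma(\mathcal{G}(n,m))=k \qquad\text{and}\qquad b(\mathcal{G}(n,m))=\Theta(\Delta(\mathcal{G}(n,m)))=\Theta(m/n).$$
   Context: $\mathcal{G}(n,m)$ denotes the random graph chosen uniformly at random among all graphs on vertex set $[n]=\{1,\dots,n\}$ with exactly $m$ edges (equivalently, the $m$-th graph of the Erdős–Rényi random graph process, which adds the edges of $K_n$ one at a time in a uniformly random order). A dominating set of a graph $G=(V,E)$ is a set $D\subseteq V$ such that every vertex not in $D$ has a neighbour in $D$; the domination number $\gamma(G)$ is the minimum size of a dominating set. The bondage number of a graph with at least one edge is $b(G)=\min\{|B|: B\subseteq E,\ \gamma(G-B)>\gamma(G)\}$. $\Delta(G)$ is the maximum degree. All logarithms are natural; asymptotics are as $n\to\infty$; "eventually" means for all but finitely many $n$; an event holds asymptotically almost surely (a.a.s.) if its probability tends to $1$. Functions hidden in $\Theta(\cdot)$ are positive. -}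

module Defs where

open import Data.Nat using (ℕ; zero; suc; _+_; _*_; _∸_; _^_; _≤_; _<_; _⊔_)
open import Data.Nat using (_!)
open import Data.Nat.Combinatorics using (_C_)
open import Data.Fin.Subset.Properties using (_∈?_)
open import Data.Fin using (Fin; toℕ)
open import Data.Fin.Properties using (_<?_; _≟_)
open import Data.Fin.Subset using (Subset; _∈_; _⊆_; _─_; ∣_∣)
open import Data.List using (List; concatMap; map; filter; allFin; length; foldr)
open import Data.List.Relation.Unary.All using (All)
open import Data.List.Relation.Unary.Unique.Propositional using (Unique)
open import Data.Vec as Vec using (Vec; lookup; tabulate)
open import Data.Bool using (Bool; true; false; if_then_else_; _∧_; _∨_)
open import Data.Product using (_×_; _,_; ∃; Σ; proj₁; proj₂)
open import Data.Sum using (_⊎_)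
open import Relation.Binary.PropositionalEquality using (_≡_)
open import Relation.Nullary.Decidable using (⌊_⌋)

-- Graphs on vertex set Fin n (= [n]).
-- The potential edges are the pairs (i , j) with i < j, listed in a fixed
-- order; a graph is the subset of potential edges that are present.

pairsL : (n : ℕ) → List (Fin n × Fin n)
pairsL n = concatMap (λ i → map (i ,_) (filter (λ j → i <? j) (allFin n))) (allFin n)

E : ℕ → ℕ
E n = length (pairsL n)

pairV : (n : ℕ) → Vec (Fin n × Fin n) (E n)
pairV n = Vec.fromList (pairsL n)

Graph : ℕ → Set
Graph n = Subset (E n)

numEdges : {n : ℕ} → Graph n → ℕ
numEdges G = ∣ G ∣

Adj : {n : ℕ} → Graph n → Fin n → Fin n → Set
Adj {n} G u v = ∃ λ (p : Fin (E n)) →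
  p ∈ G × (lookup (pairV n) p ≡ (u , v) ⊎ lookup (pairV n) p ≡ (v , u))

Dominating : {n : ℕ} → Graph n → Subset n → Set
Dominating {n} G D = (v : Fin n) → v ∈ D ⊎ (∃ λ u → u ∈ D × Adj {n} G u v)

IsDomNum : {n : ℕ} → Graph n → ℕ → Set
IsDomNum {n} G d =
  (∃ λ (D : Subset n) → Dominating {n} G D × ∣ D ∣ ≡ d) ×
  ((D : Subset n) → Dominating {n} G D → d ≤ ∣ D ∣)

RaisesDom : {n : ℕ} → Graph n → Subset (E n) → Set
RaisesDom {n} G B = ∃ λ d → ∃ λ d' → IsDomNum {n} G d × IsDomNum {n} (G ─ B) d' × d < d'

IsBondage : {n : ℕ} → Graph n → ℕ → Set
IsBondage {n} G b =
  (∃ λ (B : Subset (E n)) → B ⊆ G × ∣ B ∣ ≡ b × RaisesDom {n} G B) ×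
  ((B : Subset (E n)) → B ⊆ G → RaisesDom {n} G B → b ≤ ∣ B ∣)

incident : {n : ℕ} → Fin n × Fin n → Fin n → Bool
incident (i , j) v = ⌊ i ≟ v ⌋ ∨ ⌊ j ≟ v ⌋

deg : {n : ℕ} → Graph n → Fin n → ℕ
deg {n} G v = Vec.sum (tabulate λ p →
  if ⌊ p ∈? G ⌋ ∧ incident (lookup (pairV n) p) v then 1 else 0)

maxDeg : {n : ℕ} → Graph n → ℕ
maxDeg {n} G = foldr _⊔_ 0 (map (deg {n} G) (allFin n))

-- Asymptotically almost surely in G(n, m n).
-- G(n,m) is uniform on the (E n C m) graphs with exactly m edges.
-- AAS m P : for every t, eventually there is a list of distinct graphs with
-- m n edges satisfying P whose complement (bad graphs) has size
-- < total/(t+1); i.e. Pr[¬P] < 1/(t+1) eventually, i.e. Pr[P] → 1.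

AAS : (m : ℕ → ℕ) → ((n : ℕ) → Graph n → Set) → Set
AAS m P = (t : ℕ) → ∃ λ N → (n : ℕ) → N ≤ n →
  ∃ λ (L : List (Graph n)) →
    Unique L × All (λ G → numEdges {n} G ≡ m n × P n G) L ×
    suc t * ((E n C m n) ∸ length L) < E n C m n

-- Exponential comparison: expNum N j = Σ_{i ≤ j} N^i · j!/i!,
-- so expNum N j / j! is the j-th Taylor partial sum of e^N.

expNum : ℕ → ℕ → ℕ
expNum N zero = 1
expNum N (suc j) = suc j * expNum N j + N ^ suc j

-- LeExp M N  :⇔  M ≤ e^N   (as reals)
LeExp : ℕ → ℕ → Set
LeExp M N = ∃ λ j → M * (j !) ≤ expNum N j

{-# OPTIONS --safe #-}
module Submission where

-- Choose m just below the largest edge count for which the expected number of dominating (k − 1)-sets is at most 1/n.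
-- Then γ ≥ k by the first moment, while the second moment of the number X of dominating k-sets gives γ ≤ k. If deleting a
-- set B of s ≤ c·np edges destroys all of these, every dominating k-set D leaves some vertex v whose edges to D all lie in
-- B; by Cauchy–Schwarz over the pairs (v , J) with J ⊆ B a set of i edges at v, X² is bounded by a count of triples
-- (v , D , D′) with few or many common neighbours of v, whose expectation is o(E X)². Hence b > c·np. Conversely b ≤ 2Δ,
-- because isolating both ends of an edge raises γ, and Δ = O(np) by an exponential moment. Everything is computed in
-- G(n,p) over ℚ and transferred to G(n,m) by monotonicity (LYM inequality) and Chebyshev's inequality.

-- The constant ε is encoded as the fraction `suc p` / `suc q`. The obstacle is that the deleted set
-- B depends on G and ranges over too many sets for a union bound. Cauchy-Schwarz separates the two:
-- B enters only through its degrees, and what remains is a moment of G alone. Single edges (i = 1)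
-- without damping would leave a bound of order n(kp)²(E X)², which is useless. If v has fewer than
-- ℓ neighbours in D, the damping repays this, because so few neighbours in D and D′ together have
-- probability near (1 - p)^(2k - r) for overlap r; if v has more, one takes i = ℓ of order log n,
-- and a factor 1/ℓ!² wins. Passing from k - 1 to k multiplies the probability q of missing a vertex
-- by about 1 - p; since nqp is at least of order (log n)², the expected count rises from about 1/n
-- to at least 2^J with J of that order. The shift of 2n edges between the two edge probabilities
-- must not spoil this gain, and it does not since k² is far below n. Logarithms and exponentials
-- appear as powers of two, quotients in cross-multiplied form.

module OrderedField where

  open import Data.Nat as ℕ using (ℕ; zero; suc; z≤n)
  import Data.Nat.Properties as ℕP
  open import Data.Integer as ℤ using (ℤ) renaming (+_ to pos; -[1+_] to negsuc)
  import Data.Integer.Properties as ℤP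
  import Data.Rational as ℚ
  import Data.Rational.Properties as ℚP
  open import Data.Maybe using (Maybe; just; nothing)
  open import Data.Sum using (_⊎_)
  open import Relation.Nullary using (Dec; yes; no; ¬_)
  open import Relation.Binary.PropositionalEquality
  open import Algebra.Bundles using (CommutativeRing)
  open import Algebra.Structures using (IsCommutativeRing)
  open import Algebra.Solver.Ring.AlmostCommutativeRing using (AlmostCommutativeRing; fromCommutativeRing; _-Raw-AlmostCommutative⟶_)
  import Algebra.Solver.Ring as RingSolver
  open import Level using (0ℓ)

  -- The rationals, made opaque: transparent rational arithmetic unfolds during unification.

  infixl 6 _+_ _-_
  infixl 7 _*_
  infix 8 -_
  infix 4 _≤_ _<_ _≤?_

  abstract
    F : Set
    F = ℚ.ℚ

    0F 1F : F
    0F = ℚ.0ℚ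
    1F = ℚ.1ℚ

    _+_ _*_ : F → F → F
    _+_ = ℚ._+_
    _*_ = ℚ._*_

    -_ : F → F
    -_ = ℚ.-_

    _≤_ _<_ : F → F → Set
    _≤_ = ℚ._≤_
    _<_ = ℚ._<_

    F-isCommutativeRing : IsCommutativeRing _≡_ _+_ _*_ -_ 0F 1F
    F-isCommutativeRing = ℚP.+-*-isCommutativeRing

    ≤-refl : ∀ {x} → x ≤ x
    ≤-refl = ℚP.≤-refl

    ≤-reflexive : ∀ {x y} → x ≡ y → x ≤ y
    ≤-reflexive = ℚP.≤-reflexive

    ≤-trans : ∀ {x y z} → x ≤ y → y ≤ z → x ≤ z
    ≤-trans = ℚP.≤-trans

    ≤-antisym : ∀ {x y} → x ≤ y → y ≤ x → x ≡ y
    ≤-antisym = ℚP.≤-antisym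

    ≤-total : ∀ x y → x ≤ y ⊎ y ≤ x
    ≤-total = ℚP.≤-total

    _≤?_ : ∀ x y → Dec (x ≤ y)
    _≤?_ = ℚP._≤?_

    ≰⇒> : ∀ {x y} → ¬ (x ≤ y) → y < x
    ≰⇒> = ℚP.≰⇒>

    <⇒≤ : ∀ {x y} → x < y → x ≤ y
    <⇒≤ = ℚP.<⇒≤

    <⇒≱ : ∀ {x y} → x < y → ¬ (y ≤ x)
    <⇒≱ x<y y≤x = ℚP.<-irrefl refl (ℚP.<-≤-trans x<y y≤x)

    <-≤-trans : ∀ {x y z} → x < y → y ≤ z → x < z
    <-≤-trans = ℚP.<-≤-trans

    ≤-<-trans : ∀ {x y z} → x ≤ y → y < z → x < z
    ≤-<-trans = ℚP.≤-<-trans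

    +-mono : ∀ {a b c d} → a ≤ b → c ≤ d → a + c ≤ b + d
    +-mono = ℚP.+-mono-≤

    +-mono-<-≤ : ∀ {a b c d} → a < b → c ≤ d → a + c < b + d
    +-mono-<-≤ = ℚP.+-mono-<-≤

    *-monoˡ : ∀ {a b} c → 0F ≤ c → a ≤ b → c * a ≤ c * b
    *-monoˡ c 0≤c = ℚP.*-monoˡ-≤-nonNeg c {{ℚ.nonNegative 0≤c}}

    *-monoˡ-< : ∀ {a b} c → 0F < c → a < b → c * a < c * b
    *-monoˡ-< c 0<c = ℚP.*-monoʳ-<-pos c {{ℚ.positive 0<c}}

    0<1 : 0F < 1F
    0<1 = ℚP.positive⁻¹ ℚ.1ℚ

    inv : ∀ x → 0F < x → F
    inv x 0<x = ℚ.1/_ x {{ℚP.pos⇒nonZero x {{ℚ.positive 0<x}}}}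

    *-inv : ∀ x 0<x → x * inv x 0<x ≡ 1F
    *-inv x 0<x = ℚP.*-inverseʳ x {{ℚP.pos⇒nonZero x {{ℚ.positive 0<x}}}}

  _-_ : F → F → F
  x - y = x + (- y)

  F-commutativeRing : CommutativeRing 0ℓ 0ℓ
  F-commutativeRing = record { isCommutativeRing = F-isCommutativeRing }

  open CommutativeRing F-commutativeRing public
    using (+-assoc; +-comm; +-identityˡ; +-identityʳ; *-assoc; *-comm; *-identityˡ; *-identityʳ; zeroˡ; zeroʳ; distribˡ; distribʳ; -‿inverseʳ; -‿inverseˡ)

  FR : AlmostCommutativeRing 0ℓ 0ℓ
  FR = fromCommutativeRing F-commutativeRing

  -- The separate case for 1 makes `ι 1` reduce to `1F`, so that the numerals of the ring solver,
  -- interpreted through `⟦_⟧ℤ`, agree definitionally with `1F` and with sums of ones.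
  ι : ℕ → F
  ι zero = 0F
  ι (suc zero) = 1F
  ι (suc (suc n)) = 1F + ι (suc n)

  ι-suc : ∀ n → ι (suc n) ≡ 1F + ι n
  ι-suc zero = sym (+-identityʳ 1F)
  ι-suc (suc n) = refl

  ι-+ : ∀ m n → ι (m ℕ.+ n) ≡ ι m + ι n
  ι-+ zero n = sym (+-identityˡ (ι n))
  ι-+ (suc m) n = trans (ι-suc (m ℕ.+ n)) (trans (cong (1F +_) (ι-+ m n))
    (trans (sym (+-assoc 1F (ι m) (ι n))) (cong (_+ ι n) (sym (ι-suc m)))))

  ι-* : ∀ m n → ι (m ℕ.* n) ≡ ι m * ι n
  ι-* zero n = sym (zeroˡ (ι n))
  ι-* (suc m) n = trans (ι-+ n (m ℕ.* n)) (trans (cong (ι n +_) (ι-* m n))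
    (trans (cong (_+ ι m * ι n) (sym (*-identityˡ (ι n))))
      (trans (sym (distribʳ (ι n) 1F (ι m))) (cong (_* ι n) (sym (ι-suc m))))))

  ⟦_⟧ℤ : ℤ → F
  ⟦ pos n ⟧ℤ = ι n
  ⟦ negsuc n ⟧ℤ = - ι (suc n)

  private
    open import Algebra.Properties.Ring (CommutativeRing.ring F-commutativeRing)
      using (-‿distribˡ-*; -‿distribʳ-*; -0#≈0#; -‿involutive; -‿+-comm)

    ⊖-homo : ∀ m n → ⟦ m ℤ.⊖ n ⟧ℤ ≡ ι m + (- ι n)
    ⊖-homo m zero = trans (cong ⟦_⟧ℤ (ℤP.⊖-≥ {m} z≤n)) (sym (trans (cong (ι m +_) -0#≈0#) (+-identityʳ (ι m))))
    ⊖-homo zero (suc n) = sym (+-identityˡ _)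
    ⊖-homo (suc m) (suc n) = trans (cong ⟦_⟧ℤ (ℤP.[1+m]⊖[1+n]≡m⊖n m n)) (trans (⊖-homo m n) (sym shift))
      where
      shift : ι (suc m) + (- ι (suc n)) ≡ ι m + (- ι n)
      shift = trans (cong₂ (λ a b → a + (- b)) (trans (ι-suc m) (+-comm 1F (ι m))) (ι-suc n))
        (trans (+-assoc (ι m) 1F _) (cong (ι m +_)
          (trans (cong (1F +_) (sym (-‿+-comm 1F (ι n))))
            (trans (sym (+-assoc 1F (- 1F) (- ι n))) (trans (cong (_+ (- ι n)) (-‿inverseʳ 1F)) (+-identityˡ _))))))

    +-hom : ∀ a b → ⟦ a ℤ.+ b ⟧ℤ ≡ ⟦ a ⟧ℤ + ⟦ b ⟧ℤ
    +-hom (pos m) (pos n) = ι-+ m n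
    +-hom (pos m) (negsuc n) = ⊖-homo m (suc n)
    +-hom (negsuc m) (pos n) = trans (⊖-homo n (suc m)) (+-comm (ι n) _)
    +-hom (negsuc m) (negsuc n) = trans (cong (λ z → - ι (suc z)) (sym (ℕP.+-suc m n)))
      (trans (cong -_ (ι-+ (suc m) (suc n))) (sym (-‿+-comm (ι (suc m)) (ι (suc n)))))

    neg-hom : ∀ a → ⟦ ℤ.- a ⟧ℤ ≡ - ⟦ a ⟧ℤ
    neg-hom (pos zero) = sym -0#≈0#
    neg-hom (pos (suc n)) = refl
    neg-hom (negsuc n) = sym (-‿involutive _)

    *-hom⁺ : ∀ m b → ⟦ pos m ℤ.* b ⟧ℤ ≡ ι m * ⟦ b ⟧ℤ
    *-hom⁺ m (pos n) = trans (cong ⟦_⟧ℤ (sym (ℤP.pos-* m n))) (ι-* m n)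
    *-hom⁺ m (negsuc n) = trans (cong ⟦_⟧ℤ (sym (ℤP.neg-distribʳ-* (pos m) (pos (suc n)))))
      (trans (neg-hom (pos m ℤ.* pos (suc n))) (trans (cong -_ (*-hom⁺ m (pos (suc n)))) (-‿distribʳ-* (ι m) (ι (suc n)))))

    *-hom : ∀ a b → ⟦ a ℤ.* b ⟧ℤ ≡ ⟦ a ⟧ℤ * ⟦ b ⟧ℤ
    *-hom (pos m) b = *-hom⁺ m b
    *-hom (negsuc m) b = trans (cong ⟦_⟧ℤ (sym (ℤP.neg-distribˡ-* (pos (suc m)) b)))
      (trans (neg-hom (pos (suc m) ℤ.* b)) (trans (cong -_ (*-hom⁺ (suc m) b)) (-‿distribˡ-* (ι (suc m)) ⟦ b ⟧ℤ)))

    ℤ⟶F : ℤ.+-*-rawRing -Raw-AlmostCommutative⟶ FR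
    ℤ⟶F = record { ⟦_⟧ = ⟦_⟧ℤ ; +-homo = +-hom ; *-homo = *-hom ; -‿homo = neg-hom ; 0-homo = refl ; 1-homo = refl }

    coeff≟ : ∀ a b → Maybe (⟦ a ⟧ℤ ≡ ⟦ b ⟧ℤ)
    coeff≟ a b with a ℤP.≟ b
    ... | yes e = just (cong ⟦_⟧ℤ e)
    ... | no _ = nothing

  open RingSolver ℤ.+-*-rawRing FR ℤ⟶F coeff≟ public
    using (Polynomial; con; _:+_; _:*_; :-_; _:-_; _:=_; solve)

  κ : ∀ {n} → ℕ → Polynomial n
  κ c = con (pos c)

-- Ordered field inequalities, powers, and substitutes for the exponential function.

module Inequalities where

  open OrderedField
  open import Data.Nat as ℕ using (ℕ; zero; suc; z≤n; s≤s)
  import Data.Nat.Properties as ℕP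
  open import Data.Product using (_×_; _,_; ∃)
  open import Data.Sum using (inj₁; inj₂)
  open import Data.Empty using (⊥-elim)
  open import Relation.Nullary using (yes; no)
  open import Relation.Binary.PropositionalEquality

  ≤-tr : ∀ {x y z} → x ≤ y → y ≤ z → x ≤ z
  ≤-tr = ≤-trans

  ≤-rf : ∀ {x y} → x ≡ y → x ≤ y
  ≤-rf = ≤-reflexive

  0≤1 : 0F ≤ 1F
  0≤1 = <⇒≤ 0<1

  *-monoʳ : ∀ {a b} c → 0F ≤ c → a ≤ b → a * c ≤ b * c
  *-monoʳ {a} {b} c 0≤c h = subst₂ _≤_ (*-comm c a) (*-comm c b) (*-monoˡ c 0≤c h)

  *-mono : ∀ {a b c d} → 0F ≤ a → a ≤ b → 0F ≤ c → c ≤ d → a * c ≤ b * d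
  *-mono {a} {b} {c} {d} 0≤a a≤b 0≤c c≤d =
    ≤-tr (*-monoʳ c 0≤c a≤b) (*-monoˡ b (≤-tr 0≤a a≤b) c≤d)

  0≤* : ∀ {a b} → 0F ≤ a → 0F ≤ b → 0F ≤ a * b
  0≤* {a} {b} 0≤a 0≤b = subst (_≤ a * b) (zeroʳ a) (*-monoˡ a 0≤a 0≤b)

  0≤+ : ∀ {a b} → 0F ≤ a → 0F ≤ b → 0F ≤ a + b
  0≤+ {a} {b} 0≤a 0≤b = subst (_≤ a + b) (+-identityˡ 0F) (+-mono 0≤a 0≤b)

  0≤2 : 0F ≤ ι 2
  0≤2 = 0≤+ 0≤1 0≤1

  0≤4 : 0F ≤ ι 4
  0≤4 = 0≤+ 0≤1 (0≤+ 0≤1 0≤2)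

  0≤diff : ∀ {x y} → x ≤ y → 0F ≤ y - x
  0≤diff {x} {y} x≤y = subst (_≤ y - x) (-‿inverseʳ x) (+-mono x≤y ≤-refl)

  -- The device behind most polynomial inequalities below: the ring solver certifies the difference
  -- of the two sides as an expression built from squares and products of nonnegative factors.
  ≤-diff : ∀ {x y} d → 0F ≤ d → y - x ≡ d → x ≤ y
  ≤-diff {x} {y} d 0≤d e = subst₂ _≤_ (+-identityʳ x) (trans (cong (x +_) (sym e)) (alg x y))
    (+-mono (≤-refl {x}) 0≤d)
    where
    alg : ∀ x y → x + (y - x) ≡ y
    alg = solve 2 (λ x y → x :+ (y :- x) := y) refl

  ≤-+ˡ : ∀ {x y} → 0F ≤ y → x ≤ y + x
  ≤-+ˡ {x} {y} 0≤y = subst (_≤ y + x) (+-identityˡ x) (+-mono 0≤y ≤-refl)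

  ≤-+ʳ : ∀ {x y} → 0F ≤ y → x ≤ x + y
  ≤-+ʳ {x} {y} 0≤y = subst (_≤ x + y) (+-identityʳ x) (+-mono ≤-refl 0≤y)

  1-x≤1 : ∀ {x} → 0F ≤ x → 1F - x ≤ 1F
  1-x≤1 {x} h = ≤-diff x h (alg x)
    where
    alg : ∀ x → 1F - (1F - x) ≡ x
    alg = solve 1 (λ x → (κ 1) :- ((κ 1) :- x) := x) refl

  *≤ˡ : ∀ {x y} → 0F ≤ y → x ≤ 1F → x * y ≤ y
  *≤ˡ {x} {y} 0≤y x≤1 = subst (x * y ≤_) (*-identityˡ y) (*-monoʳ y 0≤y x≤1)

  *≤ʳ : ∀ {x y} → 0F ≤ x → y ≤ 1F → x * y ≤ x
  *≤ʳ {x} {y} 0≤x y≤1 = subst (x * y ≤_) (*-identityʳ x) (*-monoˡ x 0≤x y≤1)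

  ≤*ʳ : ∀ {x y} → 0F ≤ x → 1F ≤ y → x ≤ x * y
  ≤*ʳ {x} {y} 0≤x 1≤y = subst (_≤ x * y) (*-identityʳ x) (*-monoˡ x 0≤x 1≤y)

  *≤1 : ∀ {x y} → 0F ≤ x → x ≤ 1F → y ≤ 1F → x * y ≤ 1F
  *≤1 h1 h2 h3 = ≤-tr (*≤ʳ h1 h3) h2

  0≤sq : ∀ x → 0F ≤ x * x
  0≤sq x with ≤-total 0F x
  ... | inj₁ h = 0≤* h h
  ... | inj₂ h = subst (0F ≤_) (alg x) (0≤* h′ h′)
    where
    h′ : 0F ≤ 0F - x
    h′ = 0≤diff h
    alg : ∀ x → (0F - x) * (0F - x) ≡ x * x
    alg = solve 1 (λ x → ((κ 0) :- x) :* ((κ 0) :- x) := x :* x) refl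

  0<* : ∀ {a b} → 0F < a → 0F < b → 0F < a * b
  0<* {a} {b} 0<a 0<b = subst (_< a * b) (zeroʳ a) (*-monoˡ-< a 0<a 0<b)

  *-mono-< : ∀ {a b c d} → 0F ≤ a → a < b → 0F ≤ c → c < d → a * c < b * d
  *-mono-< {a} {b} {c} {d} 0≤a a<b 0≤c c<d = ≤-<-trans (*-monoʳ c 0≤c (<⇒≤ a<b))
    (*-monoˡ-< b (≤-<-trans 0≤a a<b) c<d)

  *-cancelˡ : ∀ {a b} c → 0F < c → c * a ≤ c * b → a ≤ b
  *-cancelˡ {a} {b} c 0<c h with a ≤? b
  ... | yes a≤b = a≤b
  ... | no a≰b = ⊥-elim (<⇒≱ (*-monoˡ-< c 0<c (≰⇒> a≰b)) h)

  *-cancelʳ : ∀ {a b} c → 0F < c → a * c ≤ b * c → a ≤ b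
  *-cancelʳ {a} {b} c 0<c h = *-cancelˡ c 0<c (subst₂ _≤_ (*-comm a c) (*-comm b c) h)

  sq-cancel : ∀ {x y} → 0F ≤ y → x * x ≤ y * y → x ≤ y
  sq-cancel {x} {y} 0≤y h with x ≤? y
  ... | yes x≤y = x≤y
  ... | no x≰y = ⊥-elim (<⇒≱ (*-mono-< 0≤y (≰⇒> x≰y) 0≤y (≰⇒> x≰y)) (h))

  0≤ι : ∀ n → 0F ≤ ι n
  0≤ι zero = ≤-refl
  0≤ι (suc n) = subst (0F ≤_) (sym (ι-suc n)) (0≤+ 0≤1 (0≤ι n))

  ι-mono : ∀ {m n} → m ℕ.≤ n → ι m ≤ ι n
  ι-mono {n = n} z≤n = 0≤ι n
  ι-mono (s≤s {m} {n} h) = subst₂ _≤_ (sym (ι-suc m)) (sym (ι-suc n)) (+-mono ≤-refl (ι-mono h))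

  0<ι : ∀ {n} → 1 ℕ.≤ n → 0F < ι n
  0<ι h = <-≤-trans 0<1 (ι-mono h)

  1≤ι : ∀ {n} → 1 ℕ.≤ n → 1F ≤ ι n
  1≤ι h = ι-mono h

  ι-mono-< : ∀ {m n} → m ℕ.< n → ι m < ι n
  ι-mono-< {m} h = <-≤-trans (subst (_< 1F + ι m) (+-identityˡ (ι m)) (+-mono-<-≤ 0<1 (≤-refl {ι m}))) (≤-tr (≤-rf (sym (ι-suc m))) (ι-mono h))

  ι-cancel-≤ : ∀ {m n} → ι m ≤ ι n → m ℕ.≤ n
  ι-cancel-≤ {m} {n} h with m ℕP.≤? n
  ... | yes m≤n = m≤n
  ... | no m≰n = ⊥-elim (<⇒≱ (ι-mono-< (ℕP.≰⇒> m≰n)) (h))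

  ι-cancel-< : ∀ {m n} → ι m < ι n → m ℕ.< n
  ι-cancel-< {m} {n} h with n ℕP.≤? m
  ... | yes n≤m = ⊥-elim (<⇒≱ h ((ι-mono n≤m)))
  ... | no n≰m = ℕP.≰⇒> n≰m

  ι-∸ : ∀ {m n} → n ℕ.≤ m → ι (m ℕ.∸ n) ≡ ι m - ι n
  ι-∸ {m} {n} h = trans (alg (ι (m ℕ.∸ n)) (ι n)) (cong (_- ι n) (trans (sym (ι-+ (m ℕ.∸ n) n)) (cong ι (ℕP.m∸n+n≡m h))))
    where
    alg : ∀ a b → a ≡ (a + b) - b
    alg = solve 2 (λ a b → a := (a :+ b) :- b) refl

  infixr 8 _^^_
  _^^_ : F → ℕ → F
  x ^^ zero = 1F
  x ^^ suc n = x * x ^^ n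

  0≤^^ : ∀ {x} → 0F ≤ x → ∀ n → 0F ≤ x ^^ n
  0≤^^ h zero = 0≤1
  0≤^^ h (suc n) = 0≤* h (0≤^^ h n)

  0<^^ : ∀ {x} → 0F < x → ∀ n → 0F < x ^^ n
  0<^^ h zero = 0<1
  0<^^ h (suc n) = 0<* h (0<^^ h n)

  ^^-mono : ∀ {x y} → 0F ≤ x → x ≤ y → ∀ n → x ^^ n ≤ y ^^ n
  ^^-mono h h′ zero = ≤-refl
  ^^-mono h h′ (suc n) = *-mono h h′ (0≤^^ h n) (^^-mono h h′ n)

  ^^-+ : ∀ x m n → x ^^ (m ℕ.+ n) ≡ x ^^ m * x ^^ n
  ^^-+ x zero n = sym (*-identityˡ (x ^^ n))
  ^^-+ x (suc m) n = trans (cong (x *_) (^^-+ x m n)) (sym (*-assoc x (x ^^ m) (x ^^ n)))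

  ^^-*-dist : ∀ x y n → (x * y) ^^ n ≡ x ^^ n * y ^^ n
  ^^-*-dist x y zero = sym (*-identityˡ 1F)
  ^^-*-dist x y (suc n) = trans (cong (x * y *_) (^^-*-dist x y n)) (alg x y (x ^^ n) (y ^^ n))
    where
    alg : ∀ a b c d → a * b * (c * d) ≡ a * c * (b * d)
    alg = solve 4 (λ a b c d → a :* b :* (c :* d) := a :* c :* (b :* d)) refl

  1^^ : ∀ n → 1F ^^ n ≡ 1F
  1^^ zero = refl
  1^^ (suc n) = trans (*-identityˡ (1F ^^ n)) (1^^ n)

  ^^-* : ∀ x m n → x ^^ (m ℕ.* n) ≡ (x ^^ n) ^^ m
  ^^-* x zero n = refl
  ^^-* x (suc m) n = trans (^^-+ x n (m ℕ.* n)) (cong (x ^^ n *_) (^^-* x m n))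

  ^^-*′ : ∀ x m n → x ^^ (m ℕ.* n) ≡ (x ^^ m) ^^ n
  ^^-*′ x m n = trans (cong (x ^^_) (ℕP.*-comm m n)) (^^-* x n m)

  ι-^ : ∀ m n → ι (m ℕ.^ n) ≡ ι m ^^ n
  ι-^ m zero = refl
  ι-^ m (suc n) = trans (ι-* m (m ℕ.^ n)) (cong (ι m *_) (ι-^ m n))

  ^^≤1 : ∀ {x} → 0F ≤ x → x ≤ 1F → ∀ n → x ^^ n ≤ 1F
  ^^≤1 {x} h h′ n = subst (x ^^ n ≤_) (1^^ n) (^^-mono h h′ n)

  1≤^^ : ∀ {x} → 1F ≤ x → ∀ n → 1F ≤ x ^^ n
  1≤^^ {x} h n = subst (_≤ x ^^ n) (1^^ n) (^^-mono 0≤1 h n)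

  ^^-anti : ∀ {x} → 0F ≤ x → x ≤ 1F → ∀ {m n} → m ℕ.≤ n → x ^^ n ≤ x ^^ m
  ^^-anti h h′ {n = n} z≤n = ^^≤1 h h′ n
  ^^-anti h h′ (s≤s l) = *-monoˡ _ h (^^-anti h h′ l)

  ^^-monoʳ : ∀ {x} → 1F ≤ x → ∀ {m n} → m ℕ.≤ n → x ^^ m ≤ x ^^ n
  ^^-monoʳ h {n = n} z≤n = 1≤^^ h n
  ^^-monoʳ h (s≤s l) = *-monoˡ _ (≤-tr 0≤1 h) (^^-monoʳ h l)

  ^^-mono-< : ∀ {x y} → 0F ≤ x → x < y → ∀ n → x ^^ suc n < y ^^ suc n
  ^^-mono-< {x} {y} h h′ zero = subst₂ _<_ (sym (*-identityʳ x)) (sym (*-identityʳ y)) h′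
  ^^-mono-< h h′ (suc n) = *-mono-< h h′ (0≤^^ h (suc n)) (^^-mono-< h h′ n)

  ^^-root : ∀ {x y} → 0F ≤ y → ∀ n → x ^^ suc n ≤ y ^^ suc n → x ≤ y
  ^^-root {x} {y} 0≤y n h with x ≤? y
  ... | yes x≤y = x≤y
  ... | no x≰y = ⊥-elim (<⇒≱ (^^-mono-< 0≤y (≰⇒> x≰y) n) (h))

  bernoulli⁺ : ∀ {x} → 0F ≤ x → ∀ n → 1F + ι n * x ≤ (1F + x) ^^ n
  bernoulli⁺ {x} h zero = ≤-rf (alg x)
    where
    alg : ∀ x → 1F + 0F * x ≡ 1F
    alg = solve 1 (λ x → (κ 1) :+ (κ 0) :* x := (κ 1)) refl
  bernoulli⁺ {x} h (suc n) rewrite ι-suc n = ≤-tr (≤-diff (ι n * (x * x)) (0≤* (0≤ι n) (0≤sq x)) (alg (ι n) x))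
    (*-monoˡ (1F + x) (0≤+ 0≤1 h) (bernoulli⁺ h n))
    where
    alg : ∀ m x → (1F + x) * (1F + m * x) - (1F + (1F + m) * x) ≡ m * (x * x)
    alg = solve 2 (λ m x → ((κ 1) :+ x) :* ((κ 1) :+ m :* x) :- ((κ 1) :+ ((κ 1) :+ m) :* x) := m :* (x :* x)) refl

  -- A converse to Bernoulli: the induction step leaves the surplus x(1 - 2nx), which the smallness
  -- hypothesis makes nonnegative.
  1+x^n≤1+2nx : ∀ {x} → 0F ≤ x → ∀ n → ι 2 * (ι n * x) ≤ 1F → (1F + x) ^^ n ≤ 1F + ι 2 * (ι n * x)
  1+x^n≤1+2nx {x} h zero _ = ≤-rf (alg x)
    where
    alg : ∀ x → 1F ≡ 1F + ι 2 * (0F * x)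
    alg = solve 1 (λ x → (κ 1) := (κ 1) :+ κ 2 :* ((κ 0) :* x)) refl
  1+x^n≤1+2nx {x} h (suc n) c rewrite ι-suc n = ≤-tr (*-monoˡ (1F + x) (0≤+ 0≤1 h) (1+x^n≤1+2nx h n c′))
    (≤-diff (x * (1F - ι 2 * (ι n * x))) (0≤* h (0≤diff c′)) (alg (ι n) x))
    where
    c′ : ι 2 * (ι n * x) ≤ 1F
    c′ = ≤-tr (*-monoˡ (ι 2) 0≤2 (*-monoʳ x h (≤-+ˡ 0≤1))) c
    alg : ∀ m x → 1F + ι 2 * ((1F + m) * x) - (1F + x) * (1F + ι 2 * (m * x))
      ≡ x * (1F - ι 2 * (m * x))
    alg = solve 2 (λ m x → (κ 1) :+ κ 2 :* (((κ 1) :+ m) :* x) :- ((κ 1) :+ x) :* ((κ 1) :+ κ 2 :* (m :* x))     := x :* ((κ 1) :- κ 2 :* (m :* x))) refl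

  -- Steps of length x ≤ 1 cannot jump over the interval [1, 2]. Cutting a power into blocks of t
  -- factors with tx in this interval replaces the logarithm in the growth bounds that follow.
  unit-step : ∀ {x} → 0F ≤ x → x ≤ 1F → ∀ n → ι 2 ≤ ι n * x →
    ∃ λ t → t ℕ.≤ n × 1F ≤ ι t * x × ι t * x ≤ ι 2
  unit-step {x} h h′ zero c = ⊥-elim (<⇒≱ 0<2 ((≤-tr c (≤-rf (zeroˡ x)))))
    where
    0<2 : 0F < ι 2
    0<2 = <-≤-trans 0<1 (ι-mono {1} {2} (s≤s z≤n))
  unit-step {x} h h′ (suc n) c rewrite ι-suc n with ι 2 ≤? ι n * x
  ... | yes d = let t , a , b = unit-step h h′ n d in t , ℕP.m≤n⇒m≤1+n a , b
  ... | no d = n , ℕP.n≤1+n n , ≤-diff (((1F + ι n) * x - ι 2) + (1F - x)) (0≤+ (0≤diff c) (0≤diff h′)) (alg (ι n) x) , <⇒≤ (≰⇒> d)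
    where
    alg : ∀ m x → m * x - 1F ≡ ((1F + m) * x - ι 2) + (1F - x)
    alg = solve 2 (λ m x → m :* x :- (κ 1) := (((κ 1) :+ m) :* x :- κ 2) :+ ((κ 1) :- x)) refl

  -- Each block contributes a factor of at least 2 by Bernoulli and uses up at most 2 of nx.
  growth : ∀ {x} → 0F ≤ x → x ≤ 1F → ∀ J n → ι (2 ℕ.* J) ≤ ι n * x → ι 2 ^^ J ≤ (1F + x) ^^ n
  growth {x} h h′ zero n c = 1≤^^ (≤-+ʳ h) n
  growth {x} h h′ (suc J) n c with unit-step h h′ n (≤-tr (≤-tr (≤-rf refl) (ι-mono (ℕP.*-monoʳ-≤ 2 (s≤s (z≤n {J}))))) c)
  ... | t , t≤n , lo , hi = ≤-tr (*-mono 0≤2 b1 (0≤^^ 0≤2 J) (growth h h′ J (n ℕ.∸ t) b2))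
          (≤-rf (trans (sym (^^-+ (1F + x) t (n ℕ.∸ t))) (cong ((1F + x) ^^_) (ℕP.m+[n∸m]≡n t≤n))))
    where
    b1 : ι 2 ≤ (1F + x) ^^ t
    b1 = ≤-tr (+-mono (≤-refl {1F}) lo) (bernoulli⁺ h t)
    alg : ∀ j t n x → (n - t) * x - j ≡ (n * x - (ι 2 + j)) + (ι 2 - t * x)
    alg = solve 4 (λ j t n x → (n :- t) :* x :- j := (n :* x :- (κ 2 :+ j)) :+ (κ 2 :- t :* x)) refl
    c′ : ι 2 + ι (2 ℕ.* J) ≤ ι n * x
    c′ = ≤-tr (≤-rf (trans (sym (ι-+ 2 (2 ℕ.* J))) (cong ι (sym (ℕP.*-distribˡ-+ 2 1 J))))) c
    b2 : ι (2 ℕ.* J) ≤ ι (n ℕ.∸ t) * x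
    b2 = subst (λ z → ι (2 ℕ.* J) ≤ z * x) (sym (ι-∸ t≤n))
      (≤-diff _ (0≤+ (0≤diff c′) (0≤diff hi)) (alg (ι (2 ℕ.* J)) (ι t) (ι n) x))

  -- (1 + x)(1 - x) ≤ 1 turns growth into decay.
  decay : ∀ {x} → 0F ≤ x → x ≤ 1F → ∀ J n → ι (2 ℕ.* J) ≤ ι n * x → ι 2 ^^ J * (1F - x) ^^ n ≤ 1F
  decay {x} h h′ J n c = ≤-tr (*-monoʳ ((1F - x) ^^ n) (0≤^^ (0≤diff h′) n) (growth h h′ J n c))
    (≤-tr (≤-rf (sym (^^-*-dist (1F + x) (1F - x) n)))
      (^^≤1 (0≤* (0≤+ 0≤1 h) (0≤diff h′)) (≤-diff (x * x) (0≤sq x) (alg x)) n))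
    where
    alg : ∀ x → 1F - (1F + x) * (1F - x) ≡ x * x
    alg = solve 1 (λ x → (κ 1) :- ((κ 1) :+ x) :* ((κ 1) :- x) := x :* x) refl

  -- Blocks with 4tx in [1, 2] grow by a factor of at most 2 each and use up at least 1 of 4nx; a
  -- remainder with 4nx < 2 is at most 1 + 2nx.
  growth-upper : ∀ {x} → 0F ≤ x → ι 4 * x ≤ 1F → ∀ J n → ι 4 * (ι n * x) ≤ ι J → (1F + x) ^^ n ≤ ι 2 ^^ J
  growth-upper {x} h h′ J n c with ι 2 ≤? ι n * (ι 4 * x)
  ... | no d = ≤-tr (1+x^n≤1+2nx h n le1) (fin J c)
    where
    alg : ∀ m x → ι 2 * 1F - ι 2 * (ι 2 * (m * x)) ≡ ι 2 - m * ((ι 4) * x)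
    alg = solve 2 (λ m x → κ 2 :* κ 1 :- κ 2 :* (κ 2 :* (m :* x)) := κ 2 :- m :* (κ 4 :* x)) refl
    le1 : ι 2 * (ι n * x) ≤ 1F
    le1 = *-cancelˡ (ι 2) (0<ι {2} (s≤s z≤n)) (≤-diff _ (0≤diff (<⇒≤ (≰⇒> d))) (alg (ι n) x))
    fin : ∀ J → ι 4 * (ι n * x) ≤ ι J → 1F + ι 2 * (ι n * x) ≤ ι 2 ^^ J
    fin zero c = ≤-tr (+-mono (≤-refl {1F}) (≤-tr (*-monoʳ (ι n * x) (0≤* (0≤ι n) h) (ι-mono {2} {4} (s≤s (s≤s z≤n)))) c)) (≤-rf (+-identityʳ 1F))
    fin (suc J) _ = ≤-tr (+-mono (≤-refl {1F}) le1) (≤-tr (≤-rf (sym (*-identityʳ (ι 2)))) (*-monoˡ (ι 2) 0≤2 (1≤^^ (1≤ι {2} (s≤s z≤n)) J)))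
  growth-upper {x} h h′ zero n c | yes d = ⊥-elim (<⇒≱ (<-≤-trans 0<1 (ι-mono {1} {2} (s≤s z≤n))) ((≤-tr d (≤-tr (≤-rf (alg (ι n) x)) c))))
    where
    alg : ∀ m x → m * ((ι 4) * x) ≡ (ι 4) * (m * x)
    alg = solve 2 (λ m x → m :* (κ 4 :* x) := κ 4 :* (m :* x)) refl
  growth-upper {x} h h′ (suc J) n c | yes d rewrite ι-suc J with unit-step (0≤* 0≤4 h) h′ n d
  ... | t , t≤n , lo , hi = ≤-tr (≤-rf (trans (cong ((1F + x) ^^_) (sym (ℕP.m+[n∸m]≡n t≤n))) (^^-+ (1F + x) t (n ℕ.∸ t))))
      (*-mono (0≤^^ (0≤+ 0≤1 h) t) b1 (0≤^^ (0≤+ 0≤1 h) (n ℕ.∸ t)) (growth-upper h h′ J (n ℕ.∸ t) b2))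
    where
    alg0 : ∀ m x → ι 2 * 1F - ι 2 * (ι 2 * (m * x)) ≡ ι 2 - m * ((ι 4) * x)
    alg0 = solve 2 (λ m x → κ 2 :* κ 1 :- κ 2 :* (κ 2 :* (m :* x)) := κ 2 :- m :* (κ 4 :* x)) refl
    le1 : ι 2 * (ι t * x) ≤ 1F
    le1 = *-cancelˡ (ι 2) (0<ι {2} (s≤s z≤n)) (≤-diff _ (0≤diff hi) (alg0 (ι t) x))
    b1 : (1F + x) ^^ t ≤ ι 2
    b1 = ≤-tr (1+x^n≤1+2nx h t le1) (+-mono (≤-refl {1F}) le1)
    alg : ∀ j m t x → j - (ι 4) * ((m - t) * x) ≡ (1F + j - (ι 4) * (m * x)) + (t * ((ι 4) * x) - 1F)
    alg = solve 4 (λ j m t x → j :- κ 4 :* ((m :- t) :* x) := ((κ 1) :+ j :- κ 4 :* (m :* x)) :+ (t :* (κ 4 :* x) :- (κ 1))) refl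
    b2 : ι 4 * (ι (n ℕ.∸ t) * x) ≤ ι J
    b2 = subst (λ z → ι 4 * (z * x) ≤ ι J) (sym (ι-∸ t≤n))
      (≤-diff _ (0≤+ (0≤diff c) (0≤diff lo)) (alg (ι J) (ι n) (ι t) x))

-- Finite sums and products, layers of the cube, expectation over random subsets.

module FiniteSums where

  open OrderedField
  open Inequalities
  open import Data.Nat as ℕ using (ℕ; zero; suc; z≤n; s≤s)
  import Data.Nat.Properties as ℕP
  open import Data.Product using (_,_)
  open import Data.Sum using (inj₁; inj₂)
  open import Data.Empty using (⊥-elim)
  open import Data.List as List using (List; []; _∷_; map; _++_; length)
  open import Data.List.Membership.Propositional using () renaming (_∈_ to _∈L_)
  open import Data.List.Relation.Unary.Any using (here; there)
  open import Data.Vec as Vec using (Vec; []; _∷_; lookup)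
  open import Data.Fin as Fin using (Fin; zero; suc)
  open import Data.Fin.Subset using (Subset; ∣_∣; _∩_; _∪_)
  open import Data.Bool using (Bool; true; false; not)
  open import Function using (_∘_)
  open import Relation.Binary.PropositionalEquality
  open import Data.List.Relation.Unary.Unique.Propositional using (Unique)
  open import Data.List.Relation.Unary.AllPairs using ([]; _∷_)
  open import Data.List.Relation.Unary.All as All using (All; []; _∷_)

  ΣL : {A : Set} → List A → (A → F) → F
  ΣL [] f = 0F
  ΣL (x ∷ xs) f = f x + ΣL xs f

  ΣL-cong : ∀ {A : Set} (xs : List A) {f g : A → F} → (∀ x → f x ≡ g x) → ΣL xs f ≡ ΣL xs g
  ΣL-cong [] h = refl
  ΣL-cong (x ∷ xs) h = cong₂ _+_ (h x) (ΣL-cong xs h)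

  ΣL-mono∈ : ∀ {A : Set} (xs : List A) {f g : A → F} → (∀ x → x ∈L xs → f x ≤ g x) → ΣL xs f ≤ ΣL xs g
  ΣL-mono∈ [] h = ≤-refl
  ΣL-mono∈ (x ∷ xs) h = +-mono (h x (here refl)) (ΣL-mono∈ xs (λ y y∈ → h y (there y∈)))

  ΣL-mono : ∀ {A : Set} (xs : List A) {f g : A → F} → (∀ x → f x ≤ g x) → ΣL xs f ≤ ΣL xs g
  ΣL-mono xs h = ΣL-mono∈ xs (λ x _ → h x)

  0≤ΣL : ∀ {A : Set} (xs : List A) {f : A → F} → (∀ x → 0F ≤ f x) → 0F ≤ ΣL xs f
  0≤ΣL [] h = ≤-refl
  0≤ΣL (x ∷ xs) h = 0≤+ (h x) (0≤ΣL xs h)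

  ΣL-0 : ∀ {A : Set} (xs : List A) → ΣL xs (λ _ → 0F) ≡ 0F
  ΣL-0 [] = refl
  ΣL-0 (x ∷ xs) = trans (+-identityˡ _) (ΣL-0 xs)

  ΣL-+ : ∀ {A : Set} (xs : List A) (f g : A → F) → ΣL xs (λ x → f x + g x) ≡ ΣL xs f + ΣL xs g
  ΣL-+ [] f g = sym (+-identityˡ 0F)
  ΣL-+ (x ∷ xs) f g = trans (cong (f x + g x +_) (ΣL-+ xs f g))
    (solve 4 (λ a b c d → a :+ b :+ (c :+ d) := a :+ c :+ (b :+ d)) refl (f x) (g x) (ΣL xs f) (ΣL xs g))

  ΣL-*ˡ : ∀ {A : Set} (xs : List A) c (f : A → F) → ΣL xs (λ x → c * f x) ≡ c * ΣL xs f
  ΣL-*ˡ [] c f = sym (zeroʳ c)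
  ΣL-*ˡ (x ∷ xs) c f = trans (cong (c * f x +_) (ΣL-*ˡ xs c f)) (sym (distribˡ c (f x) (ΣL xs f)))

  ΣL-*ʳ : ∀ {A : Set} (xs : List A) c (f : A → F) → ΣL xs (λ x → f x * c) ≡ ΣL xs f * c
  ΣL-*ʳ xs c f = trans (ΣL-cong xs (λ x → *-comm (f x) c)) (trans (ΣL-*ˡ xs c f) (*-comm c (ΣL xs f)))

  ΣL-swap : ∀ {A B : Set} (xs : List A) (ys : List B) (f : A → B → F) →
    ΣL xs (λ x → ΣL ys (f x)) ≡ ΣL ys (λ y → ΣL xs (λ x → f x y))
  ΣL-swap [] ys f = sym (ΣL-0 ys)
  ΣL-swap (x ∷ xs) ys f = trans (cong (ΣL ys (f x) +_) (ΣL-swap xs ys f)) (sym (ΣL-+ ys (f x) _))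

  ΣL-++ : ∀ {A : Set} (xs ys : List A) (f : A → F) → ΣL (xs ++ ys) f ≡ ΣL xs f + ΣL ys f
  ΣL-++ [] ys f = sym (+-identityˡ _)
  ΣL-++ (x ∷ xs) ys f = trans (cong (f x +_) (ΣL-++ xs ys f)) (sym (+-assoc _ _ _))

  ΣL-map : ∀ {A B : Set} (h : A → B) (xs : List A) (f : B → F) → ΣL (map h xs) f ≡ ΣL xs (f ∘ h)
  ΣL-map h [] f = refl
  ΣL-map h (x ∷ xs) f = cong (f (h x) +_) (ΣL-map h xs f)

  ΣL-const : ∀ {A : Set} (xs : List A) c → ΣL xs (λ _ → c) ≡ ι (length xs) * c
  ΣL-const [] c = sym (zeroˡ c)
  ΣL-const (x ∷ xs) c = trans (cong (c +_) (ΣL-const xs c))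
    (trans (solve 2 (λ c l → c :+ l :* c := (κ 1 :+ l) :* c) refl c (ι (length xs))) (cong (_* c) (sym (ι-suc (length xs)))))

  ΣL-∈ : ∀ {A : Set} {xs : List A} {f : A → F} {x} → (∀ y → 0F ≤ f y) → x ∈L xs → f x ≤ ΣL xs f
  ΣL-∈ {xs = _ ∷ xs} h (here refl) = ≤-+ʳ (0≤ΣL xs h)
  ΣL-∈ h (there x∈) = ≤-tr (ΣL-∈ h x∈) (≤-+ˡ (h _))

  ΣL-prod : ∀ {A B : Set} (xs : List A) (ys : List B) f g →
    ΣL xs f * ΣL ys g ≡ ΣL xs (λ x → ΣL ys (λ y → f x * g y))
  ΣL-prod xs ys f g = trans (sym (ΣL-*ʳ xs (ΣL ys g) f)) (ΣL-cong xs (λ x → sym (ΣL-*ˡ ys (f x) g)))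

  cauchy-schwarz : ∀ {A : Set} (xs : List A) (a b : A → F) →
    ΣL xs (λ x → a x * b x) * ΣL xs (λ x → a x * b x) ≤ ΣL xs (λ x → a x * a x) * ΣL xs (λ x → b x * b x)
  cauchy-schwarz [] a b = ≤-refl
  cauchy-schwarz (x ∷ xs) a b = ≤-diff _ (0≤+ (0≤diff ih) (0≤diff cross))
      (solve 5 (λ p q s t u → (p :* p :+ t) :* (q :* q :+ u) :- (p :* q :+ s) :* (p :* q :+ s)
         := (t :* u :- s :* s) :+ ((p :* p :* u :+ q :* q :* t) :- κ 2 :* (p :* q :* s))) refl (a x) (b x) s t u)
    where
    s = ΣL xs (λ x → a x * b x)
    t = ΣL xs (λ x → a x * a x)
    u = ΣL xs (λ x → b x * b x)
    ih = cauchy-schwarz xs a b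
    p = a x
    q = b x
    0≤t : 0F ≤ t
    0≤t = 0≤ΣL xs (λ y → 0≤sq (a y))
    0≤u : 0F ≤ u
    0≤u = 0≤ΣL xs (λ y → 0≤sq (b y))
    -- Compared after squaring: the difference of the squares is 4p²q²(tu - s²) + (p²u - q²t)², and
    -- the induction hypothesis makes the first summand nonnegative.
    cross : ι 2 * (p * q * s) ≤ p * p * u + q * q * t
    cross = sq-cancel (0≤+ (0≤* (0≤sq p) 0≤u) (0≤* (0≤sq q) 0≤t))
      (≤-diff _ (0≤+ (0≤* (0≤* 0≤4 (0≤sq (p * q))) (0≤diff ih)) (0≤sq (p * p * u - q * q * t)))
        (solve 5 (λ p q s t u → (p :* p :* u :+ q :* q :* t) :* (p :* p :* u :+ q :* q :* t) :- (κ 2 :* (p :* q :* s)) :* (κ 2 :* (p :* q :* s))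
          := κ 4 :* ((p :* q) :* (p :* q)) :* (t :* u :- s :* s) :+ (p :* p :* u :- q :* q :* t) :* (p :* p :* u :- q :* q :* t)) refl p q s t u))

  ΠL : {A : Set} → List A → (A → F) → F
  ΠL [] f = 1F
  ΠL (x ∷ xs) f = f x * ΠL xs f

  ΠL-cong : ∀ {A : Set} (xs : List A) {f g : A → F} → (∀ x → f x ≡ g x) → ΠL xs f ≡ ΠL xs g
  ΠL-cong [] h = refl
  ΠL-cong (x ∷ xs) h = cong₂ _*_ (h x) (ΠL-cong xs h)

  0≤ΠL : ∀ {A : Set} (xs : List A) {f : A → F} → (∀ x → 0F ≤ f x) → 0F ≤ ΠL xs f
  0≤ΠL [] h = 0≤1
  0≤ΠL (x ∷ xs) h = 0≤* (h x) (0≤ΠL xs h)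

  ΠL-mono : ∀ {A : Set} (xs : List A) {f g : A → F} → (∀ x → 0F ≤ f x) → (∀ x → f x ≤ g x) → ΠL xs f ≤ ΠL xs g
  ΠL-mono [] h h′ = ≤-refl
  ΠL-mono (x ∷ xs) h h′ = *-mono (h x) (h′ x) (0≤ΠL xs h) (ΠL-mono xs h h′)

  ΠL-* : ∀ {A : Set} (xs : List A) (f g : A → F) → ΠL xs f * ΠL xs g ≡ ΠL xs (λ x → f x * g x)
  ΠL-* [] f g = *-identityˡ 1F
  ΠL-* (x ∷ xs) f g = trans (solve 4 (λ a b c d → a :* b :* (c :* d) := a :* c :* (b :* d)) refl (f x) (ΠL xs f) (g x) (ΠL xs g))
    (cong (f x * g x *_) (ΠL-* xs f g))

  -- Pascal recursion in step with `layer`, for inductions over vectors; `binom≡C` identifies it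
  -- with the coefficient of the statement.
  binom : ℕ → ℕ → ℕ
  binom n zero = 1
  binom zero (suc k) = 0
  binom (suc n) (suc k) = binom n k ℕ.+ binom n (suc k)

  binom-vanish : ∀ {n k} → n ℕ.< k → binom n k ≡ 0
  binom-vanish {zero} (s≤s h) = refl
  binom-vanish {suc n} (s≤s h) = cong₂ ℕ._+_ (binom-vanish h) (binom-vanish (ℕP.m≤n⇒m≤1+n h))

  1≤binom : ∀ {n k} → k ℕ.≤ n → 1 ℕ.≤ binom n k
  1≤binom {n} z≤n = ℕP.≤-refl
  1≤binom (s≤s h) = ℕP.≤-trans (1≤binom h) (ℕP.m≤m+n _ _)

  binom-mono : ∀ {m n} k → m ℕ.≤ n → binom m k ℕ.≤ binom n k
  binom-mono zero h = ℕP.≤-refl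
  binom-mono (suc k) z≤n = z≤n
  binom-mono (suc k) (s≤s h) = ℕP.+-mono-≤ (binom-mono k h) (binom-mono (suc k) h)

  layer : ∀ N → ℕ → List (Vec Bool N)
  layer zero zero = [] ∷ []
  layer zero (suc j) = []
  layer (suc N) zero = map (false ∷_) (layer N zero)
  layer (suc N) (suc j) = map (true ∷_) (layer N j) ++ map (false ∷_) (layer N (suc j))

  ΣL-layer : ∀ N j (f : Vec Bool (suc N) → F) → ΣL (layer (suc N) (suc j)) f ≡
    ΣL (layer N j) (f ∘ (true ∷_)) + ΣL (layer N (suc j)) (f ∘ (false ∷_))
  ΣL-layer N j f = trans (ΣL-++ (map (true ∷_) (layer N j)) _ f)
    (cong₂ _+_ (ΣL-map (true ∷_) (layer N j) f) (ΣL-map (false ∷_) (layer N (suc j)) f))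

  ΣL-layer₀ : ∀ N (f : Vec Bool (suc N) → F) → ΣL (layer (suc N) zero) f ≡ ΣL (layer N zero) (f ∘ (false ∷_))
  ΣL-layer₀ N f = ΣL-map (false ∷_) (layer N zero) f

  length-layer : ∀ N j → length (layer N j) ≡ binom N j
  length-layer zero zero = refl
  length-layer zero (suc j) = refl
  length-layer (suc N) zero = trans (LP.length-map (false ∷_) (layer N zero)) (length-layer N zero)
    where import Data.List.Properties as LP
  length-layer (suc N) (suc j) = trans (LP.length-++ (map (true ∷_) (layer N j)))
    (cong₂ ℕ._+_ (trans (LP.length-map (true ∷_) (layer N j)) (length-layer N j))
      (trans (LP.length-map (false ∷_) (layer N (suc j))) (length-layer N (suc j))))
    where import Data.List.Properties as LP

  ΣL-layer-const : ∀ N j c → ΣL (layer N j) (λ _ → c) ≡ ι (binom N j) * c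
  ΣL-layer-const N j c = trans (ΣL-const (layer N j) c) (cong (λ l → ι l * c) (length-layer N j))

  ∈-layer : ∀ {N} (G : Vec Bool N) → G ∈L layer N ∣ G ∣
  ∈-layer [] = here refl
  ∈-layer {suc N} (true ∷ G) = MP.∈-++⁺ˡ (MP.∈-map⁺ (true ∷_) (∈-layer G))
    where import Data.List.Membership.Propositional.Properties as MP
  ∈-layer {suc N} (false ∷ G) with ∣ G ∣ | ∈-layer G
  ... | zero | i = MP.∈-map⁺ (false ∷_) i
    where import Data.List.Membership.Propositional.Properties as MP
  ... | suc j | i = MP.∈-++⁺ʳ (map (true ∷_) (layer N j)) (MP.∈-map⁺ (false ∷_) i)
    where import Data.List.Membership.Propositional.Properties as MP

  layer-∈ : ∀ {N} j {G : Vec Bool N} → G ∈L layer N j → ∣ G ∣ ≡ j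
  layer-∈ {zero} zero (here refl) = refl
  layer-∈ {suc N} zero i with MP.∈-map⁻ (false ∷_) i
    where import Data.List.Membership.Propositional.Properties as MP
  ... | G , i′ , refl = layer-∈ zero i′
  layer-∈ {suc N} (suc j) i with MP.∈-++⁻ (map (true ∷_) (layer N j)) i
    where import Data.List.Membership.Propositional.Properties as MP
  ... | inj₁ i′ with MP.∈-map⁻ (true ∷_) i′
    where import Data.List.Membership.Propositional.Properties as MP
  ... | G , i″ , refl = cong suc (layer-∈ j i″)
  layer-∈ {suc N} (suc j) i | inj₂ i′ with MP.∈-map⁻ (false ∷_) i′
    where import Data.List.Membership.Propositional.Properties as MP
  ... | G , i″ , refl = layer-∈ (suc j) i″

  -- Convolution form of the hypergeometric distribution

  conv : (ℕ → F) → (ℕ → F) → ℕ → F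
  conv f g zero = f 0 * g 0
  conv f g (suc k) = f 0 * g (suc k) + conv (f ∘ suc) g k

  conv-cong : ∀ {f f′ g g′ : ℕ → F} → (∀ i → f i ≡ f′ i) → (∀ i → g i ≡ g′ i) → ∀ k → conv f g k ≡ conv f′ g′ k
  conv-cong h h′ zero = cong₂ _*_ (h 0) (h′ 0)
  conv-cong h h′ (suc k) = cong₂ _+_ (cong₂ _*_ (h 0) (h′ (suc k))) (conv-cong (h ∘ suc) h′ k)

  conv-+ˡ : ∀ f f′ g k → conv (λ i → f i + f′ i) g k ≡ conv f g k + conv f′ g k
  conv-+ˡ f f′ g zero = distribʳ (g 0) (f 0) (f′ 0)
  conv-+ˡ f f′ g (suc k) = trans (cong₂ _+_ (distribʳ (g (suc k)) (f 0) (f′ 0)) (conv-+ˡ (f ∘ suc) (f′ ∘ suc) g k))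
    (solve 4 (λ a b c d → a :+ b :+ (c :+ d) := a :+ c :+ (b :+ d)) refl _ _ _ _)

  -- Multiplication by the variable, if sequences are read as generating functions; Pascal's rule
  -- becomes `binomF-suc`.
  delay : (ℕ → F) → ℕ → F
  delay f zero = 0F
  delay f (suc i) = f i

  conv-delayˡ : ∀ f g k → conv (delay f) g (suc k) ≡ conv f g k
  conv-delayˡ f g k = trans (cong (_+ conv f g k) (zeroˡ (g (suc k)))) (+-identityˡ _)

  conv-delayʳ : ∀ f g k → conv f (delay g) (suc k) ≡ conv f g k
  conv-delayʳ f g zero = trans (cong (f 0 * g 0 +_) (zeroʳ (f 1))) (+-identityʳ _)
  conv-delayʳ f g (suc k) = cong (f 0 * g (suc k) +_) (conv-delayʳ (f ∘ suc) g k)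

  conv-+ʳ : ∀ f g g′ k → conv f (λ i → g i + g′ i) k ≡ conv f g k + conv f g′ k
  conv-+ʳ f g g′ zero = distribˡ (f 0) (g 0) (g′ 0)
  conv-+ʳ f g g′ (suc k) = trans (cong₂ _+_ (distribˡ (f 0) (g (suc k)) (g′ (suc k))) (conv-+ʳ (f ∘ suc) g g′ k))
    (solve 4 (λ a b c d → a :+ b :+ (c :+ d) := a :+ c :+ (b :+ d)) refl _ _ _ _)

  range : ℕ → List ℕ
  range zero = []
  range (suc n) = zero ∷ map suc (range n)

  conv-range : ∀ f g k → conv f g k ≡ ΣL (range (suc k)) (λ r → f r * g (k ℕ.∸ r))
  conv-range f g zero = sym (+-identityʳ _)
  conv-range f g (suc k) = cong (f 0 * g (suc k) +_) (trans (conv-range (f ∘ suc) g k) (sym (ΣL-map suc (range (suc k)) _)))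

  range-< : ∀ {n r} → r ∈L range n → r ℕ.< n
  range-< {suc n} (here refl) = s≤s z≤n
  range-< {suc n} (there i) with MP.∈-map⁻ suc i
    where import Data.List.Membership.Propositional.Properties as MP
  ... | r , i′ , refl = s≤s (range-< i′)

  length-range : ∀ n → length (range n) ≡ n
  length-range zero = refl
  length-range (suc n) = cong suc (trans (LP.length-map suc (range n)) (length-range n))
    where import Data.List.Properties as LP

  binomF : ℕ → ℕ → F
  binomF n k = ι (binom n k)

  binomF-suc : ∀ n k → binomF (suc n) k ≡ delay (binomF n) k + binomF n k
  binomF-suc n zero = sym (+-identityˡ 1F)
  binomF-suc n (suc k) = ι-+ (binom n k) (binom n (suc k))

  -- Splits off the first element of the ground set. If it lies in D, Pascal's rule acts on the
  -- factor C(|D|, r), otherwise on C(n - |D|, k - r); either way one argument of `conv` is delayed.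
  hypergeometric : ∀ {n} (D : Vec Bool n) k (g : ℕ → F) →
    ΣL (layer n k) (λ D′ → g ∣ D ∩ D′ ∣) ≡ conv (λ r → binomF ∣ D ∣ r * g r) (binomF (n ℕ.∸ ∣ D ∣)) k
  hypergeometric {zero} [] zero g = solve 1 (λ g → g :+ κ 0 := κ 1 :* g :* κ 1) refl (g 0)
  hypergeometric {zero} [] (suc k) g = sym (trans (cong₂ _+_ (zeroʳ _) (vanish (λ r → binomF 0 (suc r) * g (suc r)) (λ r → zeroˡ _) k)) (+-identityˡ 0F))
    where
    vanish : ∀ f → (∀ r → f r ≡ 0F) → ∀ k → conv f (binomF 0) k ≡ 0F
    vanish f h zero = trans (cong (_* 1F) (h 0)) (zeroˡ _)
    vanish f h (suc k) = trans (cong₂ _+_ (zeroʳ _) (vanish (f ∘ suc) (h ∘ suc) k)) (+-identityˡ 0F)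
  hypergeometric {suc n} (true ∷ D) k g = trans (lhs k) (sym (trans (conv-cong split (λ _ → refl) k) (conv-+ˡ _ _ _ k)))
    where
    d = ∣ D ∣
    e = n ℕ.∸ d
    split : ∀ r → binomF (suc d) r * g r ≡ delay (λ r → binomF d r * g (suc r)) r + binomF d r * g r
    split zero = solve 1 (λ g → κ 1 :* g := κ 0 :+ κ 1 :* g) refl (g 0)
    split (suc r) = trans (cong (_* g (suc r)) (binomF-suc d (suc r))) (distribʳ (g (suc r)) (binomF d r) (binomF d (suc r)))
    lhs : ∀ k → ΣL (layer (suc n) k) (λ D′ → g ∣ (true ∷ D) ∩ D′ ∣) ≡
      conv (delay (λ r → binomF d r * g (suc r))) (binomF e) k + conv (λ r → binomF d r * g r) (binomF e) k
    lhs zero = trans (ΣL-layer₀ n _) (trans (hypergeometric D zero g) (solve 2 (λ a b → a :* b := κ 0 :* b :+ a :* b) refl (1F * g 0) 1F))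
    lhs (suc k) = trans (ΣL-layer n k _) (cong₂ _+_ (trans (hypergeometric D k (g ∘ suc)) (sym (conv-delayˡ _ _ k))) (hypergeometric D (suc k) g))
  hypergeometric {suc n} (false ∷ D) k g = trans (lhs k) (sym (trans (conv-cong (λ _ → refl) split k) (conv-+ʳ _ _ _ k)))
    where
    d = ∣ D ∣
    e = n ℕ.∸ d
    split : ∀ r → binomF (suc n ℕ.∸ d) r ≡ delay (binomF e) r + binomF e r
    split r = trans (cong (λ z → binomF z r) (ℕP.+-∸-assoc 1 (Sub′.∣p∣≤n D))) (binomF-suc e r)
      where import Data.Fin.Subset.Properties as Sub′
    lhs : ∀ k → ΣL (layer (suc n) k) (λ D′ → g ∣ (false ∷ D) ∩ D′ ∣) ≡
      conv (λ r → binomF d r * g r) (delay (binomF e)) k + conv (λ r → binomF d r * g r) (binomF e) k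
    lhs zero = trans (ΣL-layer₀ n _) (trans (hypergeometric D zero g) (solve 2 (λ a b → a :* b := a :* κ 0 :+ a :* b) refl (1F * g 0) 1F))
    lhs (suc k) = trans (ΣL-layer n k _) (cong₂ _+_ (trans (hypergeometric D k g) (sym (conv-delayʳ _ _ k))) (hypergeometric D (suc k) g))

  -- Expectation for the binomial random subset of density p, conditioning on one coordinate at a
  -- time. With N = `numPairs n` this is G(n,p).
  𝔼 : F → ∀ N → (Vec Bool N → F) → F
  𝔼 p zero f = f []
  𝔼 p (suc N) f = p * 𝔼 p N (f ∘ (true ∷_)) + (1F - p) * 𝔼 p N (f ∘ (false ∷_))

  E-cong : ∀ p N {f g : Vec Bool N → F} → (∀ G → f G ≡ g G) → 𝔼 p N f ≡ 𝔼 p N g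
  E-cong p zero h = h []
  E-cong p (suc N) h = cong₂ (λ a b → p * a + (1F - p) * b) (E-cong p N (h ∘ (true ∷_))) (E-cong p N (h ∘ (false ∷_)))

  E-+ : ∀ p N (f g : Vec Bool N → F) → 𝔼 p N (λ G → f G + g G) ≡ 𝔼 p N f + 𝔼 p N g
  E-+ p zero f g = refl
  E-+ p (suc N) f g = trans (cong₂ (λ a b → p * a + (1F - p) * b) (E-+ p N (f ∘ (true ∷_)) (g ∘ (true ∷_))) (E-+ p N (f ∘ (false ∷_)) (g ∘ (false ∷_))))
    (solve 6 (λ p r a b c d → p :* (a :+ b) :+ r :* (c :+ d) := p :* a :+ r :* c :+ (p :* b :+ r :* d)) refl p (1F - p) _ _ _ _)

  E-*ˡ : ∀ p N c (f : Vec Bool N → F) → 𝔼 p N (λ G → c * f G) ≡ c * 𝔼 p N f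
  E-*ˡ p zero c f = refl
  E-*ˡ p (suc N) c f = trans (cong₂ (λ a b → p * a + (1F - p) * b) (E-*ˡ p N c (f ∘ (true ∷_))) (E-*ˡ p N c (f ∘ (false ∷_))))
    (solve 5 (λ p r c a b → p :* (c :* a) :+ r :* (c :* b) := c :* (p :* a :+ r :* b)) refl p (1F - p) c _ _)

  E-const : ∀ p N c → 𝔼 p N (λ _ → c) ≡ c
  E-const p zero c = refl
  E-const p (suc N) c = trans (cong₂ (λ a b → p * a + (1F - p) * b) (E-const p N c) (E-const p N c))
    (solve 2 (λ p c → p :* c :+ (κ 1 :- p) :* c := c) refl p c)

  E-ΣL : ∀ p N {A : Set} (xs : List A) (f : A → Vec Bool N → F) → 𝔼 p N (λ G → ΣL xs (λ x → f x G)) ≡ ΣL xs (λ x → 𝔼 p N (f x))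
  E-ΣL p N [] f = E-const p N 0F
  E-ΣL p N (x ∷ xs) f = trans (E-+ p N (f x) _) (cong (𝔼 p N (f x) +_) (E-ΣL p N xs f))

  E-mono : ∀ p N → 0F ≤ p → p ≤ 1F → {f g : Vec Bool N → F} → (∀ G → f G ≤ g G) → 𝔼 p N f ≤ 𝔼 p N g
  E-mono p zero h h′ k = k []
  E-mono p (suc N) h h′ k = +-mono (*-monoˡ p h (E-mono p N h h′ (k ∘ (true ∷_)))) (*-monoˡ (1F - p) (0≤diff h′) (E-mono p N h h′ (k ∘ (false ∷_))))

  0≤E : ∀ p N → 0F ≤ p → p ≤ 1F → {f : Vec Bool N → F} → (∀ G → 0F ≤ f G) → 0F ≤ 𝔼 p N f
  0≤E p N h h′ k = subst (_≤ 𝔼 p N _) (E-const p N 0F) (E-mono p N h h′ k)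

  -- Measurability with respect to the coordinates selected by T; independence is derived from
  -- disjoint selections.
  Dep : ∀ {N} → (Vec Bool N → F) → (Fin N → Bool) → Set
  Dep {N} f T = ∀ G G′ → (∀ e → T e ≡ true → lookup G e ≡ lookup G′ e) → f G ≡ f G′

  Dep-tail : ∀ {N} {f : Vec Bool (suc N) → F} {T} b → Dep f T → Dep (f ∘ (b ∷_)) (T ∘ suc)
  Dep-tail b d G G′ h = d (b ∷ G) (b ∷ G′) λ { zero _ → refl ; (suc e) t → h e t }

  Dep-head : ∀ {N} {f : Vec Bool (suc N) → F} {T} → Dep f T → T zero ≡ false → ∀ G → f (true ∷ G) ≡ f (false ∷ G)
  Dep-head d z G = d (true ∷ G) (false ∷ G) λ { zero t → ⊥-elim (clash (trans (sym z) t)) ; (suc e) t → refl }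
    where
    clash : false ≢ true
    clash ()

  -- At each coordinate at most one of f and g can vary, so the other one factors out of the
  -- two-point average.
  E-indep : ∀ p N (f g : Vec Bool N → F) T → Dep f T → Dep g (not ∘ T) → 𝔼 p N (λ G → f G * g G) ≡ 𝔼 p N f * 𝔼 p N g
  E-indep p zero f g T df dg = refl
  E-indep p (suc N) f g T df dg = trans
    (cong₂ (λ a b → p * a + (1F - p) * b)
      (E-indep p N _ _ (T ∘ suc) (Dep-tail true df) (Dep-tail true dg))
      (E-indep p N _ _ (T ∘ suc) (Dep-tail false df) (Dep-tail false dg)))
    (by-head (T zero) refl)
    where
    f₁ = 𝔼 p N (f ∘ (true ∷_))
    f₀ = 𝔼 p N (f ∘ (false ∷_))
    g₁ = 𝔼 p N (g ∘ (true ∷_))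
    g₀ = 𝔼 p N (g ∘ (false ∷_))
    by-head : ∀ b → T zero ≡ b → p * (f₁ * g₁) + (1F - p) * (f₀ * g₀) ≡ (p * f₁ + (1F - p) * f₀) * (p * g₁ + (1F - p) * g₀)
    by-head true e = subst (λ z → p * (f₁ * g₁) + (1F - p) * (f₀ * z) ≡ (p * f₁ + (1F - p) * f₀) * (p * g₁ + (1F - p) * z))
      (E-cong p N (Dep-head dg (cong not e)))
      (solve 4 (λ p a b c → p :* (a :* c) :+ (κ 1 :- p) :* (b :* c) := (p :* a :+ (κ 1 :- p) :* b) :* (p :* c :+ (κ 1 :- p) :* c)) refl p f₁ f₀ g₁)
    by-head false e = subst (λ z → p * (f₁ * g₁) + (1F - p) * (z * g₀) ≡ (p * f₁ + (1F - p) * z) * (p * g₁ + (1F - p) * g₀))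
      (E-cong p N (Dep-head df e))
      (solve 4 (λ p a b c → p :* (a :* b) :+ (κ 1 :- p) :* (a :* c) := (p :* a :+ (κ 1 :- p) :* a) :* (p :* b :+ (κ 1 :- p) :* c)) refl p f₁ g₁ g₀)

  Dep-⊆ : ∀ {N} {f : Vec Bool N → F} {T T′} → (∀ e → T e ≡ true → T′ e ≡ true) → Dep f T → Dep f T′
  Dep-⊆ s d G G′ h = d G G′ (λ e t → h e (s e t))

  Dep-ΠL : ∀ {N} {X : Set} (xs : List X) (f : X → Vec Bool N → F) (T : Fin N → Bool) →
    All (λ x → Dep (f x) T) xs → Dep (λ G → ΠL xs (λ x → f x G)) T
  Dep-ΠL [] f T [] G G′ h = refl
  Dep-ΠL (x ∷ xs) f T (d ∷ ds) G G′ h = cong₂ _*_ (d G G′ h) (Dep-ΠL xs f T ds G G′ h)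

  -- Iterates `E-indep`: by disjointness the rest of the product ignores the coordinates of the head
  -- factor.
  E-ΠL : ∀ p N {X : Set} (xs : List X) (f : X → Vec Bool N → F) (T : X → Fin N → Bool) → Unique xs →
    (∀ x → Dep (f x) (T x)) → (∀ x y e → T x e ≡ true → T y e ≡ true → x ≡ y) →
    𝔼 p N (λ G → ΠL xs (λ x → f x G)) ≡ ΠL xs (λ x → 𝔼 p N (f x))
  E-ΠL p N [] f T u d disj = E-const p N 1F
  E-ΠL p N (x ∷ xs) f T (x∉ ∷ u) d disj = trans
    (E-indep p N (f x) (λ G → ΠL xs (λ x → f x G)) (T x) (d x)
      (Dep-ΠL xs f (not ∘ T x) (All.map (λ {y} x≢y → Dep-⊆ (away y x≢y) (d y)) x∉)))
    (cong (𝔼 p N (f x) *_) (E-ΠL p N xs f T u d disj))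
    where
    away : ∀ y → x ≢ y → ∀ e → T y e ≡ true → not (T x e) ≡ true
    away y x≢y e t with T x e in eq
    ... | true = ⊥-elim (x≢y (disj x y e eq t))
    ... | false = refl

  -- Generating function of the binomial variable |G ∩ A|. Since 0^0 = 1, its value at y = 0 is the
  -- probability that G misses A.
  E-pow : ∀ p y {N} (A : Vec Bool N) → 𝔼 p N (λ G → y ^^ ∣ G ∩ A ∣) ≡ (1F - p + p * y) ^^ ∣ A ∣
  E-pow p y [] = refl
  E-pow p y {suc N} (true ∷ A) = trans (cong₂ (λ a b → p * a + (1F - p) * b)
      (trans (E-*ˡ p N y (λ G → y ^^ ∣ G ∩ A ∣)) (cong (y *_) (E-pow p y A))) (E-pow p y A))
    (solve 3 (λ p y w → p :* (y :* w) :+ (κ 1 :- p) :* w := (κ 1 :- p :+ p :* y) :* w) refl p y _)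
  E-pow p y {suc N} (false ∷ A) = trans (cong₂ (λ a b → p * a + (1F - p) * b) (E-pow p y A) (E-pow p y A))
    (solve 2 (λ p w → p :* w :+ (κ 1 :- p) :* w := w) refl p _)

  E-0pow : ∀ p {N} (A : Vec Bool N) → 𝔼 p N (λ G → 0F ^^ ∣ G ∩ A ∣) ≡ (1F - p) ^^ ∣ A ∣
  E-0pow p A = trans (E-pow p 0F A) (cong (_^^ ∣ A ∣) (solve 1 (λ p → κ 1 :- p :+ p :* κ 0 := κ 1 :- p) refl p))

  E-0pow₂ : ∀ p {N} (A B : Vec Bool N) → 𝔼 p N (λ G → 0F ^^ ∣ G ∩ A ∣ * 0F ^^ ∣ G ∩ B ∣) ≡ (1F - p) ^^ ∣ A ∪ B ∣
  E-0pow₂ p [] [] = *-identityˡ 1F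
  E-0pow₂ p {suc N} (a ∷ A) (b ∷ B) = step a b
    where
    f : Vec Bool N → F
    f G = 0F ^^ ∣ G ∩ A ∣ * 0F ^^ ∣ G ∩ B ∣
    r = (1F - p) ^^ ∣ A ∪ B ∣
    ih : 𝔼 p N f ≡ r
    ih = E-0pow₂ p A B
    dead : ∀ (g : Vec Bool N → F) → (∀ G → g G ≡ 0F) → p * 𝔼 p N g + (1F - p) * 𝔼 p N f ≡ (1F - p) * r
    dead g h = trans (cong₂ (λ a b → p * a + (1F - p) * b) (trans (E-cong p N h) (E-const p N 0F)) ih)
      (solve 3 (λ p q r → p :* κ 0 :+ q :* r := q :* r) refl p (1F - p) r)
    step : ∀ a b → 𝔼 p (suc N) (λ G → 0F ^^ ∣ G ∩ (a ∷ A) ∣ * 0F ^^ ∣ G ∩ (b ∷ B) ∣) ≡ (1F - p) ^^ ∣ (a ∷ A) ∪ (b ∷ B) ∣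
    step false false = trans (cong₂ (λ a b → p * a + (1F - p) * b) ih ih) (solve 2 (λ p w → p :* w :+ (κ 1 :- p) :* w := w) refl p r)
    step true false = dead _ (λ G → solve 2 (λ a b → κ 0 :* a :* b := κ 0) refl _ _)
    step false true = dead _ (λ G → solve 2 (λ a b → a :* (κ 0 :* b) := κ 0) refl _ _)
    step true true = dead _ (λ G → solve 2 (λ a b → κ 0 :* a :* (κ 0 :* b) := κ 0) refl _ _)

  -- A Harris-type bound: the binomial factor is increasing and the powers of y ≤ 1 are decreasing.
  E-choose : ∀ p y → 0F ≤ p → p ≤ 1F → 0F ≤ y → y ≤ 1F → ∀ {N} (A B : Vec Bool N) i →
    𝔼 p N (λ G → binomF ∣ G ∩ (A ∩ B) ∣ i * (y ^^ ∣ G ∩ A ∣ * y ^^ ∣ G ∩ B ∣))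
      ≤ binomF ∣ A ∩ B ∣ i * p ^^ i * (1F - p + p * y) ^^ ∣ A ∪ B ∣
  E-choose p y 0≤p p≤1 0≤y y≤1 [] [] zero = ≤-rf (solve 0 (κ 1 :* (κ 1 :* κ 1) := κ 1 :* κ 1 :* κ 1) refl)
  E-choose p y 0≤p p≤1 0≤y y≤1 [] [] (suc i) = ≤-rf (trans (zeroˡ _) (sym (trans (cong (_* 1F) (zeroˡ _)) (zeroˡ _))))
  E-choose p y 0≤p p≤1 0≤y y≤1 {suc N} (a ∷ A) (b ∷ B) i = step a b i
    where
    q = 1F - p
    0≤q : 0F ≤ q
    0≤q = 0≤diff p≤1
    w = 1F - p + p * y
    0≤w : 0F ≤ w
    0≤w = 0≤+ 0≤q (0≤* 0≤p 0≤y)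
    y≤w : y ≤ w
    y≤w = ≤-diff _ (0≤* 0≤q (0≤diff y≤1)) (solve 2 (λ p y → κ 1 :- p :+ p :* y :- y := (κ 1 :- p) :* (κ 1 :- y)) refl p y)
    f : ℕ → Vec Bool N → F
    f i G = binomF ∣ G ∩ (A ∩ B) ∣ i * (y ^^ ∣ G ∩ A ∣ * y ^^ ∣ G ∩ B ∣)
    W = w ^^ ∣ A ∪ B ∣
    C : ℕ → F
    C i = binomF ∣ A ∩ B ∣ i * p ^^ i
    ih : ∀ i → 𝔼 p N (f i) ≤ C i * W
    ih = E-choose p y 0≤p p≤1 0≤y y≤1 A B
    0≤f : ∀ i G → 0F ≤ f i G
    0≤f i G = 0≤* (0≤ι (binom ∣ G ∩ (A ∩ B) ∣ i)) (0≤* (0≤^^ 0≤y ∣ G ∩ A ∣) (0≤^^ 0≤y ∣ G ∩ B ∣))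
    Ef : ∀ i → 0F ≤ 𝔼 p N (f i)
    Ef i = 0≤E p N 0≤p p≤1 (0≤f i)
    one : ∀ i (g : Vec Bool N → F) → (∀ G → g G ≡ y * f i G) → p * 𝔼 p N g + q * 𝔼 p N (f i) ≤ C i * (w * W)
    one i g h = ≤-tr (≤-rf (trans (cong (λ z → p * z + q * 𝔼 p N (f i)) (trans (E-cong p N h) (E-*ˡ p N y (f i))))
        (solve 3 (λ p y z → p :* (y :* z) :+ (κ 1 :- p) :* z := (κ 1 :- p :+ p :* y) :* z) refl p y (𝔼 p N (f i)))))
      (≤-tr (*-monoˡ w 0≤w (ih i)) (≤-rf (solve 3 (λ w c W → w :* (c :* W) := c :* (w :* W)) refl w (C i) W)))
    -- A present coordinate in both A and B carries y²; weakening this to y makes the damping depend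
    -- on the union alone.
    yy≤y : y * y ≤ y
    yy≤y = *≤ˡ 0≤y y≤1
    step : ∀ a b i → 𝔼 p (suc N) (λ G → binomF ∣ G ∩ ((a ∷ A) ∩ (b ∷ B)) ∣ i * (y ^^ ∣ G ∩ (a ∷ A) ∣ * y ^^ ∣ G ∩ (b ∷ B) ∣))
      ≤ binomF ∣ (a ∷ A) ∩ (b ∷ B) ∣ i * p ^^ i * w ^^ ∣ (a ∷ A) ∪ (b ∷ B) ∣
    step false false i = ≤-tr (≤-rf (solve 2 (λ p z → p :* z :+ (κ 1 :- p) :* z := z) refl p (𝔼 p N (f i)))) (ih i)
    step true false i = one i _ (λ G → solve 4 (λ c y a b → c :* (y :* a :* b) := y :* (c :* (a :* b))) refl _ y _ _)
    step false true i = one i _ (λ G → solve 4 (λ c y a b → c :* (a :* (y :* b)) := y :* (c :* (a :* b))) refl _ y _ _)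
    step true true zero = ≤-tr (+-mono (*-monoˡ p 0≤p (≤-tr (E-mono p N 0≤p p≤1 {g = λ G → y * f 0 G} (λ G →
        ≤-tr (≤-rf (solve 4 (λ c y a b → c :* (y :* a :* (y :* b)) := y :* y :* (c :* (a :* b))) refl 1F y _ _))
          (*-monoʳ (f 0 G) (0≤f 0 G) yy≤y))) ≤-refl)) ≤-refl) (one 0 (λ G → y * f 0 G) (λ _ → refl))
    step true true (suc i) = ≤-tr (+-mono (*-monoˡ p 0≤p (E-mono p N 0≤p p≤1 (λ G →
        ≤-tr (≤-rf (trans (cong (_* (y * y ^^ ∣ G ∩ A ∣ * (y * y ^^ ∣ G ∩ B ∣))) (ι-+ (binom ∣ G ∩ (A ∩ B) ∣ i) _))
               (solve 5 (λ c d y a b → (c :+ d) :* (y :* a :* (y :* b)) := y :* y :* (c :* (a :* b) :+ d :* (a :* b))) refl _ _ y _ _)))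
          (*-monoʳ (f i G + f (suc i) G) (0≤+ (0≤f i G) (0≤f (suc i) G)) yy≤y)))) ≤-refl)
      (≤-tr (≤-rf (trans (cong (λ z → p * z + q * 𝔼 p N (f (suc i))) (trans (E-*ˡ p N y _) (cong (y *_) (E-+ p N (f i) (f (suc i))))))
          (solve 4 (λ p y a b → p :* (y :* (a :+ b)) :+ (κ 1 :- p) :* b := p :* (y :* a) :+ (κ 1 :- p :+ p :* y) :* b) refl p y (𝔼 p N (f i)) (𝔼 p N (f (suc i))))))
        (≤-tr (+-mono (*-monoˡ p 0≤p (*-mono 0≤y y≤w (Ef i) (ih i))) (*-monoˡ w 0≤w (ih (suc i))))
          (≤-rf (sym (trans (cong (λ z → z * (p * p ^^ i) * (w * W)) (ι-+ (binom ∣ A ∩ B ∣ i) (binom ∣ A ∩ B ∣ (suc i))))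
            (solve 6 (λ c d p P w W → (c :+ d) :* (p :* P) :* (w :* W) := p :* (w :* (c :* P :* W)) :+ w :* (d :* (p :* P) :* W)) refl
              (binomF ∣ A ∩ B ∣ i) (binomF ∣ A ∩ B ∣ (suc i)) p (p ^^ i) w W))))))

-- From binomial random subsets to uniform layers.

module RandomSubsets where

  open OrderedField
  open Inequalities
  open FiniteSums
  open import Data.Nat as ℕ using (ℕ; zero; suc; z≤n; s≤s)
  import Data.Nat.Properties as ℕP
  open import Data.Nat.Combinatorics using (_C_; nCk+nC[k+1]≡[n+1]C[k+1])
  open import Data.Empty using (⊥-elim)
  open import Data.List using ([]; _∷_; map; _++_)
  open import Data.List.Membership.Propositional using () renaming (_∈_ to _∈L_)
  open import Data.List.Relation.Unary.Any using (here; there)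
  open import Data.Vec as Vec using (Vec; []; _∷_)
  open import Data.Fin using (zero; suc)
  open import Data.Fin.Subset using (∣_∣; _⊆_)
  import Data.Fin.Subset.Properties as SubP
  open import Data.Bool using (Bool; true; false)
  open import Function using (_∘_)
  open import Relation.Nullary using (yes; no)
  open import Relation.Nullary.Decidable using (⌊_⌋)
  open import Relation.Binary.PropositionalEquality

  binom≡C : ∀ n k → binom n k ≡ n C k
  binom≡C zero zero = refl
  binom≡C (suc n) zero = refl
  binom≡C zero (suc k) = refl
  binom≡C (suc n) (suc k) = trans (cong₂ ℕ._+_ (binom≡C n k) (binom≡C n (suc k))) (nCk+nC[k+1]≡[n+1]C[k+1] n k)

  𝟙 : Bool → F
  𝟙 true = 1F
  𝟙 false = 0F

  0≤𝟙 : ∀ b → 0F ≤ 𝟙 b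
  0≤𝟙 true = 0≤1
  0≤𝟙 false = ≤-refl

  𝟙≤1 : ∀ b → 𝟙 b ≤ 1F
  𝟙≤1 true = ≤-refl
  𝟙≤1 false = 0≤1

  0≤binomF : ∀ n k → 0F ≤ binomF n k
  0≤binomF n k = 0≤ι (binom n k)

  -- Subtraction-free form of (n - k) C(n, k) = (k + 1) C(n, k + 1), valid for k > n as well.
  binomF-ratio : ∀ n k → ι n * binomF n k ≡ ι k * binomF n k + ι (suc k) * binomF n (suc k)
  binomF-ratio zero zero = solve 0 (κ 0 :* κ 1 := κ 0 :* κ 1 :+ κ 1 :* κ 0) refl
  binomF-ratio zero (suc k) = solve 2 (λ a b → κ 0 :* κ 0 := a :* κ 0 :+ b :* κ 0) refl (ι (suc k)) (ι (suc (suc k)))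
  binomF-ratio (suc n) zero = trans (cong (_* 1F) (ι-suc n)) (trans (cong (λ z → (1F + z) * 1F) (trans (sym (*-identityʳ (ι n))) (binomF-ratio n zero)))
    (trans (solve 1 (λ b → (κ 1 :+ (κ 0 :* κ 1 :+ κ 1 :* b)) :* κ 1 := κ 0 :* κ 1 :+ κ 1 :* (κ 1 :+ b)) refl (binomF n 1))
      (cong (λ z → 0F * 1F + 1F * z) (sym (ι-+ 1 (binom n 1))))))
  binomF-ratio (suc n) (suc k) = trans (cong₂ _*_ (ι-suc n) (ι-+ (binom n k) (binom n (suc k))))
    (trans (solve 3 (λ n a b → (κ 1 :+ n) :* (a :+ b) := a :+ b :+ (n :* a :+ n :* b)) refl (ι n) a b)
     (trans (cong (a + b +_) (cong₂ _+_ (binomF-ratio n k) (binomF-ratio n (suc k))))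
       (trans (cong (λ z → a + b + (ι k * a + z * b + (z * b + ι (suc (suc k)) * c))) (ι-suc k))
        (trans (cong (λ z → a + b + (ι k * a + (1F + ι k) * b + ((1F + ι k) * b + z * c))) (trans (ι-suc (suc k)) (cong (1F +_) (ι-suc k))))
        (trans (solve 4 (λ k a b c → a :+ b :+ (k :* a :+ (κ 1 :+ k) :* b :+ ((κ 1 :+ k) :* b :+ (κ 1 :+ (κ 1 :+ k)) :* c))
           := (κ 1 :+ k) :* (a :+ b) :+ (κ 1 :+ (κ 1 :+ k)) :* (b :+ c)) refl (ι k) a b c)
        (cong₂ _+_ (cong₂ _*_ (sym (ι-suc k)) (sym (ι-+ (binom n k) (binom n (suc k)))))
          (cong₂ _*_ (sym (trans (ι-suc (suc k)) (cong (1F +_) (ι-suc k)))) (sym (ι-+ (binom n (suc k)) (binom n (suc (suc k)))))))))))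
    )
    where
    a = binomF n k
    b = binomF n (suc k)
    c = binomF n (suc (suc k))

  Increasing : ∀ {N} → (Vec Bool N → F) → Set
  Increasing f = ∀ G G′ → G ⊆ G′ → f G ≤ f G′

  Increasing-tail : ∀ {N} {f : Vec Bool (suc N) → F} b → Increasing f → Increasing (f ∘ (b ∷_))
  Increasing-tail b inc G G′ s = inc (b ∷ G) (b ∷ G′) (SubP.s⊆s s)

  ΣL-layer-mono : ∀ {N} {f : Vec Bool (suc N) → F} → Increasing f → ∀ j → ΣL (layer N j) (f ∘ (false ∷_)) ≤ ΣL (layer N j) (f ∘ (true ∷_))
  ΣL-layer-mono {N} inc j = ΣL-mono (layer N j) (λ G → inc (false ∷ G) (true ∷ G) (SubP.out⊆ (λ z → z)))

  -- Double counting of pairs G ⊂ G′ of consecutive sizes: an m-set has N - m supersets with one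
  -- more element, an (m + 1)-set has m + 1 subsets with one less. In the induction the two sections
  -- by the first coordinate give the hypotheses, and comparing them on one layer supplies the
  -- missing unit.
  local-LYM : ∀ N (f : Vec Bool N → F) → Increasing f → (∀ G → 0F ≤ f G) → ∀ m →
    ι N * ΣL (layer N m) f ≤ ι m * ΣL (layer N m) f + ι (suc m) * ΣL (layer N (suc m)) f
  local-LYM zero f inc 0≤f m = ≤-tr (≤-rf (zeroˡ (ΣL (layer zero m) f))) (0≤+ (0≤* (0≤ι m) (0≤ΣL (layer zero m) 0≤f)) (0≤* (0≤ι (suc m)) (0≤ΣL (layer zero (suc m)) 0≤f)))
  local-LYM (suc N) f inc 0≤f zero = subst₂ _≤_
    (sym (cong₂ _*_ (ι-suc N) (ΣL-layer₀ N f)))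
    (sym (cong₂ (λ a b → 0F * a + 1F * b) (ΣL-layer₀ N f) (ΣL-layer N zero f)))
    (≤-diff _ (0≤+ (0≤diff (local-LYM N f₀ (Increasing-tail false inc) (λ G → 0≤f (false ∷ G)) zero)) (0≤diff (ΣL-layer-mono inc zero)))
      (solve 4 (λ n x y z → (κ 0 :* x :+ κ 1 :* (y :+ z)) :- (κ 1 :+ n) :* x := (κ 0 :* x :+ κ 1 :* z :- n :* x) :+ (y :- x)) refl
        (ι N) (ΣL (layer N zero) f₀) (ΣL (layer N zero) (f ∘ (true ∷_))) (ΣL (layer N 1) f₀)))
    where f₀ = f ∘ (false ∷_)
  local-LYM (suc N) f inc 0≤f (suc m) = subst₂ _≤_
    (sym (cong₂ _*_ (ι-suc N) (ΣL-layer N m f)))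
    (sym (cong₂ _+_ (cong₂ _*_ (ι-suc m) (ΣL-layer N m f)) (cong₂ _*_ (trans (ι-suc (suc m)) (cong (1F +_) (ι-suc m))) (ΣL-layer N (suc m) f))))
    (≤-diff _ (0≤+ (0≤+ (0≤diff ih₁) (0≤diff ih₀)) (0≤diff (ΣL-layer-mono inc (suc m))))
      (solve 6 (λ n m a b c d →
         (κ 1 :+ m) :* (a :+ b) :+ (κ 1 :+ (κ 1 :+ m)) :* (c :+ d) :- (κ 1 :+ n) :* (a :+ b)
         := (m :* a :+ (κ 1 :+ m) :* c :- n :* a) :+ ((κ 1 :+ m) :* b :+ (κ 1 :+ (κ 1 :+ m)) :* d :- n :* b) :+ (c :- b)) refl
        (ι N) (ι m) (ΣL (layer N m) f₁) (ΣL (layer N (suc m)) f₀) (ΣL (layer N (suc m)) f₁) (ΣL (layer N (suc (suc m))) f₀)))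
    where
    f₀ = f ∘ (false ∷_)
    f₁ = f ∘ (true ∷_)
    ih₁ : ι N * ΣL (layer N m) f₁ ≤ ι m * ΣL (layer N m) f₁ + (1F + ι m) * ΣL (layer N (suc m)) f₁
    ih₁ = subst (λ z → ι N * ΣL (layer N m) f₁ ≤ ι m * ΣL (layer N m) f₁ + z * ΣL (layer N (suc m)) f₁) (ι-suc m)
      (local-LYM N f₁ (Increasing-tail true inc) (λ G → 0≤f (true ∷ G)) m)
    ih₀ : ι N * ΣL (layer N (suc m)) f₀ ≤ (1F + ι m) * ΣL (layer N (suc m)) f₀ + (1F + (1F + ι m)) * ΣL (layer N (suc (suc m))) f₀
    ih₀ = subst₂ (λ y z → ι N * ΣL (layer N (suc m)) f₀ ≤ y * ΣL (layer N (suc m)) f₀ + z * ΣL (layer N (suc (suc m))) f₀)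
      (ι-suc m) (trans (ι-suc (suc m)) (cong (1F +_) (ι-suc m)))
      (local-LYM N f₀ (Increasing-tail false inc) (λ G → 0≤f (false ∷ G)) (suc m))

  layer-density-step : ∀ N (f : Vec Bool N → F) → Increasing f → (∀ G → 0F ≤ f G) → ∀ m →
    ΣL (layer N m) f * binomF N (suc m) ≤ ΣL (layer N (suc m)) f * binomF N m
  layer-density-step N f inc 0≤f m = *-cancelˡ (ι (suc m)) (0<ι {suc m} (s≤s z≤n)) (≤-tr
    (≤-rf (trans (solve 3 (λ j l c → j :* (l :* c) := l :* (j :* c)) refl (ι (suc m)) l c′)
       (trans (cong (l *_) ratio) (solve 4 (λ n m l c → l :* (n :* c :- m :* c) := c :* (n :* l :- m :* l)) refl (ι N) (ι m) l c))))
    (≤-tr (*-monoˡ c (0≤binomF N m) (≤-diff _ (0≤diff (local-LYM N f inc 0≤f m))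
        (solve 3 (λ a b d → d :- (a :- b) := (b :+ d) :- a) refl (ι N * l) (ι m * l) (ι (suc m) * l′))))
      (≤-rf (solve 3 (λ j l c → c :* (j :* l) := j :* (l :* c)) refl (ι (suc m)) l′ c))))
    where
    l = ΣL (layer N m) f
    l′ = ΣL (layer N (suc m)) f
    c = binomF N m
    c′ = binomF N (suc m)
    ratio : ι (suc m) * c′ ≡ ι N * c - ι m * c
    ratio = trans (solve 2 (λ a b → b := (a :+ b) :- a) refl (ι m * c) (ι (suc m) * c′)) (cong (_- ι m * c) (sym (binomF-ratio N m)))

  -- Chains `layer-density-step`, cancelling the intermediate binomial coefficient; beyond layer N
  -- the coefficient on the left is zero.
  layer-density : ∀ N (f : Vec Bool N → F) → Increasing f → (∀ G → 0F ≤ f G) → ∀ m d →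
    ΣL (layer N m) f * binomF N (d ℕ.+ m) ≤ ΣL (layer N (d ℕ.+ m)) f * binomF N m
  layer-density N f inc 0≤f m zero = ≤-refl
  layer-density N f inc 0≤f m (suc d) with d ℕ.+ m ℕP.≤? N
  ... | no ≰ = ≤-tr (≤-rf (trans (cong (λ z → ΣL (layer N m) f * ι z) (binom-vanish (ℕP.m≤n⇒m≤1+n (ℕP.≰⇒> ≰)))) (zeroʳ _)))
    (0≤* (0≤ΣL (layer N (suc d ℕ.+ m)) 0≤f) (0≤ι (binom N m)))
  ... | yes j≤N = *-cancelʳ (binomF N (d ℕ.+ m)) (0<ι (1≤binom j≤N)) (≤-tr
      (≤-rf (solve 3 (λ a b c → a :* b :* c := a :* c :* b) refl _ (binomF N (suc d ℕ.+ m)) (binomF N (d ℕ.+ m))))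
      (≤-tr (*-monoʳ (binomF N (suc d ℕ.+ m)) (0≤binomF N (suc d ℕ.+ m)) (layer-density N f inc 0≤f m d))
        (≤-tr (≤-rf (solve 3 (λ a b c → a :* b :* c := a :* c :* b) refl _ (binomF N m) (binomF N (suc d ℕ.+ m))))
          (≤-tr (*-monoʳ (binomF N m) (0≤binomF N m) (layer-density-step N f inc 0≤f (d ℕ.+ m)))
            (≤-rf (solve 3 (λ a b c → a :* b :* c := a :* c :* b) refl _ (binomF N (d ℕ.+ m)) (binomF N m)))))))

  E-layer : ∀ p {N} (f : Vec Bool N → F) i j → i ℕ.+ j ≡ N →
    𝔼 p N (λ G → 𝟙 (∣ G ∣ ℕ.≡ᵇ j) * f G) ≡ p ^^ j * (1F - p) ^^ i * ΣL (layer N j) f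
  E-layer p {zero} f zero zero e = solve 1 (λ z → κ 1 :* z := κ 1 :* κ 1 :* (z :+ κ 0)) refl (f [])
  E-layer p {suc N} f (suc i) zero e = trans
    (cong₂ (λ a b → p * a + (1F - p) * b) (trans (E-cong p N (λ G → zeroˡ _)) (E-const p N 0F)) (E-layer p (f ∘ (false ∷_)) i zero (ℕP.suc-injective e)))
    (trans (solve 4 (λ p q w s → p :* κ 0 :+ q :* (κ 1 :* w :* s) := κ 1 :* (q :* w) :* s) refl p (1F - p) ((1F - p) ^^ i) (ΣL (layer N zero) (f ∘ (false ∷_))))
      (cong (1F * (1F - p) ^^ suc i *_) (sym (ΣL-layer₀ N f))))
  E-layer p {suc N} f zero (suc j) refl = trans
    (cong₂ (λ a b → p * a + (1F - p) * b) (E-layer p (f ∘ (true ∷_)) zero j refl)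
       (trans (E-cong p N (λ G → trans (cong (λ b → 𝟙 b * f (false ∷ G)) (small G)) (zeroˡ _))) (E-const p N 0F)))
    (trans (solve 4 (λ p q w s → p :* (w :* κ 1 :* s) :+ q :* κ 0 := p :* w :* κ 1 :* (s :+ κ 0)) refl p (1F - p) (p ^^ j) (ΣL (layer N j) (f ∘ (true ∷_))))
      (cong (p * p ^^ j * 1F *_) (trans (cong (ΣL (layer N j) (f ∘ (true ∷_)) +_) (sym (cong (λ l → ΣL l (f ∘ (false ∷_))) (empty N (suc N) ℕP.≤-refl)))) (sym (ΣL-layer N j f)))))
    where
    small : ∀ G → (∣ G ∣ ℕ.≡ᵇ suc N) ≡ false
    small G with ∣ G ∣ ℕ.≡ᵇ suc N in eq
    ... | false = refl
    ... | true = ⊥-elim (ℕP.<-irrefl (ℕP.≡ᵇ⇒≡ _ _ (subst (λ b → Data.Bool.T b) (sym eq) _)) (s≤s (SubP.∣p∣≤n G)))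
      where import Data.Bool
    empty : ∀ N j → N ℕ.< j → layer N j ≡ []
    empty zero (suc j) h = refl
    empty (suc N) (suc j) (s≤s h) = cong₂ (λ a b → map (true ∷_) a ++ map (false ∷_) b) (empty N j h) (empty N (suc j) (ℕP.m≤n⇒m≤1+n h))
  E-layer p {suc N} f (suc i) (suc j) e = trans
    (cong₂ (λ a b → p * a + (1F - p) * b) (E-layer p (f ∘ (true ∷_)) (suc i) j (ℕP.suc-injective (trans (sym (ℕP.+-suc (suc i) j)) e)))
       (E-layer p (f ∘ (false ∷_)) i (suc j) (ℕP.suc-injective e)))
    (trans (solve 6 (λ p q w v s t → p :* (w :* (q :* v) :* s) :+ q :* (p :* w :* v :* t) := p :* w :* (q :* v) :* (s :+ t)) refl
        p (1F - p) (p ^^ j) ((1F - p) ^^ i) (ΣL (layer N j) (f ∘ (true ∷_))) (ΣL (layer N (suc j)) (f ∘ (false ∷_))))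
      (cong (p * p ^^ j * ((1F - p) * (1F - p) ^^ i) *_) (sym (ΣL-layer N j f))))

  ΣL-pick : ∀ n j c → j ℕ.< n → ΣL (range n) (λ i → 𝟙 (j ℕ.≡ᵇ i) * c) ≡ c
  ΣL-pick (suc n) zero c h = trans (cong₂ _+_ (*-identityˡ c) (trans (ΣL-map suc (range n) _)
    (trans (ΣL-cong (range n) (λ i → zeroˡ c)) (ΣL-0 (range n))))) (+-identityʳ c)
  ΣL-pick (suc n) (suc j) c (s≤s h) = trans (cong₂ _+_ (zeroˡ c) (trans (ΣL-map suc (range n) _) (ΣL-pick n j c h))) (+-identityˡ c)

  layer-weight : F → ℕ → ℕ → F
  layer-weight p N j = p ^^ j * (1F - p) ^^ (N ℕ.∸ j)

  E-layers : ∀ p N (f : Vec Bool N → F) → 𝔼 p N f ≡ ΣL (range (suc N)) (λ j → layer-weight p N j * ΣL (layer N j) f)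
  E-layers p N f = trans (E-cong p N (λ G → sym (ΣL-pick (suc N) ∣ G ∣ (f G) (s≤s (SubP.∣p∣≤n G)))))
    (trans (E-ΣL p N (range (suc N)) (λ j G → 𝟙 (∣ G ∣ ℕ.≡ᵇ j) * f G)) (go (range (suc N)) (λ i∈ → range-< i∈)))
    where
    go : ∀ js → (∀ {j} → j ∈L js → j ℕ.< suc N) → ΣL js (λ j → 𝔼 p N (λ G → 𝟙 (∣ G ∣ ℕ.≡ᵇ j) * f G)) ≡ ΣL js (λ j → layer-weight p N j * ΣL (layer N j) f)
    go [] h = refl
    go (j ∷ js) h = cong₂ _+_ (E-layer p f (N ℕ.∸ j) j (ℕP.m∸n+n≡m (ℕP.≤-pred (h (here refl))))) (go js (λ i → h (there i)))

  0≤layer-weight : ∀ {p} → 0F ≤ p → p ≤ 1F → ∀ N j → 0F ≤ layer-weight p N j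
  0≤layer-weight h h′ N j = 0≤* (0≤^^ h j) (0≤^^ (0≤diff h′) (N ℕ.∸ j))

  -- The expectation is a mixture of layer averages. Keeping only the layers selected by g, whose
  -- averages are at least that of layer m, leaves this average times the probability of g.
  transfer : ∀ p N → 0F ≤ p → p ≤ 1F → ∀ m (f : Vec Bool N → F) (g : ℕ → Bool) →
    (∀ j → 0F ≤ ΣL (layer N j) f) →
    (∀ j → g j ≡ true → ΣL (layer N m) f * binomF N j ≤ ΣL (layer N j) f * binomF N m) →
    ΣL (layer N m) f * 𝔼 p N (λ G → 𝟙 (g ∣ G ∣)) ≤ binomF N m * 𝔼 p N f
  transfer p N 0≤p p≤1 m f g 0≤L dens = ≤-tr
    (≤-rf (trans (cong (l *_) (E-layers p N _)) (sym (ΣL-*ˡ (range (suc N)) l _))))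
    (≤-tr (ΣL-mono (range (suc N)) bound) (≤-rf (trans (ΣL-*ˡ (range (suc N)) (binomF N m) _) (cong (binomF N m *_) (sym (E-layers p N f))))))
    where
    l = ΣL (layer N m) f
    on-layer : ∀ j → ΣL (layer N j) (λ G → 𝟙 (g ∣ G ∣)) ≤ 𝟙 (g j) * binomF N j
    on-layer j = ≤-tr (ΣL-mono∈ (layer N j) (λ G i → ≤-rf (cong (λ z → 𝟙 (g z)) (layer-∈ j i))))
      (≤-rf (trans (ΣL-layer-const N j (𝟙 (g j))) (*-comm _ _)))
    bound′ : ∀ j → l * (𝟙 (g j) * binomF N j) ≤ binomF N m * ΣL (layer N j) f
    bound′ j with g j in eq
    ... | true = ≤-tr (≤-rf (cong (l *_) (*-identityˡ _))) (≤-tr (dens j eq) (≤-rf (*-comm _ _)))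
    ... | false = ≤-tr (≤-rf (trans (cong (l *_) (zeroˡ _)) (zeroʳ l))) (0≤* (0≤binomF N m) (0≤L j))
    bound : ∀ j → l * (layer-weight p N j * ΣL (layer N j) (λ G → 𝟙 (g ∣ G ∣))) ≤ binomF N m * (layer-weight p N j * ΣL (layer N j) f)
    bound j = ≤-tr (≤-rf (solve 3 (λ l w s → l :* (w :* s) := w :* (l :* s)) refl l w _))
      (≤-tr (*-monoˡ w (0≤layer-weight 0≤p p≤1 N j) (≤-tr (*-monoˡ l (0≤L m) (on-layer j)) (bound′ j)))
        (≤-rf (solve 3 (λ l w s → w :* (l :* s) := l :* (w :* s)) refl (binomF N m) w _)))
      where w = layer-weight p N j

  -- The offset t strengthens the induction: fixing the first coordinate shifts it by 1 - p or by
  -- -p.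
  E-variance : ∀ p N t → 𝔼 p N (λ G → (ι ∣ G ∣ - ι N * p + t) * (ι ∣ G ∣ - ι N * p + t)) ≡ ι N * (p * (1F - p)) + t * t
  E-variance p zero t = solve 2 (λ p t → (κ 0 :- κ 0 :* p :+ t) :* (κ 0 :- κ 0 :* p :+ t) := κ 0 :* (p :* (κ 1 :- p)) :+ t :* t) refl p t
  E-variance p (suc N) t = trans (cong₂ (λ a b → p * a + (1F - p) * b)
      (trans (E-cong p N (λ G → cong (λ z → z * z) (trans (cong₂ (λ a b → a - b * p + t) (ι-suc ∣ G ∣) (ι-suc N))
         (solve 4 (λ g n p t → κ 1 :+ g :- (κ 1 :+ n) :* p :+ t := g :- n :* p :+ (t :+ (κ 1 :- p))) refl (ι ∣ G ∣) (ι N) p t)))) (E-variance p N (t + (1F - p))))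
      (trans (E-cong p N (λ G → cong (λ z → z * z) (trans (cong (λ b → ι ∣ G ∣ - b * p + t) (ι-suc N))
         (solve 4 (λ g n p t → g :- (κ 1 :+ n) :* p :+ t := g :- n :* p :+ (t :- p)) refl (ι ∣ G ∣) (ι N) p t)))) (E-variance p N (t - p))))
    (trans (solve 3 (λ n p t → p :* (n :* (p :* (κ 1 :- p)) :+ (t :+ (κ 1 :- p)) :* (t :+ (κ 1 :- p))) :+ (κ 1 :- p) :* (n :* (p :* (κ 1 :- p)) :+ (t :- p) :* (t :- p))
        := (κ 1 :+ n) :* (p :* (κ 1 :- p)) :+ t :* t) refl (ι N) p t)
      (cong (λ z → z * (p * (1F - p)) + t * t) (sym (ι-suc N))))

  -- The size of G has variance at most N ≤ h²/2, so it leaves the window g with probability at most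
  -- one half.
  chebyshev : ∀ p N → 0F ≤ p → p ≤ 1F → ∀ h (g : ℕ → Bool) → 0F < h → ι 2 * ι N ≤ h * h →
    (∀ j → g j ≡ false → h * h ≤ (ι j - ι N * p) * (ι j - ι N * p)) →
    1F ≤ ι 2 * 𝔼 p N (λ G → 𝟙 (g ∣ G ∣))
  chebyshev p N 0≤p p≤1 h g 0<h big far = *-cancelˡ (h * h) (0<* 0<h 0<h) (≤-diff _
      (0≤+ (0≤+ (0≤diff tail) (0≤diff tail)) (0≤+ (0≤diff big) (0≤+ (0≤* (0≤ι N) (0≤diff pq≤1)) (0≤* (0≤ι N) (0≤diff pq≤1)))))
      (solve 4 (λ h e n v → h :* (κ 2 :* e) :- h :* κ 1 := (n :* v :- (h :- h :* e)) :+ (n :* v :- (h :- h :* e)) :+ ((h :- κ 2 :* n) :+ (n :* (κ 1 :- v) :+ n :* (κ 1 :- v)))) refl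
        (h * h) P (ι N) (p * (1F - p))))
    where
    P = 𝔼 p N (λ G → 𝟙 (g ∣ G ∣))
    pq≤1 : p * (1F - p) ≤ 1F
    pq≤1 = *≤1 0≤p p≤1 (1-x≤1 0≤p)
    tail : h * h - h * h * P ≤ ι N * (p * (1F - p))
    tail = subst₂ _≤_
      (trans (E-+ p N _ _) (cong₂ _+_ (E-const p N (h * h)) (trans (E-*ˡ p N (- (h * h)) _)
         (solve 2 (λ h e → (:- h) :* e := :- (h :* e)) refl (h * h) P))))
      (trans (E-variance p N 0F) (solve 1 (λ v → v :+ κ 0 :* κ 0 := v) refl _))
      (E-mono p N 0≤p p≤1 pt)
      where
      pt : ∀ G → h * h + (- (h * h)) * 𝟙 (g ∣ G ∣) ≤ (ι ∣ G ∣ - ι N * p + 0F) * (ι ∣ G ∣ - ι N * p + 0F)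
      pt G with g ∣ G ∣ in eq
      ... | true = ≤-tr (≤-rf (solve 1 (λ h → h :+ (:- h) :* κ 1 := κ 0) refl (h * h))) (0≤sq _)
      ... | false = ≤-tr (≤-rf (solve 1 (λ h → h :+ (:- h) :* κ 0 := h) refl (h * h)))
        (≤-tr (far ∣ G ∣ eq) (≤-rf (solve 1 (λ x → x :* x := (x :+ κ 0) :* (x :+ κ 0)) refl (ι ∣ G ∣ - ι N * p))))

  halve : ∀ {l c e P} → 0F ≤ l → 1F ≤ ι 2 * P → l * P ≤ c * e → l ≤ ι 2 * (c * e)
  halve {l} {c} {e} {P} 0≤l h h′ = ≤-tr (≤*ʳ 0≤l h) (≤-tr (≤-rf (solve 2 (λ l p → l :* (κ 2 :* p) := κ 2 :* (l :* p)) refl l P)) (*-monoˡ (ι 2) 0≤2 h′))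

  -- Layers at or above m have average at least that of layer m, and they carry probability at least
  -- one half; hence the factor 2.
  transfer-increasing : ∀ p N → 0F ≤ p → p ≤ 1F → ∀ m h (f : Vec Bool N → F) → Increasing f → (∀ G → 0F ≤ f G) →
    0F < h → ι 2 * ι N ≤ h * h → ι m + h ≤ ι N * p → ΣL (layer N m) f ≤ ι 2 * (binomF N m * 𝔼 p N f)
  transfer-increasing p N 0≤p p≤1 m h f inc 0≤f 0<h big low = halve (0≤ΣL (layer N m) 0≤f)
    (chebyshev p N 0≤p p≤1 h (λ j → ⌊ m ℕP.≤? j ⌋) 0<h big far)
    (transfer p N 0≤p p≤1 m f (λ j → ⌊ m ℕP.≤? j ⌋) (λ j → 0≤ΣL (layer N j) 0≤f) dens)
    where
    far : ∀ j → ⌊ m ℕP.≤? j ⌋ ≡ false → h * h ≤ (ι j - ι N * p) * (ι j - ι N * p)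
    far j e with m ℕP.≤? j
    ... | no m≰j = ≤-tr (*-mono (<⇒≤ 0<h) h≤ (<⇒≤ 0<h) h≤) (≤-rf (solve 2 (λ a b → (b :- a) :* (b :- a) := (a :- b) :* (a :- b)) refl (ι j) (ι N * p)))
      where
      h≤ : h ≤ ι N * p - ι j
      h≤ = ≤-diff _ (0≤+ (0≤diff low) (0≤diff (ι-mono (ℕP.<⇒≤ (ℕP.≰⇒> m≰j))))) (solve 4 (λ a j m h → a :- j :- h := a :- (m :+ h) :+ (m :- j)) refl (ι N * p) (ι j) (ι m) h)
    dens : ∀ j → ⌊ m ℕP.≤? j ⌋ ≡ true → ΣL (layer N m) f * binomF N j ≤ ΣL (layer N j) f * binomF N m
    dens j e with m ℕP.≤? j
    ... | yes m≤j = subst (λ j → ΣL (layer N m) f * binomF N j ≤ ΣL (layer N j) f * binomF N m) (ℕP.m∸n+n≡m m≤j) (layer-density N f inc 0≤f m (j ℕ.∸ m))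

  -- The mirror image, with `layer-density` applied to 1 - f on the layers at or below m.
  transfer-decreasing : ∀ p N → 0F ≤ p → p ≤ 1F → ∀ m h (f : Vec Bool N → F) → Increasing (λ G → 1F - f G) → (∀ G → 0F ≤ f G) → (∀ G → f G ≤ 1F) →
    0F < h → ι 2 * ι N ≤ h * h → ι N * p + h ≤ ι m → ΣL (layer N m) f ≤ ι 2 * (binomF N m * 𝔼 p N f)
  transfer-decreasing p N 0≤p p≤1 m h f inc 0≤f f≤1 0<h big high = halve (0≤ΣL (layer N m) 0≤f)
    (chebyshev p N 0≤p p≤1 h (λ j → ⌊ j ℕP.≤? m ⌋) 0<h big far)
    (transfer p N 0≤p p≤1 m f (λ j → ⌊ j ℕP.≤? m ⌋) (λ j → 0≤ΣL (layer N j) 0≤f) dens)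
    where
    far : ∀ j → ⌊ j ℕP.≤? m ⌋ ≡ false → h * h ≤ (ι j - ι N * p) * (ι j - ι N * p)
    far j e with j ℕP.≤? m
    ... | no j≰m = *-mono (<⇒≤ 0<h) h≤ (<⇒≤ 0<h) h≤
      where
      h≤ : h ≤ ι j - ι N * p
      h≤ = ≤-diff _ (0≤+ (0≤diff high) (0≤diff (ι-mono (ℕP.<⇒≤ (ℕP.≰⇒> j≰m))))) (solve 4 (λ a j m h → j :- a :- h := m :- (a :+ h) :+ (j :- m)) refl (ι N * p) (ι j) (ι m) h)
    compl : ∀ j → ΣL (layer N j) (λ G → 1F - f G) ≡ binomF N j - ΣL (layer N j) f
    compl j = trans (ΣL-+ (layer N j) (λ _ → 1F) (λ G → - f G))
      (cong₂ _+_ (trans (ΣL-layer-const N j 1F) (*-identityʳ _))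
        (trans (ΣL-cong (layer N j) (λ G → solve 1 (λ x → :- x := (:- κ 1) :* x) refl (f G)))
          (trans (ΣL-*ˡ (layer N j) (- 1F) f) (solve 1 (λ x → (:- κ 1) :* x := :- x) refl _))))
    dens : ∀ j → ⌊ j ℕP.≤? m ⌋ ≡ true → ΣL (layer N m) f * binomF N j ≤ ΣL (layer N j) f * binomF N m
    dens j e with j ℕP.≤? m
    ... | yes j≤m = ≤-diff _ (0≤diff (subst₂ (λ a b → a * binomF N m ≤ b * binomF N j) (compl j) (compl m)
        (subst (λ m → ΣL (layer N j) (λ G → 1F - f G) * binomF N m ≤ ΣL (layer N m) (λ G → 1F - f G) * binomF N j) (ℕP.m∸n+n≡m j≤m)
          (layer-density N (λ G → 1F - f G) inc (λ G → 0≤diff (f≤1 G)) j (m ℕ.∸ j)))))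
      (solve 4 (λ a b x y → x :* b :- y :* a := (b :- y) :* a :- (a :- x) :* b) refl (binomF N j) (binomF N m) (ΣL (layer N j) f) (ΣL (layer N m) f))

-- Domination expressed through the edges from a vertex to a set.

module Domination where

  open import Defs using (pairsL; pairV; Graph; Dominating; incident) renaming (E to numPairs)
  open OrderedField
  open Inequalities
  open FiniteSums
  open RandomSubsets
  open import Data.Nat as ℕ using (ℕ; zero; suc; z≤n; s≤s)
  import Data.Nat.Properties as ℕP
  open import Data.Product using (_×_; _,_; ∃; proj₁; proj₂)
  open import Data.Sum using (_⊎_; inj₁; inj₂)
  open import Data.Empty using (⊥-elim)
  open import Data.List as List using (List; []; _∷_; map; allFin; concatMap; filter)
  import Data.List.Properties as LP
  open import Data.List.Membership.Propositional.Properties using (∈-allFin)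
  open import Data.List.Membership.Propositional using () renaming (_∈_ to _∈L_)
  open import Data.List.Relation.Unary.Any using (here; there)
  open import Data.List.Relation.Unary.All as All using (All; []; _∷_)
  import Data.List.Relation.Unary.All.Properties as AllP
  open import Data.Vec as Vec using (Vec; []; _∷_; lookup)
  import Data.Vec.Properties as VP
  import Data.Vec.Relation.Unary.All as VAll
  open import Data.Fin as Fin using (Fin; zero; suc)
  import Data.Fin.Properties as FP
  open import Data.Fin.Subset using (Subset; ∣_∣; _∩_; _∪_)
  import Data.Fin.Subset.Properties as SubP
  open import Data.Bool using (Bool; true; false; _∧_; _∨_)
  import Data.Bool.Properties as BP
  open import Function using (_∘_; id)
  open import Relation.Binary using (tri<; tri≈; tri>)
  open import Relation.Nullary using (Dec; yes; no; ¬_)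
  open import Relation.Nullary.Decidable using (⌊_⌋; _⊎-dec_)
  open import Relation.Binary.PropositionalEquality

  ΣL-allFin : ∀ n (f : Fin (suc n) → F) → ΣL (allFin (suc n)) f ≡ f zero + ΣL (allFin n) (f ∘ suc)
  ΣL-allFin n f = cong (f zero +_) (trans (cong (λ l → ΣL l f) (sym (LP.map-tabulate id suc))) (ΣL-map suc (allFin n) f))

  ΠL-map : ∀ {A B : Set} (h : A → B) (xs : List A) (f : B → F) → ΠL (map h xs) f ≡ ΠL xs (f ∘ h)
  ΠL-map h [] f = refl
  ΠL-map h (x ∷ xs) f = cong (f (h x) *_) (ΠL-map h xs f)

  ΠL-allFin : ∀ n (f : Fin (suc n) → F) → ΠL (allFin (suc n)) f ≡ f zero * ΠL (allFin n) (f ∘ suc)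
  ΠL-allFin n f = cong (f zero *_) (trans (cong (λ l → ΠL l f) (sym (LP.map-tabulate id suc))) (ΠL-map suc (allFin n) f))

  ΣL-filter : ∀ {A : Set} {P : A → Set} (P? : ∀ x → Dec (P x)) (xs : List A) (f : A → F) →
    ΣL (filter P? xs) f ≡ ΣL xs (λ x → 𝟙 ⌊ P? x ⌋ * f x)
  ΣL-filter P? [] f = refl
  ΣL-filter P? (x ∷ xs) f with P? x
  ... | yes _ = cong₂ _+_ (sym (*-identityˡ (f x))) (ΣL-filter P? xs f)
  ... | no _ = trans (ΣL-filter P? xs f) (trans (sym (+-identityˡ _)) (cong (_+ _) (sym (zeroˡ (f x)))))

  ΣL-concatMap : ∀ {A B : Set} (h : A → List B) (xs : List A) (f : B → F) →
    ΣL (concatMap h xs) f ≡ ΣL xs (λ x → ΣL (h x) f)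
  ΣL-concatMap h [] f = refl
  ΣL-concatMap h (x ∷ xs) f = trans (ΣL-++ (h x) (concatMap h xs) f) (cong (ΣL (h x) f +_) (ΣL-concatMap h xs f))

  _<ᶠ_ : ∀ {n} → Fin n → Fin n → F
  i <ᶠ j = 𝟙 ⌊ i FP.<? j ⌋

  _≈ᶠ_ : ∀ {n} → Fin n → Fin n → F
  i ≈ᶠ j = 𝟙 ⌊ i FP.≟ j ⌋

  ΣL-pairs : ∀ n (f : Fin n × Fin n → F) → ΣL (pairsL n) f ≡ ΣL (allFin n) (λ i → ΣL (allFin n) (λ j → (i <ᶠ j) * f (i , j)))
  ΣL-pairs n f = trans (ΣL-concatMap _ (allFin n) f) (ΣL-cong (allFin n) (λ i →
    trans (ΣL-map (i ,_) (filter (λ j → i FP.<? j) (allFin n)) f) (ΣL-filter (λ j → i FP.<? j) (allFin n) (λ j → f (i , j)))))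

  ≈ᶠ-suc : ∀ {n} (i j : Fin n) → (suc i ≈ᶠ suc j) ≡ (i ≈ᶠ j)
  ≈ᶠ-suc i j with i FP.≟ j
  ... | yes refl = refl
  ... | no _ = refl

  ΣL-≈ : ∀ {n} (v : Fin n) (g : Fin n → F) → ΣL (allFin n) (λ i → (i ≈ᶠ v) * g i) ≡ g v
  ΣL-≈ {suc n} zero g = trans (ΣL-allFin n _) (trans (cong₂ _+_ (*-identityˡ (g zero))
    (trans (ΣL-cong (allFin n) (λ i → zeroˡ (g (suc i)))) (ΣL-0 (allFin n)))) (+-identityʳ _))
  ΣL-≈ {suc n} (suc v) g = trans (ΣL-allFin n _) (trans (cong₂ _+_ (zeroˡ (g zero))
    (trans (ΣL-cong (allFin n) (λ i → cong (_* g (suc i)) (≈ᶠ-suc i v))) (ΣL-≈ v (g ∘ suc)))) (+-identityˡ _))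

  trichotomy : ∀ {n} (i j : Fin n) → (i <ᶠ j) + (j <ᶠ i) + (j ≈ᶠ i) ≡ 1F
  trichotomy i j with i FP.<? j | j FP.<? i | j FP.≟ i
  ... | yes a | yes b | _ = ⊥-elim (FP.<-asym a b)
  ... | yes a | no _ | yes refl = ⊥-elim (FP.<-irrefl refl a)
  ... | yes _ | no _ | no _ = solve 0 (κ 1 :+ κ 0 :+ κ 0 := κ 1) refl
  ... | no _ | yes b | yes refl = ⊥-elim (FP.<-irrefl refl b)
  ... | no _ | yes _ | no _ = solve 0 (κ 0 :+ κ 1 :+ κ 0 := κ 1) refl
  ... | no _ | no _ | yes _ = solve 0 (κ 0 :+ κ 0 :+ κ 1 := κ 1) refl
  ... | no a | no b | no c with FP.<-cmp i j
  ... | tri< x _ _ = ⊥-elim (a x)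
  ... | tri≈ _ x _ = ⊥-elim (c (sym x))
  ... | tri> _ _ x = ⊥-elim (b x)

  ΣL-1 : ∀ n → ΣL (allFin n) (λ _ → 1F) ≡ ι n
  ΣL-1 n = trans (ΣL-const (allFin n) 1F) (trans (*-identityʳ _) (cong ι (LP.length-tabulate {n = n} id)))

  -- Each ordered pair of vertices falls under exactly one case of `trichotomy`; the first two are
  -- equally frequent by symmetry and the third is the diagonal.
  numPairs-eq : ∀ n → ι 2 * ι (numPairs n) + ι n ≡ ι n * ι n
  numPairs-eq n = trans (cong₂ _+_ twice diagonal)
    (trans (cong (_+ ΣL V eq) (sym (ΣL-+ V lt gt))) (trans (sym (ΣL-+ V (λ i → lt i + gt i) eq))
      (trans (ΣL-cong V row) (trans (ΣL-const V (ι n)) (cong (λ z → ι z * ι n) (LP.length-tabulate {n = n} id))))))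
    where
    V = allFin n
    lt gt eq : Fin n → F
    lt i = ΣL V (λ j → i <ᶠ j)
    gt i = ΣL V (λ j → j <ᶠ i)
    eq i = ΣL V (λ j → j ≈ᶠ i)
    count : ι (numPairs n) ≡ ΣL V lt
    count = trans (sym (*-identityʳ _)) (trans (sym (ΣL-const (pairsL n) 1F)) (trans (ΣL-pairs n (λ _ → 1F)) (ΣL-cong V (λ i → ΣL-cong V (λ j → *-identityʳ _)))))
    twice : ι 2 * ι (numPairs n) ≡ ΣL V lt + ΣL V gt
    twice = trans (cong (ι 2 *_) count) (trans (solve 1 (λ s → κ 2 :* s := s :+ s) refl (ΣL V lt)) (cong (ΣL V lt +_) (ΣL-swap V V _<ᶠ_)))
    diagonal : ι n ≡ ΣL V eq
    diagonal = trans (sym (ΣL-1 n)) (ΣL-cong V (λ i → sym (trans (ΣL-cong V (λ j → sym (*-identityʳ _))) (ΣL-≈ i (λ _ → 1F)))))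
    row : ∀ i → lt i + gt i + eq i ≡ ι n
    row i = trans (cong (_+ eq i) (sym (ΣL-+ V (i <ᶠ_) (_<ᶠ i)))) (trans (sym (ΣL-+ V (λ j → (i <ᶠ j) + (j <ᶠ i)) (_≈ᶠ i))) (trans (ΣL-cong V (λ j → trichotomy i j)) (ΣL-1 n)))

  ∣∣-sum : ∀ {n} (S : Subset n) → ΣL (allFin n) (λ v → 𝟙 (lookup S v)) ≡ ι ∣ S ∣
  ∣∣-sum [] = refl
  ∣∣-sum {suc n} (true ∷ S) = trans (ΣL-allFin n _) (trans (cong (1F +_) (∣∣-sum S)) (sym (ι-suc ∣ S ∣)))
  ∣∣-sum {suc n} (false ∷ S) = trans (ΣL-allFin n _) (trans (cong (0F +_) (∣∣-sum S)) (+-identityˡ _))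

  ∣map∣ : ∀ {A : Set} (P : A → Bool) (xs : List A) → ι ∣ Vec.map P (Vec.fromList xs) ∣ ≡ ΣL xs (𝟙 ∘ P)
  ∣map∣ P [] = refl
  ∣map∣ P (x ∷ xs) with P x
  ... | true = trans (ι-suc ∣ Vec.map P (Vec.fromList xs) ∣) (cong (1F +_) (∣map∣ P xs))
  ... | false = trans (∣map∣ P xs) (sym (+-identityˡ _))

  pairs-< : ∀ n (e : Fin (numPairs n)) → proj₁ (lookup (pairV n) e) Fin.< proj₂ (lookup (pairV n) e)
  pairs-< n e = look (fromAll {P = λ p → proj₁ p Fin.< proj₂ p} {pairsL n} (AllP.concat⁺ (AllP.map⁺ (All.universal (λ i →
      AllP.map⁺ (AllP.all-filter (λ j → i FP.<? j) (allFin n))) (allFin n))))) e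
    where
    look : ∀ {A : Set} {P : A → Set} {m} {xs : Vec A m} → VAll.All P xs → ∀ e → P (lookup xs e)
    look (p VAll.∷ ps) zero = p
    look (p VAll.∷ ps) (suc e) = look ps e
    fromAll : ∀ {A : Set} {P : A → Set} {xs : List A} → All P xs → VAll.All P (Vec.fromList xs)
    fromAll [] = VAll.[]
    fromAll (p ∷ ps) = p VAll.∷ fromAll ps

  linkᵇ : ∀ {n} → Fin n → Subset n → Fin n × Fin n → Bool
  linkᵇ v S (i , j) = (⌊ i FP.≟ v ⌋ ∧ lookup S j) ∨ (⌊ j FP.≟ v ⌋ ∧ lookup S i)

  -- The potential edges between v and S. Its intersection with G counts the neighbours of v in S.
  link : ∀ {n} → Fin n → Subset n → Subset (numPairs n)
  link {n} v S = Vec.map (linkᵇ v S) (pairV n)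

  star : ∀ {n} → Fin n → Subset (numPairs n)
  star {n} v = Vec.map (λ e → incident e v) (pairV n)

  ≟-yes : ∀ {n} {i v : Fin n} → ⌊ i FP.≟ v ⌋ ≡ true → i ≡ v
  ≟-yes {i = i} {v} e with i FP.≟ v
  ... | yes p = p

  lookup-link : ∀ {n} v (S : Subset n) e → lookup (link v S) e ≡ linkᵇ v S (lookup (pairV n) e)
  lookup-link {n} v S e = VP.lookup-map e (linkᵇ v S) (pairV n)

  -- Each member of S forms exactly one listed pair with v, in one of the two orders; v ∉ S excludes
  -- the missing pair (v, v).
  ∣link∣ : ∀ {n} v (S : Subset n) → lookup S v ≡ false → ∣ link v S ∣ ≡ ∣ S ∣
  ∣link∣ {n} v S v∉ = ι-injective (trans (∣map∣ (linkᵇ v S) (pairsL n)) (trans (ΣL-pairs n _)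
    (trans (ΣL-cong V (λ i → trans (ΣL-cong V (λ j → trans (cong ((i <ᶠ j) *_) (split i j)) (solve 5 (λ l a b c d → l :* (a :* b :+ c :* d) := a :* (l :* b) :+ c :* (l :* d)) refl (i <ᶠ j) (i ≈ᶠ v) (s j) (j ≈ᶠ v) (s i))))
        (ΣL-+ V _ _)))
     (trans (ΣL-+ V _ _) (trans (cong₂ _+_
        (trans (ΣL-cong V (λ i → ΣL-*ˡ V (i ≈ᶠ v) _)) (ΣL-≈ v (λ i → ΣL V (λ j → (i <ᶠ j) * s j))))
        (ΣL-cong V (λ i → ΣL-≈ v (λ j → (i <ᶠ j) * s i))))
      (trans (sym (ΣL-+ V _ _)) (trans (ΣL-cong V last) (∣∣-sum S))))))))
    where
    V = allFin n
    s : Fin n → F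
    s j = 𝟙 (lookup S j)
    ι-injective : ∀ {a b} → ι a ≡ ι b → a ≡ b
    ι-injective e = ℕP.≤-antisym (ι-cancel-≤ (≤-rf e)) (ι-cancel-≤ (≤-rf (sym e)))
    split : ∀ i j → 𝟙 (linkᵇ v S (i , j)) ≡ (i ≈ᶠ v) * s j + (j ≈ᶠ v) * s i
    split i j with i FP.≟ v | j FP.≟ v
    ... | yes refl | yes refl rewrite v∉ = solve 0 (κ 0 := κ 1 :* κ 0 :+ κ 1 :* κ 0) refl
    ... | yes refl | no _ rewrite BP.∨-identityʳ (lookup S j) = solve 2 (λ a b → a := κ 1 :* a :+ κ 0 :* b) refl (s j) (s i)
    ... | no _ | yes refl = solve 2 (λ a b → a := κ 0 :* b :+ κ 1 :* a) refl (s i) (s j)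
    ... | no _ | no _ = solve 2 (λ a b → κ 0 := κ 0 :* a :+ κ 0 :* b) refl (s j) (s i)
    last : ∀ j → (v <ᶠ j) * s j + (j <ᶠ v) * s j ≡ s j
    last j with j FP.≟ v | trichotomy v j
    ... | yes refl | _ rewrite v∉ = solve 2 (λ a b → a :* κ 0 :+ b :* κ 0 := κ 0) refl _ _
    ... | no _ | t = trans (solve 3 (λ a b s → a :* s :+ b :* s := (a :+ b :+ κ 0) :* s) refl _ _ (s j)) (trans (cong (_* s j) t) (*-identityˡ (s j)))

  ∨-case : ∀ {a b} → a ∨ b ≡ true → a ≡ true ⊎ b ≡ true
  ∨-case {true} e = inj₁ refl
  ∨-case {false} e = inj₂ e

  ∧-both : ∀ {a b} → a ∧ b ≡ true → a ≡ true × b ≡ true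
  ∧-both {true} {true} e = refl , refl

  linkᵇ-ends : ∀ {n} {v : Fin n} {S} (e : Fin n × Fin n) → linkᵇ v S e ≡ true →
    (proj₁ e ≡ v × lookup S (proj₂ e) ≡ true) ⊎ (proj₂ e ≡ v × lookup S (proj₁ e) ≡ true)
  linkᵇ-ends e h with ∨-case h
  ... | inj₁ a = let x , y = ∧-both a in inj₁ (≟-yes x , y)
  ... | inj₂ a = let x , y = ∧-both a in inj₂ (≟-yes x , y)

  link-ends : ∀ {n} {v : Fin n} {S} e → lookup (link v S) e ≡ true → let i , j = lookup (pairV n) e in
    (i ≡ v × lookup S j ≡ true) ⊎ (j ≡ v × lookup S i ≡ true)
  link-ends {n} {v} {S} e h = linkᵇ-ends {S = S} (lookup (pairV n) e) (trans (sym (lookup-link v S e)) h)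

  -- A common edge would have one end v and one end w, and its other end in S; with v and w outside
  -- S this forces v = w. It is the reason why vertices outside a set are dominated independently.
  link-disjoint : ∀ {n} {v w : Fin n} {S} e → lookup S v ≡ false → lookup S w ≡ false →
    lookup (link v S) e ≡ true → lookup (link w S) e ≡ true → v ≡ w
  link-disjoint {n} {v} {w} {S} e v∉ w∉ a b with link-ends {n} {v} {S} e a | link-ends {n} {w} {S} e b
  ... | inj₁ (p , _) | inj₁ (q , _) = trans (sym p) q
  ... | inj₂ (p , _) | inj₂ (q , _) = trans (sym p) q
  ... | inj₁ (p , _) | inj₂ (_ , s) = ⊥-elim (BP.not-¬ {false} (trans (sym v∉) (trans (cong (lookup S) (sym p)) s)) refl)
  ... | inj₂ (p , _) | inj₁ (_ , s) = ⊥-elim (BP.not-¬ {false} (trans (sym v∉) (trans (cong (lookup S) (sym p)) s)) refl)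

  link-∪ : ∀ {n} v (S S′ : Subset n) → link v S ∪ link v S′ ≡ link v (S ∪ S′)
  link-∪ {n} v S S′ = go (pairV n)
    where
    go : ∀ {m} (ps : Vec (Fin n × Fin n) m) → Vec.map (linkᵇ v S) ps ∪ Vec.map (linkᵇ v S′) ps ≡ Vec.map (linkᵇ v (S ∪ S′)) ps
    go [] = refl
    go ((i , j) ∷ ps) = cong₂ _∷_ (trans (bool ⌊ i FP.≟ v ⌋ ⌊ j FP.≟ v ⌋ _ _ _ _)
      (sym (cong₂ (λ x y → (⌊ i FP.≟ v ⌋ ∧ x) ∨ (⌊ j FP.≟ v ⌋ ∧ y)) (VP.lookup-zipWith _∨_ j S S′) (VP.lookup-zipWith _∨_ i S S′)))) (go ps)
      where
      bool : ∀ a b x y x′ y′ → ((a ∧ x) ∨ (b ∧ y)) ∨ ((a ∧ x′) ∨ (b ∧ y′)) ≡ (a ∧ (x ∨ x′)) ∨ (b ∧ (y ∨ y′))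
      bool false false _ _ _ _ = refl
      bool false true _ _ _ _ = refl
      bool true false x _ x′ _ rewrite BP.∨-identityʳ x | BP.∨-identityʳ x′ | BP.∨-identityʳ (x ∨ x′) = refl
      bool true true false false x′ y′ = refl
      bool true true true y x′ y′ = refl
      bool true true false true true y′ = refl
      bool true true false true false y′ = refl

  link-∩ : ∀ {n} v (S S′ : Subset n) → lookup S v ≡ false → lookup S′ v ≡ false → link v S ∩ link v S′ ≡ link v (S ∩ S′)
  link-∩ {n} v S S′ v∉ v∉′ = go (pairV n)
    where
    go : ∀ {m} (ps : Vec (Fin n × Fin n) m) → Vec.map (linkᵇ v S) ps ∩ Vec.map (linkᵇ v S′) ps ≡ Vec.map (linkᵇ v (S ∩ S′)) ps
    go [] = refl
    go ((i , j) ∷ ps) = cong₂ _∷_ (trans here′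
      (sym (cong₂ (λ x y → (⌊ i FP.≟ v ⌋ ∧ x) ∨ (⌊ j FP.≟ v ⌋ ∧ y)) (VP.lookup-zipWith _∧_ j S S′) (VP.lookup-zipWith _∧_ i S S′)))) (go ps)
      where
      here′ : linkᵇ v S (i , j) ∧ linkᵇ v S′ (i , j) ≡ (⌊ i FP.≟ v ⌋ ∧ (lookup S j ∧ lookup S′ j)) ∨ (⌊ j FP.≟ v ⌋ ∧ (lookup S i ∧ lookup S′ i))
      here′ with i FP.≟ v | j FP.≟ v
      ... | yes refl | yes refl rewrite v∉ = refl
      ... | yes refl | no _ rewrite BP.∨-identityʳ (lookup S j) | BP.∨-identityʳ (lookup S′ j) | BP.∨-identityʳ (lookup S j ∧ lookup S′ j) = refl
      ... | no _ | yes _ = refl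
      ... | no _ | no _ = refl

  link⊆star : ∀ {n} v (S : Subset n) → link v S ∩ star v ≡ link v S
  link⊆star {n} v S = go (pairV n)
    where
    go : ∀ {m} (ps : Vec (Fin n × Fin n) m) → Vec.map (linkᵇ v S) ps ∩ Vec.map (λ e → incident e v) ps ≡ Vec.map (linkᵇ v S) ps
    go [] = refl
    go ((i , j) ∷ ps) = cong₂ _∷_ (bool ⌊ i FP.≟ v ⌋ ⌊ j FP.≟ v ⌋ (lookup S j) (lookup S i)) (go ps)
      where
      bool : ∀ a b x y → ((a ∧ x) ∨ (b ∧ y)) ∧ (a ∨ b) ≡ (a ∧ x) ∨ (b ∧ y)
      bool true b x y = BP.∧-identityʳ _
      bool false true x y = BP.∧-identityʳ _
      bool false false x y = refl

  ∣∩∣-sum : ∀ {n} (S T : Subset n) → ι ∣ S ∩ T ∣ ≡ ΣL (allFin n) (λ e → 𝟙 (lookup S e) * 𝟙 (lookup T e))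
  ∣∩∣-sum {n} S T = trans (sym (∣∣-sum (S ∩ T))) (ΣL-cong (allFin n) (λ e → trans (cong 𝟙 (VP.lookup-zipWith _∧_ e S T)) (𝟙-∧ (lookup S e) (lookup T e))))
    where
    𝟙-∧ : ∀ a b → 𝟙 (a ∧ b) ≡ 𝟙 a * 𝟙 b
    𝟙-∧ true b = sym (*-identityˡ _)
    𝟙-∧ false b = sym (zeroˡ _)

  nonempty⇒∃ : ∀ {N} (S : Subset N) → 1 ℕ.≤ ∣ S ∣ → ∃ λ e → lookup S e ≡ true
  nonempty⇒∃ (true ∷ S) h = zero , refl
  nonempty⇒∃ (false ∷ S) h = let e , p = nonempty⇒∃ S h in suc e , p

  ∃⇒nonempty : ∀ {N} (S : Subset N) e → lookup S e ≡ true → 1 ℕ.≤ ∣ S ∣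
  ∃⇒nonempty (true ∷ S) e p = s≤s z≤n
  ∃⇒nonempty (false ∷ S) (suc e) p = ∃⇒nonempty S e p

  -- Decidable counterpart of domination at a single vertex, phrased by counting so that it matches
  -- `domFactor`.
  Covers : ∀ {n} → Graph n → Subset n → Fin n → Set
  Covers G D v = lookup D v ≡ true ⊎ 1 ℕ.≤ ∣ G ∩ link v D ∣

  covers? : ∀ {n} (G : Graph n) (D : Subset n) v → Dec (Covers G D v)
  covers? G D v = (lookup D v BP.≟ true) ⊎-dec (1 ℕP.≤? ∣ G ∩ link v D ∣)

  covers⇒dominating : ∀ {n} (G : Graph n) (D : Subset n) → (∀ v → Covers G D v) → Dominating {n} G D
  covers⇒dominating {n} G D h v with h v
  ... | inj₁ v∈ = inj₁ (VP.lookup⇒[]= v D v∈)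
  ... | inj₂ ne with nonempty⇒∃ (G ∩ link v D) ne
  ... | e , p with ∧-both (trans (sym (VP.lookup-zipWith _∧_ e G (link v D))) p)
  ... | e∈G , e∈l with link-ends {n} {v} {D} e e∈l
  ... | inj₁ (p , u∈) = inj₂ (_ , VP.lookup⇒[]= _ D u∈ , e , VP.lookup⇒[]= e G e∈G , inj₂ (cong (_, _) p))
  ... | inj₂ (p , u∈) = inj₂ (_ , VP.lookup⇒[]= _ D u∈ , e , VP.lookup⇒[]= e G e∈G , inj₁ (cong (_ ,_) p))

  ≟-refl : ∀ {n} (v : Fin n) → ⌊ v FP.≟ v ⌋ ≡ true
  ≟-refl v with v FP.≟ v
  ... | yes _ = refl
  ... | no n = ⊥-elim (n refl)

  dominating⇒covers : ∀ {n} (G : Graph n) (D : Subset n) → Dominating {n} G D → ∀ v → Covers G D v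
  dominating⇒covers {n} G D h v with h v
  ... | inj₁ v∈ = inj₁ (VP.[]=⇒lookup v∈)
  ... | inj₂ (u , u∈ , e , e∈ , end) = inj₂ (∃⇒nonempty (G ∩ link v D) e
      (trans (VP.lookup-zipWith _∧_ e G (link v D)) (cong₂ _∧_ (VP.[]=⇒lookup e∈) (trans (lookup-link v D e) (is-link end)))))
    where
    u∈′ = VP.[]=⇒lookup u∈
    is-link : lookup (pairV n) e ≡ (u , v) ⊎ lookup (pairV n) e ≡ (v , u) → linkᵇ v D (lookup (pairV n) e) ≡ true
    is-link (inj₁ eq) rewrite eq | ≟-refl v | u∈′ = BP.∨-zeroʳ _
    is-link (inj₂ eq) rewrite eq | ≟-refl v | u∈′ = refl

  dominating? : ∀ {n} (G : Graph n) (D : Subset n) → Dec (Dominating {n} G D)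
  dominating? {n} G D with FP.all? (covers? G D)
  ... | yes c = yes (covers⇒dominating G D c)
  ... | no ¬c = no (λ d → ¬c (dominating⇒covers G D d))

  -- Vertices of the set itself get the trivial factor, so that products can range over all
  -- vertices.
  ifOut : Bool → F → F
  ifOut true z = 1F
  ifOut false z = z

  -- 1 − 0^m is the indicator of m > 0, so domQ D is the indicator that D is dominating.
  domFactor : ∀ {n} → Subset n → Fin n → Graph n → F
  domFactor D v G = ifOut (lookup D v) (1F - 0F ^^ ∣ G ∩ link v D ∣)

  domQ : ∀ {n} → Subset n → Graph n → F
  domQ {n} D G = ΠL (allFin n) (λ v → domFactor D v G)

  0≤1-0^ : ∀ m → 0F ≤ 1F - 0F ^^ m
  0≤1-0^ zero = ≤-rf (solve 0 (κ 0 := κ 1 :- κ 1) refl)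
  0≤1-0^ (suc m) = ≤-tr 0≤1 (≤-rf (solve 1 (λ x → κ 1 := κ 1 :- κ 0 :* x) refl (0F ^^ m)))

  1-0^≤1 : ∀ m → 1F - 0F ^^ m ≤ 1F
  1-0^≤1 m = 1-x≤1 (0≤^^ ≤-refl m)

  0≤domFactor : ∀ {n} (D : Subset n) v (G : Graph n) → 0F ≤ domFactor D v G
  0≤domFactor D v G with lookup D v
  ... | true = 0≤1
  ... | false = 0≤1-0^ ∣ G ∩ link v D ∣

  domFactor≤1 : ∀ {n} (D : Subset n) v (G : Graph n) → domFactor D v G ≤ 1F
  domFactor≤1 D v G with lookup D v
  ... | true = ≤-refl
  ... | false = 1-0^≤1 ∣ G ∩ link v D ∣

  0≤domQ : ∀ {n} (D : Subset n) (G : Graph n) → 0F ≤ domQ D G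
  0≤domQ {n} D G = 0≤ΠL (allFin n) (λ v → 0≤domFactor D v G)

  domFactor-covers : ∀ {n} (D : Subset n) v (G : Graph n) → Covers G D v → domFactor D v G ≡ 1F
  domFactor-covers D v G c with lookup D v | c
  ... | true | _ = refl
  ... | false | inj₂ c′ with ∣ G ∩ link v D ∣ | c′
  ... | zero | ()
  ... | suc m | _ = solve 1 (λ x → κ 1 :- κ 0 :* x := κ 1) refl (0F ^^ m)

  domFactor-¬covers : ∀ {n} (D : Subset n) v (G : Graph n) → ¬ Covers G D v → domFactor D v G ≡ 0F
  domFactor-¬covers D v G c with lookup D v | c
  ... | true | c′ = ⊥-elim (c′ (inj₁ refl))
  ... | false | c′ with ∣ G ∩ link v D ∣ | c′
  ... | zero | _ = solve 0 (κ 1 :- κ 1 := κ 0) refl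
  ... | suc m | c″ = ⊥-elim (c″ (inj₂ (s≤s z≤n)))

  domQ-dominating : ∀ {n} (G : Graph n) (D : Subset n) → Dominating {n} G D → domQ D G ≡ 1F
  domQ-dominating {n} G D d = trans (ΠL-cong (allFin n) (λ v → domFactor-covers D v G (dominating⇒covers G D d v))) (all1 (allFin n))
    where
    all1 : ∀ (xs : List (Fin n)) → ΠL xs (λ _ → 1F) ≡ 1F
    all1 [] = refl
    all1 (x ∷ xs) = trans (*-identityˡ _) (all1 xs)

  ΠL-0 : ∀ {A : Set} {xs : List A} {f : A → F} {x} → x ∈L xs → f x ≡ 0F → ΠL xs f ≡ 0F
  ΠL-0 {xs = x ∷ xs} {f} (here refl) e = trans (cong (_* ΠL xs f) e) (zeroˡ _)
  ΠL-0 {xs = x ∷ xs} {f} (there i) e = trans (cong (f x *_) (ΠL-0 i e)) (zeroʳ _)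

  domQ-¬dominating : ∀ {n} (G : Graph n) (D : Subset n) → ¬ Dominating {n} G D → domQ D G ≡ 0F
  domQ-¬dominating {n} G D nd with FP.¬∀⟶∃¬ n (Covers G D) (covers? G D) (λ c → nd (covers⇒dominating G D c))
  ... | v , nc = ΠL-0 (∈-allFin v) (domFactor-¬covers D v G nc)

  Dep-∩ : ∀ {N} (T : Subset N) (h : ℕ → F) → Dep (λ G → h ∣ G ∩ T ∣) (lookup T)
  Dep-∩ T h G G′ a = cong h (go T G G′ a)
    where
    go : ∀ {N} (T G G′ : Subset N) → (∀ e → lookup T e ≡ true → lookup G e ≡ lookup G′ e) → ∣ G ∩ T ∣ ≡ ∣ G′ ∩ T ∣
    go [] [] [] a = refl
    go (false ∷ T) (g ∷ G) (g′ ∷ G′) a rewrite BP.∧-zeroʳ g | BP.∧-zeroʳ g′ = go T G G′ (λ e → a (suc e))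
    go (true ∷ T) (g ∷ G) (g′ ∷ G′) a rewrite a zero refl with g′ ∧ true
    ... | true = cong suc (go T G G′ (λ e → a (suc e)))
    ... | false = go T G G′ (λ e → a (suc e))

  ∣∪∣+∣∩∣ : ∀ {n} (D D′ : Subset n) → ∣ D ∪ D′ ∣ ℕ.+ ∣ D ∩ D′ ∣ ≡ ∣ D ∣ ℕ.+ ∣ D′ ∣
  ∣∪∣+∣∩∣ [] [] = refl
  ∣∪∣+∣∩∣ (true ∷ D) (true ∷ D′) = cong suc (trans (ℕP.+-suc _ _) (trans (cong suc (∣∪∣+∣∩∣ D D′)) (sym (ℕP.+-suc _ _))))
  ∣∪∣+∣∩∣ (true ∷ D) (false ∷ D′) = cong suc (∣∪∣+∣∩∣ D D′)
  ∣∪∣+∣∩∣ (false ∷ D) (true ∷ D′) = trans (cong suc (∣∪∣+∣∩∣ D D′)) (sym (ℕP.+-suc _ _))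
  ∣∪∣+∣∩∣ (false ∷ D) (false ∷ D′) = ∣∪∣+∣∩∣ D D′

  ΠL-ifOut : ∀ {n} (S : Subset n) c → ΠL (allFin n) (λ v → ifOut (lookup S v) c) ≡ c ^^ (n ℕ.∸ ∣ S ∣)
  ΠL-ifOut [] c = refl
  ΠL-ifOut {suc n} (true ∷ S) c = trans (ΠL-allFin n _) (trans (*-identityˡ _) (ΠL-ifOut S c))
  ΠL-ifOut {suc n} (false ∷ S) c = trans (ΠL-allFin n _) (trans (cong (c *_) (ΠL-ifOut S c)) (cong (c ^^_) (sym (ℕP.+-∸-assoc 1 (SubP.∣p∣≤n S)))))

-- First and second moments of the number of dominating sets.

module Moments where

  open import Defs using (Graph) renaming (E to numPairs)
  open OrderedField
  open Inequalities
  open FiniteSums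
  open RandomSubsets
  open Domination
  open import Data.Nat as ℕ using (ℕ; suc)
  import Data.Nat.Properties as ℕP
  open import Data.Product using (_×_; _,_; proj₁; proj₂)
  open import Data.Sum using (_⊎_; inj₁; inj₂)
  open import Data.List as List using (List; allFin)
  import Data.List.Properties as LP
  open import Data.List.Membership.Propositional using () renaming (_∈_ to _∈L_)
  open import Data.List.Relation.Unary.All as All using (All)
  open import Data.List.Relation.Unary.Unique.Propositional.Properties using (allFin⁺)
  open import Data.Vec as Vec using (Vec; lookup)
  import Data.Vec.Properties as VP
  open import Data.Fin as Fin using (Fin; suc)
  open import Data.Fin.Subset using (Subset; ∣_∣; _∩_; _∪_; ⁅_⁆)
  import Data.Fin.Subset.Properties as SubP
  open import Data.Bool using (Bool; true; false; not; _∧_; _∨_)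
  open import Function using (_∘_; id)
  open import Relation.Binary.PropositionalEquality

  E-1- : ∀ p N (f : Vec Bool N → F) → 𝔼 p N (λ G → 1F - f G) ≡ 1F - 𝔼 p N f
  E-1- p N f = trans (E-+ p N (λ _ → 1F) (λ G → - f G)) (cong₂ _+_ (E-const p N 1F)
    (trans (E-cong p N (λ G → solve 1 (λ x → :- x := (:- κ 1) :* x) refl (f G))) (trans (E-*ˡ p N (- 1F) f) (solve 1 (λ x → (:- κ 1) :* x := :- x) refl _))))

  bool-clash : ∀ {b} {X : Set} → b ≡ true → b ≡ false → X
  bool-clash refl ()

  -- The edges on which the factor of v depends: none if v lies in S. This is what makes the family
  -- pairwise disjoint, as `E-ΠL` requires.
  outᵇ : ∀ {n} → Subset n → (Fin n → Subset (numPairs n)) → Fin n → Fin (numPairs n) → Bool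
  outᵇ S T v e = not (lookup S v) ∧ lookup (T v) e

  outᵇ-true : ∀ {n} {S : Subset n} {T v e} → outᵇ S T v e ≡ true → lookup S v ≡ false × lookup (T v) e ≡ true
  outᵇ-true {S = S} {v = v} h with lookup S v
  ... | false = refl , h

  Dep-ifOut : ∀ {n} (S : Subset n) T v (f : Graph n → F) → Dep f (lookup (T v)) → Dep (λ G → ifOut (lookup S v) (f G)) (outᵇ S T v)
  Dep-ifOut S T v f d with lookup S v
  ... | true = λ _ _ _ → refl
  ... | false = d

  E-ifOut : ∀ {n} p b (f : Graph n → F) c → (b ≡ false → 𝔼 p (numPairs n) f ≡ c) → 𝔼 p (numPairs n) (λ G → ifOut b (f G)) ≡ ifOut b c
  E-ifOut {n} p true f c h = E-const p (numPairs n) 1F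
  E-ifOut p false f c h = h refl

  -- The n - k outside vertices are dominated independently, each failing with probability (1 -
  -- p)^k.
  E-domQ : ∀ p {n k} (D : Subset n) → ∣ D ∣ ≡ k → 𝔼 p (numPairs n) (domQ D) ≡ (1F - (1F - p) ^^ k) ^^ (n ℕ.∸ k)
  E-domQ p {n} D refl = trans (E-ΠL p _ (allFin n) (domFactor D) (outᵇ D (λ v → link v D)) (allFin⁺ n)
      (λ v → Dep-ifOut D (λ v → link v D) v _ (Dep-∩ (link v D) (λ m → 1F - 0F ^^ m)))
      (λ v w e a b → let v∉ , a′ = outᵇ-true {S = D} {λ v → link v D} {v} {e} a ; w∉ , b′ = outᵇ-true {S = D} {λ v → link v D} {w} {e} b in link-disjoint {S = D} e v∉ w∉ a′ b′))
    (trans (ΠL-cong (allFin n) (λ v → E-ifOut {n} p (lookup D v) _ (1F - (1F - p) ^^ ∣ D ∣) (λ v∉ →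
        trans (E-1- p (numPairs n) (λ G → 0F ^^ ∣ G ∩ link v D ∣)) (cong (λ z → 1F - z) (trans (E-0pow p (link v D)) (cong ((1F - p) ^^_) (∣link∣ v D v∉)))))))
      (ΠL-ifOut D _))

  pairFactor : ∀ {n} → Subset n → Subset n → Fin n → Graph n → F
  pairFactor D D′ v G = (1F - 0F ^^ ∣ G ∩ link v D ∣) * (1F - 0F ^^ ∣ G ∩ link v D′ ∣)

  -- Inclusion-exclusion for a vertex outside D ∪ D′ to have neighbours in both sets, where r is the
  -- size of the overlap.
  pairProb : F → ℕ → ℕ → F
  pairProb p k r = 1F - ι 2 * (1F - p) ^^ k + (1F - p) ^^ (2 ℕ.* k ℕ.∸ r)

  lookup-∪ : ∀ {n} (D D′ : Subset n) v → lookup (D ∪ D′) v ≡ lookup D v ∨ lookup D′ v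
  lookup-∪ D D′ v = VP.lookup-zipWith _∨_ v D D′

  ∨-false : ∀ {a b} → a ∨ b ≡ false → a ≡ false × b ≡ false
  ∨-false {false} {false} e = refl , refl

  ∉∪ : ∀ {n} (D D′ : Subset n) v → lookup (D ∪ D′) v ≡ false → lookup D v ≡ false × lookup D′ v ≡ false
  ∉∪ D D′ v e = ∨-false (trans (sym (lookup-∪ D D′ v)) e)

  ∣∪∣ : ∀ {n k} (D D′ : Subset n) → ∣ D ∣ ≡ k → ∣ D′ ∣ ≡ k → ∣ D ∪ D′ ∣ ≡ 2 ℕ.* k ℕ.∸ ∣ D ∩ D′ ∣
  ∣∪∣ {k = k} D D′ d d′ = trans (sym (ℕP.m+n∸n≡m ∣ D ∪ D′ ∣ ∣ D ∩ D′ ∣))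
    (cong (ℕ._∸ ∣ D ∩ D′ ∣) (trans (∣∪∣+∣∩∣ D D′) (cong₂ ℕ._+_ d (trans d′ (sym (ℕP.+-identityʳ k))))))

  link⊆link-∪ : ∀ {n} v (D D′ : Subset n) e → lookup (link v D) e ≡ true ⊎ lookup (link v D′) e ≡ true → lookup (link v (D ∪ D′)) e ≡ true
  link⊆link-∪ v D D′ e h = trans (cong (λ z → lookup z e) (sym (link-∪ v D D′))) (trans (VP.lookup-zipWith _∨_ e (link v D) (link v D′)) (go h))
    where
    go : ∀ {a b} → a ≡ true ⊎ b ≡ true → a ∨ b ≡ true
    go (inj₁ refl) = refl
    go {true} (inj₂ refl) = refl
    go {false} (inj₂ refl) = refl

  Dep-pairFactor : ∀ {n} (D D′ : Subset n) v → Dep (pairFactor D D′ v) (lookup (link v (D ∪ D′)))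
  Dep-pairFactor D D′ v G G′ h = cong₂ _*_
    (Dep-∩ (link v D) (λ m → 1F - 0F ^^ m) G G′ (λ e t → h e (link⊆link-∪ v D D′ e (inj₁ t))))
    (Dep-∩ (link v D′) (λ m → 1F - 0F ^^ m) G G′ (λ e t → h e (link⊆link-∪ v D D′ e (inj₂ t))))

  E-pairFactor : ∀ p {n k} (D D′ : Subset n) v → ∣ D ∣ ≡ k → ∣ D′ ∣ ≡ k → lookup (D ∪ D′) v ≡ false →
    𝔼 p (numPairs n) (pairFactor D D′ v) ≡ pairProb p k ∣ D ∩ D′ ∣
  E-pairFactor p {n} {k} D D′ v d d′ v∉ = trans
    (E-cong p N (λ G → solve 2 (λ a b → (κ 1 :- a) :* (κ 1 :- b) := κ 1 :+ ((:- κ 1) :* a :+ ((:- κ 1) :* b :+ a :* b))) refl (z D G) (z D′ G)))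
    (trans (E-+ p N _ _) (trans (cong₂ _+_ (E-const p N 1F) (trans (E-+ p N _ _) (cong₂ _+_ (trans (E-*ˡ p N (- 1F) (z D)) (cong (- 1F *_) (e0 D (proj₁ out) d)))
        (trans (E-+ p N _ _) (cong₂ _+_ (trans (E-*ˡ p N (- 1F) (z D′)) (cong (- 1F *_) (e0 D′ (proj₂ out) d′)))
          (trans (E-0pow₂ p (link v D) (link v D′)) (cong ((1F - p) ^^_) (trans (cong ∣_∣ (link-∪ v D D′)) (trans (∣link∣ v (D ∪ D′) v∉) (∣∪∣ D D′ d d′))))))))))
     (solve 2 (λ q w → κ 1 :+ ((:- κ 1) :* q :+ ((:- κ 1) :* q :+ w)) := κ 1 :- κ 2 :* q :+ w) refl ((1F - p) ^^ k) ((1F - p) ^^ (2 ℕ.* k ℕ.∸ ∣ D ∩ D′ ∣)))))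
    where
    N = numPairs n
    z : Subset n → Graph n → F
    z D G = 0F ^^ ∣ G ∩ link v D ∣
    out = ∉∪ D D′ v v∉
    e0 : ∀ D → lookup D v ≡ false → ∣ D ∣ ≡ k → 𝔼 p N (z D) ≡ (1F - p) ^^ k
    e0 D o d = trans (E-0pow p (link v D)) (cong ((1F - p) ^^_) (trans (∣link∣ v D o) d))

  pairProduct : ∀ {n} → Subset n → Subset n → Subset n → Graph n → F
  pairProduct {n} U D D′ G = ΠL (allFin n) (λ v → ifOut (lookup U v) (pairFactor D D′ v G))

  -- The set U of ignored vertices may exceed D ∪ D′, so that `E-common` can set a further vertex
  -- aside.
  E-pairs : ∀ p {n k} (U D D′ : Subset n) → ∣ D ∣ ≡ k → ∣ D′ ∣ ≡ k → (∀ v → lookup U v ≡ false → lookup (D ∪ D′) v ≡ false) →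
    𝔼 p (numPairs n) (pairProduct U D D′) ≡ pairProb p k ∣ D ∩ D′ ∣ ^^ (n ℕ.∸ ∣ U ∣)
  E-pairs p {n} U D D′ d d′ sub = trans (E-ΠL p _ (allFin n) (λ v G → ifOut (lookup U v) (pairFactor D D′ v G)) (outᵇ U T) (allFin⁺ n)
      (λ v → Dep-ifOut U T v _ (Dep-pairFactor D D′ v))
      (λ v w e a b → let v∉ , a′ = outᵇ-true {S = U} {T} {v} {e} a ; w∉ , b′ = outᵇ-true {S = U} {T} {w} {e} b in link-disjoint {S = D ∪ D′} e (sub v v∉) (sub w w∉) a′ b′))
    (trans (ΠL-cong (allFin n) (λ v → E-ifOut {n} p (lookup U v) _ _ (λ v∉ → E-pairFactor p D D′ v d d′ (sub v v∉)))) (ΠL-ifOut U _))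
    where
    T : Fin n → Subset (numPairs n)
    T v = link v (D ∪ D′)

  domQ-pair≤ : ∀ {n} (U D D′ : Subset n) (G : Graph n) → (∀ v → lookup U v ≡ false → lookup (D ∪ D′) v ≡ false) →
    domQ D G * domQ D′ G ≤ pairProduct U D D′ G
  domQ-pair≤ {n} U D D′ G sub = ≤-tr (≤-rf (ΠL-* (allFin n) (λ v → domFactor D v G) (λ v → domFactor D′ v G)))
    (ΠL-mono (allFin n) (λ v → 0≤* (0≤domFactor D v G) (0≤domFactor D′ v G)) each)
    where
    each : ∀ v → domFactor D v G * domFactor D′ v G ≤ ifOut (lookup U v) (pairFactor D D′ v G)
    each v with lookup U v in eq
    ... | true = *≤1 (0≤domFactor D v G) (domFactor≤1 D v G) (domFactor≤1 D′ v G)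
    ... | false with ∉∪ D D′ v (sub v eq)
    ... | a , b rewrite a | b = ≤-refl

  0≤pairProb : ∀ {p} → 0F ≤ p → p ≤ 1F → ∀ k r → 0F ≤ pairProb p k r
  0≤pairProb {p} h h′ k r = ≤-tr (0≤sq (1F - q)) (≤-diff _ (0≤diff (≤-tr (≤-rf (trans (sym (^^-+ ρ k k)) (cong (λ z → ρ ^^ (k ℕ.+ z)) (sym (ℕP.+-identityʳ k))))) (^^-anti (0≤diff h′) (1-x≤1 h) (ℕP.m∸n≤m (2 ℕ.* k) r))))
    (solve 2 (λ q w → (κ 1 :- κ 2 :* q :+ w) :- (κ 1 :- q) :* (κ 1 :- q) := w :- q :* q) refl q (ρ ^^ (2 ℕ.* k ℕ.∸ r))))
    where
    ρ = 1F - p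
    q = ρ ^^ k

  pairProb≤1 : ∀ {p} → 0F ≤ p → p ≤ 1F → ∀ k r → r ℕ.≤ k → pairProb p k r ≤ 1F
  pairProb≤1 {p} h h′ k r r≤k = ≤-diff _ (0≤+ (0≤^^ (0≤diff h′) k) (0≤diff (^^-anti (0≤diff h′) (1-x≤1 h) k≤)))
    (solve 2 (λ q w → κ 1 :- (κ 1 :- κ 2 :* q :+ w) := q :+ (q :- w)) refl (ρ ^^ k) (ρ ^^ (2 ℕ.* k ℕ.∸ r)))
    where
    ρ = 1F - p
    k≤ : k ℕ.≤ 2 ℕ.* k ℕ.∸ r
    k≤ = ℕP.≤-trans (ℕP.≤-reflexive (sym (trans (ℕP.m+n∸m≡n k (k ℕ.+ 0)) (ℕP.+-identityʳ k)))) (ℕP.∸-monoʳ-≤ (2 ℕ.* k) r≤k)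

  -- The exponent is a uniform lower bound for the number of vertices outside D ∪ D′ and one
  -- distinguished vertex. As `pairProb` is at most 1 for r ≤ k, the same weight serves with and
  -- without that vertex.
  overlapWeight : F → ℕ → ℕ → ℕ → F
  overlapWeight p n k r = pairProb p k r ^^ (n ℕ.∸ (2 ℕ.* k ℕ.+ 1))

  ∣∩∣≤ : ∀ {n k} (D D′ : Subset n) → ∣ D ∣ ≡ k → ∣ D ∩ D′ ∣ ℕ.≤ k
  ∣∩∣≤ D D′ refl = SubP.∣p∩q∣≤∣p∣ D D′

  E-domQ-pair : ∀ {p} → 0F ≤ p → p ≤ 1F → ∀ {n k} (D D′ : Subset n) → ∣ D ∣ ≡ k → ∣ D′ ∣ ≡ k →
    𝔼 p (numPairs n) (λ G → domQ D G * domQ D′ G) ≤ overlapWeight p n k ∣ D ∩ D′ ∣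
  E-domQ-pair {p} h h′ {n} {k} D D′ d d′ = ≤-tr (E-mono p _ h h′ (λ G → domQ-pair≤ (D ∪ D′) D D′ G (λ _ e → e)))
    (≤-tr (≤-rf (E-pairs p (D ∪ D′) D D′ d d′ (λ _ e → e)))
      (^^-anti (0≤pairProb h h′ k ∣ D ∩ D′ ∣) (pairProb≤1 h h′ k ∣ D ∩ D′ ∣ (∣∩∣≤ D D′ d)) (ℕP.∸-monoʳ-≤ n (ℕP.≤-trans (ℕP.≤-reflexive (∣∪∣ D D′ d d′)) (ℕP.≤-trans (ℕP.m∸n≤m _ ∣ D ∩ D′ ∣) (ℕP.m≤m+n _ 1))))))

  commonLinks : ∀ {n} → F → ℕ → Fin n → Subset n → Subset n → Graph n → F
  commonLinks y i v D D′ G = binomF ∣ G ∩ (link v D ∩ link v D′) ∣ i * (y ^^ ∣ G ∩ link v D ∣ * y ^^ ∣ G ∩ link v D′ ∣)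

  0≤commonLinks : ∀ {n y} → 0F ≤ y → ∀ i (v : Fin n) (D D′ : Subset n) (G : Graph n) → 0F ≤ commonLinks y i v D D′ G
  0≤commonLinks h i v D D′ G = 0≤* (0≤binomF ∣ G ∩ (link v D ∩ link v D′) ∣ i) (0≤* (0≤^^ h ∣ G ∩ link v D ∣) (0≤^^ h ∣ G ∩ link v D′ ∣))

  commonWeight : F → F → ℕ → ℕ → ℕ → ℕ → F
  commonWeight p y n k i r = binomF r i * p ^^ i * (1F - p + p * y) ^^ (2 ℕ.* k ℕ.∸ r) * overlapWeight p n k r

  -- Once v is set aside together with D ∪ D′, the remaining domination factors use no edge between
  -- v and D ∪ D′. They are therefore independent of `commonLinks`, whose mean is bounded by
  -- `E-choose`.
  E-common : ∀ {p y} → 0F ≤ p → p ≤ 1F → 0F ≤ y → y ≤ 1F → ∀ {n k} i (v : Fin n) (D D′ : Subset n) → ∣ D ∣ ≡ k → ∣ D′ ∣ ≡ k →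
    lookup D v ≡ false → lookup D′ v ≡ false →
    𝔼 p (numPairs n) (λ G → domQ D G * domQ D′ G * commonLinks y i v D D′ G) ≤ commonWeight p y n k i ∣ D ∩ D′ ∣
  E-common {p} {y} h h′ g g′ {n} {k} i v D D′ d d′ v∉ v∉′ = ≤-tr
    (E-mono p N h h′ (λ G → ≤-tr (*-monoʳ (ψ G) (0≤commonLinks g i v D D′ G) (domQ-pair≤ U D D′ G sub)) (≤-rf (*-comm _ (ψ G)))))
    (≤-tr (≤-rf (E-indep p N ψ (pairProduct U D D′) (lookup L) depψ (Dep-ΠL (allFin n) _ _ (All.universal depΠ (allFin n)))))
      (*-mono (0≤E p N h h′ (0≤commonLinks g i v D D′)) ψ≤ (0≤E p N h h′ (λ G → 0≤ΠL (allFin n) (λ w → 0≤if (lookup U w) (0≤* (0≤1-0^ ∣ G ∩ link w D ∣) (0≤1-0^ ∣ G ∩ link w D′ ∣)))))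
        (≤-tr (≤-rf (E-pairs p U D D′ d d′ sub)) (^^-anti (0≤pairProb h h′ k ∣ D ∩ D′ ∣) (pairProb≤1 h h′ k ∣ D ∩ D′ ∣ (∣∩∣≤ D D′ d)) (ℕP.∸-monoʳ-≤ n ∣U∣≤)))))
    where
    N = numPairs n
    S = D ∪ D′
    U = S ∪ ⁅ v ⁆
    L = link v S
    ψ = commonLinks y i v D D′
    0≤if : ∀ b {z} → 0F ≤ z → 0F ≤ ifOut b z
    0≤if true _ = 0≤1
    0≤if false h = h
    sub : ∀ w → lookup U w ≡ false → lookup S w ≡ false
    sub w e = proj₁ (∉∪ S ⁅ v ⁆ w e)
    v∉S : lookup S v ≡ false
    v∉S = trans (lookup-∪ D D′ v) (cong₂ _∨_ v∉ v∉′)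
    v∈U : lookup U v ≡ true
    v∈U = VP.[]=⇒lookup (SubP.x∈p∪q⁺ {p = S} {⁅ v ⁆} (inj₂ (SubP.x∈⁅x⁆ v)))
    ∣U∣≤ : ∣ U ∣ ℕ.≤ 2 ℕ.* k ℕ.+ 1
    ∣U∣≤ = ℕP.≤-trans (ℕP.m≤m+n ∣ U ∣ ∣ S ∩ ⁅ v ⁆ ∣) (ℕP.≤-trans (ℕP.≤-reflexive (∣∪∣+∣∩∣ S ⁅ v ⁆))
      (ℕP.+-mono-≤ (ℕP.≤-trans (ℕP.≤-reflexive (∣∪∣ D D′ d d′)) (ℕP.m∸n≤m _ ∣ D ∩ D′ ∣)) (ℕP.≤-reflexive (SubP.∣⁅x⁆∣≡1 v))))
    depψ : Dep ψ (lookup L)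
    depψ G G′ a = cong₂ _*_
      (Dep-∩ (link v D ∩ link v D′) (λ m → binomF m i) G G′ (λ e t → a e (link⊆link-∪ v D D′ e (inj₁ (proj₁ (∧-both (trans (sym (VP.lookup-zipWith _∧_ e (link v D) (link v D′))) t)))))))
      (cong₂ _*_ (Dep-∩ (link v D) (y ^^_) G G′ (λ e t → a e (link⊆link-∪ v D D′ e (inj₁ t))))
        (Dep-∩ (link v D′) (y ^^_) G G′ (λ e t → a e (link⊆link-∪ v D D′ e (inj₂ t)))))
    depΠ : ∀ w → Dep (λ G → ifOut (lookup U w) (pairFactor D D′ w G)) (not ∘ lookup L)
    depΠ w with lookup U w in eq
    ... | true = λ _ _ _ → refl
    ... | false = Dep-⊆ away (Dep-pairFactor D D′ w)
      where
      away : ∀ e → lookup (link w S) e ≡ true → not (lookup L e) ≡ true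
      away e t with lookup L e in eqL
      ... | false = refl
      ... | true with link-disjoint {v = v} {w} {S} e v∉S (sub w eq) eqL t
      ... | refl = bool-clash v∈U eq
    ψ≤ : 𝔼 p N ψ ≤ binomF ∣ D ∩ D′ ∣ i * p ^^ i * (1F - p + p * y) ^^ (2 ℕ.* k ℕ.∸ ∣ D ∩ D′ ∣)
    ψ≤ = ≤-tr (E-choose p y h h′ g g′ (link v D) (link v D′) i) (≤-rf (cong₂ (λ a b → binomF a i * p ^^ i * (1F - p + p * y) ^^ b)
      (trans (cong ∣_∣ (link-∩ v D D′ v∉ v∉′)) (∣link∣ v (D ∩ D′) (trans (VP.lookup-zipWith _∧_ v D D′) (cong (_∧ lookup D′ v) v∉))))
      (trans (cong ∣_∣ (link-∪ v D D′)) (trans (∣link∣ v S v∉S) (∣∪∣ D D′ d d′)))))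

  domCount : ∀ n → ℕ → Graph n → F
  domCount n k G = ΣL (layer n k) (λ D → domQ D G)

  -- For 0 < y < 1 the factor y^|G ∩ link v D| damps the pairs in which v has many neighbours in D.
  lightLink : ∀ {n} → F → Fin n → Subset n → Graph n → F
  lightLink y v D G = 𝟙 (not (lookup D v)) * domQ D G * y ^^ ∣ G ∩ link v D ∣

  -- Triples (v, D, D′) weighted by the number of i-sets of edges from v into D ∩ D′; this is the
  -- factor of Cauchy-Schwarz that does not see the deleted edges.
  commonCount : ∀ n → F → ℕ → ℕ → Graph n → F
  commonCount n y i k G = ΣL (allFin n) (λ v → ΣL (layer n k) (λ D → ΣL (layer n k) (λ D′ →
    lightLink y v D G * lightLink y v D′ G * binomF ∣ G ∩ (link v D ∩ link v D′) ∣ i)))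

  -- The sum of g(|D ∩ D′|) over all k-sets D′, for any fixed k-set D.
  overlapSum : ℕ → ℕ → (ℕ → F) → F
  overlapSum n k g = ΣL (range (suc k)) (λ r → binomF k r * g r * binomF (n ℕ.∸ k) (k ℕ.∸ r))

  ΣL-overlap : ∀ n k (g : ℕ → F) → ΣL (layer n k) (λ D → ΣL (layer n k) (λ D′ → g ∣ D ∩ D′ ∣)) ≡ binomF n k * overlapSum n k g
  ΣL-overlap n k g = trans (ΣL-cong∈ (layer n k) (λ D D∈ → trans (hypergeometric D k g)
      (trans (cong (λ d → conv (λ r → binomF d r * g r) (binomF (n ℕ.∸ d)) k) (layer-∈ k D∈)) (conv-range _ _ k)))) (ΣL-layer-const n k _)
    where
    ΣL-cong∈ : ∀ {A : Set} (xs : List A) {f g : A → F} → (∀ x → x ∈L xs → f x ≡ g x) → ΣL xs f ≡ ΣL xs g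
    ΣL-cong∈ xs h = ≤-antisym (ΣL-mono∈ xs (λ x i → ≤-rf (h x i))) (ΣL-mono∈ xs (λ x i → ≤-rf (sym (h x i))))

  E-domCount : ∀ {p} → 0F ≤ p → p ≤ 1F → ∀ n k → 𝔼 p (numPairs n) (domCount n k) ≡ binomF n k * (1F - (1F - p) ^^ k) ^^ (n ℕ.∸ k)
  E-domCount {p} h h′ n k = trans (E-ΣL p (numPairs n) (layer n k) domQ) (≤-antisym
    (≤-tr (ΣL-mono∈ (layer n k) (λ D i → ≤-rf (E-domQ p D (layer-∈ k i)))) (≤-rf (ΣL-layer-const n k _)))
    (≤-tr (≤-rf (sym (ΣL-layer-const n k _))) (ΣL-mono∈ (layer n k) (λ D i → ≤-rf (sym (E-domQ p D (layer-∈ k i)))))))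

  E-domCount² : ∀ {p} → 0F ≤ p → p ≤ 1F → ∀ n k → 𝔼 p (numPairs n) (λ G → domCount n k G * domCount n k G) ≤ binomF n k * overlapSum n k (overlapWeight p n k)
  E-domCount² {p} h h′ n k = ≤-tr (≤-rf (trans (E-cong p _ (λ G → ΣL-prod (layer n k) (layer n k) (λ D → domQ D G) (λ D → domQ D G)))
      (trans (E-ΣL p _ (layer n k) (λ D G → ΣL (layer n k) (λ D′ → domQ D G * domQ D′ G))) (ΣL-cong (layer n k) (λ D → E-ΣL p _ (layer n k) (λ D′ G → domQ D G * domQ D′ G))))))
    (≤-tr (ΣL-mono∈ (layer n k) (λ D i → ΣL-mono∈ (layer n k) (λ D′ i′ → E-domQ-pair h h′ D D′ (layer-∈ k i) (layer-∈ k i′))))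
      (≤-rf (ΣL-overlap n k (overlapWeight p n k))))

  E-commonCount : ∀ {p y} → 0F ≤ p → p ≤ 1F → 0F ≤ y → y ≤ 1F → ∀ n k i →
    𝔼 p (numPairs n) (commonCount n y i k) ≤ ι n * (binomF n k * overlapSum n k (commonWeight p y n k i))
  E-commonCount {p} {y} h h′ g g′ n k i = ≤-tr (≤-rf (trans (E-ΣL p N (allFin n) (λ v G → ΣL K (λ D → ΣL K (λ D′ → t v D D′ G))))
      (ΣL-cong (allFin n) (λ v → trans (E-ΣL p N K (λ D G → ΣL K (λ D′ → t v D D′ G))) (ΣL-cong K (λ D → E-ΣL p N K (λ D′ → t v D D′)))))))
    (≤-tr (ΣL-mono (allFin n) (λ v → ≤-tr (ΣL-mono∈ K (λ D j → ΣL-mono∈ K (λ D′ j′ → each v D D′ (layer-∈ k j) (layer-∈ k j′)))) (≤-rf (ΣL-overlap n k (commonWeight p y n k i)))))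
      (≤-rf (trans (ΣL-const (allFin n) _) (cong (λ z → ι z * (binomF n k * overlapSum n k (commonWeight p y n k i))) (LP.length-tabulate {n = n} id)))))
    where
    N = numPairs n
    K = layer n k
    t : Fin n → Subset n → Subset n → Graph n → F
    t v D D′ G = lightLink y v D G * lightLink y v D′ G * binomF ∣ G ∩ (link v D ∩ link v D′) ∣ i
    0≤w : ∀ r → r ℕ.≤ k → 0F ≤ commonWeight p y n k i r
    0≤w r r≤ = 0≤* (0≤* (0≤* (0≤binomF r i) (0≤^^ h i)) (0≤^^ (0≤+ (0≤diff h′) (0≤* h g)) (2 ℕ.* k ℕ.∸ r))) (0≤^^ (0≤pairProb h h′ k r) (n ℕ.∸ (2 ℕ.* k ℕ.+ 1)))
    each : ∀ v D D′ → ∣ D ∣ ≡ k → ∣ D′ ∣ ≡ k → 𝔼 p N (t v D D′) ≤ commonWeight p y n k i ∣ D ∩ D′ ∣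
    each v D D′ d d′ with lookup D v in eq | lookup D′ v in eq′
    ... | true | _ = ≤-tr (≤-rf (trans (E-cong p N (λ G → solve 5 (λ a b c x y → κ 0 :* a :* b :* c :* x := κ 0) refl (domQ D G) (y ^^ ∣ G ∩ link v D ∣) _ (binomF ∣ G ∩ (link v D ∩ link v D′) ∣ i) 0F)) (E-const p N 0F))) (0≤w _ (∣∩∣≤ D D′ d))
    ... | false | true = ≤-tr (≤-rf (trans (E-cong p N (λ G → solve 4 (λ a b c x → a :* (κ 0 :* b :* c) :* x := κ 0) refl _ (domQ D′ G) (y ^^ ∣ G ∩ link v D′ ∣) (binomF ∣ G ∩ (link v D ∩ link v D′) ∣ i))) (E-const p N 0F))) (0≤w _ (∣∩∣≤ D D′ d))
    ... | false | false = ≤-tr (≤-rf (E-cong p N (λ G → solve 5 (λ a b c d x → κ 1 :* a :* b :* (κ 1 :* c :* d) :* x := a :* c :* (x :* (b :* d))) refl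
        (domQ D G) (y ^^ ∣ G ∩ link v D ∣) (domQ D′ G) (y ^^ ∣ G ∩ link v D′ ∣) (binomF ∣ G ∩ (link v D ∩ link v D′) ∣ i))))
      (E-common h h′ g g′ i v D D′ d d′ eq eq′)

-- Deleted edge sets: the bound by Cauchy-Schwarz.

module EdgeDeletion where

  open import Defs using (pairV; Graph; Dominating; incident) renaming (E to numPairs)
  open OrderedField
  open Inequalities
  open FiniteSums
  open RandomSubsets
  open Domination
  open Moments
  open import Data.Nat as ℕ using (ℕ; zero; suc; z≤n; s≤s)
  import Data.Nat.Properties as ℕP
  open import Data.Product using (_×_; _,_)
  open import Data.Sum using (inj₁; inj₂)
  open import Data.Empty using (⊥-elim)
  open import Data.List as List using (List; []; _∷_; map; allFin)
  open import Data.List.Membership.Propositional using () renaming (_∈_ to _∈L_)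
  open import Data.List.Relation.Unary.Any using (here)
  open import Data.List.Relation.Unary.All using ([]; _∷_)
  open import Data.List.Membership.Propositional.Properties using (∈-allFin)
  open import Data.Nat using (_!)
  open import Data.Vec as Vec using (Vec; []; _∷_; lookup)
  import Data.Vec.Properties as VP
  open import Data.Fin as Fin using (Fin; zero; suc)
  import Data.Fin.Properties as FP
  open import Data.Fin.Subset using (Subset; ∣_∣; _∩_; _⊆_; _─_)
  import Data.Fin.Subset.Properties as SubP
  open import Data.Bool using (Bool; true; false; not; _∧_; _∨_)
  import Data.Bool.Properties as BP
  open import Relation.Nullary using (Dec; yes; no; ¬_)
  open import Relation.Nullary.Decidable using (⌊_⌋)
  open import Relation.Binary.PropositionalEquality

  subsetᵇ : ∀ {N} → Vec Bool N → Vec Bool N → Bool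
  subsetᵇ [] [] = true
  subsetᵇ (j ∷ J) (a ∷ A) = (not j ∨ a) ∧ subsetᵇ J A

  ΣL-subsets : ∀ {N} i (A : Vec Bool N) → ΣL (layer N i) (λ J → 𝟙 (subsetᵇ J A)) ≡ binomF ∣ A ∣ i
  ΣL-subsets zero [] = +-identityʳ 1F
  ΣL-subsets (suc i) [] = refl
  ΣL-subsets {suc N} zero (a ∷ A) = trans (ΣL-layer₀ N _) (ΣL-subsets zero A)
  ΣL-subsets {suc N} (suc i) (false ∷ A) = trans (ΣL-layer N i _) (trans (cong₂ _+_ (ΣL-0 (layer N i)) (ΣL-subsets (suc i) A)) (+-identityˡ _))
  ΣL-subsets {suc N} (suc i) (true ∷ A) = trans (ΣL-layer N i _) (trans (cong₂ _+_ (ΣL-subsets i A) (ΣL-subsets (suc i) A)) (sym (ι-+ (binom ∣ A ∣ i) (binom ∣ A ∣ (suc i)))))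

  𝟙-∧ : ∀ a b → 𝟙 (a ∧ b) ≡ 𝟙 a * 𝟙 b
  𝟙-∧ true b = sym (*-identityˡ _)
  𝟙-∧ false b = sym (zeroˡ _)

  subsetᵇ-∩ : ∀ {N} (J A B : Vec Bool N) → subsetᵇ J (A ∩ B) ≡ subsetᵇ J A ∧ subsetᵇ J B
  subsetᵇ-∩ [] [] [] = refl
  subsetᵇ-∩ (j ∷ J) (a ∷ A) (b ∷ B) = trans (cong ((not j ∨ (a ∧ b)) ∧_) (subsetᵇ-∩ J A B)) (go j a b (subsetᵇ J A) (subsetᵇ J B))
    where
    go : ∀ j a b x y → (not j ∨ (a ∧ b)) ∧ (x ∧ y) ≡ ((not j ∨ a) ∧ x) ∧ ((not j ∨ b) ∧ y)
    go false a b x y = refl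
    go true false b x y = refl
    go true true true x y = refl
    go true true false x y = sym (BP.∧-zeroʳ x)

  subset-factor : ∀ {N} (J A B : Vec Bool N) → 𝟙 (subsetᵇ J (A ∩ B)) ≡ 𝟙 (subsetᵇ J A) * 𝟙 (subsetᵇ J B)
  subset-factor J A B = trans (cong 𝟙 (subsetᵇ-∩ J A B)) (𝟙-∧ (subsetᵇ J A) (subsetᵇ J B))

  ΣL-cartesian : ∀ {A B : Set} (xs : List A) (ys : List B) (f : A × B → F) →
    ΣL (List.cartesianProduct xs ys) f ≡ ΣL xs (λ x → ΣL ys (λ y → f (x , y)))
  ΣL-cartesian [] ys f = refl
  ΣL-cartesian (x ∷ xs) ys f = trans (ΣL-++ (map (x ,_) ys) _ f) (cong₂ _+_ (ΣL-map (x ,_) ys f) (ΣL-cartesian xs ys f))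

  ⊆⇒∩≡ : ∀ {N} (B G : Subset N) → B ⊆ G → B ∩ G ≡ B
  ⊆⇒∩≡ [] [] s = refl
  ⊆⇒∩≡ (false ∷ B) (g ∷ G) s = cong (false ∷_) (⊆⇒∩≡ B G (SubP.drop-∷-⊆ s))
  ⊆⇒∩≡ (true ∷ B) (g ∷ G) s with s {zero} Vec.here
  ... | Vec.here = cong (true ∷_) (⊆⇒∩≡ B G (SubP.drop-∷-⊆ s))

  hitCount : ∀ n → F → ℕ → ℕ → Graph n → Graph n → F
  hitCount n y i k G B = ΣL (allFin n) (λ v → ΣL (layer n k) (λ D → lightLink y v D G * binomF ∣ B ∩ link v D ∣ i))

  -- Cauchy–Schwarz over the pairs (v , J) with J a set of i edges of B at v.
  hitCount² : ∀ n y i k (G B : Graph n) → B ⊆ G →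
    hitCount n y i k G B * hitCount n y i k G B ≤ ΣL (allFin n) (λ v → binomF ∣ B ∩ star v ∣ i) * commonCount n y i k G
  hitCount² n y i k G B B⊆G = subst₂ _≤_ (cong (λ z → z * z) (sym hits)) (cong₂ _*_ squares₁ squares₂)
    (cauchy-schwarz VJ (λ { (v , J) → a v J }) (λ { (v , J) → b v J }))
    where
    N = numPairs n
    V = allFin n
    K = layer n k
    Js = layer N i
    VJ = List.cartesianProduct V Js
    a b : Fin n → Subset N → F
    a v J = 𝟙 (subsetᵇ J (B ∩ star v))
    b v J = ΣL K (λ D → lightLink y v D G * 𝟙 (subsetᵇ J (G ∩ link v D)))
    -- Because B ⊆ G, the hit edges are the intersection of a set depending on B and v with one
    -- depending on G, v and D. An indicator J ⊆ B ∩ `link v D` then splits into the two factors of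
    -- Cauchy-Schwarz.
    regroup : ∀ v D → B ∩ link v D ≡ (B ∩ star v) ∩ (G ∩ link v D)
    regroup v D = sym (trans (SubP.∩-assoc B (star v) _) (trans (cong (B ∩_) (trans (sym (SubP.∩-assoc (star v) G _)) (trans (cong (_∩ link v D) (SubP.∩-comm (star v) G)) (SubP.∩-assoc G (star v) _))))
      (trans (sym (SubP.∩-assoc B G _)) (cong₂ _∩_ (⊆⇒∩≡ B G B⊆G) (trans (SubP.∩-comm (star v) (link v D)) (link⊆star v D))))))
    hits : hitCount n y i k G B ≡ ΣL VJ (λ { (v , J) → a v J * b v J })
    hits = trans (ΣL-cong V (λ v → trans (ΣL-cong K (λ D → trans (cong (lightLink y v D G *_) (sym (ΣL-subsets i (B ∩ link v D))))
        (trans (sym (ΣL-*ˡ Js _ _)) (ΣL-cong Js (λ J → trans (cong (lightLink y v D G *_) (trans (cong (λ z → 𝟙 (subsetᵇ J z)) (regroup v D)) (subset-factor J (B ∩ star v) (G ∩ link v D))))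
          (solve 3 (λ l a s → l :* (a :* s) := a :* (l :* s)) refl (lightLink y v D G) (a v J) (𝟙 (subsetᵇ J (G ∩ link v D)))))))))
       (trans (ΣL-swap K Js _) (ΣL-cong Js (λ J → ΣL-*ˡ K (a v J) _)))))
      (sym (ΣL-cartesian V Js (λ { (v , J) → a v J * b v J })))
    𝟙² : ∀ c → 𝟙 c * 𝟙 c ≡ 𝟙 c
    𝟙² true = *-identityˡ _
    𝟙² false = zeroˡ _
    squares₁ : ΣL VJ (λ { (v , J) → a v J * a v J }) ≡ ΣL V (λ v → binomF ∣ B ∩ star v ∣ i)
    squares₁ = trans (ΣL-cartesian V Js _) (ΣL-cong V (λ v → trans (ΣL-cong Js (λ J → 𝟙² (subsetᵇ J (B ∩ star v)))) (ΣL-subsets i (B ∩ star v))))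
    merge : ∀ v D D′ → (G ∩ link v D) ∩ (G ∩ link v D′) ≡ G ∩ (link v D ∩ link v D′)
    merge v D D′ = trans (SubP.∩-assoc G (link v D) _) (trans (cong (G ∩_) (trans (sym (SubP.∩-assoc (link v D) G _)) (trans (cong (_∩ link v D′) (SubP.∩-comm (link v D) G)) (SubP.∩-assoc G (link v D) _))))
      (trans (sym (SubP.∩-assoc G G _)) (cong (_∩ (link v D ∩ link v D′)) (SubP.∩-idem G))))
    squares₂ : ΣL VJ (λ { (v , J) → b v J * b v J }) ≡ commonCount n y i k G
    squares₂ = trans (ΣL-cartesian V Js _) (ΣL-cong V (λ v → trans (ΣL-cong Js (λ J → ΣL-prod K K _ _))
      (trans (ΣL-swap Js K _) (ΣL-cong K (λ D → trans (ΣL-swap Js K _) (ΣL-cong K (λ D′ →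
        trans (ΣL-cong Js (λ J → trans (solve 4 (λ l s l′ s′ → l :* s :* (l′ :* s′) := l :* l′ :* (s :* s′)) refl
            (lightLink y v D G) (𝟙 (subsetᵇ J (G ∩ link v D))) (lightLink y v D′ G) (𝟙 (subsetᵇ J (G ∩ link v D′))))
          (cong (lightLink y v D G * lightLink y v D′ G *_) (trans (sym (subset-factor J (G ∩ link v D) (G ∩ link v D′))) (cong (λ z → 𝟙 (subsetᵇ J z)) (merge v D D′))))))
         (trans (ΣL-*ˡ Js _ _) (cong (lightLink y v D G * lightLink y v D′ G *_) (ΣL-subsets i (G ∩ (link v D ∩ link v D′))))))))))))

  incident-sum : ∀ {n} (e : Fin n × Fin n) → ΣL (allFin n) (λ v → 𝟙 (incident e v)) ≤ ι 2
  incident-sum {n} (i , j) = ≤-tr (ΣL-mono (allFin n) (λ v → bound ⌊ i FP.≟ v ⌋ ⌊ j FP.≟ v ⌋)) (≤-rf (trans (ΣL-+ (allFin n) _ _) (cong₂ _+_ (one i) (one j))))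
    where
    bound : ∀ a b → 𝟙 (a ∨ b) ≤ 𝟙 a + 𝟙 b
    bound true b = ≤-+ʳ (0≤𝟙 b)
    bound false b = ≤-rf (sym (+-identityˡ _))
    one : ∀ i → ΣL (allFin n) (λ v → 𝟙 ⌊ i FP.≟ v ⌋) ≡ 1F
    one i = trans (ΣL-cong (allFin n) (λ v → trans (cong 𝟙 (flip i v)) (sym (*-identityʳ _)))) (ΣL-≈ i (λ _ → 1F))
      where
      flip : ∀ i v → ⌊ i FP.≟ v ⌋ ≡ ⌊ v FP.≟ i ⌋
      flip i v with i FP.≟ v | v FP.≟ i
      ... | yes _ | yes _ = refl
      ... | no _ | no _ = refl
      ... | yes p | no q = ⊥-elim (q (sym p))
      ... | no p | yes q = ⊥-elim (p (sym q))

  star-sum : ∀ n (B : Graph n) → ΣL (allFin n) (λ v → ι ∣ B ∩ star v ∣) ≤ ι 2 * ι ∣ B ∣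
  star-sum n B = ≤-tr (≤-rf (trans (ΣL-cong (allFin n) (λ v → ∣∩∣-sum B (star v))) (ΣL-swap (allFin n) (allFin N) _)))
    (≤-tr (ΣL-mono (allFin N) (λ e → ≤-tr (≤-rf (ΣL-*ˡ (allFin n) (𝟙 (lookup B e)) _))
        (≤-tr (*-monoˡ (𝟙 (lookup B e)) (0≤𝟙 (lookup B e)) (≤-tr (≤-rf (ΣL-cong (allFin n) (λ v → cong 𝟙 (VP.lookup-map e _ (pairV n))))) (incident-sum (lookup (pairV n) e)))) (≤-rf (*-comm _ (ι 2))))))
      (≤-rf (trans (ΣL-*ˡ (allFin N) (ι 2) _) (cong (ι 2 *_) (∣∣-sum B)))))
    where N = numPairs n

  factorial-binom : ∀ b i → (i !) ℕ.* binom b i ℕ.≤ b ℕ.^ i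
  factorial-binom b i = ι-cancel-≤ (go i)
    where
    go : ∀ i → ι ((i !) ℕ.* binom b i) ≤ ι (b ℕ.^ i)
    go zero = ≤-refl
    go (suc i) = ≤-tr (≤-rf (trans (ι-* (suc i ℕ.* (i !)) _) (trans (cong (_* binomF b (suc i)) (ι-* (suc i) (i !)))
        (solve 3 (λ s f c → s :* f :* c := f :* (s :* c)) refl (ι (suc i)) (ι (i !)) (binomF b (suc i))))))
      (≤-tr (*-monoˡ (ι (i !)) (0≤ι (i !)) (≤-tr (≤-+ˡ (0≤* (0≤ι i) (0≤binomF b i))) (≤-rf (sym (binomF-ratio b i)))))
        (≤-tr (≤-rf (solve 3 (λ f b c → f :* (b :* c) := b :* (f :* c)) refl (ι (i !)) (ι b) (binomF b i)))
          (≤-tr (*-monoˡ (ι b) (0≤ι b) (≤-tr (≤-rf (sym (ι-* (i !) (binom b i)))) (go i))) (≤-rf (sym (ι-* b (b ℕ.^ i)))))))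

  -- One factor of the degree power b^(i + 1) is kept for the handshake bound `star-sum`; the others
  -- are replaced by s.
  star-binom-sum : ∀ n (B : Graph n) s i → ∣ B ∣ ℕ.≤ s → ι (suc i !) * ΣL (allFin n) (λ v → binomF ∣ B ∩ star v ∣ (suc i)) ≤ ι 2 * ι s ^^ suc i
  star-binom-sum n B s i B≤s = ≤-tr (≤-rf (sym (ΣL-*ˡ (allFin n) (ι (suc i !)) _)))
    (≤-tr (ΣL-mono (allFin n) (λ v → let b = ∣ B ∩ star v ∣ in
        ≤-tr (≤-rf (sym (ι-* (suc i !) (binom b (suc i))))) (≤-tr (ι-mono (factorial-binom b (suc i)))
          (≤-tr (≤-rf (ι-^ b (suc i))) (*-monoˡ (ι b) (0≤ι b) (^^-mono (0≤ι b) (ι-mono (ℕP.≤-trans (SubP.∣p∩q∣≤∣p∣ B (star v)) B≤s)) i))))))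
      (≤-tr (≤-rf (ΣL-*ʳ (allFin n) (ι s ^^ i) _)) (≤-tr (*-monoʳ (ι s ^^ i) (0≤^^ (0≤ι s) i) (≤-tr (star-sum n B) (*-monoˡ (ι 2) 0≤2 (ι-mono B≤s)))) (≤-rf (*-assoc _ _ _)))))

  ∣∩∣≤─+ : ∀ {N} (G B T : Subset N) → ∣ G ∩ T ∣ ℕ.≤ ∣ (G ─ B) ∩ T ∣ ℕ.+ ∣ B ∩ T ∣
  ∣∩∣≤─+ [] [] [] = z≤n
  ∣∩∣≤─+ (false ∷ G) (false ∷ B) (t ∷ T) = ∣∩∣≤─+ G B T
  ∣∩∣≤─+ (false ∷ G) (true ∷ B) (false ∷ T) = ∣∩∣≤─+ G B T
  ∣∩∣≤─+ (false ∷ G) (true ∷ B) (true ∷ T) = ℕP.≤-trans (∣∩∣≤─+ G B T) (ℕP.+-monoʳ-≤ ∣ (G ─ B) ∩ T ∣ (ℕP.n≤1+n _))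
  ∣∩∣≤─+ (true ∷ G) (false ∷ B) (false ∷ T) = ∣∩∣≤─+ G B T
  ∣∩∣≤─+ (true ∷ G) (false ∷ B) (true ∷ T) = s≤s (∣∩∣≤─+ G B T)
  ∣∩∣≤─+ (true ∷ G) (true ∷ B) (false ∷ T) = ∣∩∣≤─+ G B T
  ∣∩∣≤─+ (true ∷ G) (true ∷ B) (true ∷ T) = ℕP.≤-trans (s≤s (∣∩∣≤─+ G B T)) (ℕP.≤-reflexive (sym (ℕP.+-suc _ _)))

  0≤lightLink : ∀ {n y} → 0F ≤ y → ∀ v (D : Subset n) (G : Graph n) → 0F ≤ lightLink y v D G
  0≤lightLink h v D G = 0≤* (0≤* (0≤𝟙 (not (lookup D v))) (0≤domQ D G)) (0≤^^ h ∣ G ∩ link v D ∣)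

  -- If D dominates in G, some v loses all its j ≥ 1 neighbours in D, so at least j deleted edges
  -- join v to D. For j < ℓ the prefactor Y^ℓ outweighs the damping y^j; for j ≥ ℓ some ℓ-set of
  -- deleted edges is counted.
  hit-or-light : ∀ n ℓ (G B : Graph n) (D : Subset n) y Y → 0F ≤ y → 1F ≤ Y → Y * y ≡ 1F → ¬ Dominating {n} (G ─ B) D →
    domQ D G ≤ Y ^^ ℓ * ΣL (allFin n) (λ v → lightLink y v D G * binomF ∣ B ∩ link v D ∣ 1)
      + ΣL (allFin n) (λ v → lightLink 1F v D G * binomF ∣ B ∩ link v D ∣ ℓ)
  hit-or-light n ℓ G B D y Y 0≤y 1≤Y Yy nd with dominating? G D
  ... | no ¬d = ≤-tr (≤-rf (domQ-¬dominating G D ¬d)) (0≤+ (0≤* (0≤^^ (≤-tr 0≤1 1≤Y) ℓ) (0≤ΣL (allFin n) (λ v → 0≤* (0≤lightLink 0≤y v D G) (0≤binomF ∣ B ∩ link v D ∣ 1))))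
      (0≤ΣL (allFin n) (λ v → 0≤* (0≤lightLink 0≤1 v D G) (0≤binomF ∣ B ∩ link v D ∣ ℓ))))
  ... | yes d with FP.¬∀⟶∃¬ n (Covers (G ─ B) D) (covers? (G ─ B) D) (λ c → nd (covers⇒dominating (G ─ B) D c))
  ... | v , nc = ≤-tr (≤-rf (domQ-dominating G D d)) (split (j ℕP.<? ℓ))
    where
    V = allFin n
    j = ∣ G ∩ link v D ∣
    b = ∣ B ∩ link v D ∣
    v∉ : lookup D v ≡ false
    v∉ with lookup D v in eq
    ... | false = refl
    ... | true = ⊥-elim (nc (inj₁ refl))
    1≤j : 1 ℕ.≤ j
    1≤j with dominating⇒covers G D d v
    ... | inj₁ v∈ = bool-clash v∈ v∉
    ... | inj₂ h = h
    j≤b : j ℕ.≤ b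
    j≤b with ∣ (G ─ B) ∩ link v D ∣ in eq | ∣∩∣≤─+ G B (link v D)
    ... | zero | h = h
    ... | suc m | _ = ⊥-elim (nc (inj₂ (s≤s z≤n)))
    light : ∀ y → lightLink y v D G ≡ y ^^ j
    light y = trans (cong₂ (λ a c → 𝟙 (not a) * c * y ^^ j) v∉ (domQ-dominating G D d)) (solve 1 (λ x → κ 1 :* κ 1 :* x := x) refl (y ^^ j))
    f₁ f₂ : Fin n → F
    f₁ v = lightLink y v D G * binomF ∣ B ∩ link v D ∣ 1
    f₂ v = lightLink 1F v D G * binomF ∣ B ∩ link v D ∣ ℓ
    0≤f₁ : ∀ v → 0F ≤ f₁ v
    0≤f₁ v = 0≤* (0≤lightLink 0≤y v D G) (0≤binomF ∣ B ∩ link v D ∣ 1)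
    0≤f₂ : ∀ v → 0F ≤ f₂ v
    0≤f₂ v = 0≤* (0≤lightLink 0≤1 v D G) (0≤binomF ∣ B ∩ link v D ∣ ℓ)
    split : Dec (j ℕ.< ℓ) → 1F ≤ Y ^^ ℓ * ΣL V f₁ + ΣL V f₂
    split (yes j<ℓ) = ≤-tr (≤-tr (≤-tr (≤-rf (trans (sym (1^^ j)) (trans (cong (_^^ j) (sym Yy)) (^^-*-dist Y y j))))
        (*-mono (0≤^^ (≤-tr 0≤1 1≤Y) j) (^^-monoʳ 1≤Y (ℕP.<⇒≤ j<ℓ)) (0≤^^ 0≤y j)
          (≤-tr (≤*ʳ (0≤^^ 0≤y j) (1≤ι (1≤binom (ℕP.≤-trans 1≤j j≤b)))) (≤-rf (cong (_* binomF b 1) (sym (light y)))))))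
        (*-monoˡ (Y ^^ ℓ) (0≤^^ (≤-tr 0≤1 1≤Y) ℓ) (ΣL-∈ 0≤f₁ (∈-allFin v)))) (≤-+ʳ (0≤ΣL V 0≤f₂))
    split (no j≮ℓ) = ≤-tr (≤-tr (≤-tr (1≤ι (1≤binom (ℕP.≤-trans (ℕP.≮⇒≥ j≮ℓ) j≤b))) (≤-rf (trans (sym (*-identityˡ _)) (cong (_* binomF b ℓ) (sym (trans (light 1F) (1^^ j)))))))
        (ΣL-∈ 0≤f₂ (∈-allFin v))) (≤-+ˡ (0≤* (0≤^^ (≤-tr 0≤1 1≤Y) ℓ) (0≤ΣL V 0≤f₁)))

  -- Summing `hit-or-light` over all k-sets gives X ≤ Λh₁ + h₂, so X² ≤ 2Λ²h₁² + 2h₂², and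
  -- Cauchy-Schwarz applies to each square. The factorial in front avoids a division in
  -- `star-binom-sum`. The right side depends on B only through s, which makes a bound uniform in B
  -- possible.
  destroyed : ∀ n k ℓ s (G B : Graph n) y Y → 0F ≤ y → 1F ≤ Y → Y * y ≡ 1F → B ⊆ G → ∣ B ∣ ℕ.≤ s →
    (∀ D → D ∈L layer n k → ¬ Dominating {n} (G ─ B) D) →
    ι (suc ℓ !) * (domCount n k G * domCount n k G) ≤
      ι (suc ℓ !) * (ι 4 * ι s * (Y ^^ suc ℓ * Y ^^ suc ℓ) * commonCount n y 1 k G) + ι 4 * ι s ^^ suc ℓ * commonCount n 1F (suc ℓ) k G
  destroyed n k ℓ s G B y Y 0≤y 1≤Y Yy B⊆G B≤s kill = ≤-tr (*-monoˡ f! (0≤ι (suc ℓ !)) (≤-tr (*-mono 0≤X X≤ 0≤X X≤)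
      (≤-diff _ (0≤sq (Λ * h₁ - h₂)) (solve 3 (λ l a b → κ 2 :* (l :* l :* (a :* a)) :+ κ 2 :* (b :* b) :- (l :* a :+ b) :* (l :* a :+ b) := (l :* a :- b) :* (l :* a :- b)) refl Λ h₁ h₂))))
    (≤-tr (≤-rf (solve 4 (λ f l a b → f :* (κ 2 :* (l :* a) :+ κ 2 :* b) := f :* (κ 2 :* l :* a) :+ κ 2 :* (f :* b)) refl f! (Λ * Λ) (h₁ * h₁) (h₂ * h₂)))
      (+-mono (*-monoˡ f! (0≤ι (suc ℓ !)) (≤-tr (*-monoˡ (ι 2 * (Λ * Λ)) (0≤* 0≤2 (0≤sq Λ)) (≤-tr (hitCount² n y 1 k G B B⊆G) (*-monoʳ (commonCount n y 1 k G) 0≤V₁ s₁)))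
          (≤-rf (solve 3 (λ l s v → κ 2 :* l :* (κ 2 :* s :* v) := κ 4 :* s :* l :* v) refl (Λ * Λ) (ι s) (commonCount n y 1 k G)))))
        (≤-tr (*-monoˡ (ι 2) 0≤2 (≤-tr (*-monoˡ f! (0≤ι (suc ℓ !)) (hitCount² n 1F (suc ℓ) k G B B⊆G)) (≤-tr (≤-rf (sym (*-assoc f! _ _))) (*-monoʳ _ 0≤V₂ (star-binom-sum n B s ℓ B≤s)))))
          (≤-rf (solve 2 (λ s v → κ 2 :* (κ 2 :* s :* v) := κ 4 :* s :* v) refl (ι s ^^ suc ℓ) (commonCount n 1F (suc ℓ) k G))))))
    where
    V = allFin n
    K = layer n k
    f! = ι (suc ℓ !)
    Λ = Y ^^ suc ℓ
    h₁ = hitCount n y 1 k G B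
    h₂ = hitCount n 1F (suc ℓ) k G B
    0≤X : 0F ≤ domCount n k G
    0≤X = 0≤ΣL K (λ D → 0≤domQ D G)
    0≤V : ∀ {y} → 0F ≤ y → ∀ i → 0F ≤ commonCount n y i k G
    0≤V h i = 0≤ΣL V (λ v → 0≤ΣL K (λ D → 0≤ΣL K (λ D′ → 0≤* (0≤* (0≤lightLink h v D G) (0≤lightLink h v D′ G)) (0≤binomF ∣ G ∩ (link v D ∩ link v D′) ∣ i))))
    0≤V₁ = 0≤V 0≤y 1
    0≤V₂ = 0≤V 0≤1 (suc ℓ)
    X≤ : domCount n k G ≤ Λ * h₁ + h₂
    X≤ = ≤-tr (ΣL-mono∈ K (λ D i → hit-or-light n (suc ℓ) G B D y Y 0≤y 1≤Y Yy (kill D i)))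
      (≤-rf (trans (ΣL-+ K _ _) (cong₂ _+_ (trans (ΣL-*ˡ K Λ _) (cong (Λ *_) (ΣL-swap K V _))) (ΣL-swap K V _))))
    s₁ : ΣL V (λ v → binomF ∣ B ∩ star v ∣ 1) ≤ ι 2 * ι s
    s₁ = ≤-tr (≤-rf (sym (*-identityˡ _))) (≤-tr (star-binom-sum n B s 0 B≤s) (≤-rf (cong (ι 2 *_) (*-identityʳ (ι s)))))

-- Sums over the size of the overlap of two k-sets.

module Overlaps where

  open OrderedField
  open Inequalities
  open FiniteSums
  open RandomSubsets
  open Domination
  open Moments
  open EdgeDeletion
  open import Data.Nat as ℕ using (ℕ; zero; suc; z≤n; s≤s)
  import Data.Nat.Properties as ℕP
  open import Data.List as List using (List; []; _∷_)
  open import Data.List.Membership.Propositional using () renaming (_∈_ to _∈L_)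
  open import Data.List.Relation.Unary.Any using (here; there)
  open import Data.List.Relation.Unary.All using ([]; _∷_)
  open import Data.List.Membership.Propositional.Properties using (∈-map⁺)
  open import Data.Vec as Vec using (Vec; []; _∷_)
  open import Data.Fin using (zero; suc)
  open import Data.Fin.Subset using (∣_∣; _∩_)
  import Data.Fin.Subset.Properties as SubP
  open import Data.Bool using (Bool; true; false)
  open import Relation.Nullary using (yes; no)
  open import Relation.Binary.PropositionalEquality

  subsetᵇ-count : ∀ {N} (J A : Vec Bool N) → subsetᵇ J A ≡ (∣ J ∩ A ∣ ℕ.≡ᵇ ∣ J ∣)
  subsetᵇ-count [] [] = refl
  subsetᵇ-count (false ∷ J) (a ∷ A) = subsetᵇ-count J A
  subsetᵇ-count (true ∷ J) (true ∷ A) = subsetᵇ-count J A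
  subsetᵇ-count (true ∷ J) (false ∷ A) = sym (below (SubP.∣p∩q∣≤∣p∣ J A))
    where
    below : ∀ {a b} → a ℕ.≤ b → (a ℕ.≡ᵇ suc b) ≡ false
    below z≤n = refl
    below (s≤s h) = below h

  ΣL-cong∈ : ∀ {A : Set} (xs : List A) {f g : A → F} → (∀ x → x ∈L xs → f x ≡ g x) → ΣL xs f ≡ ΣL xs g
  ΣL-cong∈ xs h = ≤-antisym (ΣL-mono∈ xs (λ x i → ≤-rf (h x i))) (ΣL-mono∈ xs (λ x i → ≤-rf (sym (h x i))))

  -- The number of k-sets containing a fixed i-set, kept in hypergeometric form; double counting
  -- eliminates it in `overlap-binom`.
  supersets : ℕ → ℕ → ℕ → F
  supersets n k i = conv (λ r → binomF i r * 𝟙 (r ℕ.≡ᵇ i)) (binomF (n ℕ.∸ i)) k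

  ΣL-supersets : ∀ {n} k i (J : Vec Bool n) → ∣ J ∣ ≡ i → ΣL (layer n k) (λ D → 𝟙 (subsetᵇ J D)) ≡ supersets n k i
  ΣL-supersets {n} k i J refl = trans (ΣL-cong (layer n k) (λ D → cong 𝟙 (subsetᵇ-count J D))) (hypergeometric J k (λ r → 𝟙 (r ℕ.≡ᵇ ∣ J ∣)))

  -- Double counting the pairs (J , D) with J ⊆ D and the triples (J , D , D′) with J ⊆ D ∩ D′, where ∣J∣ = i.
  overlap-binom : ∀ n k i → k ℕ.≤ n → binomF n i * overlapSum n k (λ r → binomF r i) ≡ binomF n k * (binomF k i * binomF k i)
  overlap-binom n k i k≤n = cancel (0<ι (1≤binom k≤n)) (trans (solve 3 (λ a k o → k :* (a :* o) := a :* (k :* o)) refl (binomF n i) (binomF n k) _)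
      (trans (cong (binomF n i *_) (trans (sym (ΣL-overlap n k (λ r → binomF r i))) pairs))
        (trans (solve 2 (λ a c → a :* (a :* (c :* c)) := (a :* c) :* (a :* c)) refl (binomF n i) c)
          (trans (cong (λ z → z * z) singles) (solve 2 (λ a b → a :* b :* (a :* b) := a :* (a :* (b :* b))) refl (binomF n k) (binomF k i))))))
    where
    K = layer n k
    Js = layer n i
    c = supersets n k i
    cancel : ∀ {a b c} → 0F < c → c * a ≡ c * b → a ≡ b
    cancel {c = c} 0<c e = ≤-antisym (*-cancelˡ c 0<c (≤-rf e)) (*-cancelˡ c 0<c (≤-rf (sym e)))
    const : ∀ x → ΣL Js (λ _ → x) ≡ binomF n i * x
    const = ΣL-layer-const n i
    singles : binomF n i * c ≡ binomF n k * binomF k i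
    singles = trans (sym (const c)) (trans (ΣL-cong∈ Js (λ J j → sym (ΣL-supersets k i J (layer-∈ i j)))) (trans (ΣL-swap Js K _)
      (trans (ΣL-cong∈ K (λ D d → trans (ΣL-subsets i D) (cong (λ z → binomF z i) (layer-∈ k d)))) (ΣL-layer-const n k (binomF k i)))))
    pairs : ΣL K (λ D → ΣL K (λ D′ → binomF ∣ D ∩ D′ ∣ i)) ≡ binomF n i * (c * c)
    pairs = trans (ΣL-cong K (λ D → trans (ΣL-cong K (λ D′ → trans (sym (ΣL-subsets i (D ∩ D′))) (ΣL-cong Js (λ J → subset-factor J D D′)))) (ΣL-swap K Js _)))
      (trans (ΣL-swap K Js _) (trans (ΣL-cong∈ Js (λ J j → trans (sym (ΣL-prod K K _ _)) (cong₂ _*_ (ΣL-supersets k i J (layer-∈ i j)) (ΣL-supersets k i J (layer-∈ i j))))) (const (c * c))))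

  -- C(k, i)/C(n, i) is a product of ratios (k - j)/(n - j), each at most k/n.
  binom-ratio-pow : ∀ {k n} → k ℕ.≤ n → ∀ i → ι n ^^ i * binomF k i ≤ ι k ^^ i * binomF n i
  binom-ratio-pow k≤n zero = ≤-refl
  binom-ratio-pow {k} {n} k≤n (suc i) with i ℕP.<? k
  ... | no i≮k = ≤-tr (≤-rf (trans (cong (λ z → ι n ^^ suc i * ι z) (binom-vanish (s≤s (ℕP.≮⇒≥ i≮k)))) (zeroʳ _))) (0≤* (0≤^^ (0≤ι k) (suc i)) (0≤binomF n (suc i)))
  ... | yes i<k = *-cancelˡ (ι (suc i)) (0<ι {suc i} (s≤s z≤n)) (≤-tr
      (≤-rf (trans (solve 4 (λ s n P c → s :* (n :* P :* c) := n :* P :* (s :* c)) refl (ι (suc i)) (ι n) (ι n ^^ i) (binomF k (suc i)))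
        (trans (cong (ι n * ι n ^^ i *_) (step k)) (solve 5 (λ n P k i c → n :* P :* (k :* c :- i :* c) := P :* c :* (n :* (k :- i))) refl (ι n) (ι n ^^ i) (ι k) (ι i) (binomF k i)))))
      (≤-tr (*-mono (0≤* (0≤^^ (0≤ι n) i) (0≤binomF k i)) (binom-ratio-pow k≤n i) (0≤* (0≤ι n) (0≤diff (ι-mono (ℕP.<⇒≤ i<k)))) cross)
        (≤-rf (sym (trans (solve 4 (λ s n P c → s :* (n :* P :* c) := n :* P :* (s :* c)) refl (ι (suc i)) (ι k) (ι k ^^ i) (binomF n (suc i)))
          (trans (cong (ι k * ι k ^^ i *_) (step n)) (solve 5 (λ k P n i c → k :* P :* (n :* c :- i :* c) := P :* c :* (k :* (n :- i))) refl (ι k) (ι k ^^ i) (ι n) (ι i) (binomF n i))))))))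
    where
    step : ∀ n → ι (suc i) * binomF n (suc i) ≡ ι n * binomF n i - ι i * binomF n i
    step n = trans (solve 2 (λ a b → b := (a :+ b) :- a) refl (ι i * binomF n i) (ι (suc i) * binomF n (suc i))) (cong (_- ι i * binomF n i) (sym (binomF-ratio n i)))
    cross : ι n * (ι k - ι i) ≤ ι k * (ι n - ι i)
    cross = ≤-diff _ (0≤* (0≤diff (ι-mono k≤n)) (0≤ι i)) (solve 3 (λ n k i → k :* (n :- i) :- n :* (k :- i) := (n :- k) :* i) refl (ι n) (ι k) (ι i))

  overlap-binom≤ : ∀ n k i → i ℕ.≤ k → k ℕ.≤ n → ι n ^^ i * overlapSum n k (λ r → binomF r i) ≤ binomF n k * (binomF k i * ι k ^^ i)
  overlap-binom≤ n k i i≤k k≤n = *-cancelˡ (binomF n i) (0<ι (1≤binom (ℕP.≤-trans i≤k k≤n))) (≤-tr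
    (≤-rf (trans (solve 3 (λ b N o → b :* (N :* o) := N :* (b :* o)) refl (binomF n i) (ι n ^^ i) _) (trans (cong (ι n ^^ i *_) (overlap-binom n k i k≤n))
      (solve 3 (λ N K c → N :* (K :* (c :* c)) := K :* c :* (N :* c)) refl (ι n ^^ i) (binomF n k) (binomF k i)))))
    (≤-tr (*-monoˡ (binomF n k * binomF k i) (0≤* (0≤binomF n k) (0≤binomF k i)) (binom-ratio-pow k≤n i))
      (≤-rf (solve 4 (λ K c P b → K :* c :* (P :* b) := b :* (K :* (c :* P))) refl (binomF n k) (binomF k i) (ι k ^^ i) (binomF n i)))))

  overlapTerm : ℕ → ℕ → ℕ → F
  overlapTerm n k r = binomF k r * binomF (n ℕ.∸ k) (k ℕ.∸ r)

  0≤overlapTerm : ∀ n k r → 0F ≤ overlapTerm n k r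
  0≤overlapTerm n k r = 0≤* (0≤binomF k r) (0≤binomF (n ℕ.∸ k) (k ℕ.∸ r))

  overlapSum-term : ∀ n k g → overlapSum n k g ≡ ΣL (range (suc k)) (λ r → overlapTerm n k r * g r)
  overlapSum-term n k g = ΣL-cong (range (suc k)) (λ r → solve 3 (λ a g b → a :* g :* b := a :* b :* g) refl (binomF k r) (g r) (binomF (n ℕ.∸ k) (k ℕ.∸ r)))

  overlapSum-1 : ∀ n k → k ℕ.≤ n → ΣL (range (suc k)) (λ r → overlapTerm n k r) ≡ binomF n k
  overlapSum-1 n k k≤n = trans (sym (trans (overlapSum-term n k (λ r → binomF r 0)) (ΣL-cong (range (suc k)) (λ r → *-identityʳ _))))
    (trans (sym (*-identityˡ _)) (trans (overlap-binom n k 0 k≤n) (solve 1 (λ x → x :* (κ 1 :* κ 1) := x) refl (binomF n k))))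

  ∈-range : ∀ {n r} → r ℕ.< n → r ∈L range n
  ∈-range {suc n} {zero} h = here refl
  ∈-range {suc n} {suc r} (s≤s h) = there (∈-map⁺ suc (∈-range h))

  binom-self : ∀ n → binom n n ≡ 1
  binom-self zero = refl
  binom-self (suc n) = trans (cong₂ ℕ._+_ (binom-self n) (binom-vanish (ℕP.≤-refl {suc n}))) refl

  -- A single term is bounded by the whole sum of `overlap-binom≤` at i = r, where it has
  -- coefficient C(r, r) = 1.
  overlapTerm≤ : ∀ n k r → r ℕ.≤ k → k ℕ.≤ n → ι n ^^ r * overlapTerm n k r ≤ binomF n k * (binomF k r * ι k ^^ r)
  overlapTerm≤ n k r r≤k k≤n = ≤-tr (*-monoˡ (ι n ^^ r) (0≤^^ (0≤ι n) r) (≤-tr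
      (≤-rf (sym (trans (cong (λ z → overlapTerm n k r * ι z) (binom-self r)) (*-identityʳ _))))
      (≤-tr (ΣL-∈ {f = λ i → overlapTerm n k i * binomF i r} (λ i → 0≤* (0≤overlapTerm n k i) (0≤binomF i r)) (∈-range (s≤s r≤k))) (≤-rf (sym (overlapSum-term n k (λ i → binomF i r)))))))
    (overlap-binom≤ n k r r≤k k≤n)

  -- Overlaps of at most k/4 carry the main mass, with weights close to P. Beyond that every term is
  -- small by itself, and there are at most k + 1 terms.
  overlapSum-bound : ∀ n k (Ψ : ℕ → F) P η τ → k ℕ.≤ n → 0F ≤ P → 0F ≤ η → 0F ≤ τ →
    (∀ r → 4 ℕ.* r ℕ.≤ k → Ψ r ≤ P * (1F + η)) →
    (∀ r → r ℕ.≤ k → k ℕ.< 4 ℕ.* r → overlapTerm n k r * Ψ r ≤ binomF n k * P * τ) →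
    overlapSum n k Ψ ≤ binomF n k * P * (1F + η + ι (suc k) * τ)
  overlapSum-bound n k Ψ P η τ k≤n 0≤P 0≤η 0≤τ small large = ≤-tr (≤-rf (overlapSum-term n k Ψ))
    (≤-tr (ΣL-mono∈ (range (suc k)) (λ r i → each r (ℕP.≤-pred (range-< i))))
      (≤-rf (trans (ΣL-+ (range (suc k)) _ _) (trans (cong₂ _+_ (trans (ΣL-*ʳ (range (suc k)) _ _) (cong (_* (P * (1F + η))) (overlapSum-1 n k k≤n)))
          (trans (ΣL-const (range (suc k)) _) (cong (λ z → ι z * (binomF n k * P * τ)) (length-range (suc k)))))
        (solve 5 (λ K P e s t → K :* (P :* (κ 1 :+ e)) :+ s :* (K :* P :* t) := K :* P :* (κ 1 :+ e :+ s :* t)) refl (binomF n k) P η (ι (suc k)) τ)))))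
    where
    0≤x : 0F ≤ binomF n k * P * τ
    0≤x = 0≤* (0≤* (0≤binomF n k) 0≤P) 0≤τ
    each : ∀ r → r ℕ.≤ k → overlapTerm n k r * Ψ r ≤ overlapTerm n k r * (P * (1F + η)) + binomF n k * P * τ
    each r r≤k with 4 ℕ.* r ℕP.≤? k
    ... | yes h = ≤-tr (*-monoˡ _ (0≤overlapTerm n k r) (small r h)) (≤-+ʳ 0≤x)
    ... | no h = ≤-tr (large r r≤k (ℕP.≰⇒> h)) (≤-+ˡ (0≤* (0≤overlapTerm n k r) (0≤* 0≤P (0≤+ 0≤1 0≤η))))

  -- For small overlaps the sum of C(r, i) is evaluated by `overlap-binom≤`, which yields the gain
  -- (k/n)^i. For large ones C(r, i) ≤ C(k, i) is crude, but τ compensates.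
  commonSum-bound : ∀ n k (Ψ : ℕ → F) P τ p w W i → i ℕ.≤ k → k ℕ.≤ n → 0F ≤ P → 0F ≤ τ → 0F ≤ p → 0F ≤ w → w ≤ 1F → 0F ≤ W →
    (∀ r → 0F ≤ Ψ r) →
    (∀ r → 4 ℕ.* r ℕ.≤ k → Ψ r ≤ P * ι 2) →
    (∀ r → 4 ℕ.* r ℕ.≤ k → w ^^ (2 ℕ.* k ℕ.∸ r) ≤ W) →
    (∀ r → r ℕ.≤ k → k ℕ.< 4 ℕ.* r → overlapTerm n k r * Ψ r ≤ binomF n k * P * τ) →
    ι n ^^ i * overlapSum n k (λ r → binomF r i * p ^^ i * w ^^ (2 ℕ.* k ℕ.∸ r) * Ψ r)
      ≤ binomF n k * P * (binomF k i * p ^^ i) * (ι 2 * W * ι k ^^ i + ι n ^^ i * (ι (suc k) * τ))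
  commonSum-bound n k Ψ P τ p w W i i≤k k≤n 0≤P 0≤τ 0≤p 0≤w w≤1 0≤W 0≤Ψ small smallW large = ≤-tr
    (*-monoˡ (ι n ^^ i) (0≤^^ (0≤ι n) i) (≤-tr (≤-rf (overlapSum-term n k _)) (≤-tr (ΣL-mono∈ (range (suc k)) (λ r j → each r (ℕP.≤-pred (range-< j))))
      (≤-rf (trans (ΣL-+ (range (suc k)) _ _) (cong₂ _+_ (ΣL-*ʳ (range (suc k)) (p ^^ i * W * (P * ι 2)) _)
        (trans (ΣL-const (range (suc k)) y) (cong (λ z → ι z * y) (length-range (suc k))))))))))
    (≤-tr (≤-rf (solve 4 (λ N S A B → N :* (S :* A :+ B) := N :* S :* A :+ N :* B) refl (ι n ^^ i) S (p ^^ i * W * (P * ι 2)) (ι (suc k) * y)))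
     (≤-tr (+-mono (*-monoʳ (p ^^ i * W * (P * ι 2)) (0≤* (0≤* (0≤^^ 0≤p i) 0≤W) (0≤* 0≤P 0≤2))
        (≤-tr (≤-rf (cong (ι n ^^ i *_) (sym (overlapSum-term n k (λ r → binomF r i))))) (overlap-binom≤ n k i i≤k k≤n))) ≤-refl)
      (≤-rf (solve 9 (λ K P C π W q N s t → K :* (C :* q) :* (π :* W :* (P :* κ 2)) :+ N :* (s :* (C :* π :* (K :* P :* t)))
         := K :* P :* (C :* π) :* (κ 2 :* W :* q :+ N :* (s :* t))) refl (binomF n k) P (binomF k i) (p ^^ i) W (ι k ^^ i) (ι n ^^ i) (ι (suc k)) τ))))
    where
    S = ΣL (range (suc k)) (λ r → overlapTerm n k r * binomF r i)
    y = binomF k i * p ^^ i * (binomF n k * P * τ)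
    0≤y : 0F ≤ y
    0≤y = 0≤* (0≤* (0≤binomF k i) (0≤^^ 0≤p i)) (0≤* (0≤* (0≤binomF n k) 0≤P) 0≤τ)
    each : ∀ r → r ℕ.≤ k → overlapTerm n k r * (binomF r i * p ^^ i * w ^^ (2 ℕ.* k ℕ.∸ r) * Ψ r)
      ≤ overlapTerm n k r * binomF r i * (p ^^ i * W * (P * ι 2)) + y
    each r r≤k with 4 ℕ.* r ℕP.≤? k
    ... | yes h = ≤-tr (≤-tr (*-monoˡ (overlapTerm n k r) (0≤overlapTerm n k r) (*-mono (0≤* (0≤* (0≤binomF r i) (0≤^^ 0≤p i)) (0≤^^ 0≤w (2 ℕ.* k ℕ.∸ r)))
            (*-monoˡ (binomF r i * p ^^ i) (0≤* (0≤binomF r i) (0≤^^ 0≤p i)) (smallW r h)) (0≤Ψ r) (small r h)))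
          (≤-rf (solve 5 (λ t b π W x → t :* (b :* π :* W :* x) := t :* b :* (π :* W :* x)) refl (overlapTerm n k r) (binomF r i) (p ^^ i) W (P * ι 2)))) (≤-+ʳ 0≤y)
    ... | no h = ≤-tr (≤-tr (≤-rf (solve 5 (λ t b π v x → t :* (b :* π :* v :* x) := b :* π :* v :* (t :* x)) refl (overlapTerm n k r) (binomF r i) (p ^^ i) (w ^^ (2 ℕ.* k ℕ.∸ r)) (Ψ r)))
          (*-mono (0≤* (0≤* (0≤binomF r i) (0≤^^ 0≤p i)) (0≤^^ 0≤w (2 ℕ.* k ℕ.∸ r)))
            (≤-tr (*≤ʳ (0≤* (0≤binomF r i) (0≤^^ 0≤p i)) (^^≤1 0≤w w≤1 (2 ℕ.* k ℕ.∸ r))) (*-monoʳ (p ^^ i) (0≤^^ 0≤p i) (ι-mono (binom-mono i r≤k))))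
            (0≤* (0≤overlapTerm n k r) (0≤Ψ r)) (large r r≤k (ℕP.≰⇒> h))))
        (≤-+ˡ (0≤* (0≤* (0≤overlapTerm n k r) (0≤binomF r i)) (0≤* (0≤* (0≤^^ 0≤p i) 0≤W) (0≤* 0≤P 0≤2))))

-- Second-moment weights near the threshold.

module Regimes where

  open OrderedField
  open Inequalities
  open FiniteSums
  open RandomSubsets
  open Domination
  open Moments
  open EdgeDeletion
  open Overlaps
  open import Data.Nat as ℕ using (ℕ; zero; suc; z≤n; s≤s; _!)
  open import Data.Nat.Properties using (_!≢0)
  import Data.Nat.Properties as ℕP
  open import Data.Nat.Combinatorics using (_C_; nCk≡nC[n∸k])
  import Data.Nat.Solver as ℕSolver
  open import Relation.Nullary using (Dec; yes; no)
  open import Relation.Nullary.Decidable using (True; toWitness)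
  open import Relation.Binary.PropositionalEquality

  module ℕS = ℕSolver.+-*-Solver

  numeral-≤ : ∀ a b {h : True (a ℕP.≤? b)} → a ℕ.≤ b
  numeral-≤ a b {h} = toWitness h

  ^-distribʳ-* : ∀ e a b → (a ℕ.* b) ℕ.^ e ≡ a ℕ.^ e ℕ.* b ℕ.^ e
  ^-distribʳ-* zero a b = refl
  ^-distribʳ-* (suc e) a b = trans (cong (a ℕ.* b ℕ.*_) (^-distribʳ-* e a b)) (ℕS.solve 4 (λ a b x y → a ℕS.:* b ℕS.:* (x ℕS.:* y) ℕS.:= a ℕS.:* x ℕS.:* (b ℕS.:* y)) refl a b (a ℕ.^ e) (b ℕ.^ e))

  -- The chain x ≤ a/N ≤ 1/T ≤ η without division.
  scaled : ∀ N a T {η x} → 1 ℕ.≤ N → 0F ≤ η → ι N * x ≤ ι a → a ℕ.* T ℕ.≤ N → 1F ≤ ι T * η → x ≤ η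
  scaled N a T {η} {x} 1≤N 0≤η h h′ h″ = *-cancelˡ (ι N) (0<ι 1≤N) (≤-tr h (≤-tr (≤*ʳ (0≤ι a) h″)
    (≤-tr (≤-rf (trans (sym (*-assoc (ι a) (ι T) η)) (cong (_* η) (sym (ι-* a T))))) (*-monoʳ η 0≤η (ι-mono h′)))))

  -- Comparing powers of x allows fractional exponents of n in integer arithmetic.
  scaled-root : ∀ N a T {η x} m → 1 ℕ.≤ N → 0F ≤ η → ι N * x ^^ suc m ≤ ι a → a ℕ.* T ℕ.^ suc m ℕ.≤ N → 1F ≤ ι T * η → x ≤ η
  scaled-root N a T {η} {x} m 1≤N 0≤η h h′ h″ = ^^-root 0≤η m (scaled N a (T ℕ.^ suc m) 1≤N (0≤^^ 0≤η (suc m)) h h′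
    (≤-tr (1≤^^ h″ (suc m)) (≤-rf (trans (^^-*-dist (ι T) η (suc m)) (cong (_* η ^^ suc m) (sym (ι-^ T (suc m))))))))

  binom≤^ : ∀ b i → binom b i ℕ.≤ b ℕ.^ i
  binom≤^ b i = ℕP.≤-trans (ℕP.m≤n*m (binom b i) (i !) {{i !≢0}}) (factorial-binom b i)

  binom-sym : ∀ i r → binom (i ℕ.+ r) r ≡ binom (i ℕ.+ r) i
  binom-sym i r = trans (binom≡C (i ℕ.+ r) r) (trans (nCk≡nC[n∸k] (ℕP.m≤n+m r i)) (trans (cong ((i ℕ.+ r) C_) (ℕP.m+n∸n≡m i r)) (sym (binom≡C (i ℕ.+ r) i))))

  binom≤2^ : ∀ k r → binom k r ℕ.≤ 2 ℕ.^ k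
  binom≤2^ zero zero = ℕP.≤-refl
  binom≤2^ zero (suc r) = z≤n
  binom≤2^ (suc k) zero = ℕP.≤-trans (binom≤2^ k zero) (ℕP.m≤m+n _ _)
  binom≤2^ (suc k) (suc r) = ℕP.≤-trans (ℕP.+-mono-≤ (binom≤2^ k r) (binom≤2^ k (suc r))) (ℕP.≤-reflexive (cong (2 ℕ.^ k ℕ.+_) (sym (ℕP.+-identityʳ _))))

  -- 1 - (1 - p)^i is the sum of p(1 - p)^j over j < i, and each term is at least p(1 - p)^i.
  geometric-gap : ∀ {p} → 0F ≤ p → p ≤ 1F → ∀ i → ι i * p * (1F - p) ^^ i ≤ 1F - (1F - p) ^^ i
  geometric-gap {p} h h′ zero = ≤-rf (solve 1 (λ p → κ 0 :* p :* κ 1 := κ 1 :- κ 1) refl p)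
  geometric-gap {p} h h′ (suc i) = ≤-tr (*-monoˡ (ι (suc i) * p) (0≤* (0≤ι (suc i)) h) (*≤ˡ (0≤^^ (0≤diff h′) i) (1-x≤1 h)))
    (≤-tr (≤-rf (cong (λ z → z * p * x) (ι-suc i))) (≤-diff _ (0≤diff (geometric-gap h h′ i))
      (solve 3 (λ p i x → κ 1 :- (κ 1 :- p) :* x :- (κ 1 :+ i) :* p :* x := κ 1 :- x :- i :* p :* x) refl p (ι i) x)))
    where x = (1F - p) ^^ i

  -- L is log₂ n up to a factor 2; R and c are constants, and Z exceeds a prescribed constant times L.
  -- Overlaps of at least k/4 will be shown to contribute a fraction of order 2^(−J).
  record Regime (n k L Z R c J : ℕ) (p : F) : Set where
    field
      0≤p : 0F ≤ p
      p≤1 : p ≤ 1F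
      1≤k : 1 ℕ.≤ k
      32≤L : 32 ℕ.≤ L
      2^L≤n : 2 ℕ.^ L ℕ.≤ n
      n≤2^2L : n ℕ.≤ 2 ℕ.^ (2 ℕ.* L)
      1024≤Z : 1024 ℕ.≤ Z
      L≤Z : L ℕ.≤ Z
      poly : Z ℕ.^ 128 ℕ.* k ℕ.^ 3 ℕ.≤ n
      1≤Rρ : 1F ≤ ι R * (1F - p)
      nq≤ : ι n * (1F - p) ^^ k ≤ ι (8 ℕ.* L ℕ.* k)
      ≤nqp : ι (L ℕ.* L) ≤ ι c * (ι n * (1F - p) ^^ k * p)
      1≤c : 1 ℕ.≤ c
      c≤L : 1024 ℕ.* c ℕ.≤ L
      kp≤ : ι k * p ≤ ι (8 ℕ.* L)
      2^J≤ : ι 2 ^^ J ≤ binomF n k * (1F - (1F - p) ^^ k) ^^ (n ℕ.∸ k)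
      J≤ : 32 ℕ.* J ℕ.≤ L ℕ.* k

    q ρ P₁ : F
    ρ = 1F - p
    q = ρ ^^ k
    P₁ = (1F - q) ^^ (n ℕ.∸ k)

    0≤ρ : 0F ≤ ρ
    0≤ρ = 0≤diff p≤1

    ρ≤1 : ρ ≤ 1F
    ρ≤1 = 1-x≤1 0≤p

    0≤q : 0F ≤ q
    0≤q = 0≤^^ 0≤ρ k

    q≤1 : q ≤ 1F
    q≤1 = ^^≤1 0≤ρ ρ≤1 k

    0≤P₁ : 0F ≤ P₁
    0≤P₁ = 0≤^^ (0≤diff q≤1) (n ℕ.∸ k)

    1≤Z : 1 ℕ.≤ Z
    1≤Z = ℕP.≤-trans (numeral-≤ 1 1024) 1024≤Z

    1≤L : 1 ℕ.≤ L
    1≤L = ℕP.≤-trans (numeral-≤ 1 32) 32≤L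

    Z^mono : ∀ {i j} → i ℕ.≤ j → Z ℕ.^ i ℕ.≤ Z ℕ.^ j
    Z^mono h = ℕP.^-monoʳ-≤ Z {{ℕ.>-nonZero 1≤Z}} h

    k^mono : ∀ {i j} → i ℕ.≤ j → k ℕ.^ i ℕ.≤ k ℕ.^ j
    k^mono h = ℕP.^-monoʳ-≤ k {{ℕ.>-nonZero 1≤k}} h

    -- Constants and polylogarithmic factors are all measured in powers of Z; the field `poly`
    -- leaves room for Z^128 next to k³.
    poly-use : ∀ {c} i j → c ℕ.≤ Z ℕ.^ i → i ℕ.≤ 128 → j ℕ.≤ 3 → c ℕ.* k ℕ.^ j ℕ.≤ n
    poly-use i j h i≤ j≤ = ℕP.≤-trans (ℕP.*-mono-≤ (ℕP.≤-trans h (Z^mono i≤)) (k^mono j≤)) poly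

    poly-pow : ∀ {c} e i j → c ℕ.≤ Z ℕ.^ i → i ℕ.≤ 128 ℕ.* e → j ℕ.≤ 3 ℕ.* e → c ℕ.* k ℕ.^ j ℕ.≤ n ℕ.^ e
    poly-pow e i j h i≤ j≤ = ℕP.≤-trans (ℕP.*-mono-≤ (ℕP.≤-trans h (Z^mono i≤)) (k^mono j≤)) (ℕP.≤-trans
      (ℕP.≤-reflexive (trans (cong₂ ℕ._*_ (sym (ℕP.^-*-assoc Z 128 e)) (sym (ℕP.^-*-assoc k 3 e))) (sym (^-distribʳ-* e (Z ℕ.^ 128) (k ℕ.^ 3))))) (ℕP.^-monoˡ-≤ e poly))

    Z* : ∀ {a b} i j → a ℕ.≤ Z ℕ.^ i → b ℕ.≤ Z ℕ.^ j → a ℕ.* b ℕ.≤ Z ℕ.^ (i ℕ.+ j)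
    Z* i j h h′ = ℕP.≤-trans (ℕP.*-mono-≤ h h′) (ℕP.≤-reflexive (sym (ℕP.^-distribˡ-+-* Z i j)))

    Z^ : ∀ {a} i e → a ℕ.≤ Z ℕ.^ i → a ℕ.^ e ℕ.≤ Z ℕ.^ (i ℕ.* e)
    Z^ i e h = ℕP.≤-trans (ℕP.^-monoˡ-≤ e h) (ℕP.≤-reflexive (ℕP.^-*-assoc Z i e))

    ≤Z : ∀ {a} → a ℕ.≤ Z → a ℕ.≤ Z ℕ.^ 1
    ≤Z h = ℕP.≤-trans h (ℕP.≤-reflexive (sym (ℕP.^-identityʳ Z)))

    numZ : ∀ a {h : True (a ℕP.≤? 1024)} → a ℕ.≤ Z ℕ.^ 1
    numZ a {h} = ≤Z (ℕP.≤-trans (toWitness h) 1024≤Z)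

    LZ : L ℕ.≤ Z ℕ.^ 1
    LZ = ≤Z L≤Z

    k³≤n : k ℕ.^ 3 ℕ.≤ n
    k³≤n = ℕP.≤-trans (ℕP.≤-reflexive (sym (ℕP.*-identityˡ _))) (poly-use {1} 0 3 ℕP.≤-refl z≤n ℕP.≤-refl)

    c*k≤n : ∀ c → c ℕ.≤ Z ℕ.^ 1 → c ℕ.* k ℕ.≤ n
    c*k≤n c h = ℕP.≤-trans (ℕP.≤-reflexive (cong (c ℕ.*_) (sym (ℕP.^-identityʳ k)))) (poly-use 1 1 h (numeral-≤ 1 128) (numeral-≤ 1 3))

    k≤n : k ℕ.≤ n
    k≤n = ℕP.≤-trans (ℕP.m≤n*m k 4) (c*k≤n 4 (numZ 4))

    1≤n : 1 ℕ.≤ n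
    1≤n = ℕP.≤-trans 1≤k k≤n

    0<n : 0F < ι n
    0<n = 0<ι 1≤n

    e : ℕ
    e = n ℕ.∸ (2 ℕ.* k ℕ.+ 1)

    2[2k+1]≤n : 2 ℕ.* (2 ℕ.* k ℕ.+ 1) ℕ.≤ n
    2[2k+1]≤n = ℕP.≤-trans (ℕP.*-monoʳ-≤ 2 (ℕP.+-monoʳ-≤ (2 ℕ.* k) 1≤k)) (ℕP.≤-trans (ℕP.≤-reflexive (ℕS.solve 1 (λ k → ℕS.con 2 ℕS.:* (ℕS.con 2 ℕS.:* k ℕS.:+ k) ℕS.:= ℕS.con 6 ℕS.:* k) refl k)) (c*k≤n 6 (numZ 6)))

    2k+1≤n : 2 ℕ.* k ℕ.+ 1 ℕ.≤ n
    2k+1≤n = ℕP.≤-trans (ℕP.m≤n*m (2 ℕ.* k ℕ.+ 1) 2) 2[2k+1]≤n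

    n∸k≡ : n ℕ.∸ k ≡ e ℕ.+ suc k
    n∸k≡ = trans (cong (ℕ._∸ k) (sym (ℕP.m∸n+n≡m 2k+1≤n))) (trans (cong (ℕ._∸ k) (ℕS.solve 2 (λ e k → e ℕS.:+ (ℕS.con 2 ℕS.:* k ℕS.:+ ℕS.con 1) ℕS.:= (e ℕS.:+ (ℕS.con 1 ℕS.:+ k)) ℕS.:+ k) refl e k)) (ℕP.m+n∸n≡m (e ℕ.+ suc k) k))

    n≤2e : ι n ≤ ι 2 * ι e
    n≤2e = ≤-tr (≤-diff _ (0≤diff (ι-mono 2[2k+1]≤n)) (trans (solve 2 (λ n k → κ 2 :* (n :- k) :- n := n :- κ 2 :* k) refl (ι n) (ι (2 ℕ.* k ℕ.+ 1))) (cong (λ z → ι n - z) (sym (ι-* 2 (2 ℕ.* k ℕ.+ 1)))))) (≤-rf (cong (ι 2 *_) (sym (ι-∸ 2k+1≤n))))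

    -- The cost of shortening the exponent n - k of `P₁` to `e`, a difference of k + 1. It is close
    -- to 1 since kq is small.
    U : F
    U = (1F + ι 2 * q) ^^ suc k

    nkq : ∀ a → ι n * (ι a * (ι (suc k) * q)) ≤ ι (a ℕ.* (suc k ℕ.* (8 ℕ.* L ℕ.* k)))
    nkq a = ≤-tr (≤-rf (solve 4 (λ n a k q → n :* (a :* (k :* q)) := a :* (k :* (n :* q))) refl (ι n) (ι a) (ι (suc k)) q))
      (≤-tr (*-monoˡ (ι a) (0≤ι a) (*-monoˡ (ι (suc k)) (0≤ι (suc k)) nq≤)) (≤-rf (sym (trans (ι-* a (suc k ℕ.* (8 ℕ.* L ℕ.* k))) (cong (ι a *_) (ι-* (suc k) (8 ℕ.* L ℕ.* k)))))))

    kq-small : ∀ {T η} → T ℕ.≤ Z → 0F ≤ η → 1F ≤ ι T * η → ι 4 * (ι (suc k) * q) ≤ η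
    kq-small {T} T≤Z 0≤η h = scaled n (4 ℕ.* (suc k ℕ.* (8 ℕ.* L ℕ.* k))) T 1≤n 0≤η (nkq 4) (ℕP.≤-trans (ℕP.*-monoˡ-≤ T (ℕP.*-monoʳ-≤ 4 (ℕP.*-monoˡ-≤ (8 ℕ.* L ℕ.* k) (s≤k))))
        (ℕP.≤-trans (ℕP.≤-reflexive (ℕS.solve 3 (λ k L T → ℕS.con 4 ℕS.:* (ℕS.con 2 ℕS.:* k ℕS.:* (ℕS.con 8 ℕS.:* L ℕS.:* k)) ℕS.:* T ℕS.:= ℕS.con 64 ℕS.:* (L ℕS.:* T) ℕS.:* (k ℕS.:^ 2)) refl k L T))
          (poly-use 3 2 (Z* 1 2 (numZ 64) (Z* 1 1 LZ (≤Z T≤Z))) (numeral-≤ 3 128) (numeral-≤ 2 3)))) h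
      where
      s≤k : suc k ℕ.≤ 2 ℕ.* k
      s≤k = ℕP.≤-trans (ℕP.+-monoˡ-≤ k 1≤k) (ℕP.≤-reflexive (cong (k ℕ.+_) (sym (ℕP.+-identityʳ k))))

    4q≤kq : ι 4 * q ≤ ι 4 * (ι (suc k) * q)
    4q≤kq = *-monoˡ (ι 4) 0≤4 (≤-tr (≤-rf (sym (*-identityˡ q))) (*-monoʳ q 0≤q (1≤ι {suc k} (s≤s z≤n))))

    kq≤¼ : ι 4 * (ι 4 * (ι (suc k) * q)) ≤ 1F
    kq≤¼ = scaled n (16 ℕ.* (suc k ℕ.* (8 ℕ.* L ℕ.* k))) 1 1≤n 0≤1 (≤-tr (≤-rf (solve 2 (λ n x → n :* (κ 4 :* (κ 4 :* x)) := n :* (κ 16 :* x)) refl (ι n) (ι (suc k) * q))) (nkq 16))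
        (ℕP.≤-trans (ℕP.*-monoˡ-≤ 1 (ℕP.*-monoʳ-≤ 16 (ℕP.*-monoˡ-≤ (8 ℕ.* L ℕ.* k) (ℕP.≤-trans (ℕP.+-monoˡ-≤ k 1≤k) (ℕP.≤-reflexive (cong (k ℕ.+_) (sym (ℕP.+-identityʳ k))))))))
          (ℕP.≤-trans (ℕP.≤-reflexive (ℕS.solve 2 (λ k L → ℕS.con 16 ℕS.:* (ℕS.con 2 ℕS.:* k ℕS.:* (ℕS.con 8 ℕS.:* L ℕS.:* k)) ℕS.:* ℕS.con 1 ℕS.:= ℕS.con 256 ℕS.:* L ℕS.:* (k ℕS.:^ 2)) refl k L))
            (poly-use 2 2 (Z* 1 1 (numZ 256) LZ) (numeral-≤ 2 128) (numeral-≤ 2 3)))) (≤-rf (sym (*-identityˡ 1F)))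

    4kq≤1 : ι 4 * (ι (suc k) * q) ≤ 1F
    4kq≤1 = ≤-tr (≤-tr (≤-rf (sym (*-identityˡ _))) (*-monoʳ (ι 4 * (ι (suc k) * q)) (0≤* 0≤4 (0≤* (0≤ι (suc k)) 0≤q)) (1≤ι {4} (s≤s z≤n)))) kq≤¼

    4q≤1 : ι 4 * q ≤ 1F
    4q≤1 = ≤-tr 4q≤kq 4kq≤1

    U≤ : U ≤ 1F + ι 4 * (ι (suc k) * q)
    U≤ = ≤-tr (1+x^n≤1+2nx (0≤* 0≤2 0≤q) (suc k) (≤-tr (≤-rf (eq)) 4kq≤1)) (+-mono ≤-refl (≤-rf eq))
      where
      eq : ι 2 * (ι (suc k) * (ι 2 * q)) ≡ ι 4 * (ι (suc k) * q)
      eq = solve 2 (λ k q → κ 2 :* (k :* (κ 2 :* q)) := κ 4 :* (k :* q)) refl (ι (suc k)) q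

    0≤U : 0F ≤ U
    0≤U = 0≤^^ (0≤+ 0≤1 (0≤* 0≤2 0≤q)) (suc k)

    UU≤2 : U * U ≤ ι 2
    UU≤2 = ≤-tr (*-mono 0≤U U≤ 0≤U U≤) (*-cancelˡ (ι 4) (0<ι {4} (s≤s z≤n)) (≤-diff _ (0≤+ (0≤+ (0≤* 0≤2 (0≤diff kq≤¼)) (0≤* x≥0 (0≤diff kq≤¼))) (0≤diff (≤-tr 4kq≤1 (1≤ι {2} (s≤s z≤n)))))
        (solve 1 (λ x → κ 4 :* κ 2 :- κ 4 :* ((κ 1 :+ x) :* (κ 1 :+ x)) := κ 2 :* (κ 1 :- κ 4 :* x) :+ x :* (κ 1 :- κ 4 :* x) :+ (κ 2 :- x)) refl x))) 
      where
      x = ι 4 * (ι (suc k) * q)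
      x≥0 : 0F ≤ x
      x≥0 = 0≤* 0≤4 (0≤* (0≤ι (suc k)) 0≤q)

    U≤2 : U ≤ ι 2
    U≤2 = ≤-tr U≤ (+-mono ≤-refl 4kq≤1)

    -- Relative to the value (1 - q)² of independent events, an overlap costs at most the factor 1 +
    -- 2w; here w will be ρ^(2k - r), the probability that a vertex has no neighbour in D ∪ D′.
    pair-step : ∀ w → 0F ≤ w → 1F - ι 2 * q + w ≤ (1F - q) * (1F - q) * (1F + ι 2 * w)
    pair-step w 0≤w = ≤-diff _ (0≤+ (0≤sq q) (0≤* 0≤w (0≤+ (0≤diff 4q≤1) (0≤* 0≤2 (0≤sq q)))))
      (solve 2 (λ q w → (κ 1 :- q) :* (κ 1 :- q) :* (κ 1 :+ κ 2 :* w) :- (κ 1 :- κ 2 :* q :+ w) := q :* q :+ w :* ((κ 1 :- κ 4 :* q) :+ κ 2 :* (q :* q))) refl q w)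

    power-e : (1F - q) ^^ e ≤ P₁ * U
    power-e = ≤-tr (≤*ʳ (0≤^^ (0≤diff q≤1) e) (1≤^^ one (suc k))) (≤-rf (trans (cong ((1F - q) ^^ e *_) (^^-*-dist (1F - q) (1F + ι 2 * q) (suc k)))
        (trans (sym (*-assoc _ _ _)) (cong (_* U) (trans (sym (^^-+ (1F - q) e (suc k))) (cong ((1F - q) ^^_) (sym n∸k≡)))))))
      where
      one : 1F ≤ (1F - q) * (1F + ι 2 * q)
      one = ≤-diff _ (0≤* 0≤q (0≤+ (0≤diff 4q≤1) (0≤* 0≤2 0≤q))) (solve 1 (λ q → (κ 1 :- q) :* (κ 1 :+ κ 2 :* q) :- κ 1 := q :* ((κ 1 :- κ 4 :* q) :+ κ 2 :* q)) refl q)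

    e≤n : e ℕ.≤ n
    e≤n = ℕP.m∸n≤m n (2 ℕ.* k ℕ.+ 1)

    weight≤ : ∀ r w → 0F ≤ w → ρ ^^ (2 ℕ.* k ℕ.∸ r) ≡ w → overlapWeight p n k r ≤ P₁ * P₁ * (U * U) * (1F + ι 2 * w) ^^ n
    weight≤ r w 0≤w refl = ≤-tr (^^-mono (0≤pairProb 0≤p p≤1 k r) (pair-step w 0≤w) e)
      (≤-tr (≤-rf (trans (^^-*-dist ((1F - q) * (1F - q)) (1F + ι 2 * w) e) (cong (_* (1F + ι 2 * w) ^^ e) (^^-*-dist (1F - q) (1F - q) e))))
        (*-mono (0≤* a a) (≤-tr (*-mono a power-e a power-e) (≤-rf (solve 2 (λ p u → p :* u :* (p :* u) := p :* p :* (u :* u)) refl P₁ U))) (0≤^^ (0≤+ 0≤1 (0≤* 0≤2 0≤w)) e) (^^-monoʳ (≤-+ʳ (0≤* 0≤2 0≤w)) e≤n)))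
      where
      a : 0F ≤ (1F - q) ^^ e
      a = 0≤^^ (0≤diff q≤1) e

    8k∸ : ∀ {r} → 4 ℕ.* r ℕ.≤ k → 7 ℕ.* k ℕ.≤ 4 ℕ.* (2 ℕ.* k ℕ.∸ r)
    8k∸ {r} h = ℕP.≤-trans (ℕP.≤-reflexive (sym (trans (cong (ℕ._∸ k) (ℕS.solve 1 (λ k → ℕS.con 8 ℕS.:* k ℕS.:= ℕS.con 7 ℕS.:* k ℕS.:+ k) refl k)) (ℕP.m+n∸n≡m (7 ℕ.* k) k))))
      (ℕP.≤-trans (ℕP.∸-monoʳ-≤ (8 ℕ.* k) h) (ℕP.≤-reflexive (sym (trans (ℕP.*-distribˡ-∸ 4 (2 ℕ.* k) r) (cong (ℕ._∸ 4 ℕ.* r) (ℕS.solve 1 (λ k → ℕS.con 4 ℕS.:* (ℕS.con 2 ℕS.:* k) ℕS.:= ℕS.con 8 ℕS.:* k) refl k))))))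

    -- For r ≤ k/4 the union of the two sets has at least 7k/4 elements.
    w⁴≤q⁷ : ∀ {r} → 4 ℕ.* r ℕ.≤ k → (ρ ^^ (2 ℕ.* k ℕ.∸ r)) ^^ 4 ≤ q ^^ 7
    w⁴≤q⁷ {r} h = subst₂ _≤_ (^^-* ρ 4 (2 ℕ.* k ℕ.∸ r)) (^^-* ρ 7 k) (^^-anti 0≤ρ ρ≤1 (8k∸ {r} h))

    -- From nq ≤ 8Lk follows nw ≤ (8Lk)^(7/4) n^(-3/4), which is small because k³ is below n by a
    -- large power of Z. Fourth powers keep the exponents integral.
    nw-small : ∀ {T η r} → T ℕ.≤ Z → 0F ≤ η → 1F ≤ ι T * η → 4 ℕ.* r ℕ.≤ k → ι 4 * (ι n * ρ ^^ (2 ℕ.* k ℕ.∸ r)) ≤ η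
    nw-small {T} {η} {r} T≤Z 0≤η Tη h = scaled-root (n ℕ.^ 3) (256 ℕ.* (8 ℕ.* L ℕ.* k) ℕ.^ 7) T 3 (ℕP.^-monoˡ-≤ 3 1≤n) 0≤η
        (≤-tr (≤-rf (trans (cong (_* (ι 4 * (ι n * w)) ^^ 4) (ι-^ n 3)) (solve 2 (λ n w → n :* (n :* (n :* κ 1)) :* ((κ 4 :* (n :* w)) :* ((κ 4 :* (n :* w)) :* ((κ 4 :* (n :* w)) :* ((κ 4 :* (n :* w)) :* κ 1))))
            := κ 256 :* ((n :* (n :* (n :* (n :* (n :* (n :* (n :* κ 1))))))) :* (w :* (w :* (w :* (w :* κ 1)))))) refl (ι n) w)))
          (≤-tr (*-monoˡ (ι 256) (0≤ι 256) (≤-tr (*-monoˡ (ι n ^^ 7) (0≤^^ (0≤ι n) 7) (w⁴≤q⁷ {r} h)) (≤-tr (≤-rf (sym (^^-*-dist (ι n) q 7))) (≤-tr (^^-mono (0≤* (0≤ι n) 0≤q) nq≤ 7) (≤-rf (sym (ι-^ (8 ℕ.* L ℕ.* k) 7)))))))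
            (≤-rf (sym (ι-* 256 ((8 ℕ.* L ℕ.* k) ℕ.^ 7))))))
        (ℕP.≤-trans (ℕP.≤-reflexive (trans (cong (λ z → 256 ℕ.* z ℕ.* T ℕ.^ 4) (^-distribʳ-* 7 (8 ℕ.* L) k)) (ℕS.solve 4 (λ a b c d → a ℕS.:* (b ℕS.:* c) ℕS.:* d ℕS.:= a ℕS.:* b ℕS.:* d ℕS.:* c) refl 256 ((8 ℕ.* L) ℕ.^ 7) (k ℕ.^ 7) (T ℕ.^ 4))))
          (poly-pow 3 19 7 (Z* 15 4 (Z* 1 14 (numZ 256) (Z^ 2 7 (Z* 1 1 (numZ 8) LZ))) (Z^ 1 4 (≤Z T≤Z))) (numeral-≤ 19 384) (numeral-≤ 7 9))) Tη
      where w = ρ ^^ (2 ℕ.* k ℕ.∸ r)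

    -- Two factors `U` and the factor (1 + 2w)^n are each at most 1 + η, and (1 + η)³ ≤ 1 + 7η for η
    -- ≤ 1.
    weight-small : ∀ {T η} r → T ℕ.≤ Z → 0F ≤ η → η ≤ 1F → 1F ≤ ι T * η → 4 ℕ.* r ℕ.≤ k → overlapWeight p n k r ≤ P₁ * P₁ * (1F + ι 7 * η)
    weight-small {T} {η} r T≤Z 0≤η η≤1 Tη h = ≤-tr (weight≤ r w 0≤w refl) (≤-tr (≤-rf (*-assoc (P₁ * P₁) (U * U) _))
        (*-monoˡ (P₁ * P₁) (0≤sq P₁) (≤-tr (*-mono (0≤sq U) (*-mono 0≤U U′ 0≤U U′) (0≤^^ (0≤+ 0≤1 (0≤* 0≤2 0≤w)) n) B′)
          (≤-diff _ (0≤* 0≤η (0≤* (0≤diff η≤1) (0≤+ 0≤4 0≤η))) (solve 1 (λ x → κ 1 :+ κ 7 :* x :- (κ 1 :+ x) :* (κ 1 :+ x) :* (κ 1 :+ x) := x :* ((κ 1 :- x) :* (κ 4 :+ x))) refl η)))))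
      where
      w = ρ ^^ (2 ℕ.* k ℕ.∸ r)
      0≤w : 0F ≤ w
      0≤w = 0≤^^ 0≤ρ (2 ℕ.* k ℕ.∸ r)
      U′ : U ≤ 1F + η
      U′ = ≤-tr U≤ (+-mono ≤-refl (kq-small T≤Z 0≤η Tη))
      4nw : ι 2 * (ι n * (ι 2 * w)) ≡ ι 4 * (ι n * w)
      4nw = solve 2 (λ n w → κ 2 :* (n :* (κ 2 :* w)) := κ 4 :* (n :* w)) refl (ι n) w
      nws = nw-small {T} {η} {r} T≤Z 0≤η Tη h
      B′ : (1F + ι 2 * w) ^^ n ≤ 1F + η
      B′ = ≤-tr (1+x^n≤1+2nx (0≤* 0≤2 0≤w) n (≤-tr (≤-rf 4nw) (≤-tr nws η≤1))) (+-mono ≤-refl (≤-tr (≤-rf 4nw) nws))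

    ρ-split : ∀ i r → i ℕ.+ r ≡ k → ρ ^^ (2 ℕ.* k ℕ.∸ r) ≡ q * ρ ^^ i
    ρ-split i r refl = trans (cong (ρ ^^_) (trans (cong (ℕ._∸ r) (ℕS.solve 2 (λ i r → ℕS.con 2 ℕS.:* (i ℕS.:+ r) ℕS.:= (i ℕS.:+ r ℕS.:+ i) ℕS.:+ r) refl i r)) (ℕP.m+n∸n≡m (i ℕ.+ r ℕ.+ i) r))) (^^-+ ρ (i ℕ.+ r) i)

    n^≤2^ : ∀ i → n ℕ.^ i ℕ.≤ 2 ℕ.^ (2 ℕ.* L ℕ.* i)
    n^≤2^ i = ℕP.≤-trans (ℕP.^-monoˡ-≤ i n≤2^2L) (ℕP.≤-reflexive (ℕP.^-*-assoc 2 (2 ℕ.* L) i))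

    -- With i = k - r, both C(k, r) = C(k, i) and C(n - k, i) are at most n^i, and n ≤ 2^(2L).
    term≤2^ : ∀ i r → i ℕ.+ r ≡ k → overlapTerm n k r ≤ ι 2 ^^ (4 ℕ.* L ℕ.* i)
    term≤2^ i r e = ≤-tr (≤-rf (sym (ι-* (binom k r) (binom (n ℕ.∸ k) (k ℕ.∸ r))))) (≤-tr (ι-mono (ℕP.≤-trans (ℕP.*-mono-≤ left right)
        (ℕP.≤-reflexive (trans (sym (ℕP.^-distribˡ-+-* 2 (2 ℕ.* L ℕ.* i) (2 ℕ.* L ℕ.* i))) (cong (2 ℕ.^_) (ℕS.solve 2 (λ L i → ℕS.con 2 ℕS.:* L ℕS.:* i ℕS.:+ ℕS.con 2 ℕS.:* L ℕS.:* i ℕS.:= ℕS.con 4 ℕS.:* L ℕS.:* i) refl L i)))))) (≤-rf (ι-^ 2 (4 ℕ.* L ℕ.* i))))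
      where
      left : binom k r ℕ.≤ 2 ℕ.^ (2 ℕ.* L ℕ.* i)
      left = ℕP.≤-trans (ℕP.≤-trans (ℕP.≤-reflexive (trans (cong (λ z → binom z r) (sym e)) (trans (binom-sym i r) (cong (λ z → binom z i) e)))) (binom≤^ k i)) (ℕP.≤-trans (ℕP.^-monoˡ-≤ i k≤n) (n^≤2^ i))
      right : binom (n ℕ.∸ k) (k ℕ.∸ r) ℕ.≤ 2 ℕ.^ (2 ℕ.* L ℕ.* i)
      right = ℕP.≤-trans (ℕP.≤-reflexive (cong (binom (n ℕ.∸ k)) (trans (cong (ℕ._∸ r) (sym e)) (ℕP.m+n∸n≡m i r))))
        (ℕP.≤-trans (binom≤^ (n ℕ.∸ k) i) (ℕP.≤-trans (ℕP.^-monoˡ-≤ i (ℕP.m∸n≤m n k)) (n^≤2^ i)))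

    -- Overlaps so large that ρ^(k−r) is bounded below
    weight-near : ∀ i r → i ℕ.+ r ≡ k → 1F ≤ ι 64 * ρ ^^ i → overlapTerm n k r * overlapWeight p n k r ≤ P₁ * ι 2
    weight-near i r ek h = ≤-tr (*-mono (0≤overlapTerm n k r) (term≤2^ i r ek) (0≤^^ (0≤pairProb 0≤p p≤1 k r) e) weight≤′)
      (≤-tr (≤-rf (solve 3 (λ t d x → t :* (x :* d) := x :* (t :* d)) refl (ι 2 ^^ (4 ℕ.* L ℕ.* i)) ((1F - q * g) ^^ e) (P₁ * U)))
        (≤-tr (*≤ʳ (0≤* 0≤P₁ 0≤U) (decay (0≤* 0≤q 0≤g) qg≤1 (4 ℕ.* L ℕ.* i) e rate)) (*-monoˡ P₁ 0≤P₁ U≤2)))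
      where
      g = 1F - ρ ^^ i
      0≤g : 0F ≤ g
      0≤g = 0≤diff (^^≤1 0≤ρ ρ≤1 i)
      qg≤1 : q * g ≤ 1F
      qg≤1 = *≤1 0≤q q≤1 (1-x≤1 (0≤^^ 0≤ρ i))
      -- Uses 1 - 2q + qρ^i ≤ (1 - q)(1 - qg). The first factor becomes `P₁`; the second, through
      -- `decay`, beats the number 2^(4Li) of such overlaps.
      weight≤′ : overlapWeight p n k r ≤ P₁ * U * (1F - q * g) ^^ e
      weight≤′ = ≤-tr (^^-mono (0≤pairProb 0≤p p≤1 k r) (≤-tr (≤-rf (cong (1F - ι 2 * q +_) (ρ-split i r ek)))
          (≤-diff _ (0≤* (0≤sq q) 0≤g) (solve 2 (λ q x → (κ 1 :- q) :* (κ 1 :- q :* (κ 1 :- x)) :- (κ 1 :- κ 2 :* q :+ q :* x) := q :* q :* (κ 1 :- x)) refl q (ρ ^^ i)))) e)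
        (≤-tr (≤-rf (^^-*-dist (1F - q) (1F - q * g) e)) (*-monoʳ ((1F - q * g) ^^ e) (0≤^^ (0≤diff qg≤1) e) power-e))
      ip≤ : ι i * p ≤ ι 64 * g
      ip≤ = ≤-tr (≤-tr (≤*ʳ (0≤* (0≤ι i) 0≤p) h) (≤-rf (solve 3 (λ i p x → i :* p :* (κ 64 :* x) := κ 64 :* (i :* p :* x)) refl (ι i) p (ρ ^^ i)))) (*-monoˡ (ι 64) (0≤ι 64) (geometric-gap 0≤p p≤1 i))
      -- The 64 of the case assumption and n ≤ 2e give 128. Against the target 8Li this asks for
      -- 1024c ≤ L, the origin of the field `c≤L`.
      rate : ι (2 ℕ.* (4 ℕ.* L ℕ.* i)) ≤ ι e * (q * g)
      rate = *-cancelˡ (ι (128 ℕ.* c)) (0<ι (ℕP.≤-trans (numeral-≤ 1 128) (ℕP.≤-trans (ℕP.≤-reflexive (sym (ℕP.*-identityʳ 128))) (ℕP.*-monoʳ-≤ 128 1≤c))))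
        (≤-tr (≤-rf (sym (ι-* (128 ℕ.* c) (2 ℕ.* (4 ℕ.* L ℕ.* i))))) (≤-tr (ι-mono {n = L ℕ.* L ℕ.* i} (ℕP.≤-trans (ℕP.≤-reflexive (ℕS.solve 3 (λ c L i → ℕS.con 128 ℕS.:* c ℕS.:* (ℕS.con 2 ℕS.:* (ℕS.con 4 ℕS.:* L ℕS.:* i)) ℕS.:= ℕS.con 1024 ℕS.:* c ℕS.:* (L ℕS.:* i)) refl c L i))
            (ℕP.≤-trans (ℕP.*-monoˡ-≤ (L ℕ.* i) c≤L) (ℕP.≤-reflexive (sym (ℕP.*-assoc L L i))))))
          (≤-tr (≤-rf (ι-* (L ℕ.* L) i)) (≤-tr (*-monoʳ (ι i) (0≤ι i) (≤-tr ≤nqp (*-monoˡ (ι c) (0≤ι c) (*-monoʳ p 0≤p (*-monoʳ q 0≤q n≤2e)))))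
            (≤-tr (≤-rf (solve 5 (λ c e q p i → c :* (κ 2 :* e :* q :* p) :* i := c :* (κ 2 :* e :* q) :* (i :* p)) refl (ι c) (ι e) q p (ι i)))
              (≤-tr (*-monoˡ (ι c * (ι 2 * ι e * q)) (0≤* (0≤ι c) (0≤* (0≤* 0≤2 (0≤ι e)) 0≤q)) ip≤)
                (≤-rf (trans (solve 4 (λ c e q g → c :* (κ 2 :* e :* q) :* (κ 64 :* g) := κ 128 :* c :* (e :* (q :* g))) refl (ι c) (ι e) q g) (cong (_* (ι e * (q * g))) (sym (ι-* 128 c)))))))))))

    1≤KP : 1F ≤ binomF n k * P₁
    1≤KP = ≤-tr (1≤^^ (1≤ι {2} (s≤s z≤n)) J) 2^J≤

    -- At least one dominating k-set is expected, and (1 + q)(1 - q) ≤ 1; so (1 + q)^n is at most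
    -- about C(n, k). It is an upper bound on nq in exponential form.
    1+q^n≤ : (1F + q) ^^ n ≤ ι (2 ℕ.* n ℕ.^ k)
    1+q^n≤ = ≤-tr (≤*ʳ (0≤^^ 0≤1+q n) 1≤KP) (≤-tr (≤-rf (solve 3 (λ a b c → a :* (b :* c) := a :* c :* b) refl ((1F + q) ^^ n) (binomF n k) P₁))
      (≤-tr (*-mono (0≤* (0≤^^ 0≤1+q n) 0≤P₁) two (0≤binomF n k) (ι-mono (binom≤^ n k))) (≤-rf (sym (ι-* 2 (n ℕ.^ k))))))
      where
      0≤1+q : 0F ≤ 1F + q
      0≤1+q = 0≤+ 0≤1 0≤q
      two : (1F + q) ^^ n * P₁ ≤ ι 2
      two = ≤-tr (≤-rf (trans (cong (λ z → (1F + q) ^^ z * P₁) (sym (ℕP.m∸n+n≡m k≤n))) (trans (cong (_* P₁) (^^-+ (1F + q) (n ℕ.∸ k) k))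
          (trans (solve 3 (λ a b c → a :* b :* c := a :* c :* b) refl ((1F + q) ^^ (n ℕ.∸ k)) ((1F + q) ^^ k) P₁) (cong (_* (1F + q) ^^ k) (sym (^^-*-dist (1F + q) (1F - q) (n ℕ.∸ k))))))))
        (≤-tr (*≤ˡ (0≤^^ 0≤1+q k) (^^≤1 (0≤* 0≤1+q (0≤diff q≤1)) (≤-diff _ (0≤sq q) (solve 1 (λ q → κ 1 :- (κ 1 :+ q) :* (κ 1 :- q) := q :* q) refl q)) (n ℕ.∸ k)))
          (≤-tr (≤-tr (^^-mono 0≤1+q (+-mono ≤-refl (≤-tr (≤-rf (sym (*-identityˡ q))) (*-monoʳ q 0≤q (1≤ι {2} (s≤s z≤n))))) k) (^^-monoʳ (≤-+ʳ (0≤* 0≤2 0≤q)) (ℕP.n≤1+n k))) U≤2))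

    -- Budget in exponents of n: the powers of 2 take 4r, the power of k takes 6r because k³ ≤ n,
    -- and n^k takes 4r because k < 4r. Together 14r out of 16r.
    far-count : ∀ r → k ℕ.< 4 ℕ.* r → (2 ℕ.^ J ℕ.* 2 ℕ.^ k ℕ.* k ℕ.^ r) ℕ.^ 16 ℕ.* (2 ℕ.* n ℕ.^ k) ℕ.≤ (2 ℕ.* n ℕ.^ r) ℕ.^ 16
    far-count r h = ℕP.≤-trans (ℕP.*-mono-≤ (ℕP.≤-trans (ℕP.≤-reflexive (trans (^-distribʳ-* 16 (2 ℕ.^ J ℕ.* 2 ℕ.^ k) (k ℕ.^ r)) (cong (ℕ._* (k ℕ.^ r) ℕ.^ 16) pow2))) (ℕP.*-mono-≤ two-part k-part)) (ℕP.*-monoʳ-≤ 2 (n^mono (ℕP.<⇒≤ h))))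
        (ℕP.≤-trans (ℕP.≤-reflexive (trans (ℕS.solve 3 (λ a b c → a ℕS.:* b ℕS.:* (ℕS.con 2 ℕS.:* c) ℕS.:= ℕS.con 2 ℕS.:* (a ℕS.:* b ℕS.:* c)) refl (n ℕ.^ (4 ℕ.* r)) (n ℕ.^ (6 ℕ.* r)) (n ℕ.^ (4 ℕ.* r)))
            (cong (2 ℕ.*_) (trans (cong (ℕ._* n ℕ.^ (4 ℕ.* r)) (sym (ℕP.^-distribˡ-+-* n (4 ℕ.* r) (6 ℕ.* r)))) (sym (ℕP.^-distribˡ-+-* n (4 ℕ.* r ℕ.+ 6 ℕ.* r) (4 ℕ.* r)))))))
          (ℕP.≤-trans (ℕP.*-mono-≤ (numeral-≤ 2 (2 ℕ.^ 16)) (n^mono (ℕP.≤-trans (ℕP.≤-reflexive (ℕS.solve 1 (λ r → ℕS.con 4 ℕS.:* r ℕS.:+ ℕS.con 6 ℕS.:* r ℕS.:+ ℕS.con 4 ℕS.:* r ℕS.:= r ℕS.:* ℕS.con 14) refl r)) (ℕP.*-monoʳ-≤ r (numeral-≤ 14 16)))))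
            (ℕP.≤-reflexive (trans (cong (2 ℕ.^ 16 ℕ.*_) (sym (ℕP.^-*-assoc n r 16))) (sym (^-distribʳ-* 16 2 (n ℕ.^ r)))))))
      where
      n^mono : ∀ {i j} → i ℕ.≤ j → n ℕ.^ i ℕ.≤ n ℕ.^ j
      n^mono = ℕP.^-monoʳ-≤ n {{ℕ.>-nonZero 1≤n}}
      pow2 : (2 ℕ.^ J ℕ.* 2 ℕ.^ k) ℕ.^ 16 ≡ 2 ℕ.^ ((J ℕ.+ k) ℕ.* 16)
      pow2 = trans (cong (ℕ._^ 16) (sym (ℕP.^-distribˡ-+-* 2 J k))) (ℕP.^-*-assoc 2 (J ℕ.+ k) 16)
      double : 2 ℕ.* ((J ℕ.+ k) ℕ.* 16) ℕ.≤ 2 ℕ.* (L ℕ.* k)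
      double = ℕP.≤-trans (ℕP.≤-reflexive (ℕS.solve 2 (λ J k → ℕS.con 2 ℕS.:* ((J ℕS.:+ k) ℕS.:* ℕS.con 16) ℕS.:= ℕS.con 32 ℕS.:* J ℕS.:+ ℕS.con 32 ℕS.:* k) refl J k))
        (ℕP.≤-trans (ℕP.+-mono-≤ J≤ (ℕP.*-monoˡ-≤ k 32≤L)) (ℕP.≤-reflexive (cong (L ℕ.* k ℕ.+_) (sym (ℕP.+-identityʳ _)))))
      two-part : 2 ℕ.^ ((J ℕ.+ k) ℕ.* 16) ℕ.≤ n ℕ.^ (4 ℕ.* r)
      two-part = ℕP.≤-trans (ℕP.^-monoʳ-≤ 2 (ℕP.*-cancelˡ-≤ {(J ℕ.+ k) ℕ.* 16} {L ℕ.* k} 2 double)) (ℕP.≤-trans (ℕP.≤-reflexive (sym (ℕP.^-*-assoc 2 L k))) (ℕP.≤-trans (ℕP.^-monoˡ-≤ k 2^L≤n) (n^mono (ℕP.<⇒≤ h))))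
      k-part : (k ℕ.^ r) ℕ.^ 16 ℕ.≤ n ℕ.^ (6 ℕ.* r)
      k-part = ℕP.≤-trans (ℕP.≤-reflexive (ℕP.^-*-assoc k r 16)) (ℕP.≤-trans (k^mono (ℕP.≤-trans (ℕP.*-monoʳ-≤ r (numeral-≤ 16 18)) (ℕP.≤-reflexive (ℕS.solve 1 (λ r → r ℕS.:* ℕS.con 18 ℕS.:= ℕS.con 3 ℕS.:* (ℕS.con 6 ℕS.:* r)) refl r))))
        (ℕP.≤-trans (ℕP.≤-reflexive (sym (ℕP.^-*-assoc k 3 (6 ℕ.* r)))) (ℕP.^-monoˡ-≤ (6 ℕ.* r) k³≤n)))

    -- Overlaps r > k/4 with ρ^(k−r) small; the loss (1 + 2w)^n is controlled through its 16th power.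
    weight-far : ∀ i r → r ℕ.≤ k → k ℕ.< 4 ℕ.* r → i ℕ.+ r ≡ k → ι 64 * ρ ^^ i ≤ 1F → ι 2 ^^ J * (overlapTerm n k r * overlapWeight p n k r) ≤ binomF n k * (P₁ * P₁) * ι 4
    weight-far i r r≤k h ek small = *-cancelˡ (ι n ^^ r) (0<^^ 0<n r) (≤-tr
        (≤-rf (solve 4 (λ N j t x → N :* (j :* (t :* x)) := j :* (N :* t) :* x) refl (ι n ^^ r) (ι 2 ^^ J) (overlapTerm n k r) (overlapWeight p n k r)))
        (≤-tr (*-mono (0≤* 0≤2J (0≤* (0≤^^ (0≤ι n) r) (0≤overlapTerm n k r))) (*-monoˡ (ι 2 ^^ J) 0≤2J (≤-tr (overlapTerm≤ n k r r≤k k≤n)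
              (*-monoˡ (binomF n k) (0≤binomF n k) (*-monoʳ (ι k ^^ r) (0≤^^ (0≤ι k) r) (≤-tr (ι-mono (binom≤2^ k r)) (≤-rf (ι-^ 2 k)))))))
            (0≤^^ (0≤pairProb 0≤p p≤1 k r) e)
            (≤-tr (weight≤ r w 0≤w (ρ-split i r ek)) (*-monoʳ B 0≤B (*-monoˡ (P₁ * P₁) (0≤sq P₁) UU≤2))))
          (≤-tr (≤-rf (solve 7 (λ j K c Q π B x → j :* (K :* (c :* Q)) :* (π :* x :* B) := K :* π :* x :* (j :* c :* Q :* B)) refl (ι 2 ^^ J) (binomF n k) (ι 2 ^^ k) (ι k ^^ r) (P₁ * P₁) B (ι 2)))
            (≤-tr (*-monoˡ (binomF n k * (P₁ * P₁) * ι 2) (0≤* (0≤* (0≤binomF n k) (0≤sq P₁)) 0≤2) root)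
              (≤-rf (solve 3 (λ K π N → K :* π :* κ 2 :* (κ 2 :* N) := N :* (K :* π :* κ 4)) refl (binomF n k) (P₁ * P₁) (ι n ^^ r)))))))
      where
      w = q * ρ ^^ i
      0≤w : 0F ≤ w
      0≤w = 0≤* 0≤q (0≤^^ 0≤ρ i)
      0≤2J : 0F ≤ ι 2 ^^ J
      0≤2J = 0≤^^ 0≤2 J
      B = (1F + ι 2 * w) ^^ n
      0≤B : 0F ≤ B
      0≤B = 0≤^^ (0≤+ 0≤1 (0≤* 0≤2 0≤w)) n
      64w≤q : ι 64 * w ≤ q
      64w≤q = ≤-tr (≤-rf (solve 2 (λ q x → κ 64 :* (q :* x) := q :* (κ 64 :* x)) refl q (ρ ^^ i))) (*≤ʳ 0≤q small)
      eq64 : ι 2 * (ι 16 * (ι 2 * w)) ≡ ι 64 * w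
      eq64 = solve 1 (λ w → κ 2 :* (κ 16 :* (κ 2 :* w)) := κ 64 :* w) refl w
      -- 64 = 2 · 16 · 2: sixteen factors 1 + 2w multiply to at most 1 + 64w ≤ 1 + q, so the loss is
      -- at most a sixteenth root of (1 + q)^n.
      B¹⁶ : B ^^ 16 ≤ (1F + q) ^^ n
      B¹⁶ = ≤-tr (≤-rf (trans (sym (^^-* (1F + ι 2 * w) 16 n)) (^^-*′ (1F + ι 2 * w) 16 n)))
        (^^-mono (0≤^^ (0≤+ 0≤1 (0≤* 0≤2 0≤w)) 16) (≤-tr (1+x^n≤1+2nx (0≤* 0≤2 0≤w) 16 (≤-tr (≤-rf eq64) (≤-tr 64w≤q q≤1))) (+-mono ≤-refl (≤-tr (≤-rf eq64) 64w≤q))) n)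
      a = 2 ℕ.^ J ℕ.* 2 ℕ.^ k ℕ.* k ℕ.^ r
      ιa : ι a ≡ ι 2 ^^ J * ι 2 ^^ k * ι k ^^ r
      ιa = trans (ι-* (2 ℕ.^ J ℕ.* 2 ℕ.^ k) (k ℕ.^ r)) (cong₂ _*_ (trans (ι-* (2 ℕ.^ J) (2 ℕ.^ k)) (cong₂ _*_ (ι-^ 2 J) (ι-^ 2 k))) (ι-^ k r))
      ιn : ι (2 ℕ.* n ℕ.^ r) ≡ ι 2 * ι n ^^ r
      ιn = trans (ι-* 2 (n ℕ.^ r)) (cong (ι 2 *_) (ι-^ n r))
      root : ι 2 ^^ J * ι 2 ^^ k * ι k ^^ r * B ≤ ι 2 * ι n ^^ r
      root = subst₂ (λ x y → x * B ≤ y) ιa ιn (^^-root (0≤ι (2 ℕ.* n ℕ.^ r)) 15 (≤-tr (≤-rf (^^-*-dist (ι a) B 16))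
        (≤-tr (*-mono (0≤^^ (0≤ι a) 16) (≤-rf (sym (ι-^ a 16))) (0≤^^ 0≤B 16) (≤-tr B¹⁶ 1+q^n≤))
          (≤-tr (≤-rf (sym (ι-* (a ℕ.^ 16) (2 ℕ.* n ℕ.^ k)))) (≤-tr (ι-mono (far-count r h)) (≤-rf (ι-^ (2 ℕ.* n ℕ.^ r) 16)))))))

    -- The near case yields 2`P₁`, which lacks a factor C(n, k)`P₁`. That factor is the expected
    -- number of dominating k-sets, at least 2^J, so both cases end with a fraction of at most
    -- 4/2^J.
    weight-large : ∀ τ → ι 2 ^^ J * τ ≡ ι 4 → ∀ r → r ℕ.≤ k → k ℕ.< 4 ℕ.* r → overlapTerm n k r * overlapWeight p n k r ≤ binomF n k * (P₁ * P₁) * τ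
    weight-large τ τ≡ r r≤k h = *-cancelˡ (ι 2 ^^ J) (0<^^ (0<ι {2} (s≤s z≤n)) J) (≤-tr (bound (1F ≤? ι 64 * ρ ^^ (k ℕ.∸ r)))
        (≤-rf (trans (cong (binomF n k * (P₁ * P₁) *_) (sym τ≡)) (solve 3 (λ x j t → x :* (j :* t) := j :* (x :* t)) refl (binomF n k * (P₁ * P₁)) (ι 2 ^^ J) τ))))
      where
      ek = ℕP.m∸n+n≡m r≤k
      bound : Dec (1F ≤ ι 64 * ρ ^^ (k ℕ.∸ r)) → ι 2 ^^ J * (overlapTerm n k r * overlapWeight p n k r) ≤ binomF n k * (P₁ * P₁) * ι 4
      bound (no x) = weight-far (k ℕ.∸ r) r r≤k h ek (<⇒≤ (≰⇒> x))
      bound (yes x) = ≤-tr (*-mono (0≤^^ 0≤2 J) 2^J≤ (0≤* (0≤overlapTerm n k r) (0≤^^ (0≤pairProb 0≤p p≤1 k r) e)) (weight-near (k ℕ.∸ r) r ek x))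
        (≤-diff _ (0≤* 0≤2 (0≤* (0≤binomF n k) (0≤sq P₁))) (solve 2 (λ K π → K :* (π :* π) :* κ 4 :- K :* π :* (π :* κ 2) := κ 2 :* (K :* (π :* π))) refl (binomF n k) P₁))

-- The probability that few deletions destroy all dominating k-sets.

module Resilience where

  open import Defs using (Graph) renaming (E to numPairs)
  open OrderedField
  open Inequalities
  open FiniteSums
  open RandomSubsets
  open Domination
  open Moments
  open EdgeDeletion
  open Overlaps
  open Regimes
  open import Data.Nat as ℕ using (ℕ; zero; suc; z≤n; s≤s; _!)
  import Data.Nat.Properties as ℕP
  open import Data.Nat.Properties using (_!≢0)
  open import Data.Product using (_×_; _,_)
  open import Data.Sum using (_⊎_; inj₁; inj₂)
  open import Data.Empty using (⊥-elim)
  open import Data.List using (allFin)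
  open import Data.Fin.Subset using (∣_∣; _∩_)
  open import Relation.Nullary using (yes; no)
  open import Relation.Binary.PropositionalEquality

  factorial-binom-lower : ∀ b i → i ℕ.≤ b → (b ℕ.∸ i) ℕ.^ i ℕ.≤ (i !) ℕ.* binom b i
  factorial-binom-lower b zero h = ℕP.≤-refl
  factorial-binom-lower b (suc i) h = ι-cancel-≤ (≤-tr (≤-rf (ι-* (b ℕ.∸ suc i) ((b ℕ.∸ suc i) ℕ.^ i)))
    (≤-tr (*-mono (0≤ι (b ℕ.∸ suc i)) (ι-mono (ℕP.∸-monoʳ-≤ b (ℕP.n≤1+n i))) (0≤ι ((b ℕ.∸ suc i) ℕ.^ i)) (≤-tr (ι-mono (ℕP.^-monoˡ-≤ i (ℕP.∸-monoʳ-≤ b (ℕP.n≤1+n i)))) (ι-mono (factorial-binom-lower b i (ℕP.<⇒≤ h)))))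
      (≤-rf (trans (cong₂ _*_ (ι-∸ (ℕP.<⇒≤ h)) (ι-* (i !) (binom b i))) (trans (solve 4 (λ b i f c → (b :- i) :* (f :* c) := f :* ((i :* c :+ (b :* c :- i :* c)) :- i :* c)) refl (ι b) (ι i) (ι (i !)) (binomF b i))
        (trans (cong (λ z → ι (i !) * (ι i * binomF b i + (z - ι i * binomF b i) - ι i * binomF b i)) (binomF-ratio b i))
          (trans (solve 4 (λ f x s c → f :* (x :+ (x :+ s :* c :- x) :- x) := s :* f :* c) refl (ι (i !)) (ι i * binomF b i) (ι (suc i)) (binomF b (suc i)))
            (sym (trans (ι-* (suc i ℕ.* (i !)) (binom b (suc i))) (cong (_* binomF b (suc i)) (ι-* (suc i) (i !)))))))))))) 

  -- From n^n ≤ n! C(2n, n) and C(2n, n) ≤ 4^n; a weak form of Stirling's lower bound.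
  n^n≤4^n*n! : ∀ n → n ℕ.^ n ℕ.≤ 4 ℕ.^ n ℕ.* (n !)
  n^n≤4^n*n! n = ℕP.≤-trans (ℕP.≤-reflexive (cong (ℕ._^ n) (sym (ℕP.m+n∸n≡m n n))))
    (ℕP.≤-trans (factorial-binom-lower (n ℕ.+ n) n (ℕP.m≤m+n n n)) (ℕP.≤-trans (ℕP.*-monoʳ-≤ (n !) (ℕP.≤-trans (binom≤2^ (n ℕ.+ n) n)
      (ℕP.≤-reflexive (trans (cong (2 ℕ.^_) (cong (n ℕ.+_) (sym (ℕP.+-identityʳ n)))) (sym (ℕP.^-*-assoc 2 2 n)))))) (ℕP.≤-reflexive (ℕP.*-comm (n !) (4 ℕ.^ n)))))

  scaled-by : ∀ N M a T {η x} → 1 ℕ.≤ N → 0F ≤ η → ι N * x ≤ ι a → a ℕ.* T ℕ.≤ N ℕ.* M → 1F ≤ ι T * η → x ≤ ι M * η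
  scaled-by N M a T {η} {x} 1≤N 0≤η h h′ h″ = *-cancelˡ (ι N) (0<ι 1≤N) (≤-tr h (≤-tr (≤*ʳ (0≤ι a) h″)
    (≤-tr (≤-rf (trans (sym (*-assoc (ι a) (ι T) η)) (cong (_* η) (sym (ι-* a T))))) (≤-tr (*-monoʳ η 0≤η (ι-mono h′)) (≤-rf (trans (cong (_* η) (ι-* N M)) (*-assoc (ι N) (ι M) η)))))))

  ½ : F
  ½ = inv (ι 2) (0<ι {2} (s≤s z≤n))

  -- Deleting s ≤ np/c₆ edges destroys all dominating k-sets with probability O(η). A set D is charged to a vertex v
  -- through the deleted edges from v to D, the light case being that of fewer than ℓ = 1 + ℓ′ neighbours of v in D.
  record Robustness (n k L Z R c J : ℕ) (p : F) (ℓ′ A s T : ℕ) (η : F) : Set where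
    field
      regime : Regime n k L Z R c J p
      1≤R : 1 ℕ.≤ R
      1≤A : 1 ℕ.≤ A
      L≤Aℓ : L ℕ.≤ A ℕ.* suc ℓ′
      s≤np : ι (1024 ℕ.* (A ℕ.* A) ℕ.* 2 ℕ.^ (4 ℕ.* A) ℕ.* s) ≤ ι n * p
      Y-small : ((64 ℕ.* R ℕ.* A) ℕ.^ suc ℓ′ ℕ.* (64 ℕ.* R ℕ.* A) ℕ.^ suc ℓ′ ℕ.* 2 ℕ.^ suc ℓ′) ℕ.^ 12 ℕ.≤ n
      J-large : 4 ℕ.* (L ℕ.* suc ℓ′) ℕ.+ 12 ℕ.* L ℕ.≤ J
      4T≤Z : 4 ℕ.* T ℕ.≤ Z
      0≤η : 0F ≤ η
      7η≤1 : ι 7 * η ≤ 1F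
      1≤Tη : 1F ≤ ι T * η

    open Regime regime public

    ℓ Y c₆ : ℕ
    ℓ = suc ℓ′
    Y = 64 ℕ.* R ℕ.* A
    c₆ = 1024 ℕ.* (A ℕ.* A) ℕ.* 2 ℕ.^ (4 ℕ.* A)

    K X̄ P² τ : F
    K = binomF n k
    X̄ = K * P₁
    P² = P₁ * P₁
    τ = ι 4 * ½ ^^ J

    2^Jτ : ι 2 ^^ J * τ ≡ ι 4
    2^Jτ = trans (solve 2 (λ a b → a :* (κ 4 :* b) := κ 4 :* (a :* b)) refl (ι 2 ^^ J) (½ ^^ J))
      (trans (cong (ι 4 *_) (trans (sym (^^-*-dist (ι 2) ½ J)) (trans (cong (_^^ J) (*-inv (ι 2) (0<ι {2} (s≤s z≤n)))) (1^^ J)))) (*-identityʳ _))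

    0<½ : 0F < ½
    0<½ with ½ ≤? 0F
    ... | no h = ≰⇒> h
    ... | yes h = ⊥-elim (<⇒≱ 0<1 (≤-tr (≤-rf (sym (*-inv (ι 2) (0<ι {2} (s≤s z≤n))))) (≤-tr (*-monoˡ (ι 2) 0≤2 h) (≤-rf (zeroʳ _)))))

    0≤τ : 0F ≤ τ
    0≤τ = 0≤* 0≤4 (0≤^^ (<⇒≤ 0<½) J)

    T≤Z : T ℕ.≤ Z
    T≤Z = ℕP.≤-trans (ℕP.m≤n*m T 4) 4T≤Z

    Z≤n : Z ℕ.≤ n
    Z≤n = ℕP.≤-trans (ℕP.≤-reflexive (sym (ℕP.*-identityʳ Z))) (poly-use 1 0 (≤Z ℕP.≤-refl) (numeral-≤ 1 128) z≤n)

    η≤1 : η ≤ 1F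
    η≤1 = ≤-tr (≤-tr (≤-rf (sym (*-identityˡ η))) (*-monoʳ η 0≤η (1≤ι {7} (s≤s z≤n)))) 7η≤1

    -- As n ≤ 2^(2L), the power 2^J dominates n^(i + 1): i factors absorb a, and one more absorbs
    -- 4T.
    τ-small : ∀ a i → a ℕ.≤ n ℕ.^ i → 2 ℕ.* L ℕ.* suc i ℕ.≤ J → ι a * τ ≤ η
    τ-small a i a≤ h = scaled (2 ℕ.^ J) (a ℕ.* 4) T (ℕP.m^n>0 2 J) 0≤η
      (≤-rf (trans (cong (_* (ι a * τ)) (ι-^ 2 J)) (trans (solve 3 (λ j a t → j :* (a :* t) := a :* (j :* t)) refl (ι 2 ^^ J) (ι a) τ) (trans (cong (ι a *_) 2^Jτ) (sym (ι-* a 4))))))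
      (ℕP.≤-trans (ℕP.≤-reflexive (trans (ℕP.*-assoc a 4 T) (ℕP.*-comm a (4 ℕ.* T)))) (ℕP.≤-trans (ℕP.*-mono-≤ (ℕP.≤-trans 4T≤Z Z≤n) a≤)
        (ℕP.≤-trans (n^≤2^ (suc i)) (ℕP.^-monoʳ-≤ 2 h)))) 1≤Tη

    sk≤n : suc k ℕ.≤ n
    sk≤n = ℕP.≤-trans (ℕP.≤-trans (ℕP.+-monoˡ-≤ k 1≤k) (ℕP.≤-reflexive (cong (k ℕ.+_) (sym (ℕP.+-identityʳ k))))) (c*k≤n 2 (numZ 2))

    12L≤J : 12 ℕ.* L ℕ.≤ J
    12L≤J = ℕP.≤-trans (ℕP.m≤n+m (12 ℕ.* L) (4 ℕ.* (L ℕ.* ℓ))) J-large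

    skτ≤η : ι (suc k) * τ ≤ η
    skτ≤η = τ-small (suc k) 1 (ℕP.≤-trans sk≤n (ℕP.≤-reflexive (sym (ℕP.*-identityʳ n)))) (ℕP.≤-trans (ℕP.≤-trans (ℕP.≤-reflexive (ℕS.solve 1 (λ L → ℕS.con 2 ℕS.:* L ℕS.:* ℕS.con 2 ℕS.:= ℕS.con 4 ℕS.:* L) refl L)) (ℕP.*-monoˡ-≤ L (numeral-≤ 4 12))) 12L≤J)

    0≤P² : 0F ≤ P²
    0≤P² = 0≤sq P₁

    second-moment : 𝔼 p (numPairs n) (λ G → domCount n k G * domCount n k G) ≤ X̄ * X̄ * (1F + ι 8 * η)
    second-moment = ≤-tr (E-domCount² 0≤p p≤1 n k) (≤-tr (*-monoˡ K (0≤binomF n k) (overlapSum-bound n k (overlapWeight p n k) P² (ι 7 * η) τ k≤n 0≤P² (0≤* (0≤ι 7) 0≤η) 0≤τ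
        (λ r h → weight-small r T≤Z 0≤η η≤1 1≤Tη h) (weight-large τ 2^Jτ)))
      (≤-tr (≤-rf (solve 3 (λ K P x → K :* (K :* (P :* P) :* x) := K :* P :* (K :* P) :* x) refl K P₁ _)) (*-monoˡ (X̄ * X̄) (0≤sq X̄)
        (≤-tr (+-mono ≤-refl skτ≤η) (≤-rf (solve 1 (λ x → κ 1 :+ κ 7 :* x :+ x := κ 1 :+ κ 8 :* x) refl η))))))

    weight≤2 : ∀ r → 4 ℕ.* r ℕ.≤ k → overlapWeight p n k r ≤ P² * ι 2
    weight≤2 r h = ≤-tr (weight-small r T≤Z 0≤η η≤1 1≤Tη h) (*-monoˡ P² 0≤P² (+-mono ≤-refl 7η≤1))

    1≤Y : 1 ℕ.≤ Y
    1≤Y = ℕP.*-mono-≤ (ℕP.*-mono-≤ (numeral-≤ 1 64) 1≤R) 1≤A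

    y : F
    y = inv (ι Y) (0<ι 1≤Y)

    Yy : ι Y * y ≡ 1F
    Yy = *-inv (ι Y) (0<ι 1≤Y)

    0≤y : 0F ≤ y
    0≤y with 0F ≤? y
    ... | yes h = h
    ... | no h = ⊥-elim (<⇒≱ 0<1 (≤-tr (≤-rf (sym Yy)) (≤-tr (*-monoˡ (ι Y) (0≤ι Y) (<⇒≤ (≰⇒> h))) (≤-rf (zeroʳ _)))))

    y≤1 : y ≤ 1F
    y≤1 = ≤-tr (≤-tr (≤-rf (sym (*-identityˡ y))) (*-monoʳ y 0≤y (1≤ι 1≤Y))) (≤-rf Yy)

    scale-y : ∀ a b → a ℕ.≤ b ℕ.* Y → ι a * y ≤ ι b
    scale-y a b h = ≤-tr (*-monoʳ y 0≤y (≤-tr (ι-mono h) (≤-rf (ι-* b Y)))) (≤-rf (trans (*-assoc (ι b) (ι Y) y) (trans (cong (ι b *_) Yy) (*-identityʳ _))))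

    -- Since ρ ≥ 1/R, 1 - p + py ≤ ρ(1 + Rpy). In the exponent, 8kRpy ≤ 64RLy = L/A ≤ ℓ; this
    -- determines the choice `Y` = 64RA.
    light-pow : ∀ r → (1F - p + p * y) ^^ (2 ℕ.* k ℕ.∸ r) ≤ ρ ^^ (2 ℕ.* k ℕ.∸ r) * ι 2 ^^ ℓ
    light-pow r = ≤-tr (^^-mono (0≤+ 0≤ρ (0≤* 0≤p 0≤y)) base (2 ℕ.* k ℕ.∸ r)) (≤-tr (≤-rf (^^-*-dist ρ (1F + x) (2 ℕ.* k ℕ.∸ r)))
        (*-monoˡ _ (0≤^^ 0≤ρ (2 ℕ.* k ℕ.∸ r)) (≤-tr (^^-monoʳ (≤-+ʳ 0≤x) (ℕP.m∸n≤m (2 ℕ.* k) r)) (growth-upper 0≤x 4x≤1 ℓ (2 ℕ.* k) rate))))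
      where
      x = ι R * (p * y)
      0≤x : 0F ≤ x
      0≤x = 0≤* (0≤ι R) (0≤* 0≤p 0≤y)
      base : 1F - p + p * y ≤ ρ * (1F + x)
      base = ≤-diff _ (0≤* (0≤diff 1≤Rρ) (0≤* 0≤p 0≤y)) (solve 3 (λ p y R → (κ 1 :- p) :* (κ 1 :+ R :* (p :* y)) :- (κ 1 :- p :+ p :* y) := (R :* (κ 1 :- p) :- κ 1) :* (p :* y)) refl p y (ι R))
      4x≤1 : ι 4 * x ≤ 1F
      4x≤1 = ≤-tr (≤-rf (solve 3 (λ R p y → κ 4 :* (R :* (p :* y)) := p :* (κ 4 :* R :* y)) refl (ι R) p y)) (≤-tr (*≤ˡ (0≤* (0≤* 0≤4 (0≤ι R)) 0≤y) p≤1)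
        (≤-tr (≤-rf (cong (_* y) (sym (ι-* 4 R)))) (scale-y (4 ℕ.* R) 1 (ℕP.≤-trans (ℕP.*-monoˡ-≤ R (numeral-≤ 4 64)) (ℕP.≤-trans (ℕP.m≤m*n (64 ℕ.* R) A {{ℕ.>-nonZero 1≤A}}) (ℕP.≤-reflexive (sym (ℕP.*-identityˡ Y))))))))
      rate : ι 4 * (ι (2 ℕ.* k) * x) ≤ ι ℓ
      rate = ≤-tr (≤-rf (trans (cong (λ z → ι 4 * (z * x)) (ι-* 2 k)) (solve 4 (λ k R p y → κ 4 :* (κ 2 :* k :* (R :* (p :* y))) := κ 8 :* R :* y :* (k :* p)) refl (ι k) (ι R) p y)))
        (≤-tr (*-monoˡ (ι 8 * ι R * y) (0≤* (0≤* (0≤ι 8) (0≤ι R)) 0≤y) kp≤) (≤-tr (≤-rf (trans (solve 3 (λ R y l → κ 8 :* R :* y :* l := κ 8 :* R :* l :* y) refl (ι R) y (ι (8 ℕ.* L)))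
            (cong (_* y) (trans (cong (_* ι (8 ℕ.* L)) (sym (ι-* 8 R))) (sym (ι-* (8 ℕ.* R) (8 ℕ.* L)))))))
          (scale-y (8 ℕ.* R ℕ.* (8 ℕ.* L)) ℓ (ℕP.≤-trans (ℕP.≤-reflexive (ℕS.solve 2 (λ R L → ℕS.con 8 ℕS.:* R ℕS.:* (ℕS.con 8 ℕS.:* L) ℕS.:= ℕS.con 64 ℕS.:* R ℕS.:* L) refl R L))
            (ℕP.≤-trans (ℕP.*-monoʳ-≤ (64 ℕ.* R) L≤Aℓ) (ℕP.≤-reflexive (ℕS.solve 3 (λ R A l → ℕS.con 64 ℕS.:* R ℕS.:* (A ℕS.:* l) ℕS.:= l ℕS.:* (ℕS.con 64 ℕS.:* R ℕS.:* A)) refl R A ℓ)))))))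

    Λ² g₀ : ℕ
    Λ² = Y ℕ.^ ℓ ℕ.* Y ℕ.^ ℓ
    g₀ = 128 ℕ.* (L ℕ.* L)

    -- In twelfth powers, (nw)^12 ≤ (nq)^21 n^(-9). Of n^9, eight factors cover k^21 with all
    -- polylogarithms, and the ninth covers the exponentials in ℓ by `Y-small`.
    light-small : ∀ r → 4 ℕ.* r ℕ.≤ k → ι (g₀ ℕ.* Λ²) * ι n * (1F - p + p * y) ^^ (2 ℕ.* k ℕ.∸ r) ≤ η
    light-small r h = ≤-tr (*-monoˡ (ι (g₀ ℕ.* Λ²) * ι n) (0≤* (0≤ι (g₀ ℕ.* Λ²)) (0≤ι n)) (light-pow r)) (≤-tr
        (≤-rf (trans (cong (ι (g₀ ℕ.* Λ²) * ι n *_) (cong (w *_) (sym (ι-^ 2 ℓ)))) (trans (solve 4 (λ a n w b → a :* n :* (w :* b) := a :* b :* (n :* w)) refl (ι (g₀ ℕ.* Λ²)) (ι n) w (ι (2 ℕ.^ ℓ))) (cong (_* (ι n * w)) (sym (ι-* (g₀ ℕ.* Λ²) (2 ℕ.^ ℓ)))))))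
      (scaled-root (n ℕ.^ 9) (g ℕ.^ 12 ℕ.* (8 ℕ.* L ℕ.* k) ℕ.^ 21) T 11 (ℕP.^-monoˡ-≤ 9 1≤n) 0≤η
        (≤-tr (≤-rf (trans (cong₂ _*_ (ι-^ n 9) (trans (^^-*-dist (ι g) (ι n * w) 12) (cong (ι g ^^ 12 *_) (^^-*-dist (ι n) w 12))))
            (trans (solve 4 (λ a b c d → a :* (b :* (c :* d)) := b :* (a :* c :* d)) refl (ι n ^^ 9) (ι g ^^ 12) (ι n ^^ 12) (w ^^ 12)) (cong (λ z → ι g ^^ 12 * (z * w ^^ 12)) (sym (^^-+ (ι n) 9 12))))))
          (≤-tr (*-mono (0≤^^ (0≤ι g) 12) (≤-rf (sym (ι-^ g 12))) (0≤* (0≤^^ (0≤ι n) 21) (0≤^^ (0≤^^ 0≤ρ (2 ℕ.* k ℕ.∸ r)) 12))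
              (≤-tr (*-monoˡ (ι n ^^ 21) (0≤^^ (0≤ι n) 21) (≤-tr (≤-rf (^^-* w 3 4)) (≤-tr (^^-mono (0≤^^ (0≤^^ 0≤ρ (2 ℕ.* k ℕ.∸ r)) 4) (w⁴≤q⁷ {r} h) 3) (≤-rf (sym (^^-* q 3 7))))))
                (≤-tr (≤-rf (sym (^^-*-dist (ι n) q 21))) (≤-tr (^^-mono (0≤* (0≤ι n) 0≤q) nq≤ 21) (≤-rf (sym (ι-^ (8 ℕ.* L ℕ.* k) 21)))))))
            (≤-rf (sym (ι-* (g ℕ.^ 12) ((8 ℕ.* L ℕ.* k) ℕ.^ 21))))))
        count 1≤Tη))
      where
      w = ρ ^^ (2 ℕ.* k ℕ.∸ r)
      g = g₀ ℕ.* Λ² ℕ.* 2 ℕ.^ ℓ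
      g₀Z : g₀ ℕ.≤ Z ℕ.^ 3
      g₀Z = Z* 1 2 (numZ 128) (Z* 1 1 LZ LZ)
      count : g ℕ.^ 12 ℕ.* (8 ℕ.* L ℕ.* k) ℕ.^ 21 ℕ.* T ℕ.^ 12 ℕ.≤ n ℕ.^ 9
      count = ℕP.≤-trans (ℕP.≤-reflexive (trans (cong₂ (λ a b → a ℕ.* b ℕ.* T ℕ.^ 12) (trans (cong (ℕ._^ 12) (ℕP.*-assoc g₀ Λ² (2 ℕ.^ ℓ))) (^-distribʳ-* 12 g₀ (Λ² ℕ.* 2 ℕ.^ ℓ))) (^-distribʳ-* 21 (8 ℕ.* L) k))
          (ℕS.solve 5 (λ a b c d t → a ℕS.:* b ℕS.:* (c ℕS.:* d) ℕS.:* t ℕS.:= b ℕS.:* (a ℕS.:* c ℕS.:* t ℕS.:* d)) refl (g₀ ℕ.^ 12) ((Λ² ℕ.* 2 ℕ.^ ℓ) ℕ.^ 12) ((8 ℕ.* L) ℕ.^ 21) (k ℕ.^ 21) (T ℕ.^ 12))))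
        (ℕP.*-mono-≤ Y-small (poly-pow 8 90 21 (Z* 78 12 (Z* 36 42 (Z^ 3 12 g₀Z) (Z^ 2 21 (Z* 1 1 (numZ 8) LZ))) (Z^ 1 12 (≤Z T≤Z))) (numeral-≤ 90 1024) (numeral-≤ 21 24)))

    0<den : 0F < ι (g₀ ℕ.* Λ²) * ι n
    0<den = 0<* (0<ι (ℕP.*-mono-≤ (ℕP.*-mono-≤ (numeral-≤ 1 128) (ℕP.*-mono-≤ 1≤L 1≤L)) (ℕP.*-mono-≤ (ℕP.m^n>0 Y {{ℕ.>-nonZero 1≤Y}} ℓ) (ℕP.m^n>0 Y {{ℕ.>-nonZero 1≤Y}} ℓ)))) 0<n

    -- Scaled so that `light-small` becomes a bound on the damping factor, uniform over small
    -- overlaps.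
    W : F
    W = η * inv (ι (g₀ ℕ.* Λ²) * ι n) 0<den

    denW : ι (g₀ ℕ.* Λ²) * ι n * W ≡ η
    denW = trans (solve 3 (λ d e i → d :* (e :* i) := e :* (d :* i)) refl (ι (g₀ ℕ.* Λ²) * ι n) η _) (trans (cong (η *_) (*-inv _ 0<den)) (*-identityʳ η))

    0≤W : 0F ≤ W
    0≤W = *-cancelˡ (ι (g₀ ℕ.* Λ²) * ι n) 0<den (≤-tr (≤-rf (zeroʳ _)) (≤-tr 0≤η (≤-rf (sym denW))))

    s≤np′ : ι s ≤ ι n * p
    s≤np′ = ≤-tr (ι-mono (ℕP.m≤n*m s c₆ {{ℕ.>-nonZero 1≤c₆}})) s≤np
      where
      1≤c₆ : 1 ℕ.≤ c₆
      1≤c₆ = ℕP.*-mono-≤ (ℕP.*-mono-≤ (numeral-≤ 1 1024) (ℕP.*-mono-≤ 1≤A 1≤A)) (ℕP.m^n>0 2 (4 ℕ.* A))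

    s≤n : ι s ≤ ι n
    s≤n = ≤-tr s≤np′ (*≤ʳ (0≤ι n) p≤1)

    Λ²≤n : Λ² ℕ.≤ n
    Λ²≤n = ℕP.≤-trans (ℕP.m≤m*n Λ² (2 ℕ.^ ℓ) {{ℕ.>-nonZero (ℕP.m^n>0 2 ℓ)}}) (ℕP.≤-trans (ℕP.≤-trans (ℕP.≤-reflexive (sym (ℕP.*-identityʳ (Λ² ℕ.* 2 ℕ.^ ℓ))))
      (ℕP.^-monoʳ-≤ (Λ² ℕ.* 2 ℕ.^ ℓ) {{ℕ.>-nonZero (ℕP.*-mono-≤ (ℕP.*-mono-≤ (ℕP.m^n>0 Y {{ℕ.>-nonZero 1≤Y}} ℓ) (ℕP.m^n>0 Y {{ℕ.>-nonZero 1≤Y}} ℓ)) (ℕP.m^n>0 2 ℓ))}} {1} {12} (numeral-≤ 1 12))) Y-small)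

    light-class : ι s * ι Λ² * 𝔼 p (numPairs n) (commonCount n y 1 k) ≤ X̄ * X̄ * (ι 2 * η)
    light-class = ≤-tr (*-monoˡ (ι s * ι Λ²) 0≤sΛ (≤-tr (E-commonCount 0≤p p≤1 0≤y y≤1 n k 1)
        (≤-tr (≤-rf (solve 3 (λ n K o → n :* (K :* o) := K :* (n :* κ 1 :* o)) refl (ι n) K _)) (*-monoˡ K (0≤binomF n k)
          (commonSum-bound n k (overlapWeight p n k) P² τ p (1F - p + p * y) W 1 1≤k k≤n 0≤P² 0≤τ 0≤p (0≤+ 0≤ρ (0≤* 0≤p 0≤y))
            (≤-diff _ (0≤* 0≤p (0≤diff y≤1)) (solve 2 (λ p y → κ 1 :- (κ 1 :- p :+ p :* y) := p :* (κ 1 :- y)) refl p y)) 0≤W (λ r → 0≤^^ (0≤pairProb 0≤p p≤1 k r) e) weight≤2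
            (λ r h → *-cancelˡ (ι (g₀ ℕ.* Λ²) * ι n) 0<den (≤-tr (light-small r h) (≤-rf (sym denW)))) (weight-large τ 2^Jτ))))))
      (≤-tr (*-monoˡ (ι s * ι Λ²) 0≤sΛ (*-monoˡ K (0≤binomF n k) (*-monoʳ tail 0≤tail (*-monoˡ (K * P²) (0≤* (0≤binomF n k) 0≤P²) (*-monoʳ (p * 1F) (0≤* 0≤p 0≤1) (≤-tr (ι-mono (binom≤^ k 1)) (≤-rf (ι-^ k 1))))))))
        (≤-tr (≤-rf (solve 10 (λ s l K P k p W n t x → s :* l :* (K :* (K :* (P :* P) :* (k :* κ 1 :* (p :* κ 1)) :* (κ 2 :* W :* (k :* κ 1) :+ n :* κ 1 :* (x :* t))))
            := K :* P :* (K :* P) :* (s :* (k :* k) :* p :* (κ 2 :* l :* W) :+ s :* l :* (k :* p) :* n :* x :* t)) refl (ι s) (ι Λ²) K P₁ (ι k) p W (ι n) τ (ι (suc k))))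
          (*-monoˡ (X̄ * X̄) (0≤sq X̄) (≤-tr (+-mono main rest) (≤-rf (solve 1 (λ x → x :+ x := κ 2 :* x) refl η))))))
      where
      0≤sΛ : 0F ≤ ι s * ι Λ²
      0≤sΛ = 0≤* (0≤ι s) (0≤ι Λ²)
      tail = ι 2 * W * ι k ^^ 1 + ι n ^^ 1 * (ι (suc k) * τ)
      0≤tail : 0F ≤ tail
      0≤tail = 0≤+ (0≤* (0≤* 0≤2 0≤W) (0≤^^ (0≤ι k) 1)) (0≤* (0≤^^ (0≤ι n) 1) (0≤* (0≤ι (suc k)) 0≤τ))
      kp² : ι k * p * (ι k * p) ≤ ι 64 * (ι L * ι L)
      kp² = ≤-tr (*-mono (0≤* (0≤ι k) 0≤p) kp≤ (0≤* (0≤ι k) 0≤p) kp≤) (≤-rf (trans (cong (λ z → z * z) (ι-* 8 L)) (solve 1 (λ L → κ 8 :* L :* (κ 8 :* L) := κ 64 :* (L :* L)) refl (ι L))))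
      -- By s ≤ np and kp ≤ 8L, sk²p ≤ 64nL². The 2 in front of Λ² turns 64 into the 128 of `g₀`.
      main : ι s * (ι k * ι k) * p * (ι 2 * ι Λ² * W) ≤ η
      main = ≤-tr (*-monoʳ (ι 2 * ι Λ² * W) 0≤2ΛW (≤-tr (≤-tr (≤-rf (solve 3 (λ s k p → s :* (k :* k) :* p := s :* (k :* k :* p)) refl (ι s) (ι k) p)) (*-monoʳ _ (0≤* (0≤* (0≤ι k) (0≤ι k)) 0≤p) s≤np′))
          (≤-tr (≤-rf (solve 3 (λ n k p → n :* p :* (k :* k :* p) := n :* (k :* p :* (k :* p))) refl (ι n) (ι k) p)) (*-monoˡ (ι n) (0≤ι n) kp²))))
        (≤-rf (trans (solve 4 (λ n L l W → n :* (κ 64 :* (L :* L)) :* (κ 2 :* l :* W) := κ 128 :* (L :* L) :* l :* n :* W) refl (ι n) (ι L) (ι Λ²) W)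
          (trans (cong (λ z → z * ι n * W) (sym (trans (ι-* g₀ Λ²) (cong (_* ι Λ²) (trans (ι-* 128 (L ℕ.* L)) (cong (ι 128 *_) (ι-* L L))))))) denW)))
        where
        0≤2ΛW : 0F ≤ ι 2 * ι Λ² * W
        0≤2ΛW = 0≤* (0≤* 0≤2 (0≤ι Λ²)) 0≤W
      8L≤n : 8 ℕ.* L ℕ.≤ n
      8L≤n = ℕP.≤-trans (ℕP.≤-reflexive (sym (ℕP.*-identityʳ (8 ℕ.* L)))) (poly-use 2 0 (Z* 1 1 (numZ 8) LZ) (numeral-≤ 2 128) z≤n)
      rest : ι s * ι Λ² * (ι k * p) * ι n * ι (suc k) * τ ≤ η
      rest = ≤-tr (*-monoʳ τ 0≤τ (*-mono (0≤* (0≤* 0≤sΛ (0≤* (0≤ι k) 0≤p)) (0≤ι n)) (*-monoʳ (ι n) (0≤ι n) (*-mono 0≤sΛ (*-mono (0≤ι s) s≤n (0≤ι Λ²) (ι-mono Λ²≤n)) (0≤* (0≤ι k) 0≤p) (≤-tr kp≤ (ι-mono 8L≤n)))) (0≤ι (suc k)) (ι-mono sk≤n)))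
        (≤-tr (≤-rf (cong (_* τ) (trans (solve 1 (λ n → n :* n :* n :* n :* n := n :* (n :* (n :* (n :* (n :* κ 1))))) refl (ι n)) (sym (ι-^ n 5))))) (τ-small (n ℕ.^ 5) 5 ℕP.≤-refl
          (ℕP.≤-trans (ℕP.≤-reflexive (ℕS.solve 1 (λ L → ℕS.con 2 ℕS.:* L ℕS.:* ℕS.con 6 ℕS.:= ℕS.con 12 ℕS.:* L) refl L)) 12L≤J)))

    ℓ≤k : ℓ ℕ.≤ k
    ℓ≤k = ℕP.*-cancelˡ-≤ {ℓ} {k} L {{ℕ.>-nonZero 1≤L}} (ℕP.≤-trans (ℕP.≤-trans (ℕP.m≤n*m (L ℕ.* ℓ) 4) (ℕP.m≤m+n _ _)) (ℕP.≤-trans J-large (ℕP.≤-trans (ℕP.m≤n*m J 32) J≤)))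

    -- Per vertex, C(k, ℓ)(pk/n)^ℓ comes from the common links and s^ℓ/ℓ! from the deleted edges.
    -- With s ≤ np/`c₆` and kp ≤ 8L the main part is at most 2n(64L²/`c₆`)^ℓ/ℓ!², and ℓ is large
    -- enough for ℓ!² to beat L^(2ℓ) up to a constant to the power ℓ.
    heavy-class : ι s ^^ ℓ * 𝔼 p (numPairs n) (commonCount n 1F ℓ k) ≤ ι (ℓ !) * (X̄ * X̄ * (ι 2 * η))
    heavy-class = *-cancelˡ (ι n ^^ ℓ) (0<^^ 0<n ℓ) (≤-tr (≤-rf (solve 3 (λ N s E → N :* (s :* E) := s :* (N :* E)) refl (ι n ^^ ℓ) (ι s ^^ ℓ) EV)) (≤-tr (*-monoˡ (ι s ^^ ℓ) 0≤sℓ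
        (≤-tr (*-monoˡ (ι n ^^ ℓ) (0≤^^ (0≤ι n) ℓ) (E-commonCount 0≤p p≤1 0≤1 ≤-refl n k ℓ))
          (≤-tr (≤-rf (solve 4 (λ N n K o → N :* (n :* (K :* o)) := n :* (K :* (N :* o))) refl (ι n ^^ ℓ) (ι n) K _)) (*-monoˡ (ι n) (0≤ι n) (*-monoˡ K (0≤binomF n k)
            (commonSum-bound n k (overlapWeight p n k) P² τ p (1F - p + p * 1F) 1F ℓ ℓ≤k k≤n 0≤P² 0≤τ 0≤p (≤-tr 0≤1 (≤-rf (sym w≡1))) (≤-rf w≡1) 0≤1 (λ r → 0≤^^ (0≤pairProb 0≤p p≤1 k r) e) weight≤2
              (λ r h → ≤-rf (trans (cong (_^^ (2 ℕ.* k ℕ.∸ r)) w≡1) (1^^ (2 ℕ.* k ℕ.∸ r)))) (weight-large τ 2^Jτ)))))))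
      (≤-tr (≤-rf (solve 10 (λ s n K P C π k N x t → s :* (n :* (K :* (K :* (P :* P) :* (C :* π) :* (κ 2 :* κ 1 :* k :+ N :* (x :* t)))))
          := K :* P :* (K :* P) :* (n :* s :* C :* π :* κ 2 :* k :+ N :* (n :* s :* C :* π :* x :* t))) refl (ι s ^^ ℓ) (ι n) K P₁ C (p ^^ ℓ) (ι k ^^ ℓ) (ι n ^^ ℓ) (ι (suc k)) τ))
        (≤-tr (*-monoˡ (X̄ * X̄) (0≤sq X̄) (+-mono main (*-monoˡ (ι n ^^ ℓ) (0≤^^ (0≤ι n) ℓ) rest)))
          (≤-rf (trans (cong (λ z → X̄ * X̄ * (z * η + ι n ^^ ℓ * (ι (ℓ !) * η))) (trans (ι-* (n ℕ.^ ℓ) (ℓ !)) (cong (_* ι (ℓ !)) (ι-^ n ℓ))))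
            (solve 4 (λ X N f e → X :* (N :* f :* e :+ N :* (f :* e)) := N :* (f :* (X :* (κ 2 :* e)))) refl (X̄ * X̄) (ι n ^^ ℓ) (ι (ℓ !)) η)))))))
      where
      EV = 𝔼 p (numPairs n) (commonCount n 1F ℓ k)
      C = binomF k ℓ
      0≤sℓ : 0F ≤ ι s ^^ ℓ
      0≤sℓ = 0≤^^ (0≤ι s) ℓ
      0≤πℓ : 0F ≤ p ^^ ℓ
      0≤πℓ = 0≤^^ 0≤p ℓ
      w≡1 : 1F - p + p * 1F ≡ 1F
      w≡1 = solve 1 (λ p → κ 1 :- p :+ p :* κ 1 := κ 1) refl p
      f = ℓ !
      fC : ι f * C ≤ ι k ^^ ℓ
      fC = ≤-tr (≤-rf (sym (ι-* f (binom k ℓ)))) (≤-tr (ι-mono (factorial-binom k ℓ)) (≤-rf (ι-^ k ℓ)))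
      main : ι n * ι s ^^ ℓ * C * p ^^ ℓ * ι 2 * ι k ^^ ℓ ≤ ι (n ℕ.^ ℓ ℕ.* f) * η
      main = scaled-by (c₆ ℕ.^ ℓ ℕ.* f) (n ℕ.^ ℓ ℕ.* f) (2 ℕ.* n ℕ.* (n ℕ.^ ℓ ℕ.* (64 ℕ.* (L ℕ.* L)) ℕ.^ ℓ)) T (ℕP.*-mono-≤ (ℕP.m^n>0 c₆ {{c₆≢0}} ℓ) (ℕ.>-nonZero⁻¹ f {{ℓ !≢0}})) 0≤η
        (≤-tr (≤-rf (trans (cong (_* (ι n * ι s ^^ ℓ * C * p ^^ ℓ * ι 2 * ι k ^^ ℓ)) (trans (ι-* (c₆ ℕ.^ ℓ) f) (cong (_* ι f) (ι-^ c₆ ℓ))))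
            (solve 7 (λ c f n s C π k → c :* f :* (n :* s :* C :* π :* κ 2 :* k) := κ 2 :* n :* (c :* s) :* π :* k :* (f :* C)) refl (ι c₆ ^^ ℓ) (ι f) (ι n) (ι s ^^ ℓ) C (p ^^ ℓ) (ι k ^^ ℓ))))
          (≤-tr (*-mono (0≤* (0≤* (0≤* (0≤* 0≤2 (0≤ι n)) (0≤* (0≤^^ (0≤ι c₆) ℓ) 0≤sℓ)) 0≤πℓ) (0≤^^ (0≤ι k) ℓ))
              (*-monoʳ (ι k ^^ ℓ) (0≤^^ (0≤ι k) ℓ) (*-monoʳ (p ^^ ℓ) 0≤πℓ (*-monoˡ (ι 2 * ι n) (0≤* 0≤2 (0≤ι n))
                 (≤-tr (≤-rf (trans (sym (^^-*-dist (ι c₆) (ι s) ℓ)) (cong (_^^ ℓ) (sym (ι-* c₆ s))))) (≤-tr (^^-mono (0≤ι (c₆ ℕ.* s)) s≤np ℓ) (≤-rf (^^-*-dist (ι n) p ℓ)))))))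
              (0≤* (0≤ι f) (0≤binomF k ℓ)) fC)
            (≤-tr (≤-rf (trans (solve 4 (λ n N π k → κ 2 :* n :* (N :* π) :* π :* k :* k := κ 2 :* n :* (N :* (k :* π :* (k :* π)))) refl (ι n) (ι n ^^ ℓ) (p ^^ ℓ) (ι k ^^ ℓ))
                (cong (λ z → ι 2 * ι n * (ι n ^^ ℓ * z)) (trans (cong₂ _*_ (sym (^^-*-dist (ι k) p ℓ)) (sym (^^-*-dist (ι k) p ℓ))) (sym (^^-*-dist (ι k * p) (ι k * p) ℓ))))))
              (≤-tr (*-monoˡ (ι 2 * ι n) (0≤* 0≤2 (0≤ι n)) (*-monoˡ (ι n ^^ ℓ) (0≤^^ (0≤ι n) ℓ) (^^-mono (0≤* (0≤* (0≤ι k) 0≤p) (0≤* (0≤ι k) 0≤p))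
                  (≤-tr (*-mono (0≤* (0≤ι k) 0≤p) kp≤ (0≤* (0≤ι k) 0≤p) kp≤) (≤-rf (trans (sym (ι-* (8 ℕ.* L) (8 ℕ.* L))) (cong ι (ℕS.solve 1 (λ L → ℕS.con 8 ℕS.:* L ℕS.:* (ℕS.con 8 ℕS.:* L) ℕS.:= ℕS.con 64 ℕS.:* (L ℕS.:* L)) refl L))))) ℓ)))
                (≤-rf (sym (trans (ι-* (2 ℕ.* n) _) (cong₂ _*_ (ι-* 2 n) (trans (ι-* (n ℕ.^ ℓ) _) (cong₂ _*_ (ι-^ n ℓ) (ι-^ (64 ℕ.* (L ℕ.* L)) ℓ)))))))))))
        count 1≤Tη
        where
        1≤c₆ : 1 ℕ.≤ c₆
        1≤c₆ = ℕP.*-mono-≤ (ℕP.*-mono-≤ (numeral-≤ 1 1024) (ℕP.*-mono-≤ 1≤A 1≤A)) (ℕP.m^n>0 2 (4 ℕ.* A))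
        c₆≢0 = ℕ.>-nonZero 1≤c₆
        B = 1024 ℕ.* (A ℕ.* A)
        -- The first part of `c₆`: L ≤ Aℓ and ℓ^ℓ ≤ 4^ℓ ℓ!, used twice, give 64 · 4² = 1024.
        ratio : (64 ℕ.* (L ℕ.* L)) ℕ.^ ℓ ℕ.≤ B ℕ.^ ℓ ℕ.* (f ℕ.* f)
        ratio = ℕP.≤-trans (ℕP.^-monoˡ-≤ ℓ (ℕP.*-monoʳ-≤ 64 (ℕP.*-mono-≤ L≤Aℓ L≤Aℓ))) (ℕP.≤-trans (ℕP.≤-reflexive (trans (cong (ℕ._^ ℓ) (ℕS.solve 2 (λ A l → ℕS.con 64 ℕS.:* (A ℕS.:* l ℕS.:* (A ℕS.:* l)) ℕS.:= ℕS.con 64 ℕS.:* (A ℕS.:* A) ℕS.:* (l ℕS.:* l)) refl A ℓ))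
            (trans (^-distribʳ-* ℓ (64 ℕ.* (A ℕ.* A)) (ℓ ℕ.* ℓ)) (cong ((64 ℕ.* (A ℕ.* A)) ℕ.^ ℓ ℕ.*_) (^-distribʳ-* ℓ ℓ ℓ)))))
          (ℕP.≤-trans (ℕP.*-monoʳ-≤ ((64 ℕ.* (A ℕ.* A)) ℕ.^ ℓ) (ℕP.*-mono-≤ (n^n≤4^n*n! ℓ) (n^n≤4^n*n! ℓ)))
            (ℕP.≤-reflexive (trans (ℕS.solve 3 (λ a b f → a ℕS.:* (b ℕS.:* f ℕS.:* (b ℕS.:* f)) ℕS.:= a ℕS.:* (b ℕS.:* b) ℕS.:* (f ℕS.:* f)) refl ((64 ℕ.* (A ℕ.* A)) ℕ.^ ℓ) (4 ℕ.^ ℓ) f)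
              (cong (ℕ._* (f ℕ.* f)) (trans (cong ((64 ℕ.* (A ℕ.* A)) ℕ.^ ℓ ℕ.*_) (sym (^-distribʳ-* ℓ 4 4))) (trans (sym (^-distribʳ-* ℓ (64 ℕ.* (A ℕ.* A)) 16)) (cong (ℕ._^ ℓ) (ℕS.solve 1 (λ a → ℕS.con 64 ℕS.:* a ℕS.:* ℕS.con 16 ℕS.:= ℕS.con 1024 ℕS.:* a) refl (A ℕ.* A))))))))))
        -- The second part of `c₆`: 2^(4Aℓ) ≥ 2^(4L) ≥ n², enough for the factor n from the sum over
        -- v and for T.
        2nT : 2 ℕ.* n ℕ.* T ℕ.≤ (2 ℕ.^ (4 ℕ.* A)) ℕ.^ ℓ
        2nT = ℕP.≤-trans (ℕP.≤-trans (ℕP.≤-reflexive (ℕS.solve 2 (λ n T → ℕS.con 2 ℕS.:* n ℕS.:* T ℕS.:= n ℕS.:* (ℕS.con 2 ℕS.:* T)) refl n T)) (ℕP.*-monoʳ-≤ n (ℕP.≤-trans (ℕP.≤-trans (ℕP.*-monoˡ-≤ T (numeral-≤ 2 4)) (ℕP.≤-trans 4T≤Z Z≤n)) (ℕP.≤-reflexive (sym (ℕP.*-identityʳ n))))))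
          (ℕP.≤-trans (n^≤2^ 2) (ℕP.≤-trans (ℕP.^-monoʳ-≤ 2 (ℕP.≤-trans (ℕP.≤-reflexive (ℕS.solve 1 (λ L → ℕS.con 2 ℕS.:* L ℕS.:* ℕS.con 2 ℕS.:= ℕS.con 4 ℕS.:* L) refl L)) (ℕP.≤-trans (ℕP.*-monoʳ-≤ 4 L≤Aℓ) (ℕP.≤-reflexive (sym (ℕP.*-assoc 4 A ℓ)))))) (ℕP.≤-reflexive (sym (ℕP.^-*-assoc 2 (4 ℕ.* A) ℓ)))))
        count : 2 ℕ.* n ℕ.* (n ℕ.^ ℓ ℕ.* (64 ℕ.* (L ℕ.* L)) ℕ.^ ℓ) ℕ.* T ℕ.≤ c₆ ℕ.^ ℓ ℕ.* f ℕ.* (n ℕ.^ ℓ ℕ.* f)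
        count = ℕP.≤-trans (ℕP.≤-reflexive (ℕS.solve 4 (λ n N r T → ℕS.con 2 ℕS.:* n ℕS.:* (N ℕS.:* r) ℕS.:* T ℕS.:= N ℕS.:* (ℕS.con 2 ℕS.:* n ℕS.:* T ℕS.:* r)) refl n (n ℕ.^ ℓ) ((64 ℕ.* (L ℕ.* L)) ℕ.^ ℓ) T))
          (ℕP.≤-trans (ℕP.*-monoʳ-≤ (n ℕ.^ ℓ) (ℕP.*-mono-≤ 2nT ratio)) (ℕP.≤-reflexive (trans (ℕS.solve 4 (λ N a b f → N ℕS.:* (a ℕS.:* (b ℕS.:* (f ℕS.:* f))) ℕS.:= b ℕS.:* a ℕS.:* f ℕS.:* (N ℕS.:* f)) refl (n ℕ.^ ℓ) ((2 ℕ.^ (4 ℕ.* A)) ℕ.^ ℓ) (B ℕ.^ ℓ) f)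
            (cong (λ z → z ℕ.* f ℕ.* (n ℕ.^ ℓ ℕ.* f)) (sym (^-distribʳ-* ℓ B (2 ℕ.^ (4 ℕ.* A))))))))
      rest : ι n * ι s ^^ ℓ * C * p ^^ ℓ * ι (suc k) * τ ≤ ι f * η
      rest = ≤-tr (*-monoʳ τ 0≤τ (≤-tr (*-mono (0≤* (0≤* (0≤* (0≤ι n) 0≤sℓ) (0≤binomF k ℓ)) 0≤πℓ)
            (≤-tr (*≤ʳ (0≤* (0≤* (0≤ι n) 0≤sℓ) (0≤binomF k ℓ)) (^^≤1 0≤p p≤1 ℓ)) (*-mono (0≤* (0≤ι n) 0≤sℓ) (*-monoˡ (ι n) (0≤ι n) (^^-mono (0≤ι s) s≤n ℓ)) (0≤binomF k ℓ) (≤-tr (ι-mono (ℕP.≤-trans (binom≤^ k ℓ) (ℕP.^-monoˡ-≤ ℓ k≤n))) (≤-rf (ι-^ n ℓ)))))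
            (0≤ι (suc k)) (ι-mono sk≤n)) (≤-rf pow)))
        (≤-tr (τ-small (n ℕ.^ (2 ℕ.* ℓ ℕ.+ 2)) (2 ℕ.* ℓ ℕ.+ 2) ℕP.≤-refl (ℕP.≤-trans (ℕP.≤-reflexive (ℕS.solve 2 (λ L l → ℕS.con 2 ℕS.:* L ℕS.:* (ℕS.con 1 ℕS.:+ (ℕS.con 2 ℕS.:* l ℕS.:+ ℕS.con 2)) ℕS.:= ℕS.con 4 ℕS.:* (L ℕS.:* l) ℕS.:+ ℕS.con 6 ℕS.:* L) refl L ℓ))
            (ℕP.≤-trans (ℕP.+-monoʳ-≤ (4 ℕ.* (L ℕ.* ℓ)) (ℕP.*-monoˡ-≤ L (numeral-≤ 6 12))) J-large)))
          (≤-tr (≤-rf (sym (*-identityˡ η))) (*-monoʳ η 0≤η (1≤ι (ℕ.>-nonZero⁻¹ f {{ℓ !≢0}})))))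
        where
        pow : ι n * ι n ^^ ℓ * ι n ^^ ℓ * ι n ≡ ι (n ℕ.^ (2 ℕ.* ℓ ℕ.+ 2))
        pow = trans (solve 2 (λ n N → n :* N :* N :* n := N :* N :* (n :* (n :* κ 1))) refl (ι n) (ι n ^^ ℓ)) (trans (cong (_* ι n ^^ 2) (sym (^^-+ (ι n) ℓ ℓ)))
          (trans (sym (^^-+ (ι n) (ℓ ℕ.+ ℓ) 2)) (trans (cong (λ z → ι n ^^ (z ℕ.+ 2)) (cong (ℓ ℕ.+_) (sym (ℕP.+-identityʳ ℓ)))) (sym (ι-^ n (2 ℕ.* ℓ ℕ.+ 2))))))

    -- Chebyshev and Markov in one pointwise inequality: with `X̄` = E X, X̄² ≤ 2(X - X̄)² + 2X²,
    -- where on the event the last term is bounded as in `destroyed`. The variance and the two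
    -- classes contribute 16η each.
    fragile-prob : ∀ (f : Graph n → F) →
      (∀ G → f G ≡ 0F ⊎ (f G ≡ 1F × ι (ℓ !) * (domCount n k G * domCount n k G) ≤
        ι (ℓ !) * (ι 4 * ι s * (ι Y ^^ ℓ * ι Y ^^ ℓ) * commonCount n y 1 k G) + ι 4 * ι s ^^ ℓ * commonCount n 1F ℓ k G)) →
      𝔼 p (numPairs n) f ≤ ι 48 * η
    fragile-prob f hf = *-cancelˡ (ℓ! * (X̄ * X̄)) (0<* 0<ℓ! (0<* 0<X̄ 0<X̄)) (≤-tr (≤-rf (sym (E-*ˡ p N (ℓ! * (X̄ * X̄)) f)))
        (≤-tr (E-mono p N 0≤p p≤1 each) (≤-tr (≤-rf expand) (≤-tr (+-mono (+-mono (+-mono (*-monoˡ (ι 2 * ℓ!) (0≤* 0≤2 0≤ℓ!) second-moment) ≤-refl)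
            (*-monoˡ (ι 8 * ℓ!) (0≤* (0≤ι 8) 0≤ℓ!) (≤-tr (≤-rf (cong (λ z → ι s * z * V₁) ΛΛ)) light-class))) (*-monoˡ (ι 8) (0≤ι 8) heavy-class))
          (≤-rf (solve 3 (λ f X e → κ 2 :* f :* (X :* X :* (κ 1 :+ κ 8 :* e)) :+ (:- (κ 2 :* f :* (X :* X))) :+ κ 8 :* f :* (X :* X :* (κ 2 :* e)) :+ κ 8 :* (f :* (X :* X :* (κ 2 :* e)))
            := f :* (X :* X) :* (κ 48 :* e)) refl ℓ! X̄ η))))))
      where
      N = numPairs n
      ℓ! = ι (ℓ !)
      0<ℓ! : 0F < ℓ!
      0<ℓ! = 0<ι (ℕ.>-nonZero⁻¹ (ℓ !) {{ℓ !≢0}})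
      0≤ℓ! = <⇒≤ 0<ℓ!
      0<X̄ : 0F < X̄
      0<X̄ = <-≤-trans 0<1 1≤KP
      X : Graph n → F
      X = domCount n k
      v₁ v₂ : Graph n → F
      v₁ = commonCount n y 1 k
      v₂ = commonCount n 1F ℓ k
      V₁ = 𝔼 p N v₁
      V₂ = 𝔼 p N v₂
      L₁ = ι Y ^^ ℓ * ι Y ^^ ℓ
      ΛΛ : L₁ ≡ ι Λ²
      ΛΛ = sym (trans (ι-* (Y ℕ.^ ℓ) (Y ℕ.^ ℓ)) (cong₂ _*_ (ι-^ Y ℓ) (ι-^ Y ℓ)))
      0≤link : ∀ {y} → 0F ≤ y → ∀ i G → 0F ≤ commonCount n y i k G
      0≤link h i G = 0≤ΣL (allFin n) (λ v → 0≤ΣL (layer n k) (λ D → 0≤ΣL (layer n k) (λ D′ → 0≤* (0≤* (0≤lightLink h v D G) (0≤lightLink h v D′ G)) (0≤binomF ∣ G ∩ (link v D ∩ link v D′) ∣ i))))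
      rhs : Graph n → F
      rhs G = ι 2 * ℓ! * (X G * X G) + (ι 2 * ℓ! * (X̄ * X̄) + - (ι 4 * ℓ! * X̄) * X G) + (ι 8 * ℓ! * (ι s * L₁) * v₁ G + ι 8 * ι s ^^ ℓ * v₂ G)
      each : ∀ G → ℓ! * (X̄ * X̄) * f G ≤ rhs G
      each G with hf G
      ... | inj₁ e = ≤-tr (≤-rf (trans (cong (ℓ! * (X̄ * X̄) *_) e) (zeroʳ _)))
        (≤-diff _ (0≤+ (0≤* (0≤* 0≤2 0≤ℓ!) (0≤sq (X G - X̄))) (0≤+ (0≤* (0≤* (0≤* (0≤ι 8) 0≤ℓ!) (0≤* (0≤ι s) (≤-tr (0≤ι Λ²) (≤-rf (sym ΛΛ))))) (0≤link 0≤y 1 G)) (0≤* (0≤* (0≤ι 8) (0≤^^ (0≤ι s) ℓ)) (0≤link 0≤1 ℓ G))))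
          (solve 4 (λ f X x r → κ 2 :* f :* (x :* x) :+ (κ 2 :* f :* (X :* X) :+ (:- (κ 4 :* f :* X)) :* x) :+ r :- κ 0 := κ 2 :* f :* ((x :- X) :* (x :- X)) :+ r) refl ℓ! X̄ (X G) (ι 8 * ℓ! * (ι s * L₁) * v₁ G + ι 8 * ι s ^^ ℓ * v₂ G)))
      ... | inj₂ (e , d) = ≤-tr (≤-rf (trans (cong (ℓ! * (X̄ * X̄) *_) e) (*-identityʳ _)))
        (≤-diff _ (0≤+ (0≤* 0≤ℓ! (0≤sq (X̄ - ι 2 * X G))) (0≤+ (0≤diff d) (0≤diff d)))
          (solve 8 (λ f X x s l a t b → κ 2 :* f :* (x :* x) :+ (κ 2 :* f :* (X :* X) :+ (:- (κ 4 :* f :* X)) :* x) :+ (κ 8 :* f :* (s :* l) :* a :+ κ 8 :* t :* b) :- f :* (X :* X)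
            := f :* ((X :- κ 2 :* x) :* (X :- κ 2 :* x)) :+ ((f :* (κ 4 :* s :* l :* a) :+ κ 4 :* t :* b :- f :* (x :* x)) :+ (f :* (κ 4 :* s :* l :* a) :+ κ 4 :* t :* b :- f :* (x :* x)))) refl
            ℓ! X̄ (X G) (ι s) L₁ (v₁ G) (ι s ^^ ℓ) (v₂ G)))
      expand : 𝔼 p N rhs ≡ ι 2 * ℓ! * 𝔼 p N (λ G → X G * X G) + (- (ι 2 * ℓ! * (X̄ * X̄))) + ι 8 * ℓ! * (ι s * L₁ * V₁) + ι 8 * (ι s ^^ ℓ * V₂)
      expand = trans (E-+ p N _ _) (trans (cong₂ _+_ (trans (E-+ p N _ _) (cong₂ _+_ (E-*ˡ p N (ι 2 * ℓ!) _) (trans (E-+ p N _ _) (cong₂ _+_ (E-const p N _) (trans (E-*ˡ p N _ X) (cong (- (ι 4 * ℓ! * X̄) *_) (E-domCount 0≤p p≤1 n k)))))))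
          (trans (E-+ p N _ _) (cong₂ _+_ (E-*ˡ p N _ v₁) (E-*ˡ p N _ v₂))))
        (solve 8 (λ f X m s l a t b → κ 2 :* f :* m :+ (κ 2 :* f :* (X :* X) :+ (:- (κ 4 :* f :* X)) :* X) :+ (κ 8 :* f :* (s :* l) :* a :+ κ 8 :* t :* b)
          := κ 2 :* f :* m :+ (:- (κ 2 :* f :* (X :* X))) :+ κ 8 :* f :* (s :* l :* a) :+ κ 8 :* (t :* b)) refl ℓ! X̄ (𝔼 p N (λ G → X G * X G)) (ι s) L₁ V₁ (ι s ^^ ℓ) V₂))

-- Parameters at the threshold edge count.

module Thresholds where

  open import Defs using () renaming (E to numPairs)
  open OrderedField
  open Inequalities
  open FiniteSums
  open RandomSubsets
  open Domination
  open Moments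
  open EdgeDeletion
  open Overlaps
  open Regimes
  open Resilience
  open import Data.Nat as ℕ using (ℕ; zero; suc; z≤n; s≤s)
  import Data.Nat.Properties as ℕP
  open import Data.Nat.DivMod using (_/_; m/n*n≤m; m≡m%n+[m/n]*n; m%n<n)
  open import Data.Product using (_×_; _,_; ∃)
  open import Data.Empty using (⊥-elim)
  open import Relation.Nullary using (yes; no; ¬_)
  open import Relation.Nullary.Decidable using (True; toWitness)
  open import Relation.Binary.PropositionalEquality

  halfOf : ∀ x → 2 ℕ.≤ x → ∃ λ h → 2 ℕ.* h ℕ.≤ x × x ℕ.≤ 3 ℕ.* h
  halfOf x 2≤x = go x 2≤x
    where
    go : ∀ x → 2 ℕ.≤ x → ∃ λ h → 2 ℕ.* h ℕ.≤ x × x ℕ.≤ 3 ℕ.* h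
    go (suc zero) (s≤s ())
    go (suc (suc zero)) _ = 1 , ℕP.≤-refl , numeral-≤ 2 3
    go (suc (suc (suc zero))) _ = 1 , numeral-≤ 2 3 , ℕP.≤-refl
    go (suc (suc (suc (suc x)))) _ = let h , a , b = go (suc (suc x)) (s≤s (s≤s z≤n)) in
      suc h , ℕP.≤-trans (ℕP.≤-reflexive (ℕP.*-suc 2 h)) (s≤s (s≤s a)) , ℕP.≤-trans (s≤s (s≤s b)) (ℕP.≤-trans (ℕP.+-monoˡ-≤ (3 ℕ.* h) (numeral-≤ 2 3)) (ℕP.≤-reflexive (sym (ℕP.*-suc 3 h))))

  -- Chosen so that `R₀ c` to the power κ is at least 2^(2L) when κ ≥ 1 and L ≤ c(κ + 1).
  R₀ : ℕ → ℕ
  R₀ c = 2 ℕ.^ (4 ℕ.* c)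

  1≤R₀ : ∀ c → 1 ℕ.≤ R₀ c
  1≤R₀ c = ℕP.m^n>0 2 (4 ℕ.* c)

  abstract
    -- 2304 = 48 · 48: the product of the constants in `Lk≤48Rnq₁` and `L≤p₁`, multiplied together
    -- in `L²≤`.
    c₂ : ℕ → ℕ
    c₂ c = 2304 ℕ.* (R₀ c ℕ.* c)

    c₂-def : ∀ c → c₂ c ≡ 2304 ℕ.* (R₀ c ℕ.* c)
    c₂-def c = refl

  R₀*c≤c₂ : ∀ c → R₀ c ℕ.* c ℕ.≤ c₂ c
  R₀*c≤c₂ c = ℕP.≤-trans (ℕP.m≤n*m (R₀ c ℕ.* c) 2304) (ℕP.≤-reflexive (sym (c₂-def c)))

  1+n≤2^n : ∀ n → suc n ℕ.≤ 2 ℕ.^ n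
  1+n≤2^n zero = ℕP.≤-refl
  1+n≤2^n (suc n) = ℕP.+-mono-≤ (ℕP.m^n>0 2 n) (ℕP.≤-trans (1+n≤2^n n) (ℕP.≤-reflexive (sym (ℕP.+-identityʳ (2 ℕ.^ n)))))

  -- `A₀` must exceed 1024 `c₂` and 24(2`y₀` + 1), although `y₀`, the binary logarithm of 64 `R₀`
  -- `A₀`, grows with it. A power of two with this exponent achieves both.
  y₀ A₀ : ℕ → ℕ
  y₀ c = 6 ℕ.+ 4 ℕ.* c ℕ.+ (4 ℕ.* c ℕ.+ 16 ℕ.+ c₂ c)
  A₀ c = 2 ℕ.^ (4 ℕ.* c ℕ.+ 16 ℕ.+ c₂ c)

  c₂*1024≤A₀ : ∀ c → c₂ c ℕ.* 1024 ℕ.≤ A₀ c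
  c₂*1024≤A₀ c = ℕP.≤-trans (ℕP.*-mono-≤ (ℕP.≤-trans (ℕP.n≤1+n (c₂ c)) (1+n≤2^n (c₂ c))) (numeral-≤ 1024 (2 ℕ.^ 16)))
    (ℕP.≤-trans (ℕP.≤-reflexive (sym (ℕP.^-distribˡ-+-* 2 (c₂ c) 16))) (ℕP.^-monoʳ-≤ 2 (ℕP.≤-trans (ℕP.m≤n+m (c₂ c ℕ.+ 16) (4 ℕ.* c)) (ℕP.≤-reflexive (ℕS.solve 2 (λ a b → a ℕS.:+ (b ℕS.:+ ℕS.con 16) ℕS.:= a ℕS.:+ ℕS.con 16 ℕS.:+ b) refl (4 ℕ.* c) (c₂ c))))))

  24[2y₀+1]≤A₀ : ∀ c → 24 ℕ.* (2 ℕ.* y₀ c ℕ.+ 1) ℕ.≤ A₀ c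
  24[2y₀+1]≤A₀ c = ℕP.≤-trans (ℕP.m≤m+n _ (a ℕ.* 984 ℕ.+ b ℕ.* 1032)) (ℕP.≤-trans (ℕP.≤-reflexive (expand a b))
    (ℕP.≤-trans (ℕP.*-mono-≤ (1+n≤2^n (a ℕ.+ b)) (numeral-≤ 1080 (2 ℕ.^ 16))) (ℕP.≤-trans (ℕP.≤-reflexive (sym (ℕP.^-distribˡ-+-* 2 (a ℕ.+ b) 16)))
      (ℕP.≤-reflexive (cong (2 ℕ.^_) (ℕS.solve 2 (λ a b → a ℕS.:+ b ℕS.:+ ℕS.con 16 ℕS.:= a ℕS.:+ ℕS.con 16 ℕS.:+ b) refl a b))))))
    where
    a = 4 ℕ.* c
    b = c₂ c
    expand : ∀ a b → 24 ℕ.* (2 ℕ.* (6 ℕ.+ a ℕ.+ (a ℕ.+ 16 ℕ.+ b)) ℕ.+ 1) ℕ.+ (a ℕ.* 984 ℕ.+ b ℕ.* 1032) ≡ suc (a ℕ.+ b) ℕ.* 1080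
    expand = ℕS.solve 2 (λ a b → ℕS.con 24 ℕS.:* (ℕS.con 2 ℕS.:* (ℕS.con 6 ℕS.:+ a ℕS.:+ (a ℕS.:+ ℕS.con 16 ℕS.:+ b)) ℕS.:+ ℕS.con 1) ℕS.:+ (a ℕS.:* ℕS.con 984 ℕS.:+ b ℕS.:* ℕS.con 1032) ℕS.:= (ℕS.con 1 ℕS.:+ (a ℕS.:+ b)) ℕS.:* ℕS.con 1080) refl

  -- The edge probability a/N is maximal with at most 1/n dominating sets of size κ = k − 1 expected; here δ = 1/N.
  -- With m = a − n edges, p₂ = a/N serves for events increasing in G and p₁ = (a − 2n)/N for decreasing ones:
  -- the margin of n edges on both sides exceeds the standard deviation of the number of edges.
  record Threshold (n κ L c₁ Z a : ℕ) (δ : F) : Set where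
    field
      1≤κ : 1 ℕ.≤ κ
      2^L≤n : 2 ℕ.^ L ℕ.≤ n
      n≤2^2L : n ℕ.≤ 2 ℕ.^ (2 ℕ.* L)
      1≤c₁ : 1 ℕ.≤ c₁
      L≤c₁k : L ℕ.≤ c₁ ℕ.* suc κ
      c₂≤L : c₂ c₁ ℕ.* 1536 ℕ.≤ L
      8192≤Z : 8192 ℕ.≤ Z
      c₂≤Z : c₂ c₁ ℕ.≤ Z
      L≤Z : L ℕ.≤ Z
      poly : Z ℕ.^ 128 ℕ.* suc κ ℕ.^ 3 ℕ.≤ n
      Nδ : ι (numPairs n) * δ ≡ 1F
      0≤δ : 0F ≤ δ
      a<N : suc a ℕ.≤ numPairs n
      below : ι n * (binomF n κ * (1F - (1F - ι a * δ) ^^ κ) ^^ (n ℕ.∸ κ)) ≤ 1F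
      above : 1F < ι n * (binomF n κ * (1F - (1F - ι (suc a) * δ) ^^ κ) ^^ (n ℕ.∸ κ))

    k N : ℕ
    k = suc κ
    N = numPairs n

    p₁ p₂ p′ ζ ρ₁ ρ₂ ρ′ q₁ q₂ q′ : F
    p₂ = ι a * δ
    p′ = ι (suc a) * δ
    ζ = ι (2 ℕ.* n ℕ.+ 1) * δ
    p₁ = p′ - ζ
    ρ₁ = 1F - p₁
    ρ₂ = 1F - p₂
    ρ′ = 1F - p′
    q₁ = ρ₁ ^^ k
    q₂ = ρ₂ ^^ κ
    q′ = ρ′ ^^ κ

    R c : ℕ
    R = R₀ c₁
    c = c₂ c₁

    1≤R : 1 ℕ.≤ R
    1≤R = 1≤R₀ c₁

    R*c₁≤c : R ℕ.* c₁ ℕ.≤ c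
    R*c₁≤c = R₀*c≤c₂ c₁

    R*c₁≤Z : R ℕ.* c₁ ℕ.≤ Z
    R*c₁≤Z = ℕP.≤-trans R*c₁≤c c₂≤Z

    1≤c : 1 ℕ.≤ c
    1≤c = ℕP.≤-trans (ℕP.*-mono-≤ 1≤R 1≤c₁) R*c₁≤c

    R≤c : R ℕ.≤ c
    R≤c = ℕP.≤-trans (ℕP.m≤m*n R c₁ {{ℕ.>-nonZero 1≤c₁}}) R*c₁≤c

    c₁≤c : c₁ ℕ.≤ c
    c₁≤c = ℕP.≤-trans (ℕP.m≤n*m c₁ R {{ℕ.>-nonZero 1≤R}}) R*c₁≤c

    1536≤L : 1536 ℕ.≤ L
    1536≤L = ℕP.≤-trans (ℕP.≤-trans (ℕP.≤-reflexive (sym (ℕP.*-identityˡ 1536))) (ℕP.*-monoˡ-≤ 1536 1≤c)) c₂≤L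

    1≤L : 1 ℕ.≤ L
    1≤L = ℕP.≤-trans (numeral-≤ 1 1536) 1536≤L

    1≤Z : 1 ℕ.≤ Z
    1≤Z = ℕP.≤-trans (numeral-≤ 1 8192) 8192≤Z

    use : ∀ {x} i j → x ℕ.≤ Z ℕ.^ i → i ℕ.≤ 128 → j ℕ.≤ 3 → x ℕ.* k ℕ.^ j ℕ.≤ n
    use i j h i≤ j≤ = ℕP.≤-trans (ℕP.*-mono-≤ (ℕP.≤-trans h (ℕP.^-monoʳ-≤ Z {{ℕ.>-nonZero 1≤Z}} i≤)) (ℕP.^-monoʳ-≤ k j≤)) poly

    Z*′ : ∀ {a b} i j → a ℕ.≤ Z ℕ.^ i → b ℕ.≤ Z ℕ.^ j → a ℕ.* b ℕ.≤ Z ℕ.^ (i ℕ.+ j)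
    Z*′ i j h h′ = ℕP.≤-trans (ℕP.*-mono-≤ h h′) (ℕP.≤-reflexive (sym (ℕP.^-distribˡ-+-* Z i j)))

    inZ : ∀ {a} → a ℕ.≤ Z → a ℕ.≤ Z ℕ.^ 1
    inZ h = ℕP.≤-trans h (ℕP.≤-reflexive (sym (ℕP.^-identityʳ Z)))

    numeralZ : ∀ b → {h : True (b ℕP.≤? 8192)} → b ℕ.≤ Z ℕ.^ 1
    numeralZ b {h} = inZ (ℕP.≤-trans (toWitness h) 8192≤Z)

    ck≤n : ∀ {x} i → x ℕ.≤ Z ℕ.^ i → i ℕ.≤ 128 → x ℕ.* k ℕ.≤ n
    ck≤n {x} i h i≤ = ℕP.≤-trans (ℕP.≤-reflexive (cong (x ℕ.*_) (sym (ℕP.^-identityʳ k)))) (use i 1 h i≤ (numeral-≤ 1 3))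

    ck²≤n : ∀ {x} i → x ℕ.≤ Z ℕ.^ i → i ℕ.≤ 128 → x ℕ.* (k ℕ.* k) ℕ.≤ n
    ck²≤n {x} i h i≤ = ℕP.≤-trans (ℕP.≤-reflexive (cong (λ z → x ℕ.* (k ℕ.* z)) (sym (ℕP.*-identityʳ k)))) (use i 2 h i≤ (numeral-≤ 2 3))

    x≤n : ∀ {x} i → x ℕ.≤ Z ℕ.^ i → i ℕ.≤ 128 → x ℕ.≤ n
    x≤n {x} i h i≤ = ℕP.≤-trans (ℕP.m≤m*n x k) (ck≤n i h i≤)

    4k≤n : 4 ℕ.* k ℕ.≤ n
    4k≤n = ck≤n 1 (numeralZ 4) (numeral-≤ 1 128)

    k≤n : k ℕ.≤ n
    k≤n = ℕP.≤-trans (ℕP.m≤n*m k 4) 4k≤n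

    κ≤n : κ ℕ.≤ n
    κ≤n = ℕP.≤-trans (ℕP.n≤1+n κ) k≤n

    2≤n : 2 ℕ.≤ n
    2≤n = x≤n 1 (numeralZ 2) (numeral-≤ 1 128)

    1≤n : 1 ℕ.≤ n
    1≤n = ℕP.≤-trans (numeral-≤ 1 2) 2≤n

    0<n : 0F < ι n
    0<n = 0<ι 1≤n

    0≤p₂ : 0F ≤ p₂
    0≤p₂ = 0≤* (0≤ι a) 0≤δ

    0≤p′ : 0F ≤ p′
    0≤p′ = 0≤* (0≤ι (suc a)) 0≤δ

    0≤ζ : 0F ≤ ζ
    0≤ζ = 0≤* (0≤ι (2 ℕ.* n ℕ.+ 1)) 0≤δ

    p′≤1 : p′ ≤ 1F
    p′≤1 = ≤-tr (*-monoʳ δ 0≤δ (ι-mono a<N)) (≤-rf Nδ)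

    p₂≤p′ : p₂ ≤ p′
    p₂≤p′ = *-monoʳ δ 0≤δ (ι-mono (ℕP.n≤1+n a))

    p₂≤1 : p₂ ≤ 1F
    p₂≤1 = ≤-tr p₂≤p′ p′≤1

    p′≡ : p′ ≡ p₂ + δ
    p′≡ = trans (cong (_* δ) (ι-suc a)) (solve 2 (λ a d → (κ′ 1 :+ a) :* d := a :* d :+ d) refl (ι a) δ)
      where
      κ′ : ∀ {m} → ℕ → Polynomial m
      κ′ = OrderedField.κ

    0≤ρ′ = 0≤diff p′≤1
    0≤ρ₂ = 0≤diff p₂≤1
    ρ′≤1 = 1-x≤1 0≤p′
    ρ₂≤1 = 1-x≤1 0≤p₂

    0≤q′ : 0F ≤ q′
    0≤q′ = 0≤^^ 0≤ρ′ κ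

    q′≤1 : q′ ≤ 1F
    q′≤1 = ^^≤1 0≤ρ′ ρ′≤1 κ

    0≤q₂ : 0F ≤ q₂
    0≤q₂ = 0≤^^ 0≤ρ₂ κ

    q₂≤1 : q₂ ≤ 1F
    q₂≤1 = ^^≤1 0≤ρ₂ ρ₂≤1 κ

    n≤2[n∸k] : ι n ≤ ι 2 * ι (n ℕ.∸ k)
    n≤2[n∸k] = ≤-tr (≤-diff _ (0≤diff (≤-tr (≤-tr (≤-rf (sym (ι-* 2 k))) (ι-mono (ℕP.≤-trans (ℕP.*-monoˡ-≤ k (numeral-≤ 2 4)) 4k≤n))) ≤-refl)) (solve 2 (λ n k → OrderedField.κ 2 :* (n :- k) :- n := n :- OrderedField.κ 2 :* k) refl (ι n) (ι k)))
      (≤-rf (cong (ι 2 *_) (sym (ι-∸ k≤n))))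

    n≤2[n∸κ] : ι n ≤ ι 2 * ι (n ℕ.∸ κ)
    n≤2[n∸κ] = ≤-tr n≤2[n∸k] (*-monoˡ (ι 2) 0≤2 (ι-mono (ℕP.∸-monoʳ-≤ n (ℕP.n≤1+n κ))))

    -- If q′ were larger, `decay` would push n times the expected number, which involves at most n ·
    -- n^κ ≤ 2^(2Lk), down to at most 1, against `above`.
    nq′≤ : ι n * q′ ≤ ι (8 ℕ.* L ℕ.* k)
    nq′≤ with ι n * q′ ≤? ι (8 ℕ.* L ℕ.* k)
    ... | yes h = h
    ... | no h = ⊥-elim (<⇒≱ above (≤-tr (≤-rf (sym (*-assoc _ _ _))) (≤-tr (*-monoʳ _ (0≤^^ (0≤diff q′≤1) (n ℕ.∸ κ)) count)
        (decay 0≤q′ q′≤1 (2 ℕ.* L ℕ.* k) (n ℕ.∸ κ) rate))))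
      where
      count : ι n * binomF n κ ≤ ι 2 ^^ (2 ℕ.* L ℕ.* k)
      count = ≤-tr (≤-rf (sym (ι-* n (binom n κ)))) (≤-tr (ι-mono (ℕP.≤-trans (ℕP.*-monoʳ-≤ n (binom≤^ n κ)) (ℕP.≤-trans (ℕP.^-monoˡ-≤ k n≤2^2L) (ℕP.≤-reflexive (ℕP.^-*-assoc 2 (2 ℕ.* L) k))))) (≤-rf (ι-^ 2 (2 ℕ.* L ℕ.* k))))
      rate : ι (2 ℕ.* (2 ℕ.* L ℕ.* k)) ≤ ι (n ℕ.∸ κ) * q′
      rate = *-cancelˡ (ι 2) (0<ι {2} (s≤s z≤n)) (≤-tr (≤-rf (trans (sym (ι-* 2 (2 ℕ.* (2 ℕ.* L ℕ.* k)))) (cong ι (ℕS.solve 2 (λ L k → ℕS.con 2 ℕS.:* (ℕS.con 2 ℕS.:* (ℕS.con 2 ℕS.:* L ℕS.:* k)) ℕS.:= ℕS.con 8 ℕS.:* L ℕS.:* k) refl L k))))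
        (≤-tr (<⇒≤ (≰⇒> h)) (≤-tr (*-monoʳ q′ 0≤q′ n≤2[n∸κ]) (≤-rf (*-assoc _ _ _)))))

    complement-step : ∀ {x} → 0F ≤ x → ι 2 * x ≤ 1F → 1F ≤ (1F - x) * (1F + ι 2 * x)
    complement-step {x} h h′ = ≤-diff _ (0≤* h (0≤diff h′)) (solve 1 (λ x → (OrderedField.κ 1 :- x) :* (OrderedField.κ 1 :+ OrderedField.κ 2 :* x) :- OrderedField.κ 1 := x :* (OrderedField.κ 1 :- OrderedField.κ 2 :* x)) refl x)

    -- A lower bound for (1 - x)^t: (1 - x)(1 + 2x) ≥ 1 reduces it to `growth-upper`.
    slow-decay : ∀ {x} t J → 0F ≤ x → ι 8 * x ≤ 1F → ι 8 * (ι t * x) ≤ ι J → 1F ≤ (1F - x) ^^ t * ι 2 ^^ J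
    slow-decay {x} t J h h′ h″ = ≤-tr (1≤^^ (complement-step h (≤-tr (*-monoʳ x h (ι-mono {2} {8} (numeral-≤ 2 8))) h′)) t) (≤-tr (≤-rf (^^-*-dist (1F - x) (1F + ι 2 * x) t))
      (*-monoˡ _ (0≤^^ (0≤diff x≤1) t) (growth-upper (0≤* 0≤2 h) (≤-tr (≤-rf (solve 1 (λ x → OrderedField.κ 4 :* (OrderedField.κ 2 :* x) := OrderedField.κ 8 :* x) refl x)) h′) J t
        (≤-tr (≤-rf (solve 2 (λ t x → OrderedField.κ 4 :* (t :* (OrderedField.κ 2 :* x)) := OrderedField.κ 8 :* (t :* x)) refl (ι t) x)) h″))))
      where
      x≤1 : x ≤ 1F
      x≤1 = ≤-tr (≤-tr (≤-rf (sym (*-identityˡ x))) (*-monoʳ x h (ι-mono {1} {8} (numeral-≤ 1 8)))) h′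

    Lκ≤n : L ℕ.* κ ℕ.≤ n
    Lκ≤n = ℕP.≤-trans (ℕP.*-monoʳ-≤ L (ℕP.n≤1+n κ)) (ck≤n 1 (inZ L≤Z) (numeral-≤ 1 128))

    -- C(n, κ) ≥ (n/κ)^κ, and κ² ≤ n then gives C(n, κ)² ≥ n^κ ≥ 2^(Lκ).
    2^J≤C : ∀ J → 2 ℕ.* J ℕ.≤ L ℕ.* κ → ι 2 ^^ J ≤ binomF n κ
    2^J≤C J h = sq-cancel (0≤binomF n κ) (≤-tr (≤-rf (trans (sym (^^-+ (ι 2) J J)) (sym (ι-^ 2 (J ℕ.+ J))))) (≤-tr (ι-mono (ℕP.≤-trans two C²)) (≤-rf (ι-* (binom n κ) (binom n κ)))))
      where
      two : 2 ℕ.^ (J ℕ.+ J) ℕ.≤ n ℕ.^ κ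
      two = ℕP.≤-trans (ℕP.^-monoʳ-≤ 2 (ℕP.≤-trans (ℕP.≤-reflexive (cong (J ℕ.+_) (sym (ℕP.+-identityʳ J)))) h)) (ℕP.≤-trans (ℕP.≤-reflexive (sym (ℕP.^-*-assoc 2 L κ))) (ℕP.^-monoˡ-≤ κ 2^L≤n))
      lower : n ℕ.^ κ ℕ.≤ κ ℕ.^ κ ℕ.* binom n κ
      lower = ι-cancel-≤ (≤-tr (≤-rf (trans (ι-^ n κ) (sym (trans (cong (λ z → ι n ^^ κ * ι z) (binom-self κ)) (*-identityʳ _))))) (≤-tr (binom-ratio-pow κ≤n κ) (≤-rf (trans (cong (_* binomF n κ) (sym (ι-^ κ κ))) (sym (ι-* (κ ℕ.^ κ) (binom n κ)))))))
      κκ≤n : κ ℕ.* κ ℕ.≤ n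
      κκ≤n = ℕP.≤-trans (ℕP.*-mono-≤ (ℕP.n≤1+n κ) (ℕP.n≤1+n κ)) (ℕP.≤-trans (ℕP.≤-reflexive (sym (ℕP.*-identityˡ (k ℕ.* k)))) (ck²≤n 1 (numeralZ 1) (numeral-≤ 1 128)))
      C² : n ℕ.^ κ ℕ.≤ binom n κ ℕ.* binom n κ
      C² = ℕP.*-cancelˡ-≤ {n ℕ.^ κ} {binom n κ ℕ.* binom n κ} (n ℕ.^ κ) {{ℕ.>-nonZero (ℕP.m^n>0 n {{ℕ.>-nonZero 1≤n}} κ)}} (ℕP.≤-trans (ℕP.*-mono-≤ lower lower)
        (ℕP.≤-trans (ℕP.≤-reflexive (trans (ℕS.solve 2 (λ a b → a ℕS.:* b ℕS.:* (a ℕS.:* b) ℕS.:= a ℕS.:* a ℕS.:* (b ℕS.:* b)) refl (κ ℕ.^ κ) (binom n κ)) (cong (ℕ._* (binom n κ ℕ.* binom n κ)) (sym (^-distribʳ-* κ κ κ)))))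
          (ℕP.*-monoˡ-≤ (binom n κ ℕ.* binom n κ) (ℕP.^-monoˡ-≤ κ κκ≤n))))

    k≤2κ : k ℕ.≤ 2 ℕ.* κ
    k≤2κ = ℕP.≤-trans (ℕP.+-monoˡ-≤ κ 1≤κ) (ℕP.≤-reflexive (cong (κ ℕ.+_) (sym (ℕP.+-identityʳ κ))))

    -- Take J between Lκ/3 and Lκ/2. If 8nq₂ were below J, then (1 - q₂)^n ≥ 2^(-J) ≥ 1/C(n, κ), and
    -- n times the expected number would be at least n ≥ 2, against `below`. As Lk ≤ 2Lκ ≤ 6J, the
    -- constant is 6 · 8.
    Lk≤48nq₂ : ι (L ℕ.* k) ≤ ι 48 * (ι n * q₂)
    Lk≤48nq₂ with halfOf (L ℕ.* κ) (ℕP.*-mono-≤ (ℕP.≤-trans (numeral-≤ 2 1536) 1536≤L) 1≤κ)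
    ... | J , 2J≤ , ≤3J with ι J ≤? ι 8 * (ι n * q₂)
    ... | yes h = ≤-tr (ι-mono (ℕP.≤-trans (ℕP.*-monoʳ-≤ L k≤2κ) (ℕP.≤-trans (ℕP.≤-reflexive (ℕS.solve 2 (λ L κ → L ℕS.:* (ℕS.con 2 ℕS.:* κ) ℕS.:= ℕS.con 2 ℕS.:* (L ℕS.:* κ)) refl L κ)) (ℕP.≤-trans (ℕP.*-monoʳ-≤ 2 ≤3J) (ℕP.≤-reflexive (sym (ℕP.*-assoc 2 3 J)))))))
        (≤-tr (≤-rf (ι-* 6 J)) (≤-tr (*-monoˡ (ι 6) (0≤ι 6) h) (≤-rf (solve 1 (λ x → OrderedField.κ 6 :* (OrderedField.κ 8 :* x) := OrderedField.κ 48 :* x) refl (ι n * q₂)))))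
    ... | no h = ⊥-elim (ℕP.<⇒≱ 2≤n (ι-cancel-≤ (≤-tr (≤*ʳ (0≤ι n) one) (≤-tr (*-monoˡ (ι n) (0≤ι n) (≤-tr (≤-rf (*-comm _ _)) (*-mono (0≤^^ 0≤2 J) (2^J≤C J 2J≤) (0≤^^ (0≤diff q₂≤1) n) (^^-anti (0≤diff q₂≤1) (1-x≤1 0≤q₂) (ℕP.m∸n≤m n κ))))) below))))
      where
      small : ι 8 * (ι n * q₂) ≤ ι J
      small = <⇒≤ (≰⇒> h)
      8q₂ : ι 8 * q₂ ≤ 1F
      8q₂ = *-cancelˡ (ι n) 0<n (≤-tr (≤-rf (solve 2 (λ n q → n :* (OrderedField.κ 8 :* q) := OrderedField.κ 8 :* (n :* q)) refl (ι n) q₂)) (≤-tr small (≤-tr (ι-mono (ℕP.≤-trans (ℕP.≤-trans (ℕP.m≤n*m J 2) 2J≤) Lκ≤n)) (≤-rf (sym (*-identityʳ (ι n)))))))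
      one : 1F ≤ (1F - q₂) ^^ n * ι 2 ^^ J
      one = slow-decay n J 0≤q₂ 8q₂ small

    q₂-not-tiny : ¬ (ι 2 ^^ (2 ℕ.* L) * q₂ ≤ 1F)
    q₂-not-tiny h = ℕP.<⇒≱ {48} {L ℕ.* k} (ℕP.≤-trans (numeral-≤ 49 1536) (ℕP.≤-trans 1536≤L (ℕP.m≤m*n L k))) (ι-cancel-≤ (≤-tr Lk≤48nq₂
      (≤-tr (*-monoˡ (ι 48) (0≤ι 48) (≤-tr (*-monoʳ q₂ 0≤q₂ (≤-tr (ι-mono n≤2^2L) (≤-rf (ι-^ 2 (2 ℕ.* L))))) h)) (≤-rf (*-identityʳ _)))))

    -- The lower bound k ≥ ε log n enters here, as L ≤ c₁k ≤ 2c₁κ: with ρ₂ < 1/R, q₂ would be at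
    -- most 2^(-2L), which `q₂-not-tiny` excludes.
    1≤Rρ₂ : 1F ≤ ι R * ρ₂
    1≤Rρ₂ with 1F ≤? ι R * ρ₂
    ... | yes h = h
    ... | no h = ⊥-elim (q₂-not-tiny (≤-tr (*-monoʳ q₂ 0≤q₂ big) (≤-tr (≤-rf (sym (^^-*-dist (ι R) ρ₂ κ))) (^^≤1 (0≤* (0≤ι R) 0≤ρ₂) (<⇒≤ (≰⇒> h)) κ))))
      where
      big : ι 2 ^^ (2 ℕ.* L) ≤ ι R ^^ κ
      big = ≤-tr (^^-monoʳ (1≤ι {2} (numeral-≤ 1 2)) (ℕP.≤-trans (ℕP.*-monoʳ-≤ 2 (ℕP.≤-trans L≤c₁k (ℕP.*-monoʳ-≤ c₁ k≤2κ))) (ℕP.≤-reflexive (ℕS.solve 2 (λ c κ → ℕS.con 2 ℕS.:* (c ℕS.:* (ℕS.con 2 ℕS.:* κ)) ℕS.:= ℕS.con 4 ℕS.:* c ℕS.:* κ) refl c₁ κ))))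
        (≤-rf (trans (^^-*′ (ι 2) (4 ℕ.* c₁) κ) (cong (_^^ κ) (sym (ι-^ 2 (4 ℕ.* c₁))))))

    kp₂≤ : ι k * p₂ ≤ ι (8 ℕ.* L)
    kp₂≤ with ι (2 ℕ.* (2 ℕ.* L)) ≤? ι κ * p₂
    ... | yes h = ⊥-elim (q₂-not-tiny (decay 0≤p₂ p₂≤1 (2 ℕ.* L) κ h))
    ... | no h = ≤-tr (*-monoʳ p₂ 0≤p₂ (≤-tr (ι-mono k≤2κ) (≤-rf (ι-* 2 κ)))) (≤-tr (≤-rf (*-assoc _ _ _)) (≤-tr (*-monoˡ (ι 2) 0≤2 (<⇒≤ (≰⇒> h))) (≤-rf (trans (sym (ι-* 2 (2 ℕ.* (2 ℕ.* L)))) (cong ι (ℕS.solve 1 (λ L → ℕS.con 2 ℕS.:* (ℕS.con 2 ℕS.:* (ℕS.con 2 ℕS.:* L)) ℕS.:= ℕS.con 8 ℕS.:* L) refl L))))))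

    n²≤4N : n ℕ.* n ℕ.≤ 4 ℕ.* N
    n²≤4N = ι-cancel-≤ (≤-diff _ (0≤diff (≤-tr (≤-rf (sym (ι-* 2 n))) (≤-tr (ι-mono (ℕP.*-monoˡ-≤ n 2≤n)) (≤-rf (ι-* n n))))) (trans (cong₂ _-_ (ι-* 4 N) (ι-* n n))
      (trans (cong (λ z → ι 4 * ι N - z) (sym (numPairs-eq n))) (trans (solve 2 (λ N n → OrderedField.κ 4 :* N :- (OrderedField.κ 2 :* N :+ n) := (OrderedField.κ 2 :* N :+ n) :- OrderedField.κ 2 :* n) refl (ι N) (ι n)) (cong (_- ι 2 * ι n) (numPairs-eq n))))))

    -- The shift by 2n + 1 edges changes the probability only by order 1/n, because N ≥ n²/4.
    nζ≤12 : ι n * ζ ≤ ι 12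
    nζ≤12 = ≤-tr (≤-rf (trans (sym (*-assoc _ _ _)) (cong (_* δ) (sym (ι-* n (2 ℕ.* n ℕ.+ 1)))))) (≤-tr (*-monoʳ δ 0≤δ (ι-mono (ℕP.≤-trans (ℕP.*-monoʳ-≤ n (ℕP.+-monoʳ-≤ (2 ℕ.* n) 1≤n))
        (ℕP.≤-trans (ℕP.≤-reflexive (ℕS.solve 1 (λ n → n ℕS.:* (ℕS.con 2 ℕS.:* n ℕS.:+ n) ℕS.:= ℕS.con 3 ℕS.:* (n ℕS.:* n)) refl n)) (ℕP.≤-trans (ℕP.*-monoʳ-≤ 3 n²≤4N) (ℕP.≤-reflexive (sym (ℕP.*-assoc 3 4 N))))))))
      (≤-rf (trans (cong (_* δ) (ι-* 12 N)) (trans (*-assoc _ _ _) (trans (cong (ι 12 *_) Nδ) (*-identityʳ _))))))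

    ζ-small : ∀ x → 12 ℕ.* x ℕ.≤ n → ι x * ζ ≤ 1F
    ζ-small x h = *-cancelˡ (ι n) 0<n (≤-tr (≤-rf (solve 3 (λ n x z → n :* (x :* z) := x :* (n :* z)) refl (ι n) (ι x) ζ)) (≤-tr (*-monoˡ (ι x) (0≤ι x) nζ≤12) (≤-tr (≤-rf (trans (*-comm _ _) (sym (ι-* 12 x)))) (≤-tr (ι-mono h) (≤-rf (sym (*-identityʳ _)))))))

    δ≤ζ : δ ≤ ζ
    δ≤ζ = ≤-tr (≤-rf (sym (*-identityˡ δ))) (*-monoʳ δ 0≤δ (1≤ι (ℕP.m≤n+m 1 (2 ℕ.* n))))

    1≤2Rρ′ : 1F ≤ ι (2 ℕ.* R) * ρ′
    1≤2Rρ′ = ≤-tr (≤-diff _ (0≤+ (0≤* 0≤2 (0≤diff 1≤Rρ₂)) (0≤diff (≤-tr (*-monoˡ (ι (2 ℕ.* R)) (0≤ι (2 ℕ.* R)) δ≤ζ) (ζ-small (2 ℕ.* R) R-small))))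
        (trans (cong (λ z → z * (1F - p₂ - δ) - 1F) (ι-* 2 R)) (trans (solve 3 (λ R p d → OrderedField.κ 2 :* R :* (OrderedField.κ 1 :- p :- d) :- OrderedField.κ 1 := OrderedField.κ 2 :* (R :* (OrderedField.κ 1 :- p) :- OrderedField.κ 1) :+ (OrderedField.κ 1 :- OrderedField.κ 2 :* R :* d)) refl (ι R) p₂ δ) (cong (λ z → ι 2 * (ι R * ρ₂ - 1F) + (1F - z * δ)) (sym (ι-* 2 R))))))
      (≤-rf (cong (ι (2 ℕ.* R) *_) (trans (solve 2 (λ p d → OrderedField.κ 1 :- p :- d := OrderedField.κ 1 :- (p :+ d)) refl p₂ δ) (cong (λ z → 1F - z) (sym p′≡)))))
      where
      R-small : 12 ℕ.* (2 ℕ.* R) ℕ.≤ n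
      R-small = x≤n 3 (Z*′ 1 2 (numeralZ 12) (Z*′ 1 1 (numeralZ 2) (inZ (ℕP.≤-trans R≤c c₂≤Z)))) (numeral-≤ 3 128)

    -- If κp′ were small against L, then q′ ≥ n^(-1/2), hence n ≤ (nq′)² ≤ (8Lk)², which is
    -- impossible as k³ is below n by a power of Z. For 8p′ > 1 the bound follows from L ≤ c₁k.
    L≤p′ : ι L ≤ ι (24 ℕ.* c₁) * (ι k * p′)
    L≤p′ with ι 8 * p′ ≤? 1F
    ... | no h = ≤-tr (ι-mono {L} {3 ℕ.* (c₁ ℕ.* k)} (ℕP.≤-trans L≤c₁k (ℕP.m≤n*m (c₁ ℕ.* k) 3))) (≤-tr (≤-rf (trans (ι-* 3 (c₁ ℕ.* k)) (sym (*-identityʳ _)))) (≤-tr (*-monoˡ _ (0≤* (0≤ι 3) (0≤ι (c₁ ℕ.* k))) (<⇒≤ (≰⇒> h)))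
        (≤-rf (trans (cong (λ z → ι 3 * z * (ι 8 * p′)) (ι-* c₁ k)) (trans (solve 3 (λ c k p → OrderedField.κ 3 :* (c :* k) :* (OrderedField.κ 8 :* p) := OrderedField.κ 24 :* c :* (k :* p)) refl (ι c₁) (ι k) p′) (cong (_* (ι k * p′)) (sym (ι-* 24 c₁))))))))
    ... | yes 8p′ with halfOf L (ℕP.≤-trans (numeral-≤ 2 1536) 1536≤L)
    ... | J , 2J≤ , ≤3J with ι J ≤? ι 8 * (ι κ * p′)
    ... | yes h = ≤-tr (ι-mono ≤3J) (≤-tr (≤-rf (ι-* 3 J)) (≤-tr (*-monoˡ (ι 3) (0≤ι 3) (≤-tr h (*-monoˡ (ι 8) (0≤ι 8) (*-monoʳ p′ 0≤p′ (ι-mono (ℕP.n≤1+n κ))))))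
        (≤-tr (≤-rf (solve 1 (λ x → OrderedField.κ 3 :* (OrderedField.κ 8 :* x) := OrderedField.κ 24 :* x) refl (ι k * p′))) (*-monoʳ (ι k * p′) (0≤* (0≤ι k) 0≤p′) (ι-mono (ℕP.≤-trans (ℕP.≤-reflexive (sym (ℕP.*-identityʳ 24))) (ℕP.*-monoʳ-≤ 24 1≤c₁)))))))
    ... | no h = ⊥-elim (ℕP.<⇒≱ big (ι-cancel-≤ {n} {8 ℕ.* L ℕ.* k ℕ.* (8 ℕ.* L ℕ.* k)} (≤-tr (≤*ʳ (0≤ι n) one²)
        (≤-tr (≤-rf (solve 2 (λ n q → n :* (q :* q :* n) := n :* q :* (n :* q)) refl (ι n) q′)) (≤-tr (*-mono (0≤* (0≤ι n) 0≤q′) nq′≤ (0≤* (0≤ι n) 0≤q′) nq′≤) (≤-rf (sym (ι-* (8 ℕ.* L ℕ.* k) (8 ℕ.* L ℕ.* k)))))))))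
      where
      one : 1F ≤ q′ * ι 2 ^^ J
      one = slow-decay κ J 0≤p′ 8p′ (<⇒≤ (≰⇒> h))
      one² : 1F ≤ q′ * q′ * ι n
      one² = ≤-tr (≤-rf (sym (*-identityˡ 1F))) (≤-tr (*-mono 0≤1 one 0≤1 one) (≤-tr (≤-rf (solve 2 (λ q j → q :* j :* (q :* j) := q :* q :* (j :* j)) refl q′ (ι 2 ^^ J)))
        (*-monoˡ (q′ * q′) (0≤sq q′) (≤-tr (≤-rf (trans (sym (^^-+ (ι 2) J J)) (sym (ι-^ 2 (J ℕ.+ J))))) (ι-mono (ℕP.≤-trans (ℕP.^-monoʳ-≤ 2 (ℕP.≤-trans (ℕP.≤-reflexive (cong (J ℕ.+_) (sym (ℕP.+-identityʳ J)))) 2J≤)) 2^L≤n))))))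
      big : 8 ℕ.* L ℕ.* k ℕ.* (8 ℕ.* L ℕ.* k) ℕ.< n
      big = ℕP.≤-trans (ℕP.+-monoˡ-≤ (8 ℕ.* L ℕ.* k ℕ.* (8 ℕ.* L ℕ.* k)) (ℕP.*-mono-≤ (ℕP.*-mono-≤ 1≤L 1≤L) (s≤s (z≤n {κ ℕ.+ κ ℕ.* k}))))
        (ℕP.≤-trans (ℕP.≤-reflexive (ℕS.solve 2 (λ L k → L ℕS.:* L ℕS.:* (k ℕS.:* k) ℕS.:+ ℕS.con 8 ℕS.:* L ℕS.:* k ℕS.:* (ℕS.con 8 ℕS.:* L ℕS.:* k) ℕS.:= ℕS.con 65 ℕS.:* (L ℕS.:* L) ℕS.:* (k ℕS.:* k)) refl L k))
          (ck²≤n 3 (Z*′ 1 2 (numeralZ 65) (Z*′ 1 1 (inZ L≤Z) (inZ L≤Z))) (numeral-≤ 3 128)))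

    48c₁k>0 : 0F < ι (48 ℕ.* c₁) * ι k
    48c₁k>0 = 0<* (0<ι (ℕP.*-mono-≤ (numeral-≤ 1 48) 1≤c₁)) (0<ι {k} (s≤s z≤n))

    L≤p₁ : ι L ≤ ι (48 ℕ.* c₁) * (ι k * p₁)
    L≤p₁ = ≤-diff _ (0≤+ (0≤+ (0≤diff L≤p′) (0≤diff L≤p′)) (0≤diff (≤-tr small (1≤ι 1≤L))))
      (trans (cong (λ z → z * (ι k * p₁) - ι L) (ι-* 48 c₁)) (trans (solve 5 (λ c k p z L → OrderedField.κ 48 :* c :* (k :* (p :- z)) :- L := (OrderedField.κ 24 :* c :* (k :* p) :- L) :+ (OrderedField.κ 24 :* c :* (k :* p) :- L) :+ (L :- OrderedField.κ 48 :* c :* k :* z)) refl (ι c₁) (ι k) p′ ζ (ι L))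
        (cong₂ (λ u v → (u * (ι k * p′) - ι L) + (u * (ι k * p′) - ι L) + (ι L - v * ζ)) (sym (ι-* 24 c₁)) (sym (trans (ι-* (48 ℕ.* c₁) k) (cong (_* ι k) (ι-* 48 c₁)))))))
      where
      small : ι (48 ℕ.* c₁ ℕ.* k) * ζ ≤ 1F
      small = ζ-small (48 ℕ.* c₁ ℕ.* k) (ℕP.≤-trans (ℕP.≤-reflexive (sym (ℕP.*-assoc 12 (48 ℕ.* c₁) k))) (ck≤n 3 (Z*′ 1 2 (numeralZ 12) (Z*′ 1 1 (numeralZ 48) (inZ (ℕP.≤-trans c₁≤c c₂≤Z)))) (numeral-≤ 3 128)))

    0≤p₁ : 0F ≤ p₁
    0≤p₁ = *-cancelˡ (ι (48 ℕ.* c₁) * ι k) 48c₁k>0 (≤-tr (≤-rf (zeroʳ _)) (≤-tr (0≤ι L) (≤-tr L≤p₁ (≤-rf (sym (*-assoc _ _ _))))))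

    p₁≤p₂ : p₁ ≤ p₂
    p₁≤p₂ = ≤-diff _ (0≤diff δ≤ζ) (trans (cong (λ z → p₂ - (z - ζ)) p′≡) (solve 3 (λ p d z → p :- (p :+ d :- z) := z :- d) refl p₂ δ ζ))

    p₁≤1 : p₁ ≤ 1F
    p₁≤1 = ≤-tr p₁≤p₂ p₂≤1

    0≤ρ₁ = 0≤diff p₁≤1

    ρ₂≤ρ₁ : ρ₂ ≤ ρ₁
    ρ₂≤ρ₁ = ≤-diff _ (0≤diff p₁≤p₂) (solve 2 (λ a b → OrderedField.κ 1 :- a :- (OrderedField.κ 1 :- b) := b :- a) refl p₁ p₂)

    1≤Rρ₁ : 1F ≤ ι R * ρ₁
    1≤Rρ₁ = ≤-tr 1≤Rρ₂ (*-monoˡ (ι R) (0≤ι R) ρ₂≤ρ₁)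

    0≤q₁ : 0F ≤ q₁
    0≤q₁ = 0≤^^ 0≤ρ₁ k

    -- Relative effect of the shift: ρ₁ ≤ ρ′(1 + x) and (1 + x)^κ ≤ 1 + ε.
    x ε : F
    x = ι (2 ℕ.* R) * ζ
    ε = ι 2 * (ι κ * x)

    0≤x : 0F ≤ x
    0≤x = 0≤* (0≤ι (2 ℕ.* R)) 0≤ζ

    0≤ε : 0F ≤ ε
    0≤ε = 0≤* 0≤2 (0≤* (0≤ι κ) 0≤x)

    -- The shift must cost less than the k-th vertex gains. Here ε is of order k/n and p₁ at least
    -- of order L/k, so it suffices that k² is far below n.
    2ε≤p₁ : ι 2 * ε ≤ p₁
    2ε≤p₁ = *-cancelˡ (ι (48 ℕ.* c₁) * ι k) 48c₁k>0 (≤-tr (≤-rf (trans (cong₂ (λ u v → u * ι k * (ι 2 * (ι 2 * (ι κ * (v * ζ))))) (ι-* 48 c₁) (ι-* 2 R))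
        (trans (solve 5 (λ c k κ′ R z → OrderedField.κ 48 :* c :* k :* (OrderedField.κ 2 :* (OrderedField.κ 2 :* (κ′ :* (OrderedField.κ 2 :* R :* z)))) := OrderedField.κ 384 :* (R :* c) :* (k :* κ′) :* z) refl (ι c₁) (ι k) (ι κ) (ι R) ζ)
          (cong (_* ζ) (sym (trans (ι-* (384 ℕ.* (R ℕ.* c₁)) (k ℕ.* κ)) (cong₂ _*_ (trans (ι-* 384 (R ℕ.* c₁)) (cong (ι 384 *_) (ι-* R c₁))) (ι-* k κ))))))))
      (≤-tr (ζ-small (384 ℕ.* (R ℕ.* c₁) ℕ.* (k ℕ.* κ)) count) (≤-tr (1≤ι 1≤L) (≤-tr L≤p₁ (≤-rf (sym (*-assoc _ _ _)))))))
      where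
      count : 12 ℕ.* (384 ℕ.* (R ℕ.* c₁) ℕ.* (k ℕ.* κ)) ℕ.≤ n
      count = ℕP.≤-trans (ℕP.*-monoʳ-≤ 12 (ℕP.*-monoʳ-≤ (384 ℕ.* (R ℕ.* c₁)) (ℕP.*-monoʳ-≤ k (ℕP.n≤1+n κ)))) (ℕP.≤-trans (ℕP.≤-reflexive (sym (ℕP.*-assoc 12 (384 ℕ.* (R ℕ.* c₁)) (k ℕ.* k))))
        (ck²≤n 3 (Z*′ 1 2 (numeralZ 12) (Z*′ 1 1 (numeralZ 384) (inZ R*c₁≤Z))) (numeral-≤ 3 128)))

    ε≤1 : ε ≤ 1F
    ε≤1 = ≤-tr (≤-tr (≤-tr (≤-rf (sym (*-identityˡ ε))) (*-monoʳ ε 0≤ε (ι-mono {1} {2} (numeral-≤ 1 2)))) 2ε≤p₁) p₁≤1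

    ρ₁^κ≤ : ρ₁ ^^ κ ≤ q′ * (1F + ε)
    ρ₁^κ≤ = ≤-tr (^^-mono 0≤ρ₁ (≤-diff _ (0≤* 0≤ζ (0≤diff 1≤2Rρ′)) (solve 3 (λ p z w → (OrderedField.κ 1 :- p) :* (OrderedField.κ 1 :+ w :* z) :- (OrderedField.κ 1 :- (p :- z)) := z :* (w :* (OrderedField.κ 1 :- p) :- OrderedField.κ 1)) refl p′ ζ (ι (2 ℕ.* R)))) κ)
      (≤-tr (≤-rf (^^-*-dist ρ′ (1F + x) κ)) (*-monoˡ q′ 0≤q′ (1+x^n≤1+2nx 0≤x κ ε≤1)))

    -- Sets of size k = κ + 1 bring one more factor ρ₁ = 1 - p₁, which outweighs the loss 1 + ε with
    -- ε ≤ p₁/2. So q drops by at least p₁q′/2, the quantity `d` below.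
    2q₁≤ : ι 2 * q₁ ≤ (ι 2 - p₁) * q′
    2q₁≤ = ≤-tr (*-monoˡ (ι 2) 0≤2 (*-monoˡ ρ₁ 0≤ρ₁ ρ₁^κ≤)) (≤-diff _ (0≤* (0≤+ (0≤* 0≤ρ₁ (0≤diff 2ε≤p₁)) (0≤sq p₁)) 0≤q′)
      (solve 3 (λ p q e → (OrderedField.κ 2 :- p) :* q :- OrderedField.κ 2 :* ((OrderedField.κ 1 :- p) :* (q :* (OrderedField.κ 1 :+ e))) := ((OrderedField.κ 1 :- p) :* (p :- OrderedField.κ 2 :* e) :+ p :* p) :* q) refl p₁ q′ ε))

    d : F
    d = q′ - q₁

    p₁q′≤2d : p₁ * q′ ≤ ι 2 * d
    p₁q′≤2d = ≤-diff _ (0≤diff 2q₁≤) (solve 3 (λ p q r → OrderedField.κ 2 :* (q :- r) :- p :* q := (OrderedField.κ 2 :- p) :* q :- OrderedField.κ 2 :* r) refl p₁ q′ q₁)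

    0≤d : 0F ≤ d
    0≤d = *-cancelˡ (ι 2) (0<ι {2} (s≤s z≤n)) (≤-tr (≤-rf (zeroʳ _)) (≤-tr (0≤* 0≤p₁ 0≤q′) p₁q′≤2d))

    q₁≤q′ : q₁ ≤ q′
    q₁≤q′ = ≤-diff d 0≤d refl

    d≤1 : d ≤ 1F
    d≤1 = ≤-tr (≤-diff q₁ 0≤q₁ (solve 2 (λ a b → a :- (a :- b) := b) refl q′ q₁)) q′≤1

    Lk≤48Rnq₁ : ι (L ℕ.* k) ≤ ι 48 * (ι n * (ι R * q₁))
    Lk≤48Rnq₁ = ≤-tr Lk≤48nq₂ (*-monoˡ (ι 48) (0≤ι 48) (*-monoˡ (ι n) (0≤ι n) (≤-tr (≤-tr (^^-mono 0≤ρ₂ ρ₂≤ρ₁ κ) (≤-tr (≤-rf (sym (*-identityˡ _))) (*-monoʳ (ρ₁ ^^ κ) (0≤^^ 0≤ρ₁ κ) 1≤Rρ₁))) (≤-rf (*-assoc _ _ _)))))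

    L²≤ : ι (L ℕ.* L) ≤ ι c * (ι n * q₁ * p₁)
    L²≤ = *-cancelˡ (ι k) (0<ι {k} (s≤s z≤n)) (≤-tr (≤-rf (trans (sym (ι-* k (L ℕ.* L))) (trans (cong ι (ℕS.solve 2 (λ k L → k ℕS.:* (L ℕS.:* L) ℕS.:= L ℕS.:* k ℕS.:* L) refl k L)) (ι-* (L ℕ.* k) L))))
      (≤-tr (*-mono (0≤ι (L ℕ.* k)) Lk≤48Rnq₁ (0≤ι L) L≤p₁) (≤-rf (trans (cong (λ z → ι 48 * (ι n * (ι R * q₁)) * (z * (ι k * p₁))) (ι-* 48 c₁))
        (trans (solve 6 (λ n R q c k p → OrderedField.κ 48 :* (n :* (R :* q)) :* (OrderedField.κ 48 :* c :* (k :* p)) := k :* (OrderedField.κ 2304 :* (R :* c) :* (n :* q :* p))) refl (ι n) (ι R) q₁ (ι c₁) (ι k) p₁)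
          (cong (λ z → ι k * (z * (ι n * q₁ * p₁))) (sym (trans (cong ι (c₂-def c₁)) (trans (ι-* 2304 (R ℕ.* c₁)) (cong (ι 2304 *_) (ι-* R c₁))))))))))) 

    c*32≢0 : ℕ.NonZero (c ℕ.* 32)
    c*32≢0 = ℕ.>-nonZero (ℕP.*-mono-≤ 1≤c (numeral-≤ 1 32))

    -- (n - k)`d` ≥ L²/(4c) pays for J₀ doublings and for 2L more that cover the factor n; the
    -- divisor 32c also secures 32J₀ ≤ Lk for `Regime`.
    J₀ : ℕ
    J₀ = (L ℕ.* L) / (c ℕ.* 32)
      where instance _ = c*32≢0

    J₀-upper : J₀ ℕ.* (c ℕ.* 32) ℕ.≤ L ℕ.* L
    J₀-upper = m/n*n≤m (L ℕ.* L) (c ℕ.* 32) {{c*32≢0}}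

    L²<J₀ : L ℕ.* L ℕ.< suc J₀ ℕ.* (c ℕ.* 32)
    L²<J₀ = ℕP.≤-trans (s≤s (ℕP.≤-reflexive (m≡m%n+[m/n]*n (L ℕ.* L) (c ℕ.* 32) {{c*32≢0}}))) (ℕP.+-monoˡ-≤ (J₀ ℕ.* (c ℕ.* 32)) (m%n<n (L ℕ.* L) (c ℕ.* 32) {{c*32≢0}}))

    c*b≤L : ∀ b → {h : True (b ℕP.≤? 1536)} → c ℕ.* b ℕ.≤ L
    c*b≤L b {h} = ℕP.≤-trans (ℕP.*-monoʳ-≤ c (toWitness h)) c₂≤L

    C≤K : binomF n κ ≤ binomF n k
    C≤K = *-cancelˡ (ι k) (0<ι {k} (s≤s z≤n)) (≤-diff _ (0≤* (0≤diff (ι-mono {κ ℕ.+ k} {n} room)) (0≤binomF n κ)) (trans (cong (_- ι k * binomF n κ) step)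
      (trans (solve 4 (λ n κ′ k C → (n :* C :- κ′ :* C) :- k :* C := (n :- (κ′ :+ k)) :* C) refl (ι n) (ι κ) (ι k) (binomF n κ)) (cong (λ z → (ι n - z) * binomF n κ) (sym (ι-+ κ k))))))
      where
      room : κ ℕ.+ k ℕ.≤ n
      room = ℕP.≤-trans (ℕP.+-mono-≤ (ℕP.n≤1+n κ) (ℕP.m≤n*m k 3)) 4k≤n
      step : ι k * binomF n k ≡ ι n * binomF n κ - ι κ * binomF n κ
      step = trans (solve 2 (λ a b → b := (a :+ b) :- a) refl (ι κ * binomF n κ) (ι k * binomF n k)) (cong (_- ι κ * binomF n κ) (sym (binomF-ratio n κ)))

    -- (1 - q′)(1 + `d`) ≤ 1 - q₁ and C(n, κ) ≤ C(n, k): from κ at p′ to k at p₁ the expected number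
    -- gains at least (1 + `d`)^(n - k), starting above 1/n by `above`.
    2^J₀≤ : ι 2 ^^ J₀ ≤ binomF n k * (1F - q₁) ^^ (n ℕ.∸ k)
    2^J₀≤ = *-cancelʳ (ι 2 ^^ (2 ℕ.* L)) (0<^^ (0<ι {2} (s≤s z≤n)) (2 ℕ.* L)) (≤-tr (≤-rf (sym (^^-+ (ι 2) J₀ (2 ℕ.* L)))) (≤-tr (growth 0≤d d≤1 (J₀ ℕ.+ 2 ℕ.* L) (n ℕ.∸ k) rate)
        (≤-tr (≤-rf (sym (*-identityˡ _))) (≤-tr (*-monoʳ D (0≤^^ (0≤+ 0≤1 0≤d) (n ℕ.∸ k)) (≤-tr (<⇒≤ above) (*-monoˡ (ι n) (0≤ι n) (*-mono (0≤binomF n κ) C≤K (0≤^^ (0≤diff q′≤1) (n ℕ.∸ κ)) (^^-anti (0≤diff q′≤1) (1-x≤1 0≤q′) (ℕP.∸-monoʳ-≤ n (ℕP.n≤1+n κ)))))))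
          (≤-tr (≤-rf (trans (solve 4 (λ n K u v → n :* (K :* u) :* v := n :* (K :* (u :* v))) refl (ι n) (binomF n k) ((1F - q′) ^^ (n ℕ.∸ k)) D) (cong (λ z → ι n * (binomF n k * z)) (sym (^^-*-dist (1F - q′) (1F + d) (n ℕ.∸ k))))))
            (≤-tr (*-mono (0≤ι n) (≤-tr (ι-mono n≤2^2L) (≤-rf (ι-^ 2 (2 ℕ.* L)))) (0≤* (0≤binomF n k) (0≤^^ (0≤* (0≤diff q′≤1) (0≤+ 0≤1 0≤d)) (n ℕ.∸ k)))
              (*-monoˡ (binomF n k) (0≤binomF n k) (^^-mono (0≤* (0≤diff q′≤1) (0≤+ 0≤1 0≤d)) (≤-diff _ (0≤* 0≤q′ 0≤d) (solve 2 (λ a b → OrderedField.κ 1 :- b :- (OrderedField.κ 1 :- a) :* (OrderedField.κ 1 :+ (a :- b)) := a :* (a :- b)) refl q′ q₁)) (n ℕ.∸ k)))) (≤-rf (*-comm _ _))))))))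
      where
      D = (1F + d) ^^ (n ℕ.∸ k)
      count : (c ℕ.* 4) ℕ.* (2 ℕ.* (J₀ ℕ.+ 2 ℕ.* L)) ℕ.≤ L ℕ.* L
      count = ℕP.*-cancelˡ-≤ {(c ℕ.* 4) ℕ.* (2 ℕ.* (J₀ ℕ.+ 2 ℕ.* L))} {L ℕ.* L} 4 (ℕP.≤-trans (ℕP.≤-reflexive (ℕS.solve 3 (λ c J L → ℕS.con 4 ℕS.:* ((c ℕS.:* ℕS.con 4) ℕS.:* (ℕS.con 2 ℕS.:* (J ℕS.:+ ℕS.con 2 ℕS.:* L))) ℕS.:= J ℕS.:* (c ℕS.:* ℕS.con 32) ℕS.:+ c ℕS.:* ℕS.con 64 ℕS.:* L) refl c J₀ L))
        (ℕP.≤-trans (ℕP.+-mono-≤ J₀-upper (ℕP.*-monoˡ-≤ L (c*b≤L 64))) (ℕP.+-monoʳ-≤ (L ℕ.* L) (ℕP.m≤m+n (L ℕ.* L) _))))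
      rate : ι (2 ℕ.* (J₀ ℕ.+ 2 ℕ.* L)) ≤ ι (n ℕ.∸ k) * d
      rate = *-cancelˡ (ι (c ℕ.* 4)) (0<ι (ℕP.*-mono-≤ 1≤c (numeral-≤ 1 4))) (≤-tr (≤-rf (sym (ι-* (c ℕ.* 4) (2 ℕ.* (J₀ ℕ.+ 2 ℕ.* L))))) (≤-tr (ι-mono count) (≤-tr L²≤
        (≤-tr (*-monoˡ (ι c) (0≤ι c) (≤-tr (≤-rf (trans (*-assoc (ι n) q₁ p₁) (cong (ι n *_) (*-comm q₁ p₁)))) (*-mono (0≤ι n) n≤2[n∸k] (0≤* 0≤p₁ 0≤q₁) (≤-tr (*-monoˡ p₁ 0≤p₁ q₁≤q′) p₁q′≤2d))))
          (≤-rf (trans (solve 3 (λ c m d → c :* (OrderedField.κ 2 :* m :* (OrderedField.κ 2 :* d)) := c :* OrderedField.κ 4 :* (m :* d)) refl (ι c) (ι (n ℕ.∸ k)) d) (cong (_* (ι (n ℕ.∸ k) * d)) (sym (ι-* c 4)))))))))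

    regime : Regime n k L Z R c J₀ p₁
    regime = record
      { 0≤p = 0≤p₁ ; p≤1 = p₁≤1 ; 1≤k = s≤s z≤n ; 32≤L = ℕP.≤-trans (numeral-≤ 32 1536) 1536≤L ; 2^L≤n = 2^L≤n ; n≤2^2L = n≤2^2L
      ; 1024≤Z = ℕP.≤-trans (numeral-≤ 1024 8192) 8192≤Z ; L≤Z = L≤Z ; poly = poly ; 1≤Rρ = 1≤Rρ₁
      ; nq≤ = ≤-tr (*-monoˡ (ι n) (0≤ι n) q₁≤q′) nq′≤ ; ≤nqp = L²≤ ; 1≤c = 1≤c
      ; c≤L = ℕP.≤-trans (ℕP.≤-reflexive (ℕP.*-comm 1024 c)) (c*b≤L 1024)
      ; kp≤ = ≤-tr (*-monoˡ (ι k) (0≤ι k) p₁≤p₂) kp₂≤ ; 2^J≤ = 2^J₀≤ ; J≤ = J≤ }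
      where
      J≤ : 32 ℕ.* J₀ ℕ.≤ L ℕ.* k
      J≤ = ℕP.*-cancelˡ-≤ {32 ℕ.* J₀} {L ℕ.* k} c {{ℕ.>-nonZero 1≤c}} (ℕP.≤-trans (ℕP.≤-reflexive (ℕS.solve 2 (λ c J → c ℕS.:* (ℕS.con 32 ℕS.:* J) ℕS.:= J ℕS.:* (c ℕS.:* ℕS.con 32)) refl c J₀))
        (ℕP.≤-trans J₀-upper (ℕP.≤-trans (ℕP.*-monoʳ-≤ L (ℕP.≤-trans L≤c₁k (ℕP.*-monoˡ-≤ k c₁≤c))) (ℕP.≤-reflexive (ℕS.solve 3 (λ c L k → L ℕS.:* (c ℕS.:* k) ℕS.:= c ℕS.:* (L ℕS.:* k)) refl c L k)))))

    A : ℕ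
    A = A₀ c₁

    1≤A : 1 ℕ.≤ A
    1≤A = ℕP.m^n>0 2 (4 ℕ.* c₁ ℕ.+ 16 ℕ.+ c)

    ℓ′ : ℕ
    ℓ′ = (L / A) {{ℕ.>-nonZero 1≤A}}

    L≤Aℓ : L ℕ.≤ A ℕ.* suc ℓ′
    L≤Aℓ = ℕP.≤-trans (ℕP.≤-trans (ℕP.≤-reflexive (m≡m%n+[m/n]*n L A {{ℕ.>-nonZero 1≤A}})) (ℕP.+-monoˡ-≤ (ℓ′ ℕ.* A) (ℕP.<⇒≤ (m%n<n L A {{ℕ.>-nonZero 1≤A}})))) (ℕP.≤-reflexive (ℕP.*-comm (suc ℓ′) A))

    robustness : ∀ s T η → A ℕ.≤ L → ι (1024 ℕ.* (A ℕ.* A) ℕ.* 2 ℕ.^ (4 ℕ.* A) ℕ.* s) ≤ ι n * p₁ → 4 ℕ.* T ℕ.≤ Z → 0F ≤ η → ι 7 * η ≤ 1F → 1F ≤ ι T * η →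
      Robustness n k L Z R c J₀ p₁ ℓ′ A s T η
    robustness s T η A≤L s≤ 4T≤Z 0≤η 7η≤1 1≤Tη = record
      { regime = regime ; 1≤R = 1≤R ; 1≤A = 1≤A ; L≤Aℓ = L≤Aℓ ; s≤np = s≤ ; Y-small = Y-small ; J-large = J-large ; 4T≤Z = 4T≤Z ; 0≤η = 0≤η ; 7η≤1 = 7η≤1 ; 1≤Tη = 1≤Tη }
      where
      ℓ = suc ℓ′
      Aℓ≤2L : A ℕ.* ℓ ℕ.≤ 2 ℕ.* L
      Aℓ≤2L = ℕP.≤-trans (ℕP.≤-reflexive (ℕP.*-comm A ℓ)) (ℕP.+-mono-≤ A≤L (ℕP.≤-trans (m/n*n≤m L A {{ℕ.>-nonZero 1≤A}}) (ℕP.≤-reflexive (sym (ℕP.+-identityʳ L)))))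
      y = y₀ c₁
      Y≡ : 64 ℕ.* R ℕ.* A ≡ 2 ℕ.^ y
      Y≡ = trans (cong (ℕ._* A) (sym (ℕP.^-distribˡ-+-* 2 6 (4 ℕ.* c₁)))) (sym (ℕP.^-distribˡ-+-* 2 (6 ℕ.+ 4 ℕ.* c₁) (4 ℕ.* c₁ ℕ.+ 16 ℕ.+ c)))
      Y-small : ((64 ℕ.* R ℕ.* A) ℕ.^ ℓ ℕ.* (64 ℕ.* R ℕ.* A) ℕ.^ ℓ ℕ.* 2 ℕ.^ ℓ) ℕ.^ 12 ℕ.≤ n
      Y-small = ℕP.≤-trans (ℕP.≤-reflexive (trans (cong (ℕ._^ 12) (trans (cong (λ z → z ℕ.* z ℕ.* 2 ℕ.^ ℓ) (trans (cong (ℕ._^ ℓ) Y≡) (ℕP.^-*-assoc 2 y ℓ)))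
          (trans (cong (ℕ._* 2 ℕ.^ ℓ) (sym (ℕP.^-distribˡ-+-* 2 (y ℕ.* ℓ) (y ℕ.* ℓ)))) (sym (ℕP.^-distribˡ-+-* 2 (y ℕ.* ℓ ℕ.+ y ℕ.* ℓ) ℓ))))) (ℕP.^-*-assoc 2 (y ℕ.* ℓ ℕ.+ y ℕ.* ℓ ℕ.+ ℓ) 12)))
        (ℕP.≤-trans (ℕP.^-monoʳ-≤ 2 (ℕP.*-cancelˡ-≤ {(y ℕ.* ℓ ℕ.+ y ℕ.* ℓ ℕ.+ ℓ) ℕ.* 12} {L} 2 (ℕP.≤-trans
            (ℕP.≤-reflexive (ℕS.solve 2 (λ y l → ℕS.con 2 ℕS.:* ((y ℕS.:* l ℕS.:+ y ℕS.:* l ℕS.:+ l) ℕS.:* ℕS.con 12) ℕS.:= ℕS.con 24 ℕS.:* (ℕS.con 2 ℕS.:* y ℕS.:+ ℕS.con 1) ℕS.:* l) refl y ℓ))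
            (ℕP.≤-trans (ℕP.*-monoˡ-≤ ℓ (24[2y₀+1]≤A₀ c₁)) Aℓ≤2L)))) 2^L≤n)
      1≤J₀ : 1 ℕ.≤ J₀
      1≤J₀ = ℕP.≮⇒≥ λ { (s≤s J₀≤0) → ℕP.<⇒≱ L²<J₀ (ℕP.≤-trans (ℕP.*-monoˡ-≤ (c ℕ.* 32) (s≤s J₀≤0)) (ℕP.≤-trans (ℕP.≤-reflexive (ℕP.*-identityˡ (c ℕ.* 32)))
        (ℕP.≤-trans (c*b≤L 32) (ℕP.m≤m*n L L {{ℕ.>-nonZero 1≤L}})))) }
      -- After multiplication by 128c the summands are 512cLℓ and 1536cL, each at most L²: the first
      -- by 1024c ≤ A and Aℓ ≤ 2L, the second by `c₂≤L`.
      J-large : 4 ℕ.* (L ℕ.* ℓ) ℕ.+ 12 ℕ.* L ℕ.≤ J₀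
      J-large = ℕP.*-cancelʳ-≤ (4 ℕ.* (L ℕ.* ℓ) ℕ.+ 12 ℕ.* L) J₀ (c ℕ.* 64) {{ℕ.>-nonZero (ℕP.*-mono-≤ 1≤c (numeral-≤ 1 64))}} (ℕP.≤-trans
        (ℕP.*-cancelˡ-≤ {(4 ℕ.* (L ℕ.* ℓ) ℕ.+ 12 ℕ.* L) ℕ.* (c ℕ.* 64)} {L ℕ.* L} 2 (ℕP.≤-trans
          (ℕP.≤-reflexive (ℕS.solve 3 (λ L l c → ℕS.con 2 ℕS.:* ((ℕS.con 4 ℕS.:* (L ℕS.:* l) ℕS.:+ ℕS.con 12 ℕS.:* L) ℕS.:* (c ℕS.:* ℕS.con 64)) ℕS.:= L ℕS.:* (l ℕS.:* (c ℕS.:* ℕS.con 512)) ℕS.:+ L ℕS.:* (c ℕS.:* ℕS.con 1536)) refl L ℓ c))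
          (ℕP.≤-trans (ℕP.+-mono-≤ (ℕP.*-monoʳ-≤ L ℓc) (ℕP.*-monoʳ-≤ L c₂≤L)) (ℕP.≤-reflexive (cong (L ℕ.* L ℕ.+_) (sym (ℕP.+-identityʳ (L ℕ.* L))))))))
        (ℕP.≤-trans (ℕP.<⇒≤ L²<J₀) (ℕP.≤-trans (ℕP.*-monoˡ-≤ (c ℕ.* 32) (ℕP.+-monoˡ-≤ J₀ 1≤J₀)) (ℕP.≤-reflexive (ℕS.solve 2 (λ J c → (J ℕS.:+ J) ℕS.:* (c ℕS.:* ℕS.con 32) ℕS.:= J ℕS.:* (c ℕS.:* ℕS.con 64)) refl J₀ c)))))
        where
        ℓc : ℓ ℕ.* (c ℕ.* 512) ℕ.≤ L
        ℓc = ℕP.*-cancelˡ-≤ {ℓ ℕ.* (c ℕ.* 512)} {L} 2 (ℕP.≤-trans (ℕP.≤-reflexive (ℕS.solve 2 (λ l c → ℕS.con 2 ℕS.:* (l ℕS.:* (c ℕS.:* ℕS.con 512)) ℕS.:= (c ℕS.:* ℕS.con 1024) ℕS.:* l) refl ℓ c))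
          (ℕP.≤-trans (ℕP.*-monoˡ-≤ ℓ (c₂*1024≤A₀ c₁)) Aℓ≤2L))

-- Binary logarithms and the exponential hypothesis.

module Logarithms where

  open import Defs using (LeExp; expNum)
  open import Data.Nat using (>-nonZero; ℕ; zero; suc; _+_; _*_; _^_; _≤_; _<_; z≤n; s≤s; _!)
  open import Data.Nat.Properties
  open Regimes using (^-distribʳ-*)
  open Thresholds using (1+n≤2^n)
  open import Data.Nat.DivMod using (_/_; m/n*n≤m; m≡m%n+[m/n]*n; m%n<n)
  open import Data.Nat.Solver using (module +-*-Solver)
  open import Data.Product using (_×_; _,_; ∃)
  open import Relation.Nullary using (yes; no)
  open import Relation.Binary.PropositionalEquality

  open +-*-Solver

  -- Partial sums of e^(y/2), scaled by 2^j j!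

  halfExp : ℕ → ℕ → ℕ
  halfExp y zero = 1
  halfExp y (suc j) = 2 * suc j * halfExp y j + y ^ suc j

  expNum-halfExp : ∀ N j → 2 ^ j * expNum N j ≡ halfExp (2 * N) j
  expNum-halfExp N zero = refl
  expNum-halfExp N (suc j) = trans (solve 5 (λ t s e N P → con 2 :* t :* (s :* e :+ N :* P) := con 2 :* s :* (t :* e) :+ con 2 :* N :* (t :* P)) refl (2 ^ j) (suc j) (expNum N j) N (N ^ j))
    (cong₂ (λ a b → 2 * suc j * a + 2 * N * b) (expNum-halfExp N j) (dist j))
    where
    dist : ∀ j → 2 ^ j * N ^ j ≡ (2 * N) ^ j
    dist zero = refl
    dist (suc j) = trans (solve 3 (λ t N P → con 2 :* t :* (N :* P) := con 2 :* N :* (t :* P)) refl (2 ^ j) N (N ^ j)) (cong (2 * N *_) (dist j))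

  pow-increment : ∀ y i → suc y ^ suc i ≤ y ^ suc i + suc i * suc y ^ i
  pow-increment y zero = ≤-reflexive (solve 1 (λ y → (con 1 :+ y) :* con 1 := y :* con 1 :+ con 1 :* con 1) refl y)
  pow-increment y (suc i) = ≤-trans (*-monoʳ-≤ (suc y) (pow-increment y i))
    (≤-trans (≤-reflexive (solve 4 (λ y a s b → (con 1 :+ y) :* (a :+ s :* b) := y :* a :+ (a :+ s :* ((con 1 :+ y) :* b))) refl y (y ^ suc i) (suc i) (suc y ^ i)))
      (+-monoʳ-≤ (y * y ^ suc i) (+-monoˡ-≤ (suc i * suc y ^ suc i) (^-monoˡ-≤ (suc i) (n≤1+n y)))))

  -- Reflects e^(1/2) ≤ 2: `increment` shows that raising y by 1 adds at most half of the new value,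
  -- so the new value is at most twice the old one.
  halfExp-step : ∀ y j → halfExp (suc y) j ≤ 2 * halfExp y j
  halfExp-step y j = +-cancelʳ-≤ (halfExp (suc y) j) (halfExp (suc y) j) (2 * halfExp y j) (≤-trans (≤-reflexive (solve 1 (λ a → a :+ a := con 2 :* a) refl (halfExp (suc y) j))) (double j))
    where
    increment : ∀ j → halfExp (suc y) (suc j) ≤ halfExp y (suc j) + suc j * halfExp (suc y) j
    increment zero = ≤-reflexive (solve 1 (λ y → con 2 :* con 1 :* con 1 :+ (con 1 :+ y) :* con 1 := con 2 :* con 1 :* con 1 :+ y :* con 1 :+ con 1 :* con 1) refl y)
    increment (suc j) = ≤-trans (+-mono-≤ (*-monoʳ-≤ (2 * suc (suc j)) (increment j)) (pow-increment y (suc j)))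
      (≤-reflexive (solve 6 (λ h s g y P Q → con 2 :* (con 1 :+ s) :* (h :+ s :* g) :+ (P :+ (con 1 :+ s) :* Q) := con 2 :* (con 1 :+ s) :* h :+ P :+ (con 1 :+ s) :* (con 2 :* s :* g :+ Q)) refl (halfExp y (suc j)) (suc j) (halfExp (suc y) j) y (y ^ suc (suc j)) (suc y ^ suc j)))
    double : ∀ j → 2 * halfExp (suc y) j ≤ 2 * halfExp y j + halfExp (suc y) j
    double zero = n≤1+n 2
    double (suc j) = ≤-trans (*-monoʳ-≤ 2 (increment j)) (≤-trans (≤-reflexive (solve 3 (λ h s g → con 2 :* (h :+ s :* g) := con 2 :* h :+ con 2 :* s :* g) refl (halfExp y (suc j)) (suc j) (halfExp (suc y) j)))
      (+-monoʳ-≤ (2 * halfExp y (suc j)) (m≤m+n _ _)))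

  halfExp-bound : ∀ y j → halfExp y j ≤ 2 ^ y * (2 ^ j * j !)
  halfExp-bound zero j = ≤-trans (≤-reflexive (base j)) (≤-reflexive (sym (+-identityʳ _)))
    where
    base : ∀ j → halfExp 0 j ≡ 2 ^ j * j !
    base zero = refl
    base (suc j) = trans (+-identityʳ _) (trans (cong (2 * suc j *_) (base j)) (solve 3 (λ s t f → con 2 :* s :* (t :* f) := con 2 :* t :* (s :* f)) refl (suc j) (2 ^ j) (j !)))
  halfExp-bound (suc y) j = ≤-trans (halfExp-step y j) (≤-trans (*-monoʳ-≤ 2 (halfExp-bound y j)) (≤-reflexive (sym (*-assoc 2 (2 ^ y) (2 ^ j * j !)))))

  LeExp⇒≤ : ∀ M N → LeExp M N → M ≤ 2 ^ (2 * N)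
  LeExp⇒≤ M N (j , h) = *-cancelʳ-≤ M (2 ^ (2 * N)) (2 ^ j * j !) {{m*n≢0 (2 ^ j) (j !) {{m^n≢0 2 j}} {{j !≢0}}}} (≤-trans
    (≤-reflexive (solve 3 (λ M t f → M :* (t :* f) := t :* (M :* f)) refl M (2 ^ j) (j !)))
    (≤-trans (*-monoʳ-≤ (2 ^ j) h) (≤-trans (≤-reflexive (expNum-halfExp N j)) (halfExp-bound (2 * N) j))))

  2^-cancel : ∀ {a b} → 2 ^ a ≤ 2 ^ b → a ≤ b
  2^-cancel {a} {b} h = ≮⇒≥ (λ b<a → <⇒≱ (^-monoʳ-< 2 (s≤s (s≤s z≤n)) b<a) h)

  binaryLog : ∀ n → 1 ≤ n → ∃ λ L → 2 ^ L ≤ n × n < 2 ^ suc L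
  binaryLog (suc zero) _ = 0 , ≤-refl , ≤-refl
  binaryLog (suc (suc n)) _ with binaryLog (suc n) (s≤s z≤n)
  ... | L , lo , hi with suc (suc n) <? 2 ^ suc L
  ... | yes h = L , m≤n⇒m≤1+n lo , h
  ... | no h = suc L , ≮⇒≥ h , <-≤-trans (s≤s hi) (≤-trans (+-monoˡ-≤ (2 ^ suc L) (m^n>0 2 (suc L))) (≤-reflexive (cong (2 ^ suc L +_) (sym (+-identityʳ (2 ^ suc L))))))

  -- With d = D + 1 and h = ⌊L/(2d)⌋, CL ≤ (h + 1)² ≤ 2^(2h), and 2hd ≤ L.
  poly≤exp : ∀ C D L → 2 * suc D * (2 * C * suc D) ≤ L → (C * L) ^ suc D ≤ 2 ^ L
  poly≤exp C D L big = ≤-trans (^-monoˡ-≤ d (≤-trans CL (*-mono-≤ (1+n≤2^n h) (1+n≤2^n h))))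
      (≤-trans (≤-reflexive (trans (cong (_^ d) (sym (^-distribˡ-+-* 2 h h))) (^-*-assoc 2 (h + h) d))) (^-monoʳ-≤ 2 (≤-trans (≤-reflexive (solve 2 (λ h d → (h :+ h) :* d := h :* (con 2 :* d)) refl h d)) (m/n*n≤m L (2 * d)))))
    where
    d = suc D
    h = L / (2 * d)
    L< : L < suc h * (2 * d)
    L< = ≤-trans (s≤s (≤-reflexive (m≡m%n+[m/n]*n L (2 * d)))) (+-monoˡ-≤ (h * (2 * d)) (m%n<n L (2 * d)))
    2Cd≤ : 2 * C * d ≤ suc h
    2Cd≤ = <⇒≤ (*-cancelˡ-< (2 * d) (2 * C * d) (suc h) (≤-<-trans big (<-≤-trans L< (≤-reflexive (*-comm (suc h) (2 * d))))))
    CL : C * L ≤ suc h * suc h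
    CL = ≤-trans (*-monoʳ-≤ C (<⇒≤ L<)) (≤-trans (≤-reflexive (solve 3 (λ C s d → C :* (s :* (con 2 :* d)) := con 2 :* C :* d :* s) refl C (suc h) d)) (*-monoˡ-≤ (suc h) 2Cd≤))

  pow-root : ∀ {a b} e → a ^ suc e ≤ b ^ suc e → a ≤ b
  pow-root {a} {b} e h = ≮⇒≥ (λ b<a → <⇒≱ (^-monoˡ-< (suc e) b<a) h)

  -- A polynomial in log n is absorbed by the n^ε room in k³ ≤ n^(1 − 3ε).
  absorb : ∀ p q n k L C → 2 ^ L ≤ n → k ^ (3 * suc q) * n ^ (3 * suc p) ≤ n ^ suc q →
    2 * (128 * suc q) * (2 * C * (128 * suc q)) ≤ L → (C * L) ^ 128 * k ^ 3 ≤ n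
  absorb p q n k L C 2^L≤n hyp big = pow-root q (≤-trans (≤-reflexive (trans (^-distribʳ-* (suc q) ((C * L) ^ 128) (k ^ 3)) (cong₂ _*_ (^-*-assoc (C * L) 128 (suc q)) (^-*-assoc k 3 (suc q)))))
    (≤-trans (*-monoˡ-≤ (k ^ (3 * suc q)) (≤-trans (poly≤exp C (q + 127 * suc q) L big) (≤-trans 2^L≤n (≤-trans (≤-reflexive (sym (^-identityʳ n))) (^-monoʳ-≤ n {{n≢0}} {1} {3 * suc p} (s≤s z≤n))))))
      (≤-trans (≤-reflexive (*-comm (n ^ (3 * suc p)) (k ^ (3 * suc q)))) hyp)))
    where
    n≢0 = >-nonZero (≤-trans (m^n>0 2 L) 2^L≤n)

  -- 2^L ≤ n ≤ n^(p + 1) ≤ e^(k(q + 1)) ≤ 4^(k(q + 1)), and exponents of 2 are compared.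
  log≤ : ∀ p q n k L → 2 ^ L ≤ n → LeExp (n ^ suc p) (k * suc q) → L ≤ 2 * suc q * k
  log≤ p q n k L 2^L≤n hyp = ≤-trans (m≤m*n L (suc p)) (≤-trans (2^-cancel (≤-trans (≤-trans (≤-reflexive (sym (^-*-assoc 2 L (suc p)))) (^-monoˡ-≤ (suc p) 2^L≤n)) (LeExp⇒≤ (n ^ suc p) (k * suc q) hyp)))
    (≤-reflexive (solve 2 (λ k s → con 2 :* (k :* s) := con 2 :* s :* k) refl k (suc q))))

-- Domination and bondage numbers, degrees, and monotone bad events.

module BondageNumbers where

  open import Defs using (pairsL; pairV; Graph; Dominating; incident; IsDomNum; RaisesDom; IsBondage; deg; maxDeg) renaming (E to numPairs)
  open OrderedField
  open Inequalities
  open FiniteSums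
  open RandomSubsets
  open Domination
  open Moments
  open EdgeDeletion
  open Overlaps
  open Regimes
  open Resilience
  open import Data.Nat as ℕ using (ℕ; zero; suc; z≤n; s≤s; _⊔_)
  import Data.Nat.Properties as ℕP
  open import Data.Product using (_×_; _,_; ∃; proj₁; proj₂)
  open import Data.Sum using (_⊎_; inj₁; inj₂)
  open import Data.Empty using (⊥-elim)
  open import Data.List as List using (List; []; _∷_; map; allFin; foldr)
  import Data.List.Properties as LP
  open import Data.List.Membership.Propositional using () renaming (_∈_ to _∈L_)
  open import Data.List.Membership.Propositional.Properties using (∈-allFin)
  open import Data.List.Relation.Unary.Any using (here; there)
  open import Data.Vec as Vec using (Vec; []; _∷_; lookup; tabulate)
  import Data.Vec.Properties as VP
  open import Data.Fin as Fin using (Fin; zero; suc)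
  import Data.Fin.Properties as FP
  open import Data.Fin.Subset using (Subset; ∣_∣; _∩_; _∪_; _⊆_; _─_; _∈_; _∉_; ⊥; ⊤) renaming (_-_ to _∖_)
  import Data.Fin.Subset.Properties as SubP
  open import Data.Bool using (Bool; true; false; if_then_else_; _∧_; _∨_)
  import Data.Bool.Properties as BP
  open import Function using (_∘_)
  open import Relation.Nullary using (Dec; yes; no; ¬_)
  open import Relation.Nullary.Decidable using (⌊_⌋; _×-dec_; ¬?; decidable-stable)
  open import Relation.Binary.PropositionalEquality

  sum-tabulate-∩ : ∀ {N} {X : Set} (G : Subset N) (ps : Vec X N) (f : X → Bool) →
    Vec.sum (tabulate λ e → if ⌊ e SubP.∈? G ⌋ ∧ f (lookup ps e) then 1 else 0) ≡ ∣ G ∩ Vec.map f ps ∣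
  sum-tabulate-∩ [] [] f = refl
  sum-tabulate-∩ (g ∷ G) (p ∷ ps) f = trans (cong (head g +ℕ_) (trans (cong Vec.sum (VP.tabulate-cong (λ e → cong (λ b → if b ∧ f (lookup ps e) then 1 else 0) (tail e)))) (sum-tabulate-∩ G ps f))) (count g (f p))
    where
    infixl 6 _+ℕ_
    _+ℕ_ = ℕ._+_
    head : Bool → ℕ
    head g = if ⌊ zero SubP.∈? (g ∷ G) ⌋ ∧ f p then 1 else 0
    tail : ∀ e → ⌊ suc e SubP.∈? (g ∷ G) ⌋ ≡ ⌊ e SubP.∈? G ⌋
    tail e with e SubP.∈? G
    ... | yes _ = refl
    ... | no _ = refl
    count : ∀ g b → (if ⌊ zero SubP.∈? (g ∷ G) ⌋ ∧ b then 1 else 0) +ℕ ∣ G ∩ Vec.map f ps ∣ ≡ ∣ (g ∧ b) ∷ (G ∩ Vec.map f ps) ∣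
    count true true = refl
    count true false = refl
    count false true = refl
    count false false = refl

  deg≡ : ∀ n (G : Graph n) v → deg {n} G v ≡ ∣ G ∩ star v ∣
  deg≡ n G v = sum-tabulate-∩ G (pairV n) (λ e → incident e v)

  foldr-⊔-upper : ∀ {X : Set} (f : X → ℕ) (xs : List X) {x} → x ∈L xs → f x ℕ.≤ foldr _⊔_ 0 (map f xs)
  foldr-⊔-upper f (x ∷ xs) (here refl) = ℕP.m≤m⊔n (f x) _
  foldr-⊔-upper f (x ∷ xs) (there i) = ℕP.≤-trans (foldr-⊔-upper f xs i) (ℕP.m≤n⊔m (f x) _)

  foldr-⊔-least : ∀ {X : Set} (f : X → ℕ) (xs : List X) {d} → (∀ x → f x ℕ.≤ d) → foldr _⊔_ 0 (map f xs) ℕ.≤ d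
  foldr-⊔-least f [] h = z≤n
  foldr-⊔-least f (x ∷ xs) h = ℕP.⊔-lub (h x) (foldr-⊔-least f xs h)

  star≤maxDeg : ∀ n (G : Graph n) v → ∣ G ∩ star v ∣ ℕ.≤ maxDeg {n} G
  star≤maxDeg n G v = ℕP.≤-trans (ℕP.≤-reflexive (sym (deg≡ n G v))) (foldr-⊔-upper (deg {n} G) (allFin n) (∈-allFin v))

  maxDeg≤ : ∀ n (G : Graph n) d → (∀ v → ∣ G ∩ star v ∣ ℕ.≤ d) → maxDeg {n} G ℕ.≤ d
  maxDeg≤ n G d h = foldr-⊔-least (deg {n} G) (allFin n) (λ v → ℕP.≤-trans (ℕP.≤-reflexive (deg≡ n G v)) (h v))

  edges≤n*maxDeg : ∀ n (G : Graph n) → ∣ G ∣ ℕ.≤ n ℕ.* maxDeg {n} G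
  edges≤n*maxDeg n G = ι-cancel-≤ (≤-tr (≤-rf (sym (∣∣-sum G))) (≤-tr (ΣL-mono (allFin N) (λ e → ≤-tr (≤*ʳ (0≤𝟙 (lookup G e)) (touched e)) (≤-rf (sym (ΣL-*ˡ (allFin n) (𝟙 (lookup G e)) _)))))
      (≤-tr (≤-rf (trans (ΣL-swap (allFin N) (allFin n) _) (ΣL-cong (allFin n) (λ v → sym (∣∩∣-sum G (star v))))))
        (≤-tr (ΣL-mono (allFin n) (λ v → ι-mono (star≤maxDeg n G v))) (≤-rf (trans (ΣL-const (allFin n) _) (trans (cong (λ z → ι z * ι (maxDeg {n} G)) (LP.length-tabulate {n = n} (λ x → x))) (sym (ι-* n (maxDeg {n} G)))))))))) 
    where
    N = numPairs n
    touched : ∀ e → 1F ≤ ΣL (allFin n) (λ v → 𝟙 (lookup (star v) e))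
    touched e = ≤-tr (≤-rf (sym (trans (cong 𝟙 (VP.lookup-map e _ (pairV n))) (cong (λ b → 𝟙 (b ∨ ⌊ j FP.≟ i ⌋)) (≟-refl i))))) (ΣL-∈ {f = λ v → 𝟙 (lookup (star v) e)} (λ v → 0≤𝟙 (lookup (star v) e)) (∈-allFin i))
      where
      i = proj₁ (lookup (pairV n) e)
      j = proj₂ (lookup (pairV n) e)

  ∣star∣≤n : ∀ {n} (v : Fin n) → ∣ star v ∣ ℕ.≤ n
  ∣star∣≤n {n} v = ι-cancel-≤ (≤-tr (≤-rf (trans (∣map∣ (λ e → incident e v) (pairsL n)) (ΣL-pairs n _)))
      (≤-tr (ΣL-mono V (λ i → ≤-tr (ΣL-mono V (λ j → ≤-tr (*-monoˡ (i <ᶠ j) (0≤𝟙 ⌊ i FP.<? j ⌋) (split ⌊ i FP.≟ v ⌋ ⌊ j FP.≟ v ⌋))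
           (≤-rf (solve 3 (λ l a b → l :* (a :+ b) := a :* l :+ b :* l) refl (i <ᶠ j) (i ≈ᶠ v) (j ≈ᶠ v)))))
         (≤-rf (trans (ΣL-+ V _ _) (cong₂ _+_ (ΣL-*ˡ V (i ≈ᶠ v) _) (ΣL-≈ v (i <ᶠ_)))))))
      (≤-tr (≤-rf (trans (ΣL-+ V _ _) (trans (cong (_+ ΣL V (_<ᶠ v)) (ΣL-≈ v (λ i → ΣL V (i <ᶠ_)))) (sym (ΣL-+ V _ _)))))
        (≤-tr (ΣL-mono V (λ j → ≤-tr (≤-+ʳ (0≤𝟙 ⌊ j FP.≟ v ⌋)) (≤-rf (trichotomy v j)))) (≤-rf (ΣL-1 n))))))
    where
    V = allFin n
    split : ∀ a b → 𝟙 (a ∨ b) ≤ 𝟙 a + 𝟙 b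
    split true b = ≤-+ʳ (0≤𝟙 b)
    split false b = ≤-rf (sym (+-identityˡ _))

  least : ∀ {P : ℕ → Set} → (∀ i → Dec (P i)) → ∀ m → P m → ∃ λ b → P b × (∀ j → P j → b ℕ.≤ j)
  least P? zero p = zero , p , λ _ _ → z≤n
  least {P} P? (suc m) p with P? zero
  ... | yes p₀ = zero , p₀ , λ _ _ → z≤n
  ... | no ¬p₀ with least {P ∘ suc} (P? ∘ suc) m p
  ... | b , pb , min = suc b , pb , λ { zero p₀ → ⊥-elim (¬p₀ p₀) ; (suc j) pj → s≤s (min j pj) }

  extend : ∀ {n} (D : Subset n) j → ∣ D ∣ ℕ.≤ j → j ℕ.≤ n → ∃ λ D′ → D ⊆ D′ × ∣ D′ ∣ ≡ j
  extend [] zero h h′ = [] , (λ z → z) , refl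
  extend (true ∷ D) (suc j) (s≤s h) (s≤s h′) = let D′ , s , e = extend D j h h′ in true ∷ D′ , SubP.s⊆s s , cong suc e
  extend (false ∷ D) j h h′ with j ℕP.≤? _
  extend (false ∷ D) j h h′ | yes j≤n = let D′ , s , e = extend D j h j≤n in false ∷ D′ , SubP.s⊆s s , e
  extend {suc n} (false ∷ D) (suc j) h (s≤s h′) | no j≰n with ∣ D ∣ ℕP.≤? j
  ... | yes h″ = let D′ , s , e = extend D j h″ h′ in true ∷ D′ , SubP.out⊆ s , cong suc e
  ... | no h″ = ⊥-elim (j≰n (ℕP.≤-trans (ℕP.≰⇒> h″) (SubP.∣p∣≤n D)))
  extend {n} (false ∷ D) zero h h′ | no j≰n = ⊥-elim (j≰n z≤n)

  dominating-mono : ∀ {n} (G G′ : Graph n) (D D′ : Subset n) → G ⊆ G′ → D ⊆ D′ → Dominating {n} G D → Dominating {n} G′ D′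
  dominating-mono G G′ D D′ g d h v with h v
  ... | inj₁ v∈ = inj₁ (d v∈)
  ... | inj₂ (u , u∈ , e , e∈ , end) = inj₂ (u , d u∈ , e , g e∈ , end)

  -- Exact size k is as good as size at most k, since dominating sets can be enlarged; see
  -- `hasDom-mono`.
  HasDom : ∀ n → Graph n → ℕ → Set
  HasDom n G k = ∃ λ (D : Subset n) → ∣ D ∣ ≡ k × Dominating {n} G D

  hasDom? : ∀ n (G : Graph n) k → Dec (HasDom n G k)
  hasDom? n G k = SubP.anySubset? (λ D → (∣ D ∣ ℕP.≟ k) ×-dec dominating? G D)

  hasDom-mono : ∀ {n} (G G′ : Graph n) {j k} → G ⊆ G′ → j ℕ.≤ k → k ℕ.≤ n → HasDom n G j → HasDom n G′ k
  hasDom-mono G G′ {j} {k} g j≤k k≤n (D , e , d) with extend D k (ℕP.≤-trans (ℕP.≤-reflexive e) j≤k) k≤n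
  ... | D′ , s , e′ = D′ , e′ , dominating-mono G G′ D D′ g s d

  domNum : ∀ n (G : Graph n) → ∃ λ d → IsDomNum {n} G d
  domNum n G with least (hasDom? n G) n (⊤ , SubP.∣⊤∣≡n n , λ v → inj₁ SubP.∈⊤)
  ... | d , (D , e , dom) , min = d , (D , dom , e) , λ D′ dom′ → min ∣ D′ ∣ (D′ , refl , dom′)

  domNum-unique : ∀ {n} (G : Graph n) {d d′} → IsDomNum {n} G d → IsDomNum {n} G d′ → d ≡ d′
  domNum-unique G ((D , dom , e) , min) ((D′ , dom′ , e′) , min′) =
    ℕP.≤-antisym (ℕP.≤-trans (min D′ dom′) (ℕP.≤-reflexive e′)) (ℕP.≤-trans (min′ D dom) (ℕP.≤-reflexive e))

  -- With γ(G) = k, raising the domination number means that no dominating k-set survives. This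
  -- lemma and `⇒raises` replace `RaisesDom` by that decidable condition.
  raises⇒ : ∀ {n k} (G B : Graph n) → k ℕ.≤ n → IsDomNum {n} G k → RaisesDom {n} G B → ¬ HasDom n (G ─ B) k
  raises⇒ G B k≤n γ (d , d′ , γd , (_ , min) , d<d′) (D , e , dom) =
    ℕP.<⇒≱ d<d′ (ℕP.≤-trans (min D dom) (ℕP.≤-reflexive (trans e (domNum-unique G γ γd))))

  ⇒raises : ∀ {n k} (G B : Graph n) → k ℕ.≤ n → IsDomNum {n} G k → ¬ HasDom n (G ─ B) k → RaisesDom {n} G B
  ⇒raises {n} {k} G B k≤n γ ¬h with domNum n (G ─ B)
  ... | d′ , γ′@((D , dom , e) , _) = k , d′ , γ , γ′ , ℕP.≰⇒> (λ d′≤k → ¬h (hasDom-mono (G ─ B) (G ─ B) (λ z → z) d′≤k k≤n (D , e , dom)))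

  -- For γ(G) = k this is the event b(G) ≤ s. It is stated without γ so that it is decreasing in G.
  Fragile : ∀ n → ℕ → ℕ → Graph n → Set
  Fragile n k s G = ∃ λ (B : Subset (numPairs n)) → B ⊆ G × ∣ B ∣ ℕ.≤ s × ¬ HasDom n (G ─ B) k

  fragile? : ∀ n k s (G : Graph n) → Dec (Fragile n k s G)
  fragile? n k s G = SubP.anySubset? (λ B → (B SubP.⊆? G) ×-dec ((∣ B ∣ ℕP.≤? s) ×-dec ¬? (hasDom? n (G ─ B) k)))

  ∣∩∪∣≤ : ∀ {N} (G S T : Subset N) → ∣ G ∩ (S ∪ T) ∣ ℕ.≤ ∣ G ∩ S ∣ ℕ.+ ∣ G ∩ T ∣
  ∣∩∪∣≤ G S T = ℕP.≤-trans (ℕP.≤-reflexive (cong ∣_∣ (SubP.∩-distribˡ-∪ G S T))) (ℕP.≤-trans (ℕP.m≤m+n _ ∣ (G ∩ S) ∩ (G ∩ T) ∣) (ℕP.≤-reflexive (∣∪∣+∣∩∣ (G ∩ S) (G ∩ T))))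

  -- Deleting all edges at the two ends of an edge isolates both ends, although one of them suffices in G.
  star-pair-raises : ∀ n (G : Graph n) k e → e ∈ G → ¬ HasDom n G k → k ℕ.≤ n →
    let u , v = lookup (pairV n) e in ¬ HasDom n (G ─ (G ∩ (star u ∪ star v))) (suc k)
  star-pair-raises n G k e e∈ ¬h k≤n (D , ∣D∣ , dom) = ¬h (hasDom-mono G G (λ z → z) (ℕP.≤-pred (ℕP.≤-trans (SubP.x∈p⇒∣p-x∣<∣p∣ u∈) (ℕP.≤-reflexive ∣D∣))) k≤n (D ∖ u , refl , dom′))
    where
    u = proj₁ (lookup (pairV n) e)
    v = proj₂ (lookup (pairV n) e)
    B = G ∩ (star u ∪ star v)
    u≢v : u ≢ v
    u≢v eq = FP.<-irrefl eq (pairs-< n e)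
    ∈-star : ∀ w f → incident (lookup (pairV n) f) w ≡ true → f ∈ star w
    ∈-star w f h = VP.lookup⇒[]= f (star w) (trans (VP.lookup-map f _ (pairV n)) h)
    end-incident : ∀ {a w} f → lookup (pairV n) f ≡ (a , w) ⊎ lookup (pairV n) f ≡ (w , a) → incident (lookup (pairV n) f) w ≡ true
    end-incident {a} {w} f (inj₁ eq) rewrite eq | ≟-refl w = BP.∨-zeroʳ _
    end-incident {a} {w} f (inj₂ eq) rewrite eq | ≟-refl w = refl
    ─-∉ : ∀ {f} → f ∈ G ─ B → f ∉ B
    ─-∉ {f} h h′ = go G B f h h′
      where
      go : ∀ {N} (G B : Subset N) f → f ∈ G ─ B → f ∈ B → Data.Empty.⊥
      go (g ∷ G) (true ∷ B) zero () Vec.here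
      go (g ∷ G) (b ∷ B) (suc f) (Vec.there h) (Vec.there h′) = go G B f h h′
    isolated : ∀ w → (∀ {f} → f ∈ star w → f ∈ star u ∪ star v) → w ∈ D
    isolated w sub with dom w
    ... | inj₁ w∈ = w∈
    ... | inj₂ (a , a∈ , f , f∈ , end) = ⊥-elim (─-∉ f∈ (SubP.x∈p∩q⁺ (SubP.p─q⊆p G B f∈ , sub (∈-star w f (end-incident f end)))))
    u∈ : u ∈ D
    u∈ = isolated u (λ h → SubP.x∈p∪q⁺ (inj₁ h))
    v∈ : v ∈ D
    v∈ = isolated v (λ h → SubP.x∈p∪q⁺ {p = star u} (inj₂ h))
    dom′ : Dominating {n} G (D ∖ u)
    dom′ w with w FP.≟ u
    ... | yes refl = inj₂ (v , SubP.x∈p∧x≢y⇒x∈p-y v∈ (λ eq → u≢v (sym eq)) , e , e∈ , inj₂ refl)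
    ... | no w≢u with dom w
    ... | inj₁ w∈ = inj₁ (SubP.x∈p∧x≢y⇒x∈p-y w∈ w≢u)
    ... | inj₂ (a , a∈ , f , f∈ , end) with a FP.≟ u
    ... | no a≢u = inj₂ (a , SubP.x∈p∧x≢y⇒x∈p-y a∈ a≢u , f , SubP.p─q⊆p G B f∈ , end)
    ... | yes refl = ⊥-elim (─-∉ f∈ (SubP.x∈p∩q⁺ (SubP.p─q⊆p G B f∈ , SubP.x∈p∪q⁺ (inj₁ (∈-star u f (end-incident f (swap end)))))))
      where
      swap : ∀ {A B : Set} → A ⊎ B → B ⊎ A
      swap (inj₁ x) = inj₂ x
      swap (inj₂ x) = inj₁ x

  -- The bondage number is the least size of a deletion set after which no dominating k-set remains;
  -- the cut at the two ends of an edge is such a set. The empty deletion set in the negation of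
  -- `Fragile` shows γ ≤ k.
  bondage-bounds : ∀ n κ s (G : Graph n) → suc κ ℕ.≤ n → 1 ℕ.≤ ∣ G ∣ → ¬ HasDom n G κ → ¬ Fragile n (suc κ) s G →
    IsDomNum {n} G (suc κ) × ∃ λ b → IsBondage {n} G b × suc s ℕ.≤ b × b ℕ.≤ 2 ℕ.* maxDeg {n} G
  bondage-bounds n κ s G k≤n 1≤∣G∣ ¬low ¬fragile = γ , bondage
    where
    k = suc κ
    small : ∀ B → B ⊆ G → ∣ B ∣ ℕ.≤ s → HasDom n (G ─ B) k
    small B B⊆G B≤s = decidable-stable (hasDom? n (G ─ B) k) (λ ¬h → ¬fragile (B , B⊆G , B≤s , ¬h))
    γ : IsDomNum {n} G k
    γ with small ⊥ (λ z → ⊥-elim (SubP.∉⊥ z)) (ℕP.≤-trans (ℕP.≤-reflexive (SubP.∣⊥∣≡0 (numPairs n))) z≤n)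
    ... | D , e , dom = (D , dominating-mono (G ─ ⊥) G D D (SubP.p─q⊆p G ⊥) (λ z → z) dom , e) ,
      λ D′ dom′ → ℕP.≮⇒≥ (λ D′<k → ¬low (hasDom-mono G G (λ z → z) (ℕP.≤-pred D′<k) (ℕP.≤-trans (ℕP.n≤1+n κ) k≤n) (D′ , refl , dom′)))
    Q : ℕ → Set
    Q b = ∃ λ (B : Subset (numPairs n)) → B ⊆ G × ∣ B ∣ ≡ b × ¬ HasDom n (G ─ B) k
    Q? : ∀ b → Dec (Q b)
    Q? b = SubP.anySubset? (λ B → (B SubP.⊆? G) ×-dec ((∣ B ∣ ℕP.≟ b) ×-dec ¬? (hasDom? n (G ─ B) k)))
    cut : Fin (numPairs n) → Subset (numPairs n)
    cut e = G ∩ (star (proj₁ (lookup (pairV n) e)) ∪ star (proj₂ (lookup (pairV n) e)))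
    cut-raises : ∀ e → lookup G e ≡ true → Q ∣ cut e ∣
    cut-raises e e∈ = cut e , (λ {f} → SubP.p∩q⊆p G _ {f}) , refl , star-pair-raises n G κ e (VP.lookup⇒[]= e G e∈) ¬low (ℕP.≤-trans (ℕP.n≤1+n κ) k≤n)
    bondage : ∃ λ b → IsBondage {n} G b × suc s ℕ.≤ b × b ℕ.≤ 2 ℕ.* maxDeg {n} G
    bondage with nonempty⇒∃ G 1≤∣G∣
    ... | e , e∈ with least Q? ∣ cut e ∣ (cut-raises e e∈)
    ... | b , (B , B⊆G , ∣B∣ , ¬h) , min = b , ((B , B⊆G , ∣B∣ , ⇒raises G B k≤n γ ¬h) , λ B′ B′⊆G r → min ∣ B′ ∣ (B′ , B′⊆G , refl , raises⇒ G B′ k≤n γ r)) ,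
        ℕP.≰⇒> (λ b≤s → ¬h (small B B⊆G (ℕP.≤-trans (ℕP.≤-reflexive ∣B∣) b≤s))) ,
        ℕP.≤-trans (min _ (cut-raises e e∈)) (ℕP.≤-trans (∣∩∪∣≤ G (star u) (star v)) (ℕP.≤-trans (ℕP.+-mono-≤ (star≤maxDeg n G u) (star≤maxDeg n G v)) (ℕP.≤-reflexive (cong (maxDeg {n} G ℕ.+_) (sym (ℕP.+-identityʳ _))))))
      where
      u = proj₁ (lookup (pairV n) e)
      v = proj₂ (lookup (pairV n) e)

  low-prob : ∀ {p} → 0F ≤ p → p ≤ 1F → ∀ n k → 𝔼 p (numPairs n) (λ G → 𝟙 ⌊ hasDom? n G k ⌋) ≤ binomF n k * (1F - (1F - p) ^^ k) ^^ (n ℕ.∸ k)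
  low-prob {p} h h′ n k = ≤-tr (E-mono p (numPairs n) h h′ each) (≤-rf (E-domCount h h′ n k))
    where
    each : ∀ G → 𝟙 ⌊ hasDom? n G k ⌋ ≤ domCount n k G
    each G with hasDom? n G k
    ... | no _ = 0≤ΣL (layer n k) (λ D → 0≤domQ D G)
    ... | yes (D , refl , dom) = ≤-tr (≤-rf (sym (domQ-dominating G D dom))) (ΣL-∈ {f = λ D → domQ D G} (λ D → 0≤domQ D G) (∈-layer D))

  Crowded : ∀ n → ℕ → Graph n → Set
  Crowded n d G = ∃ λ (v : Fin n) → d ℕ.≤ ∣ G ∩ star v ∣

  crowded? : ∀ n d (G : Graph n) → Dec (Crowded n d G)
  crowded? n d G = FP.any? (λ v → d ℕP.≤? ∣ G ∩ star v ∣)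

  -- Exponential moment to base 2: the mean of 2^deg is (1 + p)^|star v|, and ½^d pays for reaching
  -- degree d.
  crowded-prob : ∀ {p} → 0F ≤ p → p ≤ 1F → ∀ n d → 𝔼 p (numPairs n) (λ G → 𝟙 ⌊ crowded? n d G ⌋) ≤ ½ ^^ d * (ι n * (1F + p) ^^ n)
  crowded-prob {p} h h′ n d = ≤-tr (E-mono p N h h′ each) (≤-tr (≤-rf (trans (E-*ˡ p N (½ ^^ d) _) (cong (½ ^^ d *_) (E-ΣL p N (allFin n) (λ v G → ι 2 ^^ ∣ G ∩ star v ∣)))))
      (*-monoˡ (½ ^^ d) 0≤½^d (≤-tr (ΣL-mono (allFin n) (λ v → ≤-tr (≤-rf (trans (E-pow p (ι 2) (star v)) (cong (_^^ ∣ star v ∣) (solve 1 (λ p → κ 1 :- p :+ p :* κ 2 := κ 1 :+ p) refl p)))) (^^-monoʳ (≤-+ʳ h) (∣star∣≤n v))))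
        (≤-rf (trans (ΣL-const (allFin n) _) (cong (λ z → ι z * (1F + p) ^^ n) (LP.length-tabulate {n = n} (λ x → x))))))))
    where
    N = numPairs n
    2½≡1 : ι 2 * ½ ≡ 1F
    2½≡1 = *-inv (ι 2) (0<ι {2} (s≤s z≤n))
    0≤½ : 0F ≤ ½
    0≤½ = *-cancelˡ (ι 2) (0<ι {2} (s≤s z≤n)) (≤-tr (≤-rf (zeroʳ _)) (≤-tr 0≤1 (≤-rf (sym 2½≡1))))
    0≤½^d : 0F ≤ ½ ^^ d
    0≤½^d = 0≤^^ 0≤½ d
    0≤Σ : ∀ G → 0F ≤ ΣL (allFin n) (λ v → ι 2 ^^ ∣ G ∩ star v ∣)
    0≤Σ G = 0≤ΣL (allFin n) (λ v → 0≤^^ (0≤ι 2) ∣ G ∩ star v ∣)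
    each : ∀ G → 𝟙 ⌊ crowded? n d G ⌋ ≤ ½ ^^ d * ΣL (allFin n) (λ v → ι 2 ^^ ∣ G ∩ star v ∣)
    each G with crowded? n d G
    ... | no _ = 0≤* 0≤½^d (0≤Σ G)
    ... | yes (v , d≤) = ≤-tr (≤-rf (trans (sym (1^^ d)) (trans (cong (_^^ d) (trans (sym 2½≡1) (*-comm (ι 2) ½))) (^^-*-dist ½ (ι 2) d)))) (*-monoˡ (½ ^^ d) 0≤½^d
        (≤-tr (^^-monoʳ (1≤ι {2} (s≤s z≤n)) d≤) (ΣL-∈ {f = λ v → ι 2 ^^ ∣ G ∩ star v ∣} (λ v → 0≤^^ (0≤ι 2) ∣ G ∩ star v ∣) (∈-allFin v))))

  𝟙-mono : ∀ {A B : Set} (a : Dec A) (b : Dec B) → (A → B) → 𝟙 ⌊ a ⌋ ≤ 𝟙 ⌊ b ⌋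
  𝟙-mono (yes x) (yes y) h = ≤-refl
  𝟙-mono (yes x) (no y) h = ⊥-elim (y (h x))
  𝟙-mono (no x) b h = 0≤𝟙 ⌊ b ⌋

  low-increasing : ∀ n k → k ℕ.≤ n → Increasing (λ (G : Graph n) → 𝟙 ⌊ hasDom? n G k ⌋)
  low-increasing n k k≤n G G′ s = 𝟙-mono (hasDom? n G k) (hasDom? n G′ k) (hasDom-mono G G′ s ℕP.≤-refl k≤n)

  crowded-increasing : ∀ n d → Increasing (λ (G : Graph n) → 𝟙 ⌊ crowded? n d G ⌋)
  crowded-increasing n d G G′ s = 𝟙-mono (crowded? n d G) (crowded? n d G′) (λ { (v , h) → v , ℕP.≤-trans h (SubP.p⊆q⇒∣p∣≤∣q∣ (λ i → let a , b = SubP.x∈p∩q⁻ G (star v) i in SubP.x∈p∩q⁺ (s a , b))) })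

  -- A deletion set B of G′ ⊇ G restricts to B ∩ G, because G - (B ∩ G) is contained in G′ - B.
  fragile-decreasing : ∀ n k s → k ℕ.≤ n → Increasing (λ (G : Graph n) → 1F - 𝟙 ⌊ fragile? n k s G ⌋)
  fragile-decreasing n k s k≤n G G′ sub = ≤-diff _ (0≤diff (𝟙-mono (fragile? n k s G′) (fragile? n k s G) descend))
      (solve 2 (λ a b → κ 1 :- a :- (κ 1 :- b) := b :- a) refl (𝟙 ⌊ fragile? n k s G′ ⌋) (𝟙 ⌊ fragile? n k s G ⌋))
    where
    ─-mono : ∀ {N} (G G′ B : Subset N) → G ⊆ G′ → G ─ (B ∩ G) ⊆ G′ ─ B
    ─-mono (true ∷ G) (g′ ∷ G′) (false ∷ B) s {zero} Vec.here with s {zero} Vec.here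
    ... | Vec.here = Vec.here
    ─-mono (false ∷ G) (g′ ∷ G′) (false ∷ B) s {zero} ()
    ─-mono (false ∷ G) (g′ ∷ G′) (true ∷ B) s {zero} ()
    ─-mono (g ∷ G) (g′ ∷ G′) (b ∷ B) s {suc f} (Vec.there h) = Vec.there (─-mono G G′ B (SubP.drop-∷-⊆ s) h)
    descend : Fragile n k s G′ → Fragile n k s G
    descend (B , B⊆ , B≤ , ¬h) = B ∩ G , SubP.p∩q⊆q B G , ℕP.≤-trans (SubP.∣p∩q∣≤∣p∣ B G) B≤ ,
      λ h → ¬h (hasDom-mono (G ─ (B ∩ G)) (G′ ─ B) (─-mono G G′ B sub) ℕP.≤-refl k≤n h)

-- Almost all graphs with m edges have the desired properties.

module TypicalGraphs where

  open import Defs using (Graph; IsDomNum; IsBondage; maxDeg) renaming (E to numPairs)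
  open OrderedField
  open Inequalities
  open FiniteSums
  open RandomSubsets
  open Domination
  open Moments
  open EdgeDeletion
  open Overlaps
  open Regimes
  open Resilience
  open Thresholds
  open Logarithms using (binaryLog; absorb; log≤; 2^-cancel)
  open BondageNumbers
  open import Data.Nat as ℕ using (ℕ; zero; suc; z≤n; s≤s)
  import Data.Nat.Properties as ℕP
  open import Data.Nat.Combinatorics using (_C_)
  open import Data.Nat.DivMod using (_/_; m/n*n≤m; m≡m%n+[m/n]*n; m%n<n)
  open import Data.Product using (_×_; _,_; ∃; proj₁; proj₂)
  open import Data.Sum using (_⊎_; inj₁; inj₂)
  open import Data.Empty using (⊥-elim)
  open import Data.List as List using (List; []; _∷_; map; length; filter)
  import Data.List.Properties as LP
  open import Data.List.Membership.Propositional using () renaming (_∈_ to _∈L_)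
  open import Data.List.Membership.Propositional.Properties using (∈-map⁻; ∈-filter⁻)
  open import Data.List.Relation.Unary.All as All using (All)
  open import Data.List.Relation.Unary.Unique.Propositional using (Unique)
  import Data.List.Relation.Unary.Unique.Propositional.Properties as UP
  open import Data.List.Relation.Unary.AllPairs using ([]; _∷_)
  open import Data.Vec as Vec using (Vec; []; _∷_)
  open import Data.Fin.Subset using (∣_∣)
  open import Data.Bool using (Bool; true; false)
  open import Relation.Nullary using (Dec; yes; no; ¬_)
  open import Relation.Nullary.Decidable using (⌊_⌋; _×-dec_; ¬?)
  open import Relation.Binary.PropositionalEquality

  unique-layer : ∀ N j → Unique (layer N j)
  unique-layer zero zero = All.[] ∷ []
  unique-layer zero (suc j) = []
  unique-layer (suc N) zero = UP.map⁺ (λ { refl → refl }) (unique-layer N zero)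
  unique-layer (suc N) (suc j) = UP.++⁺ (UP.map⁺ (λ { refl → refl }) (unique-layer N j)) (UP.map⁺ (λ { refl → refl }) (unique-layer N (suc j))) disjoint
    where
    disjoint : ∀ {v} → v ∈L map (true ∷_) (layer N j) × v ∈L map (false ∷_) (layer N (suc j)) → Data.Empty.⊥
    disjoint (a , b) with ∈-map⁻ (true ∷_) a | ∈-map⁻ (false ∷_) b
    ... | _ , _ , refl | _ , _ , ()

  length-filter : ∀ {X : Set} {P : X → Set} (P? : ∀ x → Dec (P x)) (xs : List X) → ι (length (filter P? xs)) ≡ ΣL xs (λ x → 𝟙 ⌊ P? x ⌋)
  length-filter P? xs = trans (sym (*-identityʳ _)) (trans (sym (ΣL-const (filter P? xs) 1F)) (trans (ΣL-filter P? xs (λ _ → 1F)) (ΣL-cong xs (λ x → *-identityʳ _))))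

  -- Union bound: the bad events use up at most half of the admissible fraction 1/(t + 1), which
  -- leaves room for the strict inequality.
  good-list : ∀ N m (P₁ P₂ P₃ : Vec Bool N → Set) (P₁? : ∀ G → Dec (P₁ G)) (P₂? : ∀ G → Dec (P₂ G)) (P₃? : ∀ G → Dec (P₃ G)) t →
    1 ℕ.≤ binom N m →
    ι 4 * ι (suc t) * (ΣL (layer N m) (λ G → 𝟙 ⌊ P₁? G ⌋) + ΣL (layer N m) (λ G → 𝟙 ⌊ P₂? G ⌋)) ≤ binomF N m →
    ι 4 * ι (suc t) * ΣL (layer N m) (λ G → 𝟙 ⌊ P₃? G ⌋) ≤ binomF N m →
    ∃ λ (xs : List (Vec Bool N)) → Unique xs × All (λ G → ∣ G ∣ ≡ m × ¬ P₁ G × ¬ P₂ G × ¬ P₃ G) xs × suc t ℕ.* (N C m ℕ.∸ length xs) ℕ.< N C m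
  good-list N m P₁ P₂ P₃ P₁? P₂? P₃? t 1≤C h₁₂ h₃ = xs , UP.filter⁺ good? (unique-layer N m) ,
      All.tabulate (λ i → let i′ , g = ∈-filter⁻ good? {xs = layer N m} i in layer-∈ m i′ , g) ,
      subst (λ c → suc t ℕ.* (c ℕ.∸ length xs) ℕ.< c) (binom≡C N m) (ι-cancel-< (≤-<-trans few small))
    where
    good? : ∀ G → Dec (¬ P₁ G × ¬ P₂ G × ¬ P₃ G)
    good? G = ¬? (P₁? G) ×-dec (¬? (P₂? G) ×-dec ¬? (P₃? G))
    xs = filter good? (layer N m)
    W₁ = ΣL (layer N m) (λ G → 𝟙 ⌊ P₁? G ⌋)
    W₂ = ΣL (layer N m) (λ G → 𝟙 ⌊ P₂? G ⌋)
    W₃ = ΣL (layer N m) (λ G → 𝟙 ⌊ P₃? G ⌋)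
    W = W₁ + W₂ + W₃
    C′ = binomF N m
    total : C′ ≡ ΣL (layer N m) (λ _ → 1F)
    total = sym (trans (ΣL-layer-const N m 1F) (*-identityʳ _))
    union : ∀ {A B C : Set} (a : Dec A) (b : Dec B) (c : Dec C) → 1F ≤ 𝟙 ⌊ ¬? a ×-dec (¬? b ×-dec ¬? c) ⌋ + (𝟙 ⌊ a ⌋ + 𝟙 ⌊ b ⌋ + 𝟙 ⌊ c ⌋)
    union (yes _) b c = ≤-tr (≤-tr (≤-+ʳ (0≤𝟙 ⌊ b ⌋)) (≤-+ʳ (0≤𝟙 ⌊ c ⌋))) (≤-+ˡ ≤-refl)
    union (no _) (yes _) c = ≤-tr (≤-tr (≤-+ˡ ≤-refl) (≤-+ʳ (0≤𝟙 ⌊ c ⌋))) (≤-+ˡ ≤-refl)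
    union (no _) (no _) (yes _) = ≤-tr (≤-+ˡ (0≤+ ≤-refl ≤-refl)) (≤-+ˡ ≤-refl)
    union (no _) (no _) (no _) = ≤-+ʳ (0≤+ (0≤+ ≤-refl ≤-refl) ≤-refl)
    covered : C′ ≤ ι (length xs) + W
    covered = ≤-tr (≤-rf total) (≤-tr (ΣL-mono (layer N m) (λ G → union (P₁? G) (P₂? G) (P₃? G)))
      (≤-rf (trans (ΣL-+ (layer N m) _ _) (cong₂ _+_ (sym (length-filter good? (layer N m))) (trans (ΣL-+ (layer N m) _ _) (cong (_+ W₃) (ΣL-+ (layer N m) _ _)))))))
    len≤ : length xs ℕ.≤ binom N m
    len≤ = ℕP.≤-trans (LP.length-filter good? (layer N m)) (ℕP.≤-reflexive (length-layer N m))
    few : ι (suc t ℕ.* (binom N m ℕ.∸ length xs)) ≤ ι (suc t) * W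
    few = ≤-tr (≤-rf (trans (ι-* (suc t) (binom N m ℕ.∸ length xs)) (cong (ι (suc t) *_) (ι-∸ len≤)))) (*-monoˡ (ι (suc t)) (0≤ι (suc t)) (≤-diff _ (0≤diff covered) (solve 3 (λ w c l → w :- (c :- l) := l :+ w :- c) refl W C′ (ι (length xs)))))
    small : ι (suc t) * W < C′
    small with C′ ≤? ι (suc t) * W
    ... | no h = ≰⇒> h
    ... | yes h = ⊥-elim (<⇒≱ (0<ι 1≤C) (*-cancelˡ (ι 2) (0<ι {2} (s≤s z≤n)) (≤-diff _ (0≤+ (0≤+ (0≤diff h₁₂) (0≤diff h₃)) (0≤* 0≤4 (0≤diff h)))
      (solve 5 (λ c s a b d → κ 2 :* κ 0 :- κ 2 :* c := ((c :- κ 4 :* s :* (a :+ b)) :+ (c :- κ 4 :* s :* d)) :+ κ 4 :* (s :* (a :+ b :+ d) :- c)) refl C′ (ι (suc t)) W₁ W₂ W₃))))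

  invℕ : ℕ → F
  invℕ zero = 0F
  invℕ (suc m) = inv (ι (suc m)) (0<ι {suc m} (s≤s z≤n))

  *-invℕ : ∀ {m} → 1 ℕ.≤ m → ι m * invℕ m ≡ 1F
  *-invℕ {suc m} h = *-inv (ι (suc m)) (0<ι {suc m} (s≤s z≤n))

  0≤invℕ : ∀ m → 0F ≤ invℕ m
  0≤invℕ zero = ≤-refl
  0≤invℕ (suc m) = *-cancelˡ (ι (suc m)) (0<ι {suc m} (s≤s z≤n)) (≤-tr (≤-rf (zeroʳ _)) (≤-tr 0≤1 (≤-rf (sym (*-invℕ {suc m} (s≤s z≤n))))))

  lastBelow : ∀ {P : ℕ → Set} → (∀ i → Dec (P i)) → ℕ → ℕ
  lastBelow P? zero = zero
  lastBelow P? (suc b) with P? b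
  ... | yes _ = b
  ... | no _ = lastBelow P? b

  lastBelow-spec : ∀ {P : ℕ → Set} (P? : ∀ i → Dec (P i)) b → P 0 → ¬ P b → let a = lastBelow P? b in P a × ¬ P (suc a) × suc a ℕ.≤ b
  lastBelow-spec P? zero p ¬p = ⊥-elim (¬p p)
  lastBelow-spec P? (suc b) p ¬p with P? b
  ... | yes pb = pb , ¬p , ℕP.≤-refl
  ... | no ¬pb = let x , y , z = lastBelow-spec P? b p ¬pb in x , y , ℕP.m≤n⇒m≤1+n z

  -- At edge probability a/N, at most 1/n dominating κ-sets are expected.
  Few : ℕ → ℕ → ℕ → Set
  Few n κ a = ι n * (binomF n κ * (1F - (1F - ι a * invℕ (numPairs n)) ^^ κ) ^^ (n ℕ.∸ κ)) ≤ 1F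

  few? : ∀ n κ a → Dec (Few n κ a)
  few? n κ a = _ ≤? _

  threshold : ℕ → ℕ → ℕ
  threshold n κ = lastBelow (few? n κ) (numPairs n)

  abstract
    c₆ : ℕ → ℕ
    c₆ c = 1024 ℕ.* (A₀ c ℕ.* A₀ c) ℕ.* 2 ℕ.^ (4 ℕ.* A₀ c)

    c₆-def : ∀ c → c₆ c ≡ 1024 ℕ.* (A₀ c ℕ.* A₀ c) ℕ.* 2 ℕ.^ (4 ℕ.* A₀ c)
    c₆-def c = refl

  1≤c₆ : ∀ c → 1 ℕ.≤ c₆ c
  1≤c₆ c = ℕP.≤-trans (ℕP.*-mono-≤ (ℕP.*-mono-≤ (numeral-≤ 1 1024) (ℕP.*-mono-≤ 1≤A₀ 1≤A₀)) (ℕP.m^n>0 2 (4 ℕ.* A₀ c))) (ℕP.≤-reflexive (sym (c₆-def c)))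
    where
    1≤A₀ : 1 ℕ.≤ A₀ c
    1≤A₀ = ℕP.m^n>0 2 (4 ℕ.* c ℕ.+ 16 ℕ.+ c₂ c)

  Conclusion : ∀ n κ c₁ m → Graph n → Set
  Conclusion n κ c₁ m G = ∣ G ∣ ≡ m × IsDomNum {n} G (suc κ) ×
    (∃ λ b → IsBondage {n} G b × maxDeg {n} G ℕ.≤ c₆ c₁ ℕ.* 68 ℕ.* b × b ℕ.≤ 2 ℕ.* maxDeg {n} G) ×
    m ℕ.≤ n ℕ.* maxDeg {n} G × n ℕ.* maxDeg {n} G ℕ.≤ m ℕ.* 68

  fragile-unlikely : ∀ {n k L Z R c J p ℓ′ A s T η} → Robustness n k L Z R c J p ℓ′ A s T η → 𝔼 p (numPairs n) (λ G → 𝟙 ⌊ fragile? n k s G ⌋) ≤ ι 48 * η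
  fragile-unlikely {n} {k} {ℓ′ = ℓ′} {s = s} rb = fragile-prob (λ G → 𝟙 ⌊ fragile? n k s G ⌋) each
    where
    open Robustness rb using (fragile-prob; ℓ; Y; y; 0≤y; 1≤Y; Yy)
    each : ∀ G → 𝟙 ⌊ fragile? n k s G ⌋ ≡ 0F ⊎ (𝟙 ⌊ fragile? n k s G ⌋ ≡ 1F × _)
    each G with fragile? n k s G
    ... | no _ = inj₁ refl
    ... | yes (B , B⊆G , B≤s , ¬h) = inj₂ (refl , destroyed n k ℓ′ s G B y (ι Y) 0≤y (1≤ι 1≤Y) Yy B⊆G B≤s (λ D D∈ dom → ¬h (D , layer-∈ k D∈ , dom)))

  0≤½ : 0F ≤ ½
  0≤½ = *-cancelˡ (ι 2) (0<ι {2} (s≤s z≤n)) (≤-tr (≤-rf (zeroʳ _)) (≤-tr 0≤1 (≤-rf (sym (*-inv (ι 2) (0<ι {2} (s≤s z≤n)))))))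

  crowded-unlikely : ∀ {p} → 0F ≤ p → p ≤ 1F → ∀ n J d → ι 4 * (ι n * p) ≤ ι J → n ℕ.* n ℕ.* 2 ℕ.^ J ℕ.≤ 2 ℕ.^ d → ι n * 𝔼 p (numPairs n) (λ G → 𝟙 ⌊ crowded? n d G ⌋) ≤ 1F
  crowded-unlikely {p} 0≤p p≤1 n J d 4np≤J count = ≤-tr (*-monoˡ (ι n) (0≤ι n) (crowded-prob 0≤p p≤1 n d))
    (≤-tr (*-monoˡ (ι n) (0≤ι n) (*-monoˡ h 0≤h (*-monoˡ (ι n) (0≤ι n) [1+p]^n)))
      (≤-tr (≤-rf (trans (solve 3 (λ n h t → n :* (h :* (n :* t)) := h :* (n :* n :* t)) refl (ι n) h (ι 2 ^^ J)) (cong (h *_) (trans (cong₂ _*_ (sym (ι-* n n)) (sym (ι-^ 2 J))) (sym (ι-* (n ℕ.* n) (2 ℕ.^ J)))))))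
        (≤-tr (*-monoˡ h 0≤h (≤-tr (ι-mono count) (≤-rf (ι-^ 2 d))))
          (≤-rf (trans (sym (^^-*-dist ½ (ι 2) d)) (trans (cong (_^^ d) (trans (*-comm ½ (ι 2)) (*-inv (ι 2) (0<ι {2} (s≤s z≤n))))) (1^^ d)))))))
    where
    h = ½ ^^ d
    0≤h : 0F ≤ h
    0≤h = 0≤^^ 0≤½ d
    -- `growth-upper` requires 4p ≤ 1; otherwise n ≤ 4np ≤ J, and (1 + p)^n ≤ 2^n suffices.
    [1+p]^n : (1F + p) ^^ n ≤ ι 2 ^^ J
    [1+p]^n with ι 4 * p ≤? 1F
    ... | yes small = growth-upper 0≤p small J n 4np≤J
    ... | no large = ≤-tr (^^-mono (0≤+ 0≤1 0≤p) (≤-tr (+-mono ≤-refl p≤1) (≤-rf (solve 0 (κ 1 :+ κ 1 := κ 2) refl))) n) (^^-monoʳ (1≤ι {2} (s≤s z≤n)) {n} {J} (ι-cancel-≤ {n} {J} (≤-tr (≤*ʳ (0≤ι n) (<⇒≤ (≰⇒> large))) (≤-tr (≤-rf (solve 2 (λ n p → n :* (κ 4 :* p) := κ 4 :* (n :* p)) refl (ι n) p)) 4np≤J))))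

  -- Applied with μ = ⌊m/n⌋ and s = ⌊μ/`c₆`⌋: then Δ ≤ 68μ and b ≥ s + 1 > μ/`c₆`, which pins b and
  -- Δ to the order of m/n.
  conclude : ∀ n κ c₁ m μ s → suc κ ℕ.≤ n → 1 ℕ.≤ m → μ ℕ.* n ℕ.≤ m → μ ℕ.< suc s ℕ.* c₆ c₁ → (G : Graph n) →
    ∣ G ∣ ≡ m × ¬ HasDom n G κ × ¬ Crowded n (suc (μ ℕ.* 68)) G × ¬ Fragile n (suc κ) s G → Conclusion n κ c₁ m G
  conclude n κ c₁ m μ s k≤n 1≤m μn≤m μ<c₆[1+s] G (∣G∣ , ¬low , ¬crowded , ¬fragile) = ∣G∣ , proj₁ bounds , (b , proj₁ (proj₂ (proj₂ bounds)) , Δ≤b , proj₂ (proj₂ (proj₂ (proj₂ bounds)))) , m≤nΔ , nΔ≤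
    where
    bounds = bondage-bounds n κ s G k≤n (ℕP.≤-trans 1≤m (ℕP.≤-reflexive (sym ∣G∣))) ¬low ¬fragile
    b = proj₁ (proj₂ bounds)
    Δ = maxDeg {n} G
    rotate : ∀ b c x → b ℕ.* c ℕ.* x ≡ c ℕ.* x ℕ.* b
    rotate b c x = trans (ℕP.*-assoc b c x) (ℕP.*-comm b (c ℕ.* x))
    Δ≤ : Δ ℕ.≤ μ ℕ.* 68
    Δ≤ = maxDeg≤ n G (μ ℕ.* 68) (λ v → ℕP.≤-pred (ℕP.≰⇒> (λ h → ¬crowded (v , h))))
    Δ≤b : Δ ℕ.≤ c₆ c₁ ℕ.* 68 ℕ.* b
    Δ≤b = ℕP.≤-trans Δ≤ (ℕP.≤-trans (ℕP.*-monoˡ-≤ 68 (ℕP.≤-trans (ℕP.<⇒≤ μ<c₆[1+s]) (ℕP.*-monoˡ-≤ (c₆ c₁) (proj₁ (proj₂ (proj₂ (proj₂ bounds))))))) (ℕP.≤-reflexive (rotate b (c₆ c₁) 68)))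
    m≤nΔ : m ℕ.≤ n ℕ.* Δ
    m≤nΔ = ℕP.≤-trans (ℕP.≤-reflexive (sym ∣G∣)) (edges≤n*maxDeg n G)
    nΔ≤ : n ℕ.* Δ ℕ.≤ m ℕ.* 68
    nΔ≤ = ℕP.≤-trans (ℕP.*-monoʳ-≤ n Δ≤) (ℕP.≤-trans (ℕP.≤-reflexive (trans (sym (ℕP.*-assoc n μ 68)) (cong (ℕ._* 68) (ℕP.*-comm n μ)))) (ℕP.*-monoˡ-≤ 68 μn≤m))

  typical : ∀ t n κ L c₁ Z a → Threshold n κ L c₁ Z a (invℕ (numPairs n)) → A₀ c₁ ℕ.≤ L → 4 ℕ.* (400 ℕ.* suc t) ℕ.≤ Z →
    ∃ λ (xs : List (Graph n)) → Unique xs × All (Conclusion n κ c₁ (a ℕ.∸ n)) xs × suc t ℕ.* (numPairs n C (a ℕ.∸ n) ℕ.∸ length xs) ℕ.< numPairs n C (a ℕ.∸ n)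
  typical t n κ′ L c₁ Z a th A≤L 4T≤Z = finish (good-list N m (λ G → HasDom n G κ′) (Crowded n d₀) (Fragile n k s) (λ G → hasDom? n G κ′) (crowded? n d₀) (fragile? n k s) t 1≤C light heavy)
    where
    open Threshold th
    δ = invℕ N
    X m μ s d₀ T : ℕ
    X = 48 ℕ.* c₁ ℕ.* k
    m = a ℕ.∸ n
    -- 400 rounds up 384 = 4 · 2 · 48: the quarter share in `good-list`, the factor 2 of the
    -- transfer, and the 48η of `fragile-prob`.
    T = 400 ℕ.* suc t
    N*p₁ : ι N * p₁ ≡ ι a - ι (2 ℕ.* n)
    N*p₁ = trans (cong₂ (λ u v → ι N * (u * δ - v * δ)) (ι-suc a) (ι-+ (2 ℕ.* n) 1))
      (trans (solve 4 (λ N a b d → N :* ((κ 1 :+ a) :* d :- (b :+ κ 1) :* d) := (N :* d) :* (a :- b)) refl (ι N) (ι a) (ι (2 ℕ.* n)) δ) (trans (cong (_* (ι a - ι (2 ℕ.* n))) Nδ) (*-identityˡ _)))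
    2n≤a : 2 ℕ.* n ℕ.≤ a
    2n≤a = ι-cancel-≤ (≤-diff _ (0≤* (0≤ι N) 0≤p₁) (sym N*p₁))
    r : ℕ
    r = a ℕ.∸ 2 ℕ.* n
    N*p₁′ : ι N * p₁ ≡ ι r
    N*p₁′ = trans N*p₁ (sym (ι-∸ 2n≤a))
    NL≤ : N ℕ.* L ℕ.≤ X ℕ.* r
    NL≤ = ι-cancel-≤ (≤-tr (≤-rf (ι-* N L)) (≤-tr (*-monoˡ (ι N) (0≤ι N) L≤p₁) (≤-rf (trans (solve 4 (λ N c k p → N :* (c :* (k :* p)) := c :* k :* (N :* p)) refl (ι N) (ι (48 ℕ.* c₁)) (ι k) p₁)
      (trans (cong₂ _*_ (sym (ι-* (48 ℕ.* c₁) k)) N*p₁′) (sym (ι-* X r)))))))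
    -- The edge count exceeds nL. Hence r and m are of the same order, and ⌊m/n⌋ ≥ L, so that powers
    -- of n are bounded by exponentials in μ.
    nL≤r : n ℕ.* L ℕ.≤ r
    nL≤r = ℕP.*-cancelˡ-≤ {n ℕ.* L} {r} n {{ℕ.>-nonZero 1≤n}} (ℕP.≤-trans (ℕP.≤-reflexive (sym (ℕP.*-assoc n n L))) (ℕP.≤-trans (ℕP.*-monoˡ-≤ L n²≤4N) (ℕP.≤-trans (ℕP.≤-reflexive (ℕP.*-assoc 4 N L))
      (ℕP.≤-trans (ℕP.*-monoʳ-≤ 4 NL≤) (ℕP.≤-trans (ℕP.≤-reflexive (sym (ℕP.*-assoc 4 X r))) (ℕP.*-monoˡ-≤ r 4X≤n))))))
      where
      4X≤n : 4 ℕ.* X ℕ.≤ n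
      4X≤n = ℕP.≤-trans (ℕP.≤-reflexive (sym (ℕP.*-assoc 4 (48 ℕ.* c₁) k))) (ck≤n 3 (Z*′ 1 2 (numeralZ 4) (Z*′ 1 1 (numeralZ 48) (inZ (ℕP.≤-trans c₁≤c c₂≤Z)))) (numeral-≤ 3 128))
    n≤nL : n ℕ.≤ n ℕ.* L
    n≤nL = ℕP.m≤m*n n L {{ℕ.>-nonZero 1≤L}}
    n≤a : n ℕ.≤ a
    n≤a = ℕP.≤-trans (ℕP.m≤n*m n 2) 2n≤a
    a≡m+n : a ≡ m ℕ.+ n
    a≡m+n = sym (ℕP.m∸n+n≡m n≤a)
    m≡r+n : m ≡ r ℕ.+ n
    m≡r+n = ℕP.+-cancelʳ-≡ n m (r ℕ.+ n) (trans (sym a≡m+n) (trans (sym (ℕP.m∸n+n≡m 2n≤a)) (trans (cong (r ℕ.+_) (cong (n ℕ.+_) (ℕP.+-identityʳ n))) (sym (ℕP.+-assoc r n n)))))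
    r≤m : r ℕ.≤ m
    r≤m = ℕP.≤-trans (ℕP.m≤m+n r n) (ℕP.≤-reflexive (sym m≡r+n))
    m≤2r : m ℕ.≤ 2 ℕ.* r
    m≤2r = ℕP.≤-trans (ℕP.≤-reflexive m≡r+n) (ℕP.+-monoʳ-≤ r (ℕP.≤-trans (ℕP.≤-trans n≤nL nL≤r) (ℕP.≤-reflexive (sym (ℕP.+-identityʳ r)))))
    nL≤m : n ℕ.* L ℕ.≤ m
    nL≤m = ℕP.≤-trans nL≤r r≤m
    1≤m : 1 ℕ.≤ m
    1≤m = ℕP.≤-trans 1≤n (ℕP.≤-trans n≤nL nL≤m)
    n≢0 = ℕ.>-nonZero 1≤n
    c₆≢0 = ℕ.>-nonZero (1≤c₆ c₁)
    μ = (m / n) {{n≢0}}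
    s = (μ / c₆ c₁) {{c₆≢0}}
    -- 68 = 64 + 4: (1 + p₂)^n ≤ 2^(64μ) by `4np₂≤`, and n² ≤ 2^(4L) ≤ 2^(4μ) pays for the choice of
    -- the vertex and for the target probability 1/n.
    d₀ = suc (μ ℕ.* 68)
    μn≤m : μ ℕ.* n ℕ.≤ m
    μn≤m = m/n*n≤m m n {{n≢0}}
    m<[1+μ]n : m ℕ.< suc μ ℕ.* n
    m<[1+μ]n = ℕP.≤-trans (s≤s (ℕP.≤-reflexive (m≡m%n+[m/n]*n m n {{n≢0}}))) (ℕP.+-monoˡ-≤ (μ ℕ.* n) (m%n<n m n {{n≢0}}))
    L≤μ : L ℕ.≤ μ
    L≤μ = ℕP.≤-pred (ℕP.*-cancelʳ-< n L (suc μ) (ℕP.≤-<-trans (ℕP.≤-trans (ℕP.≤-reflexive (ℕP.*-comm L n)) nL≤m) m<[1+μ]n))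
    μ<c₆[1+s] : μ ℕ.< suc s ℕ.* c₆ c₁
    μ<c₆[1+s] = ℕP.≤-trans (s≤s (ℕP.≤-reflexive (m≡m%n+[m/n]*n μ (c₆ c₁) {{c₆≢0}}))) (ℕP.+-monoˡ-≤ (s ℕ.* c₆ c₁) (m%n<n μ (c₆ c₁) {{c₆≢0}}))
    2N≤n² : 2 ℕ.* N ℕ.≤ n ℕ.* n
    2N≤n² = ι-cancel-≤ (≤-tr (≤-rf (ι-* 2 N)) (≤-tr (≤-+ʳ (0≤ι n)) (≤-rf (trans (numPairs-eq n) (sym (ι-* n n))))))
    s-count : N ℕ.* (c₆ c₁ ℕ.* s) ℕ.≤ n ℕ.* r
    s-count = ℕP.*-cancelˡ-≤ {N ℕ.* (c₆ c₁ ℕ.* s)} {n ℕ.* r} 2 (ℕP.≤-trans (ℕP.≤-reflexive (sym (ℕP.*-assoc 2 N (c₆ c₁ ℕ.* s)))) (ℕP.≤-trans (ℕP.*-mono-≤ 2N≤n² (ℕP.≤-trans (ℕP.≤-reflexive (ℕP.*-comm (c₆ c₁) s)) (m/n*n≤m μ (c₆ c₁) {{c₆≢0}})))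
      (ℕP.≤-trans (ℕP.≤-reflexive (trans (ℕP.*-assoc n n μ) (cong (n ℕ.*_) (ℕP.*-comm n μ)))) (ℕP.≤-trans (ℕP.*-monoʳ-≤ n (ℕP.≤-trans μn≤m m≤2r)) (ℕP.≤-reflexive (trans (sym (ℕP.*-assoc n 2 r)) (trans (cong (ℕ._* r) (ℕP.*-comm n 2)) (ℕP.*-assoc 2 n r))))))))
    s≤np : ι (c₆ c₁ ℕ.* s) ≤ ι n * p₁
    s≤np = *-cancelˡ (ι N) (0<ι (ℕP.≤-trans (s≤s z≤n) a<N)) (≤-tr (≤-rf (sym (ι-* N (c₆ c₁ ℕ.* s)))) (≤-tr (ι-mono s-count) (≤-rf (trans (ι-* n r) (trans (cong (ι n *_) (sym N*p₁′)) (solve 3 (λ n N p → n :* (N :* p) := N :* (n :* p)) refl (ι n) (ι N) p₁))))))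
    1≤T : 1 ℕ.≤ T
    1≤T = ℕP.*-mono-≤ (numeral-≤ 1 400) (s≤s (z≤n {t}))
    η : F
    η = invℕ T
    Tη : ι T * η ≡ 1F
    Tη = *-invℕ 1≤T
    7η≤1 : ι 7 * η ≤ 1F
    7η≤1 = ≤-tr (*-monoʳ η (0≤invℕ T) (ι-mono (ℕP.≤-trans (numeral-≤ 7 400) (ℕP.m≤m*n 400 (suc t))))) (≤-rf Tη)
    rb : Robustness n k L Z R c J₀ p₁ ℓ′ A s T η
    rb = robustness s T η A≤L (≤-tr (≤-rf (cong (λ z → ι (z ℕ.* s)) (sym (c₆-def c₁)))) s≤np) 4T≤Z (0≤invℕ T) 7η≤1 (≤-rf (sym Tη))
    fragile-bound : 𝔼 p₁ N (λ G → 𝟙 ⌊ fragile? n k s G ⌋) ≤ ι 48 * η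
    fragile-bound = fragile-unlikely rb
    2N≤n²F : ι 2 * ι N ≤ ι n * ι n
    2N≤n²F = ≤-tr (≤-rf (sym (ι-* 2 N))) (≤-tr (ι-mono 2N≤n²) (≤-rf (ι-* n n)))
    m≤N : m ℕ.≤ N
    m≤N = ℕP.≤-trans (ℕP.m∸n≤m a n) (ℕP.≤-trans (ℕP.n≤1+n a) a<N)
    1≤C : 1 ℕ.≤ binom N m
    1≤C = 1≤binom m≤N
    C′ = binomF N m
    0≤C′ : 0F ≤ C′
    0≤C′ = 0≤binomF N m
    ιm+n : ι m + ι n ≡ ι a
    ιm+n = trans (sym (ι-+ m n)) (cong ι (sym a≡m+n))
    Np₂ : ι m + ι n ≤ ι N * p₂
    Np₂ = ≤-rf (trans ιm+n (sym (trans (solve 3 (λ N a d → N :* (a :* d) := N :* d :* a) refl (ι N) (ι a) δ) (trans (cong (_* ι a) Nδ) (*-identityˡ _)))))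
    Np₁+n : ι N * p₁ + ι n ≤ ι m
    Np₁+n = ≤-rf (trans (cong (_+ ι n) N*p₁′) (trans (sym (ι-+ r n)) (cong ι (sym m≡r+n))))
    heavy : ι 4 * ι (suc t) * ΣL (layer N m) (λ G → 𝟙 ⌊ fragile? n k s G ⌋) ≤ C′
    heavy = ≤-tr (*-monoˡ (ι 4 * ι (suc t)) (0≤* 0≤4 (0≤ι (suc t))) (≤-tr (transfer-decreasing p₁ N 0≤p₁ p₁≤1 m (ι n) _ (fragile-decreasing n k s k≤n) (λ G → 0≤𝟙 ⌊ fragile? n k s G ⌋) (λ G → 𝟙≤1 ⌊ fragile? n k s G ⌋) 0<n 2N≤n²F Np₁+n)
        (*-monoˡ (ι 2) 0≤2 (*-monoˡ C′ 0≤C′ fragile-bound))))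
      (≤-tr (≤-rf (solve 3 (λ s c e → κ 4 :* s :* (κ 2 :* (c :* (κ 48 :* e))) := c :* (κ 384 :* s :* e)) refl (ι (suc t)) C′ η))
        (≤-tr (*-monoˡ C′ 0≤C′ (≤-tr (*-monoʳ η (0≤invℕ T) (*-monoʳ (ι (suc t)) (0≤ι (suc t)) (ι-mono {384} {400} (numeral-≤ 384 400)))) (≤-rf (trans (cong (_* η) (sym (ι-* 400 (suc t)))) Tη)))) (≤-rf (*-identityʳ C′))))
    to-layer : ∀ (f : Graph n → F) → Increasing f → (∀ G → 0F ≤ f G) → ι n * 𝔼 p₂ N f ≤ 1F → ι n * ΣL (layer N m) f ≤ ι 2 * C′
    to-layer f inc 0≤f h = ≤-tr (*-monoˡ (ι n) (0≤ι n) (transfer-increasing p₂ N 0≤p₂ p₂≤1 m (ι n) f inc 0≤f 0<n 2N≤n²F Np₂))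
      (≤-tr (≤-rf (solve 3 (λ n c e → n :* (κ 2 :* (c :* e)) := κ 2 :* (c :* (n :* e))) refl (ι n) C′ (𝔼 p₂ N f))) (*-monoˡ (ι 2) 0≤2 (≤-tr (*-monoˡ C′ 0≤C′ h) (≤-rf (*-identityʳ C′)))))
    low-layer : ι n * ΣL (layer N m) (λ G → 𝟙 ⌊ hasDom? n G κ′ ⌋) ≤ ι 2 * C′
    low-layer = to-layer _ (low-increasing n κ′ κ≤n) (λ G → 0≤𝟙 ⌊ hasDom? n G κ′ ⌋) (≤-tr (*-monoˡ (ι n) (0≤ι n) (low-prob 0≤p₂ p₂≤1 n κ′)) below)
    4np₂≤ : ι 4 * (ι n * p₂) ≤ ι (μ ℕ.* 64)
    4np₂≤ = *-cancelˡ (ι n) 0<n (≤-tr (≤-rf (trans (solve 3 (λ n a d → n :* (κ 4 :* (n :* (a :* d))) := κ 4 :* a :* (n :* n :* d)) refl (ι n) (ι a) δ) (cong (λ z → ι 4 * ι a * (z * δ)) (sym (ι-* n n)))))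
      (≤-tr (*-monoˡ (ι 4 * ι a) (0≤* 0≤4 (0≤ι a)) (≤-tr (*-monoʳ δ 0≤δ (≤-tr (ι-mono n²≤4N) (≤-rf (ι-* 4 N)))) (≤-rf (trans (*-assoc _ _ _) (trans (cong (ι 4 *_) Nδ) (*-identityʳ _))))))
        (≤-tr (≤-rf (trans (solve 1 (λ a → κ 4 :* a :* κ 4 := a :* κ 16) refl (ι a)) (sym (ι-* a 16)))) (≤-tr (ι-mono count) (≤-rf (ι-* n (μ ℕ.* 64)))))))
      where
      count : a ℕ.* 16 ℕ.≤ n ℕ.* (μ ℕ.* 64)
      count = ℕP.≤-trans (ℕP.*-monoˡ-≤ 16 (ℕP.≤-trans (ℕP.≤-reflexive a≡m+n) (ℕP.+-mono-≤ (ℕP.<⇒≤ m<[1+μ]n) (ℕP.≤-trans (ℕP.≤-reflexive (sym (ℕP.*-identityˡ n))) (ℕP.*-monoˡ-≤ n (ℕP.≤-trans 1≤L L≤μ))))))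
        (ℕP.≤-trans (ℕP.*-monoˡ-≤ 16 (ℕP.+-monoˡ-≤ (μ ℕ.* n) (ℕP.*-monoˡ-≤ n (ℕP.+-monoˡ-≤ μ (ℕP.≤-trans 1≤L L≤μ)))))
          (ℕP.≤-trans (ℕP.m≤m+n _ (μ ℕ.* n ℕ.* 16)) (ℕP.≤-reflexive (ℕS.solve 2 (λ u n → ((u ℕS.:+ u) ℕS.:* n ℕS.:+ u ℕS.:* n) ℕS.:* ℕS.con 16 ℕS.:+ (u ℕS.:* n) ℕS.:* ℕS.con 16 ℕS.:= n ℕS.:* (u ℕS.:* ℕS.con 64)) refl μ n))))
    crowded-layer : ι n * ΣL (layer N m) (λ G → 𝟙 ⌊ crowded? n d₀ G ⌋) ≤ ι 2 * C′
    crowded-layer = to-layer _ (crowded-increasing n d₀) (λ G → 0≤𝟙 ⌊ crowded? n d₀ G ⌋) (crowded-unlikely 0≤p₂ p₂≤1 n (μ ℕ.* 64) d₀ 4np₂≤ count)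
      where
      count : n ℕ.* n ℕ.* 2 ℕ.^ (μ ℕ.* 64) ℕ.≤ 2 ℕ.^ d₀
      count = ℕP.≤-trans (ℕP.*-monoˡ-≤ (2 ℕ.^ (μ ℕ.* 64)) (ℕP.*-mono-≤ n≤2^2L n≤2^2L)) (ℕP.≤-trans (ℕP.≤-reflexive (trans (cong (ℕ._* 2 ℕ.^ (μ ℕ.* 64)) (sym (ℕP.^-distribˡ-+-* 2 (2 ℕ.* L) (2 ℕ.* L)))) (sym (ℕP.^-distribˡ-+-* 2 (2 ℕ.* L ℕ.+ 2 ℕ.* L) (μ ℕ.* 64)))))
        (ℕP.^-monoʳ-≤ 2 (ℕP.≤-trans (ℕP.+-monoˡ-≤ (μ ℕ.* 64) (ℕP.+-mono-≤ (ℕP.*-monoʳ-≤ 2 L≤μ) (ℕP.*-monoʳ-≤ 2 L≤μ))) (ℕP.≤-trans (ℕP.≤-reflexive (ℕS.solve 1 (λ u → ℕS.con 2 ℕS.:* u ℕS.:+ ℕS.con 2 ℕS.:* u ℕS.:+ u ℕS.:* ℕS.con 64 ℕS.:= u ℕS.:* ℕS.con 68) refl μ)) (ℕP.n≤1+n _)))))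
    light : ι 4 * ι (suc t) * (ΣL (layer N m) (λ G → 𝟙 ⌊ hasDom? n G κ′ ⌋) + ΣL (layer N m) (λ G → 𝟙 ⌊ crowded? n d₀ G ⌋)) ≤ C′
    light = *-cancelˡ (ι n) 0<n (≤-tr (≤-rf (solve 4 (λ n s a b → n :* (κ 4 :* s :* (a :+ b)) := κ 4 :* s :* (n :* a :+ n :* b)) refl (ι n) (ι (suc t)) _ _))
      (≤-tr (*-monoˡ (ι 4 * ι (suc t)) (0≤* 0≤4 (0≤ι (suc t))) (+-mono low-layer crowded-layer)) (≤-tr (≤-rf (trans (solve 2 (λ s c → κ 4 :* s :* (κ 2 :* c :+ κ 2 :* c) := κ 16 :* s :* c) refl (ι (suc t)) C′) (cong (_* C′) (sym (ι-* 16 (suc t))))))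
        (*-monoʳ C′ 0≤C′ (ι-mono (ℕP.≤-trans (ℕP.*-monoˡ-≤ (suc t) (numeral-≤ 16 1600)) (ℕP.≤-trans (ℕP.≤-reflexive (ℕP.*-assoc 4 400 (suc t))) (ℕP.≤-trans 4T≤Z (x≤n 1 (inZ ℕP.≤-refl) (numeral-≤ 1 128))))))))))
    finish : (∃ λ (xs : List (Graph n)) → Unique xs × All (λ G → ∣ G ∣ ≡ m × ¬ HasDom n G κ′ × ¬ Crowded n d₀ G × ¬ Fragile n k s G) xs × suc t ℕ.* (N C m ℕ.∸ length xs) ℕ.< N C m) →
      ∃ λ (xs : List (Graph n)) → Unique xs × All (Conclusion n κ′ c₁ m) xs × suc t ℕ.* (N C m ℕ.∸ length xs) ℕ.< N C m
    finish (xs , u , al , lt) = xs , u , All.map (λ {G} → conclude n κ′ c₁ m μ s k≤n 1≤m μn≤m μ<c₆[1+s] G) al , lt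

-- The threshold conditions hold for all large n.

module EventualValidity where

  open import Defs using (Graph; IsDomNum; IsBondage; maxDeg; LeExp) renaming (E to numPairs)
  open OrderedField
  open Inequalities
  open FiniteSums
  open Domination using (numPairs-eq)
  open Regimes using (numeral-≤)
  open Thresholds
  open Logarithms using (binaryLog; absorb; log≤; 2^-cancel)
  open TypicalGraphs
  open import Data.Nat as ℕ using (ℕ; zero; suc; z≤n; s≤s)
  import Data.Nat.Properties as ℕP
  open import Data.Product using (_×_; _,_; ∃; proj₁; proj₂)
  open import Data.Empty using (⊥-elim)
  open import Relation.Nullary using (¬_)
  open import Relation.Binary.PropositionalEquality

  abstract
    -- Multiplied by L this is the Z of `Threshold`: it dominates L, the fixed constants and the
    -- accuracy demanded by t.
    constants : ℕ → ℕ → ℕ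
    constants c t = 8192 ℕ.+ (c₂ c ℕ.+ 4 ℕ.* (400 ℕ.* suc t))

    8192≤constants : ∀ c t → 8192 ℕ.≤ constants c t
    8192≤constants c t = ℕP.m≤m+n 8192 (c₂ c ℕ.+ 4 ℕ.* (400 ℕ.* suc t))

    c₂≤constants : ∀ c t → c₂ c ℕ.≤ constants c t
    c₂≤constants c t = ℕP.≤-trans (ℕP.m≤m+n (c₂ c) (4 ℕ.* (400 ℕ.* suc t))) (ℕP.m≤n+m _ 8192)

    t≤constants : ∀ c t → 4 ℕ.* (400 ℕ.* suc t) ℕ.≤ constants c t
    t≤constants c t = ℕP.≤-trans (ℕP.m≤n+m (4 ℕ.* (400 ℕ.* suc t)) (c₂ c)) (ℕP.m≤n+m _ 8192)

    startLog : ℕ → ℕ → ℕ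
    startLog q t = (c₂ (2 ℕ.* suc q) ℕ.* 1536 ℕ.+ A₀ (2 ℕ.* suc q)) ℕ.+ 2 ℕ.* (128 ℕ.* suc q) ℕ.* (2 ℕ.* constants (2 ℕ.* suc q) t ℕ.* (128 ℕ.* suc q))

    c₂≤startLog : ∀ q t → c₂ (2 ℕ.* suc q) ℕ.* 1536 ℕ.≤ startLog q t
    c₂≤startLog q t = ℕP.≤-trans (ℕP.m≤m+n _ (A₀ (2 ℕ.* suc q))) (ℕP.m≤m+n _ _)

    A₀≤startLog : ∀ q t → A₀ (2 ℕ.* suc q) ℕ.≤ startLog q t
    A₀≤startLog q t = ℕP.≤-trans (ℕP.m≤n+m (A₀ (2 ℕ.* suc q)) (c₂ (2 ℕ.* suc q) ℕ.* 1536)) (ℕP.m≤m+n _ _)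

    absorb≤startLog : ∀ q t → 2 ℕ.* (128 ℕ.* suc q) ℕ.* (2 ℕ.* constants (2 ℕ.* suc q) t ℕ.* (128 ℕ.* suc q)) ℕ.≤ startLog q t
    absorb≤startLog q t = ℕP.m≤n+m _ (c₂ (2 ℕ.* suc q) ℕ.* 1536 ℕ.+ A₀ (2 ℕ.* suc q))

  -- Lower end of the search for `threshold`: in the empty graph no set of κ < n vertices dominates.
  few-0 : ∀ n κ → suc κ ℕ.≤ n → Few n κ 0
  few-0 n κ κ<n = ≤-tr (≤-rf (trans (cong (λ z → ι n * (binomF n κ * z)) (vanish (n ℕ.∸ κ) (ℕP.m<n⇒0<n∸m κ<n))) (solve 2 (λ n b → n :* (b :* OrderedField.κ 0) := OrderedField.κ 0) refl (ι n) (binomF n κ)))) 0≤1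
    where
    base : 1F - (1F - ι 0 * invℕ (numPairs n)) ^^ κ ≡ 0F
    base = trans (cong (λ z → 1F - z ^^ κ) (solve 1 (λ d → OrderedField.κ 1 :- OrderedField.κ 0 :* d := OrderedField.κ 1) refl (invℕ (numPairs n)))) (trans (cong (λ z → 1F - z) (1^^ κ)) (solve 0 (OrderedField.κ 1 :- OrderedField.κ 1 := OrderedField.κ 0) refl))
    vanish : ∀ j → 1 ℕ.≤ j → (1F - (1F - ι 0 * invℕ (numPairs n)) ^^ κ) ^^ j ≡ 0F
    vanish (suc j) _ = trans (cong (_* (1F - (1F - ι 0 * invℕ (numPairs n)) ^^ κ) ^^ j) base) (zeroˡ _)

  -- Upper end of the search: in the complete graph every nonempty set dominates, and n C(n, κ) ≥ 2.
  ¬few-all : ∀ n κ → 2 ℕ.≤ n → 1 ℕ.≤ numPairs n → 1 ℕ.≤ κ → κ ℕ.≤ n → ¬ Few n κ (numPairs n)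
  ¬few-all n (suc κ) 2≤n 1≤N _ κ≤n few = ℕP.<⇒≱ (ℕP.*-mono-≤ 2≤n (1≤binom κ≤n)) (ι-cancel-≤ (≤-tr (≤-rf (trans (ι-* n (binom n (suc κ))) (cong (ι n *_) (sym (trans (cong (binomF n (suc κ) *_) value) (*-identityʳ _)))))) few))
    where
    value : (1F - (1F - ι (numPairs n) * invℕ (numPairs n)) ^^ suc κ) ^^ (n ℕ.∸ suc κ) ≡ 1F
    value = trans (cong (_^^ (n ℕ.∸ suc κ)) (trans (cong (λ z → 1F - (1F - z) * (1F - ι (numPairs n) * invℕ (numPairs n)) ^^ κ) (*-invℕ 1≤N)) (solve 1 (λ x → OrderedField.κ 1 :- (OrderedField.κ 1 :- OrderedField.κ 1) :* x := OrderedField.κ 1) refl ((1F - ι (numPairs n) * invℕ (numPairs n)) ^^ κ)))) (1^^ (n ℕ.∸ suc κ))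

  1≤numPairs : ∀ n → 2 ℕ.≤ n → 1 ℕ.≤ numPairs n
  1≤numPairs n 2≤n = ℕP.*-cancelˡ-< 2 0 (numPairs n) (ℕP.≤-trans (ℕP.≤-trans (s≤s z≤n) 2≤n) (ℕP.+-cancelʳ-≤ n n (2 ℕ.* numPairs n) (ℕP.≤-trans (ℕP.≤-trans (ℕP.≤-reflexive (cong (n ℕ.+_) (sym (ℕP.+-identityʳ n)))) (ℕP.*-monoˡ-≤ n 2≤n))
    (ι-cancel-≤ (≤-rf (trans (ι-* n n) (trans (sym (numPairs-eq n)) (trans (cong (_+ ι n) (sym (ι-* 2 (numPairs n)))) (sym (ι-+ (2 ℕ.* numPairs n) n))))))))))

  eventually : ∀ p q t n k → 2 ℕ.^ suc (startLog q t) ℕ.≤ n → LeExp (n ℕ.^ suc p) (k ℕ.* suc q) → k ℕ.^ (3 ℕ.* suc q) ℕ.* n ℕ.^ (3 ℕ.* suc p) ℕ.≤ n ℕ.^ suc q →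
    suc (k ℕ.∸ 1) ≡ k × ∃ λ L → Threshold n (k ℕ.∸ 1) L (2 ℕ.* suc q) (constants (2 ℕ.* suc q) t ℕ.* L) (threshold n (k ℕ.∸ 1)) (invℕ (numPairs n)) ×
      A₀ (2 ℕ.* suc q) ℕ.≤ L × 4 ℕ.* (400 ℕ.* suc t) ℕ.≤ constants (2 ℕ.* suc q) t ℕ.* L
  eventually p q t n k big hyp₁ hyp₂ = with-k k refl
    where
    S c C : ℕ
    S = startLog q t
    c = 2 ℕ.* suc q
    C = constants c t
    1≤n : 1 ℕ.≤ n
    1≤n = ℕP.≤-trans (ℕP.m^n>0 2 (suc S)) big
    log : ∃ λ L → 2 ℕ.^ L ℕ.≤ n × n ℕ.< 2 ℕ.^ suc L
    log = binaryLog n 1≤n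
    L = proj₁ log
    2^L≤n : 2 ℕ.^ L ℕ.≤ n
    2^L≤n = proj₁ (proj₂ log)
    n<2^ : n ℕ.< 2 ℕ.^ suc L
    n<2^ = proj₂ (proj₂ log)
    S≤L : S ℕ.≤ L
    S≤L = ℕP.≤-pred (2^-cancel (ℕP.≤-trans big (ℕP.<⇒≤ n<2^)))
    1≤c : 1 ℕ.≤ c
    1≤c = s≤s z≤n
    c≤c₂ : c ℕ.≤ c₂ c
    c≤c₂ = ℕP.≤-trans (ℕP.≤-trans (ℕP.≤-reflexive (sym (ℕP.*-identityˡ c))) (ℕP.*-monoˡ-≤ c (1≤R₀ c))) (R₀*c≤c₂ c)
    1≤c₂ : 1 ℕ.≤ c₂ c
    1≤c₂ = ℕP.≤-trans 1≤c c≤c₂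
    c₂≤L : c₂ c ℕ.* 1536 ℕ.≤ L
    c₂≤L = ℕP.≤-trans (c₂≤startLog q t) S≤L
    1≤L : 1 ℕ.≤ L
    1≤L = ℕP.≤-trans (ℕP.*-mono-≤ 1≤c₂ (numeral-≤ 1 1536)) c₂≤L
    C≤Z : C ℕ.≤ C ℕ.* L
    C≤Z = ℕP.m≤m*n C L {{ℕ.>-nonZero 1≤L}}
    2≤n : 2 ℕ.≤ n
    2≤n = ℕP.≤-trans (ℕP.^-monoʳ-≤ 2 1≤L) 2^L≤n
    L≤ck : L ℕ.≤ c ℕ.* k
    L≤ck = log≤ p q n k L 2^L≤n hyp₁
    poly : (C ℕ.* L) ℕ.^ 128 ℕ.* k ℕ.^ 3 ℕ.≤ n
    poly = absorb p q n k L C 2^L≤n hyp₂ (ℕP.≤-trans (absorb≤startLog q t) S≤L)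
    with-k : ∀ k′ → k ≡ k′ → suc (k ℕ.∸ 1) ≡ k × ∃ λ L → Threshold n (k ℕ.∸ 1) L c (C ℕ.* L) (threshold n (k ℕ.∸ 1)) (invℕ (numPairs n)) ×
      A₀ c ℕ.≤ L × 4 ℕ.* (400 ℕ.* suc t) ℕ.≤ C ℕ.* L
    -- L ≤ ck with L far above c excludes k = 0 and k = 1, so κ = k - 1 is at least 1.
    with-k zero refl = ⊥-elim (ℕP.<⇒≱ 1≤L (ℕP.≤-trans L≤ck (ℕP.≤-reflexive (ℕP.*-zeroʳ c))))
    with-k (suc zero) refl = ⊥-elim (ℕP.<⇒≱ (ℕP.<-≤-trans (ℕP.*-monoʳ-< (c₂ c) {{ℕ.>-nonZero 1≤c₂}} (numeral-≤ 2 1536)) c₂≤L) (ℕP.≤-trans L≤ck (ℕP.*-monoˡ-≤ 1 c≤c₂)))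
    with-k (suc (suc κ′)) refl = refl , L , thresholdHolds , ℕP.≤-trans (A₀≤startLog q t) S≤L , ℕP.≤-trans (t≤constants c t) C≤Z
      where
      κ₁ = suc κ′
      1≤Z : 1 ℕ.≤ C ℕ.* L
      1≤Z = ℕP.≤-trans (ℕP.≤-trans (numeral-≤ 1 8192) (8192≤constants c t)) C≤Z
      κ<n : suc κ₁ ℕ.≤ n
      κ<n = ℕP.≤-trans (ℕP.m≤m*n (suc κ₁) (suc κ₁ ℕ.^ 2) {{ℕ.>-nonZero (ℕP.m^n>0 (suc κ₁) 2)}}) (ℕP.≤-trans (ℕP.m≤n*m (suc κ₁ ℕ.^ 3) ((C ℕ.* L) ℕ.^ 128) {{ℕ.>-nonZero (ℕP.m^n>0 (C ℕ.* L) {{ℕ.>-nonZero 1≤Z}} 128)}}) poly)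
      spec = lastBelow-spec (few? n κ₁) (numPairs n) (few-0 n κ₁ κ<n) (¬few-all n κ₁ 2≤n (1≤numPairs n 2≤n) (s≤s z≤n) (ℕP.<⇒≤ κ<n))
      thresholdHolds : Threshold n κ₁ L c (C ℕ.* L) (threshold n κ₁) (invℕ (numPairs n))
      thresholdHolds = record
        { 1≤κ = s≤s z≤n
        ; 2^L≤n = 2^L≤n
        ; n≤2^2L = ℕP.≤-trans (ℕP.<⇒≤ n<2^) (ℕP.^-monoʳ-≤ 2 (ℕP.≤-trans (ℕP.+-monoˡ-≤ L 1≤L) (ℕP.≤-reflexive (cong (L ℕ.+_) (sym (ℕP.+-identityʳ L))))))
        ; 1≤c₁ = 1≤c
        ; L≤c₁k = L≤ck
        ; c₂≤L = c₂≤L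
        ; 8192≤Z = ℕP.≤-trans (8192≤constants c t) C≤Z
        ; c₂≤Z = ℕP.≤-trans (c₂≤constants c t) C≤Z
        ; L≤Z = ℕP.m≤n*m L C {{ℕ.>-nonZero (ℕP.≤-trans 1≤c₂ (c₂≤constants c t))}}
        ; poly = poly
        ; Nδ = *-invℕ (1≤numPairs n 2≤n)
        ; 0≤δ = 0≤invℕ (numPairs n)
        ; a<N = proj₂ (proj₂ spec)
        ; below = proj₁ spec
        ; above = ≰⇒> (proj₁ (proj₂ spec))
        }

  conclusion⇒ : ∀ n κ k c m a A (G : Graph n) → suc κ ≡ k → c₆ c ℕ.* 68 ℕ.≤ suc a → 68 ℕ.≤ suc A → Conclusion n κ c m G →
    IsDomNum {n} G k × (∃ λ b → IsBondage {n} G b × 1 ℕ.* maxDeg {n} G ℕ.≤ suc a ℕ.* b × 1 ℕ.* b ℕ.≤ suc A ℕ.* maxDeg {n} G) ×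
    1 ℕ.* m ℕ.≤ suc a ℕ.* n ℕ.* maxDeg {n} G × 1 ℕ.* n ℕ.* maxDeg {n} G ℕ.≤ suc A ℕ.* m
  conclusion⇒ n κ k c m a A G κ+1 a≤ A≤ (_ , γ , (b , isb , Δ≤b , b≤2Δ) , m≤nΔ , nΔ≤) = subst (IsDomNum {n} G) κ+1 γ ,
    (b , isb , one (ℕP.≤-trans Δ≤b (ℕP.*-monoˡ-≤ b a≤)) , one (ℕP.≤-trans b≤2Δ (ℕP.*-monoˡ-≤ Δ (ℕP.≤-trans (numeral-≤ 2 68) A≤)))) ,
    one (ℕP.≤-trans m≤nΔ (ℕP.*-monoˡ-≤ Δ (ℕP.m≤n*m n (suc a)))) ,
    ℕP.≤-trans (ℕP.≤-reflexive (cong (ℕ._* Δ) (ℕP.*-identityˡ n))) (ℕP.≤-trans nΔ≤ (ℕP.≤-trans (ℕP.≤-reflexive (ℕP.*-comm m 68)) (ℕP.*-monoˡ-≤ m A≤)))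
    where
    Δ = maxDeg {n} G
    one : ∀ {x y} → x ℕ.≤ y → 1 ℕ.* x ℕ.≤ y
    one {x} h = ℕP.≤-trans (ℕP.≤-reflexive (ℕP.*-identityˡ x)) h

-- Assembly of the theorem.

open import Defs
open import Data.Nat using (ℕ; suc; _+_; _*_; _∸_; _^_; _≤_)
open import Data.Product using (_×_; _,_; ∃; proj₁)
open import Data.Nat.Properties using (m+n≤o⇒m≤o; m+n≤o⇒n≤o; n≤1+n; ≤-refl)
open import Data.List.Relation.Unary.All as All using ()
open TypicalGraphs using (threshold; c₆; typical)
open EventualValidity using (startLog; constants; eventually; conclusion⇒)

theorem2p1 : (p q : ℕ) (k : ℕ → ℕ) →
    (∃ λ N₀ → (n : ℕ) → N₀ ≤ n →
    LeExp (n ^ suc p) (k n * suc q) ×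
    k n ^ (3 * suc q) * n ^ (3 * suc p) ≤ n ^ suc q) →
    ∃ λ (m : ℕ → ℕ) → ∃ λ a₁ → ∃ λ a₂ → ∃ λ A₁ → ∃ λ A₂ →
    AAS m (λ n G →
    IsDomNum {n} G (k n) ×
    (∃ λ b → IsBondage {n} G b ×
    suc a₁ * maxDeg {n} G ≤ suc a₂ * b ×
    suc A₂ * b ≤ suc A₁ * maxDeg {n} G) ×
    suc a₁ * m n ≤ suc a₂ * n * maxDeg {n} G ×
    suc A₂ * n * maxDeg {n} G ≤ suc A₁ * m n)
-- The constants enter through their successors: Δ ≤ (68`c₆` + 1)b and b ≤ 68Δ, m ≤ (68`c₆` + 1)nΔ
-- and nΔ ≤ 68m. For large n the subtractions k - 1 and a - n are not truncated.
theorem2p1 p q k (N₀ , hyp) = m , 0 , c₆ c * 68 , 67 , 0 , aas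
  where
  c : ℕ
  c = 2 * suc q
  m : ℕ → ℕ
  m n = threshold n (k n ∸ 1) ∸ n
  aas : AAS m _
  aas t = N₀ + 2 ^ suc (startLog q t) , λ n N≤n →
    let hyp₁ , hyp₂ = hyp n (m+n≤o⇒m≤o N₀ N≤n)
        k≡ , L , th , A≤L , t≤Z = eventually p q t n (k n) (m+n≤o⇒n≤o N₀ N≤n) hyp₁ hyp₂
        xs , unique , good , few = typical t n (k n ∸ 1) L c (constants c t * L) (threshold n (k n ∸ 1)) th A≤L t≤Z
    in xs , unique , All.map (λ {G} g → proj₁ g , conclusion⇒ n (k n ∸ 1) (k n) c (m n) (c₆ c * 68) 67 G k≡ (n≤1+n _) ≤-refl g) good , few
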